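{- Let $\ell$ be a prime, $\mathfrak{r}$ a positive integer, $\mathfrak{q}=\ell^{\mathfrak{r}}>11$ and $n=\mathfrak{q}+1$. Let $B$ be an $n$-element set and $G$ a subgroup of $\mathrm{Perm}(B)$ that contains a subgroup $H$ isomorphic to $\mathbf{L}_2(\mathfrak{q})=\mathrm{PSL}(2,\mathbb{F}_{\mathfrak{q}})$. If $p$ is an odd prime, then the $G$-module $(\mathbb{F}_p^B)^{00}$ is central simple.
   Context: $\mathbb{F}_{\mathfrak{q}}$ is a field with $\mathfrak{q}$ elements. $\mathbb{F}_p^B$ is the space of maps $h:B\to\mathbb{F}_p$ with action $(sh)(b)=h(s^{ -1}(b))$; $(\mathbb{F}_p^B)^0=\{h:\sum_b h(b)=0\}$; the heart $(\mathbb{F}_p^B)^{00}$ is $(\mathbb{F}_p^B)^0/(\mathbb{F}_p\cdot1_B)$ if $p\mid n$ ($1_B$ the constant function $1$) and $(\mathbb{F}_p^B)^0$ otherwise. For a group $G$ acting linearly on $V$, an $\mathbb{F}_p$-subalgebra $R\subset\mathrm{End}_{\mathbb{F}_p}(V)$ containing $\mathrm{Id}$ is $G$-normal if $gRg^{ -1}\subset R$ for all $g\in G$; $V$ is central simple if every $G$-normal subalgebra is a central simple $\mathbb{F}_p$-algebra. -}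

module Defs where

open import Level using (0ℓ)
open import Data.Nat as ℕ using (ℕ; zero; suc)
open import Data.Nat.Divisibility as ℕD using (_∣?_)
open import Data.Nat.Primality using (Prime)
open import Data.Integer as ℤ using (ℤ; +_)
open import Data.Integer.Divisibility as ℤD using ()
open import Data.Fin using (Fin; zero; suc)
open import Data.Fin.Permutation as P using (Permutation′; _⟨$⟩ʳ_; flip; _∘ₚ_)
open import Data.Product using (Σ; ∃; ∃-syntax; _×_; _,_)
open import Data.Sum using (_⊎_)
open import Relation.Nullary using (¬_; yes; no)
open import Relation.Binary.PropositionalEquality using (_≡_)
open import Algebra.Bundles using (CommutativeRing)

record Field : Set₁ where
  field
    cring : CommutativeRing 0ℓ 0ℓ
  open CommutativeRing cring public
  field
    0≉1     : ¬ (0# ≈ 1#)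
    inverse : ∀ x → ¬ (x ≈ 0#) → ∃[ y ] (x * y ≈ 1#)

HasCard : Field → ℕ → Set
HasCard K q = Σ (Fin q → Carrier) λ e →
  (∀ x → ∃[ i ] (e i ≈ x)) × (∀ i j → e i ≈ e j → i ≡ j)
  where open Field K

-- SL(2,K) and PSL(2,K) = SL(2,K)/{±I}, as a setoid of matrices

module Mat (K : Field) where
  open Field K

  record M2 : Set where
    constructor mat
    field a b c d : Carrier

  open M2 public

  _·ₘ_ : M2 → M2 → M2
  x ·ₘ y = mat (a x * a y + b x * c y) (a x * b y + b x * d y)
               (c x * a y + d x * c y) (c x * b y + d x * d y)

  negₘ : M2 → M2
  negₘ x = mat (- a x) (- b x) (- c x) (- d x)

  _≈ₘ_ : M2 → M2 → Set
  x ≈ₘ y = (a x ≈ a y) × (b x ≈ b y) × (c x ≈ c y) × (d x ≈ d y)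

  IsSL : M2 → Set
  IsSL x = (a x * d x - b x * c x) ≈ 1#

  _≈ₚₛₗ_ : M2 → M2 → Set
  x ≈ₚₛₗ y = (x ≈ₘ y) ⊎ (x ≈ₘ negₘ y)

Perm : ℕ → Set
Perm n = Permutation′ n

-- group law written as function composition: (g ·ₚ h) b = g (h b)
_·ₚ_ : ∀ {n} → Perm n → Perm n → Perm n
g ·ₚ h = h ∘ₚ g

record IsSubgroup {n : ℕ} (G : Perm n → Set) : Set where
  field
    resp  : ∀ {g h} → g P.≈ h → G g → G h
    has-id : G P.id
    mul   : ∀ {g h} → G g → G h → G (g ·ₚ h)
    inv   : ∀ {g} → G g → G (flip g)

record IsoPSL2 {n : ℕ} (K : Field) (H : Perm n → Set) : Set₁ where
  open Mat K
  field
    φ      : M2 → Perm n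
    into   : ∀ x → IsSL x → H (φ x)
    wd     : ∀ x y → IsSL x → IsSL y → x ≈ₚₛₗ y → φ x P.≈ φ y
    hom    : ∀ x y → IsSL x → IsSL y → φ (x ·ₘ y) P.≈ (φ x ·ₚ φ y)
    inj    : ∀ x y → IsSL x → IsSL y → φ x P.≈ φ y → x ≈ₚₛₗ y
    surj   : ∀ h → H h → ∃[ x ] (IsSL x × φ x P.≈ h)

-- The permutation module F_p^B and its heart, B = Fin n.
-- Elements of F_p are represented by integers modulo p.

Vecℤ : ℕ → Set
Vecℤ n = Fin n → ℤ

_≡[mod_]_ : ℤ → ℕ → ℤ → Set
x ≡[mod p ] y = (+ p) ℤD.∣ (x ℤ.- y)

sumℤ : ∀ {n} → Vecℤ n → ℤ
sumℤ {zero}  h = ℤ.+ 0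
sumℤ {suc n} h = h zero ℤ.+ sumℤ (λ i → h (suc i))

InV0 : (p n : ℕ) → Vecℤ n → Set
InV0 p n h = sumℤ h ≡[mod p ] (+ 0)

-- equality in the heart (F_p^B)^00: modulo p, and additionally modulo
-- constant functions when p ∣ n
HeartEq : (p n : ℕ) → Vecℤ n → Vecℤ n → Set
HeartEq p n h h' with p ∣? n
... | yes _ = ∃[ c ] (∀ b → (h b ℤ.- h' b) ≡[mod p ] c)
... | no  _ = ∀ b → h b ≡[mod p ] h' b

RawEnd : ℕ → Set
RawEnd n = Vecℤ n → Vecℤ n

record IsLinear (p n : ℕ) (f : RawEnd n) : Set where
  field
    pres0 : ∀ h → InV0 p n h → InV0 p n (f h)
    cong  : ∀ h h' → InV0 p n h → InV0 p n h' → HeartEq p n h h' → HeartEq p n (f h) (f h')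
    add   : ∀ h h' → InV0 p n h → InV0 p n h' →
            HeartEq p n (f (λ b → h b ℤ.+ h' b)) (λ b → f h b ℤ.+ f h' b)
    smul  : ∀ c h → InV0 p n h → HeartEq p n (f (λ b → c ℤ.* h b)) (λ b → c ℤ.* f h b)

EqE : (p n : ℕ) → RawEnd n → RawEnd n → Set
EqE p n f g = ∀ h → InV0 p n h → HeartEq p n (f h) (g h)

idE : ∀ {n} → RawEnd n
idE h = h

zeroE : ∀ {n} → RawEnd n
zeroE h = λ _ → ℤ.+ 0

_+E_ : ∀ {n} → RawEnd n → RawEnd n → RawEnd n
(f +E g) h = λ b → f h b ℤ.+ g h b

_·E_ : ∀ {n} → ℤ → RawEnd n → RawEnd n
(c ·E f) h = λ b → c ℤ.* f h b

_∘E_ : ∀ {n} → RawEnd n → RawEnd n → RawEnd n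
(f ∘E g) h = f (g h)

act : ∀ {n} → Perm n → RawEnd n
act s h b = h (flip s ⟨$⟩ʳ b)

record IsSubalgebra (p n : ℕ) (R : RawEnd n → Set) : Set where
  field
    linear : ∀ f → R f → IsLinear p n f
    resp   : ∀ f g → R f → IsLinear p n g → EqE p n f g → R g
    has-id : R idE
    plus   : ∀ f g → R f → R g → R (f +E g)
    scal   : ∀ c f → R f → R (c ·E f)
    comp   : ∀ f g → R f → R g → R (f ∘E g)

IsGNormal : (p n : ℕ) → (Perm n → Set) → (RawEnd n → Set) → Set
IsGNormal p n G R = ∀ g f → G g → R f → R (act g ∘E (f ∘E act (flip g)))

record IsIdeal (p n : ℕ) (R I : RawEnd n → Set) : Set where
  field
    sub    : ∀ f → I f → R f
    resp   : ∀ f g → I f → R g → EqE p n f g → I g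
    has-0  : I zeroE
    plus   : ∀ f g → I f → I g → I (f +E g)
    mulˡ   : ∀ r f → R r → I f → I (r ∘E f)
    mulʳ   : ∀ r f → R r → I f → I (f ∘E r)

record IsCentralSimple (p n : ℕ) (R : RawEnd n → Set) : Set₁ where
  field
    nonzero : ¬ EqE p n idE zeroE
    simple  : ∀ (I : RawEnd n → Set) → IsIdeal p n R I →
              (∃[ f ] (I f × ¬ EqE p n f zeroE)) → I idE
    central : ∀ z → R z → (∀ r → R r → EqE p n (z ∘E r) (r ∘E z)) →
              ∃[ c ] (EqE p n z (c ·E idE))

IsCentralSimpleModule : (p n : ℕ) → (Perm n → Set) → Set₁
IsCentralSimpleModule p n G =
  ∀ (R : RawEnd n → Set) → IsSubalgebra p n R → IsGNormal p n G R → IsCentralSimple p n R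

module Submission where

open import Data.Nat as ℕ using (ℕ; zero; suc)
open import Data.Integer as ℤ using (ℤ; +_; -[1+_])
import Data.Nat.Properties as ℕP
import Data.Integer.Properties as ℤP
import Data.Fin.Properties as FP
open import Level using (0ℓ)
open import Algebra.Bundles using (CommutativeRing)
open import Data.Product using (∃; ∃₂; _×_; _,_; proj₁; proj₂; ∃-syntax)
open import Data.Sum using (_⊎_; inj₁; inj₂; [_,_]′)
open import Data.Unit using (⊤; tt)
open import Data.Empty using (⊥; ⊥-elim)
open import Data.Fin using (Fin; zero; suc)
open import Relation.Nullary using (¬_; Dec; yes; no; does)
open import Relation.Nullary.Decidable using (_×-dec_; ¬?; _→-dec_; decidable-stable; map′; recompute)
open import Data.Bool using (Bool; true; false)
open import Data.Nat.Primality using (Prime)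
open import Relation.Binary.Structures using (IsEquivalence)
import Relation.Binary.PropositionalEquality as ≡
open ≡ using (_≡_; _≢_)

-- Let q be the order of the field. Three facts about the group of matrices carry the theorem. For q
-- > 11 it acts trivially on every set of at most q points (`SmallAction`). An action on at most q +
-- 1 points in which some u(x) moves a point is the action on the projective line
-- (`projective-line`). For odd p the heart of that action is irreducible, and its equivariant
-- endomorphisms are scalars (`irreducible-and-schur`).
--
-- Simplicity follows from the first fact and irreducibility by Clifford theory. Let f be a nonzero
-- element of an ideal of a normal subalgebra, and pass to the finite normal subring `Gen f`. It has
-- a simple module inside the heart, and the group translates this module. Translates with different
-- annihilators are linearly independent, so their classes number at most the dimension, which is at
-- most q; the group permutes the classes, hence fixes them, and there is one class. By density some
-- element of the ideal is the identity on one translate. Its difference from 1 annihilates all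
-- translates, and these span the heart, so the element is 1.
--
-- For the centre, let z be central. Its conjugates commute and lie in `Gen z`, which is
-- commutative, and simple by the argument just given, so a field. They are roots of one nonzero
-- polynomial of degree at most q over the prime field, hence at most q in number, and the group
-- fixes them all. So z commutes with the group and is a scalar.
--
-- The actions are recognised by counting. Suppose the unipotent group U moves a point P but a
-- nonzero x in U fixes it. The torus elements that preserve the U-orbit of P act through squares on
-- the cosets of the stabiliser. Comparing Borel orbits with the q + 1 available points leaves one
-- orbit of moved points, and the relation w u(x) w = u(-1/x) h(1/x) w u(-1/x) then yields more
-- torus elements than the count permits. So the U-orbit of a moved point is a copy of the affine
-- line with at most one point outside. The torus fixes an origin on it, and w must send the origin
-- outside: otherwise w permutes the affine line, all but three field elements are accounted for by
-- a few quadratic equations, and q is at most 11.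
--
-- In the heart, if p does not divide q + 1, averaging over U projects onto the multiples of one
-- vector, which generates everything. If p divides q + 1, averaging over the torus maps into the
-- span of [0] - [infinity] and the quadratic character, and further group elements separate these
-- two.

-- Ring solver with integer coefficients.

module Solver where
  open import Algebra.Solver.Ring.AlmostCommutativeRing using (fromCommutativeRing; _-Raw-AlmostCommutative⟶_)
  open import Data.Maybe using (map)
  open import Relation.Nullary.Decidable using (dec⇒maybe)

  module IntegerCoefficientSolver (R : CommutativeRing 0ℓ 0ℓ) where
    open CommutativeRing R
    open import Algebra.Properties.Semiring.Mult.TCOptimised semiring
      using (×-homo-+; ×1-homo-*; 1+×) renaming (_×_ to _⋆_)
    open import Algebra.Properties.Ring ring
      using (-‿distribˡ-*; -‿distribʳ-*; -‿involutive; -0#≈0#)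
    open import Algebra.Properties.AbelianGroup +-abelianGroup using (⁻¹-∙-comm)
    open import Relation.Binary.Reasoning.Setoid setoid

    -- Integer coefficients let the solver cancel opposite terms and add numerals in any commutative
    -- ring, whatever its characteristic. The optimised multiple makes the image of 1 equal to `1#`
    -- by computation.
    fromℤ : ℤ → Carrier
    fromℤ (+ n)    = n ⋆ 1#
    fromℤ -[1+ n ] = - (suc n ⋆ 1#)

    fromℤ-neg : ∀ i → fromℤ (ℤ.- i) ≈ - fromℤ i
    fromℤ-neg (+ zero)  = sym -0#≈0#
    fromℤ-neg (+ suc n) = refl
    fromℤ-neg -[1+ n ]  = sym (-‿involutive _)

    fromℤ-⊖ : ∀ m n → fromℤ (m ℤ.⊖ n) ≈ m ⋆ 1# - n ⋆ 1#
    fromℤ-⊖ zero    zero    = sym (-‿inverseʳ 0#)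
    fromℤ-⊖ zero    (suc n) = sym (+-identityˡ _)
    fromℤ-⊖ (suc m) zero    = sym (trans (+-congˡ -0#≈0#) (+-identityʳ _))
    fromℤ-⊖ (suc m) (suc n) = begin
      fromℤ (suc m ℤ.⊖ suc n)              ≡⟨ ≡.cong fromℤ (ℤP.[1+m]⊖[1+n]≡m⊖n m n) ⟩
      fromℤ (m ℤ.⊖ n)                      ≈⟨ fromℤ-⊖ m n ⟩
      m ⋆ 1# - n ⋆ 1#                      ≈⟨ +-congʳ (+-identityʳ _) ⟨
      (m ⋆ 1# + 0#) - n ⋆ 1#               ≈⟨ +-congʳ (+-congˡ (-‿inverseʳ 1#)) ⟨
      (m ⋆ 1# + (1# - 1#)) - n ⋆ 1#        ≈⟨ +-congʳ (+-assoc _ _ _) ⟨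
      ((m ⋆ 1# + 1#) - 1#) - n ⋆ 1#        ≈⟨ +-assoc _ _ _ ⟩
      (m ⋆ 1# + 1#) + (- 1# - n ⋆ 1#)      ≈⟨ +-cong (+-comm _ _) (⁻¹-∙-comm 1# (n ⋆ 1#)) ⟩
      (1# + m ⋆ 1#) - (1# + n ⋆ 1#)        ≈⟨ +-cong (1+× m 1#) (-‿cong (1+× n 1#)) ⟨
      suc m ⋆ 1# - suc n ⋆ 1#              ∎

    fromℤ-+ : ∀ i j → fromℤ (i ℤ.+ j) ≈ fromℤ i + fromℤ j
    fromℤ-+ (+ m)    (+ n)    = ×-homo-+ 1# m n
    fromℤ-+ (+ m)    -[1+ n ] = fromℤ-⊖ m (suc n)
    fromℤ-+ -[1+ m ] (+ n)    = trans (fromℤ-⊖ n (suc m)) (+-comm _ _)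
    fromℤ-+ -[1+ m ] -[1+ n ] = begin
      - (suc (suc (m ℕ.+ n)) ⋆ 1#)         ≡⟨ ≡.cong (λ k → - (suc k ⋆ 1#)) (≡.sym (Data.Nat.Properties.+-suc m n)) ⟩
      - ((suc m ℕ.+ suc n) ⋆ 1#)           ≈⟨ -‿cong (×-homo-+ 1# (suc m) (suc n)) ⟩
      - (suc m ⋆ 1# + suc n ⋆ 1#)          ≈⟨ ⁻¹-∙-comm _ _ ⟨
      - (suc m ⋆ 1#) - suc n ⋆ 1#          ∎
      where import Data.Nat.Properties

    fromℤ-+* : ∀ m j → fromℤ (+ m ℤ.* j) ≈ fromℤ (+ m) * fromℤ j
    fromℤ-+* m (+ n)    = trans (reflexive (≡.cong fromℤ (≡.sym (ℤP.pos-* m n)))) (×1-homo-* m n)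
    fromℤ-+* m -[1+ n ] = begin
      fromℤ (+ m ℤ.* -[1+ n ])             ≡⟨ ≡.cong fromℤ (ℤP.neg-distribʳ-* (+ m) (+ suc n)) ⟨
      fromℤ (ℤ.- (+ m ℤ.* + suc n))        ≈⟨ fromℤ-neg (+ m ℤ.* + suc n) ⟩
      - fromℤ (+ m ℤ.* + suc n)            ≈⟨ -‿cong (fromℤ-+* m (+ suc n)) ⟩
      - (m ⋆ 1# * (suc n ⋆ 1#))            ≈⟨ -‿distribʳ-* _ _ ⟩
      m ⋆ 1# * - (suc n ⋆ 1#)              ∎

    fromℤ-* : ∀ i j → fromℤ (i ℤ.* j) ≈ fromℤ i * fromℤ j
    fromℤ-* (+ m)    j = fromℤ-+* m j
    fromℤ-* -[1+ m ] j = begin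
      fromℤ (-[1+ m ] ℤ.* j)               ≡⟨ ≡.cong fromℤ (ℤP.neg-distribˡ-* (+ suc m) j) ⟨
      fromℤ (ℤ.- (+ suc m ℤ.* j))          ≈⟨ fromℤ-neg (+ suc m ℤ.* j) ⟩
      - fromℤ (+ suc m ℤ.* j)              ≈⟨ -‿cong (fromℤ-+* (suc m) j) ⟩
      - (suc m ⋆ 1# * fromℤ j)             ≈⟨ -‿distribˡ-* _ _ ⟩
      - (suc m ⋆ 1#) * fromℤ j             ∎

    homo : CommutativeRing.rawRing ℤP.+-*-commutativeRing -Raw-AlmostCommutative⟶ fromCommutativeRing R
    homo = record
      { ⟦_⟧ = fromℤ ; +-homo = fromℤ-+ ; *-homo = fromℤ-* ; -‿homo = fromℤ-neg ; 0-homo = refl ; 1-homo = refl }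

    open import Algebra.Solver.Ring (CommutativeRing.rawRing ℤP.+-*-commutativeRing) (fromCommutativeRing R) homo
      (λ i j → map (λ eq → reflexive (≡.cong fromℤ eq)) (dec⇒maybe (i ℤ.≟ j))) public
      using (solve; _:=_; _:+_; _:*_; _:-_; :-_; con)

    test : ∀ x y → (x + y) * (x - y) + (1# + 1#) * x ≈ x * x - y * y + x + x
    test = solve 2 (λ x y → (x :+ y) :* (x :- y) :+ (con (+ 1) :+ con (+ 1)) :* x := x :* x :- y :* y :+ x :+ x) refl

-- Counting by injections between enumerated predicates.

module Counting where
  open import Data.Fin using (combine; remQuot; splitAt; _↑ˡ_; _↑ʳ_; join)
  open import Data.Product using (Σ)
  open import Data.Sum.Properties using (inj₁-injective; inj₂-injective)
  open import Relation.Unary using (Decidable)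
  open ≡

  -- A predicate listed without repetition by `Fin n`. Cardinalities are the indices `n`, and they
  -- are compared only by injections, through `enum-≤`.
  record Enum {A : Set} (P : A → Set) (n : ℕ) : Set where
    field
      at  : Fin n → A
      sat : ∀ i → P (at i)
      inj : ∀ i j → at i ≡ at j → i ≡ j
      idx : ∀ x → P x → ∃ λ i → at i ≡ x

  open Enum public

  enum-≤ : ∀ {A B : Set} {P : A → Set} {Q : B → Set} {m n} → Enum P m → Enum Q n →
           (f : ∀ x → P x → B) → (∀ x p → Q (f x p)) →
           (∀ x p y p′ → f x p ≡ f y p′ → x ≡ y) → m ℕ.≤ n
  enum-≤ {m = m} {n} e e′ f fQ f-inj = FP.injective⇒≤ {f = g} g-inj
    where
    g : Fin m → Fin n
    g i = proj₁ (idx e′ (f (at e i) (sat e i)) (fQ _ _))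
    g-inj : ∀ {i j} → g i ≡ g j → i ≡ j
    g-inj {i} {j} eq = inj e i j (f-inj _ _ _ _
      (trans (sym (proj₂ (idx e′ _ (fQ (at e i) (sat e i)))))
      (trans (cong (at e′) eq) (proj₂ (idx e′ _ (fQ (at e j) (sat e j)))))))

  enum-all : ∀ n → Enum {Fin n} (λ _ → ⊤) n
  enum-all n = record { at = λ i → i ; sat = λ _ → tt ; inj = λ _ _ eq → eq ; idx = λ x _ → x , refl }

  enum-Bool : Enum {Bool} (λ _ → ⊤) 2
  enum-Bool = record
    { at = λ { zero → true ; (suc _) → false }
    ; sat = λ _ → tt
    ; inj = λ { zero zero _ → refl ; zero (suc _) () ; (suc _) zero () ; (suc zero) (suc zero) _ → refl }
    ; idx = λ { true _ → zero , refl ; false _ → suc zero , refl } }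

  enum-× : ∀ {A B : Set} {P : A → Set} {Q : B → Set} {m n} → Enum P m → Enum Q n →
           Enum {A × B} (λ (a , b) → P a × Q b) (m ℕ.* n)
  enum-× {m = m} {n} e e′ = record
    { at = λ k → at e (proj₁ (remQuot {m} n k)) , at e′ (proj₂ (remQuot {m} n k))
    ; sat = λ k → sat e _ , sat e′ _
    ; inj = λ i j eq → trans (sym (FP.combine-remQuot {m} n i))
        (trans (cong₂ combine (inj e _ _ (cong proj₁ eq)) (inj e′ _ _ (cong proj₂ eq)))
               (FP.combine-remQuot {m} n j))
    ; idx = λ (a , b) (p , q) → let (i , ei) = idx e a p ; (j , ej) = idx e′ b q in
        combine i j ,
        cong₂ _,_ (trans (cong (λ z → at e (proj₁ z)) (FP.remQuot-combine {m} {n} i j)) ei)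
                  (trans (cong (λ z → at e′ (proj₂ z)) (FP.remQuot-combine {m} {n} i j)) ej) }

  enum-cons : ∀ {n k} {P : Fin (suc n) → Set} → P zero → Enum (λ i → P (suc i)) k → Enum P (suc k)
  enum-cons {n} {k} {P} p e = record
    { at = at′
    ; sat = λ { zero → p ; (suc i) → sat e i }
    ; inj = λ { zero zero _ → refl ; zero (suc _) () ; (suc _) zero ()
              ; (suc i) (suc j) eq → cong suc (inj e i j (FP.suc-injective eq)) }
    ; idx = λ { zero _ → zero , refl ; (suc x) q → suc (proj₁ (idx e x q)) , cong suc (proj₂ (idx e x q)) } }
    where
    at′ : Fin (suc k) → Fin (suc n)
    at′ zero    = zero
    at′ (suc i) = suc (at e i)

  enum-skip : ∀ {n k} {P : Fin (suc n) → Set} → ¬ P zero → Enum (λ i → P (suc i)) k → Enum P k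
  enum-skip {n} {k} {P} ¬p e = record
    { at = λ i → suc (at e i) ; sat = sat e
    ; inj = λ i j eq → inj e i j (FP.suc-injective eq)
    ; idx = λ { zero q → ⊥-elim (¬p q) ; (suc x) q → proj₁ (idx e x q) , cong suc (proj₂ (idx e x q)) } }

  enum-split : ∀ {n} {P : Fin n → Set} → Decidable P →
               ∃₂ λ k k′ → Enum P k × Enum (λ i → ¬ P i) k′ × k ℕ.+ k′ ≡ n
  enum-split {zero} P? = 0 , 0 , none , none , refl
    where
    none : ∀ {Q : Fin 0 → Set} → Enum Q 0
    none = record { at = λ () ; sat = λ () ; inj = λ () ; idx = λ () }
  enum-split {suc n} P? with P? zero | enum-split (λ i → P? (suc i))
  ... | yes p | k , k′ , e , e′ , eq = suc k , k′ , enum-cons p e , enum-skip (λ ¬p → ¬p p) e′ , cong suc eq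
  ... | no ¬p | k , k′ , e , e′ , eq = k , suc k′ , enum-skip ¬p e , enum-cons ¬p e′ , trans (ℕP.+-suc k k′) (cong suc eq)

  enum-⊎ : ∀ {A B : Set} {P : A → Set} {Q : B → Set} {m n} → Enum P m → Enum Q n →
           Enum {A ⊎ B} [ P , Q ]′ (m ℕ.+ n)
  enum-⊎ {A} {B} {P} {Q} {m} {n} e e′ = record
    { at = λ k → at′ (splitAt m k)
    ; sat = λ k → sat′ (splitAt m k)
    ; inj = λ i j eq → trans (sym (FP.join-splitAt m n i)) (trans (cong (join m n) (inj′ (splitAt m i) (splitAt m j) eq)) (FP.join-splitAt m n j))
    ; idx = λ { (inj₁ x) p → let (i , ei) = idx e x p in i ↑ˡ n , trans (cong at′ (FP.splitAt-↑ˡ m i n)) (cong inj₁ ei)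
              ; (inj₂ x) p → let (i , ei) = idx e′ x p in m ↑ʳ i , trans (cong at′ (FP.splitAt-↑ʳ m n i)) (cong inj₂ ei) } }
    where
    at′ : Fin m ⊎ Fin n → A ⊎ B
    at′ (inj₁ i) = inj₁ (at e i)
    at′ (inj₂ j) = inj₂ (at e′ j)
    sat′ : ∀ s → [ P , Q ]′ (at′ s)
    sat′ (inj₁ i) = sat e i
    sat′ (inj₂ j) = sat e′ j
    inj′ : ∀ s t → at′ s ≡ at′ t → s ≡ t
    inj′ (inj₁ i) (inj₁ j) eq = cong inj₁ (inj e i j (inj₁-injective eq))
    inj′ (inj₁ i) (inj₂ j) ()
    inj′ (inj₂ i) (inj₁ j) ()
    inj′ (inj₂ i) (inj₂ j) eq = cong inj₂ (inj e′ i j (inj₂-injective eq))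

  module _ {X : Set} (_~_ : X → X → Set) (_~?_ : ∀ x y → Dec (x ~ y)) where

    Distinct : ∀ {c} → (Fin c → X) → Set
    Distinct r = ∀ i j → r i ~ r j → i ≡ j

    -- Chosen greedily from the end of the list: a new element is kept only if it is unrelated to
    -- all those kept so far.
    representatives : (∀ {x} → x ~ x) → (∀ {x y} → x ~ y → y ~ x) → ∀ {n} (f : Fin n → X) →
      ∃ λ c → Σ (Fin c → Fin n) λ r → Distinct (λ i → f (r i)) × (∀ k → ∃ λ i → f k ~ f (r i))
    representatives refl~ sym~ {zero}  f = 0 , (λ ()) , (λ ()) , λ ()
    representatives refl~ sym~ {suc n} f with representatives refl~ sym~ (λ i → f (suc i))
    ... | c , r , r-inj , cov with FP.any? (λ i → f zero ~? f (suc (r i)))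
    ...   | yes (i , eq) = c , (λ i → suc (r i)) , r-inj , λ { zero → i , eq ; (suc k) → cov k }
    ...   | no new = suc c , r′ , r′-inj , λ { zero → zero , refl~ ; (suc k) → suc (proj₁ (cov k)) , proj₂ (cov k) }
      where
      r′ : Fin (suc c) → Fin (suc n)
      r′ zero    = zero
      r′ (suc i) = suc (r i)
      r′-inj : Distinct (λ i → f (r′ i))
      r′-inj zero    zero    _  = refl
      r′-inj zero    (suc j) eq = ⊥-elim (new (j , eq))
      r′-inj (suc i) zero    eq = ⊥-elim (new (i , sym~ eq))
      r′-inj (suc i) (suc j) eq = cong suc (r-inj i j eq)

  -- Counts by giving each element some code that determines it. The code is a relation and not a
  -- function, so it can be chosen by case analysis and decoded separately in each case.
  coding-≤ : ∀ {A T : Set} {P : A → Set} {Q : T → Set} {m n} → Enum P m → Enum Q n → (∀ s → Q s) →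
             (R : A → T → Set) → (∀ x → P x → ∃ (R x)) → (∀ {x y} s → R x s → R y s → x ≡ y) → m ℕ.≤ n
  coding-≤ e e′ Qall R code decode = enum-≤ e e′ (λ x p → proj₁ (code x p)) (λ _ _ → Qall _)
    λ x p y p′ eq → decode _ (proj₂ (code x p)) (subst (R y) (sym eq) (proj₂ (code y p′)))

-- Finite fields and their square classes.

module FiniteFields where
  open Solver
  open Counting
  open import Algebra.Structures using (IsCommutativeRing)
  open import Data.Fin using (_<?_; _<_; _≟_)
  open import Function using (id)
  open import Relation.Binary.Definitions using (tri<; tri≈; tri>)
  open ≡

  agree : ∀ {P Q : Set} (p : Dec P) (r : Dec Q) → does p ≡ does r → (Q → P) × (P → Q)
  agree (yes p) (yes r) _ = (λ _ → p) , (λ _ → r)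
  agree (no ¬p) (no ¬r) _ = (λ r → ⊥-elim (¬r r)) , (λ p → ⊥-elim (¬p p))

  -- The carrier is `Fin q` with propositional equality, so equations and quantifiers over the field
  -- are decidable. `inv` is total, and its value at zero is unspecified.
  record FiniteField (q : ℕ) : Set where
    infixl 6 _+_
    infixl 7 _*_
    infix  8 -_
    field
      _+_ _*_ : Fin q → Fin q → Fin q
      -_ inv  : Fin q → Fin q
      0# 1#   : Fin q
      isCommutativeRing : IsCommutativeRing _≡_ _+_ _*_ -_ 0# 1#
      0≢1     : 0# ≢ 1#
      *-inv   : ∀ x → x ≢ 0# → x * inv x ≡ 1#

    bundle : CommutativeRing 0ℓ 0ℓ
    bundle = record { isCommutativeRing = isCommutativeRing }

    open IsCommutativeRing isCommutativeRing public
      using (+-assoc; +-comm; +-identityˡ; +-identityʳ; -‿inverseʳ; -‿inverseˡ; *-assoc; *-comm; *-identityˡ; *-identityʳ; zeroˡ; zeroʳ; distribˡ; distribʳ)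
    open IntegerCoefficientSolver bundle public using (solve; _:=_; _:+_; _:*_; _:-_; :-_; con)

    infixl 6 _-_
    _-_ : Fin q → Fin q → Fin q
    x - y = x + - y

    Nz : Fin q → Set
    Nz x = x ≢ 0#

    Nz? : ∀ x → Dec (Nz x)
    Nz? x = ¬? (x ≟ 0#)

    inv-* : ∀ {x} → Nz x → inv x * x ≡ 1#
    inv-* nz = trans (*-comm _ _) (*-inv _ nz)

    1-nz : Nz 1#
    1-nz eq = 0≢1 (sym eq)

    *-cancel : ∀ {x y z} → Nz x → x * y ≡ x * z → y ≡ z
    *-cancel {x} {y} {z} nz eq = begin
      y                ≡⟨ *-identityˡ y ⟨
      1# * y           ≡⟨ cong (_* y) (inv-* nz) ⟨
      (inv x * x) * y  ≡⟨ *-assoc _ _ _ ⟩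
      inv x * (x * y)  ≡⟨ cong (inv x *_) eq ⟩
      inv x * (x * z)  ≡⟨ *-assoc _ _ _ ⟨
      (inv x * x) * z  ≡⟨ cong (_* z) (inv-* nz) ⟩
      1# * z           ≡⟨ *-identityˡ z ⟩
      z                ∎
      where open ≡-Reasoning

    *-nz : ∀ {x y} → Nz x → Nz y → Nz (x * y)
    *-nz nx ny eq = ny (*-cancel nx (trans eq (sym (zeroʳ _))))

    inv-nz : ∀ {x} → Nz x → Nz (inv x)
    inv-nz {x} nz eq = 0≢1 (trans (sym (zeroʳ x)) (trans (cong (x *_) (sym eq)) (*-inv x nz)))

    inv-unique : ∀ {x y} → Nz x → x * y ≡ 1# → y ≡ inv x
    inv-unique nz eq = *-cancel nz (trans eq (sym (*-inv _ nz)))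

    inv-inv : ∀ {x} → Nz x → inv (inv x) ≡ x
    inv-inv nz = sym (inv-unique (inv-nz nz) (inv-* nz))

    inv-mul : ∀ {x y} → Nz x → Nz y → inv (x * y) ≡ inv x * inv y
    inv-mul {x} {y} nx ny = sym (inv-unique (*-nz nx ny)
      (trans (solve 4 (λ x y i j → (x :* y) :* (i :* j) := (x :* i) :* (y :* j)) refl x y (inv x) (inv y))
      (trans (cong₂ _*_ (*-inv x nx) (*-inv y ny)) (*-identityˡ 1#))))

    inv-1 : inv 1# ≡ 1#
    inv-1 = sym (inv-unique 1-nz (*-identityˡ 1#))

    zero-product : ∀ x y → x * y ≡ 0# → x ≡ 0# ⊎ y ≡ 0#
    zero-product x y eq with x ≟ 0#
    ... | yes p = inj₁ p
    ... | no nx = inj₂ (*-cancel nx (trans eq (sym (zeroʳ x))))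

    diff≡0 : ∀ {x y} → x - y ≡ 0# → x ≡ y
    diff≡0 {x} {y} eq = trans (solve 2 (λ x y → x := (x :- y) :+ y) refl x y) (trans (cong (_+ y) eq) (+-identityˡ y))

    ≡⇒diff : ∀ {x y} → x ≡ y → x - y ≡ 0#
    ≡⇒diff {x} refl = -‿inverseʳ x

    neg-nz : ∀ {x} → Nz x → Nz (- x)
    neg-nz {x} nz eq = nz (trans (solve 1 (λ x → x := :- (:- x)) refl x) (trans (cong -_ eq) (solve 0 (:- con (+ 0) := con (+ 0)) refl)))

    neg-neg : ∀ x → - - x ≡ x
    neg-neg = solve 1 (λ x → :- (:- x) := x) refl

    inv-neg : ∀ {x} → Nz x → inv (- x) ≡ - inv x
    inv-neg {x} nz = sym (inv-unique (neg-nz nz)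
      (trans (solve 2 (λ x y → (:- x) :* (:- y) := x :* y) refl x (inv x)) (*-inv x nz)))

    squares-≡ : ∀ x y → x * x ≡ y * y → x ≡ y ⊎ x ≡ - y
    squares-≡ x y eq = [ (λ p → inj₁ (diff≡0 p))
                       , (λ p → inj₂ (diff≡0 (trans (solve 2 (λ x y → x :- (:- y) := x :+ y) refl x y) p))) ]′
      (zero-product (x - y) (x + y) (trans (solve 2 (λ x y → (x :- y) :* (x :+ y) := x :* x :- y :* y) refl x y) (≡⇒diff eq)))

    -- Singles out one of `a` and `- a` by the order of `Fin q`; the choice has no algebraic
    -- meaning. Together with `a * a` it determines `a`, which is how "at most two square roots"
    -- becomes an injection.
    sign : Fin q → Bool
    sign a = does (a <? - a)

    sign-neg : ∀ b → sign (- b) ≡ sign b → - b ≡ b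
    sign-neg b eq with FP.<-cmp b (- b)
    ... | tri≈ _ r _ = sym r
    ... | tri< r _ _ = ⊥-elim (FP.<-asym r (subst (- b <_) (neg-neg b) (proj₁ (agree (- b <? - - b) (b <? - b) eq) r)))
    ... | tri> ¬r _ r = ⊥-elim (¬r (proj₂ (agree (- b <? - - b) (b <? - b) eq) (subst (- b <_) (sym (neg-neg b)) r)))

    square-sign : ∀ a b → a * a ≡ b * b → sign a ≡ sign b → a ≡ b
    square-sign a b eq s = [ id , (λ { refl → sign-neg b s }) ]′ (squares-≡ a b eq)

    Square : Fin q → Set
    Square x = ∃ λ a → Nz a × a * a ≡ x

    Square? : ∀ x → Dec (Square x)
    Square? x = FP.any? λ a → Nz? a ×-dec (a * a ≟ x)

    square-1 : Square 1#
    square-1 = 1# , 1-nz , *-identityˡ 1#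

    square-* : ∀ {x y} → Square x → Square y → Square (x * y)
    square-* (a , na , refl) (b , nb , refl) = a * b , *-nz na nb ,
      solve 2 (λ a b → (a :* b) :* (a :* b) := (a :* a) :* (b :* b)) refl a b

    square-nz : ∀ {x} → Square x → Nz x
    square-nz (a , na , refl) = *-nz na na

    square-inv : ∀ {x} → Square x → Square (inv x)
    square-inv (a , na , refl) = inv a , inv-nz na , sym (inv-mul na na)

    square-div : ∀ {x y} → Square x → Square (x * y) → Square y
    square-div {x} {y} sx sxy = subst Square
      (trans (sym (*-assoc _ _ _)) (trans (cong (_* y) (inv-* (square-nz sx))) (*-identityˡ y)))
      (square-* (square-inv sx) sxy)

    -- Otherwise the three square classes of 1, x and y would be disjoint, and reading off
    -- (square, sign of the root) would inject three copies of the nonzero elements into two.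
    nonsquare-* : ∀ {x y} → Nz x → Nz y → ¬ Square x → ¬ Square y → Square (x * y)
    nonsquare-* {x} {y} nx ny ¬x ¬y with Square? (x * y)
    ... | yes s = s
    ... | no ¬xy = ⊥-elim (contra (enum-split Nz?))
      where
      rep : Fin 3 → Fin q
      rep zero          = 1#
      rep (suc zero)    = x
      rep (suc (suc _)) = y
      rep-nz : ∀ i → Nz (rep i)
      rep-nz zero          = 1-nz
      rep-nz (suc zero)    = nx
      rep-nz (suc (suc _)) = ny
      cross : ∀ {s t a b} → Nz s → Nz a → Nz b → s * (a * a) ≡ t * (b * b) → Square (s * t)
      cross {s} {t} {a} {b} ns na nb eq = s * (a * inv b) , *-nz ns (*-nz na (inv-nz nb)) , (begin
          (s * (a * inv b)) * (s * (a * inv b))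
            ≡⟨ solve 3 (λ s a i → (s :* (a :* i)) :* (s :* (a :* i)) := s :* (s :* (a :* a)) :* (i :* i)) refl s a (inv b) ⟩
          s * (s * (a * a)) * (inv b * inv b)
            ≡⟨ cong (λ z → s * z * (inv b * inv b)) eq ⟩
          s * (t * (b * b)) * (inv b * inv b)
            ≡⟨ solve 4 (λ s t b i → s :* (t :* (b :* b)) :* (i :* i) := s :* t :* ((b :* i) :* (b :* i))) refl s t b (inv b) ⟩
          s * t * ((b * inv b) * (b * inv b))
            ≡⟨ cong (λ z → s * t * (z * z)) (*-inv b nb) ⟩
          s * t * (1# * 1#)
            ≡⟨ solve 2 (λ s t → s :* t :* (con (+ 1) :* con (+ 1)) := s :* t) refl s t ⟩
          s * t ∎)
        where open ≡-Reasoning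
      distinct : ∀ i j → Square (rep i * rep j) → i ≡ j
      distinct zero zero _ = refl
      distinct zero (suc zero) s = ⊥-elim (¬x (square-div square-1 s))
      distinct zero (suc (suc zero)) s = ⊥-elim (¬y (square-div square-1 s))
      distinct (suc zero) zero s = ⊥-elim (¬x (square-div square-1 (subst Square (*-comm _ _) s)))
      distinct (suc (suc zero)) zero s = ⊥-elim (¬y (square-div square-1 (subst Square (*-comm _ _) s)))
      distinct (suc zero) (suc zero) _ = refl
      distinct (suc zero) (suc (suc zero)) s = ⊥-elim (¬xy s)
      distinct (suc (suc zero)) (suc zero) s = ⊥-elim (¬xy (subst Square (*-comm _ _) s))
      distinct (suc (suc zero)) (suc (suc zero)) _ = refl
      contra : (∃₂ λ k k′ → Enum Nz k × Enum (λ i → ¬ Nz i) k′ × k ℕ.+ k′ ≡ q) → ⊥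
      contra (zero , _ , e , _) with idx e 1# 1-nz
      ... | () , _
      contra (k@(suc _) , _ , e , _) = ℕP.<⇒≱ (ℕP.*-monoˡ-< k {2} {3} (ℕ.s≤s (ℕ.s≤s (ℕ.s≤s ℕ.z≤n))))
        (enum-≤ (enum-× (enum-all 3) e) (enum-× enum-Bool e)
          (λ (i , a) _ → sign a , rep i * (a * a))
          (λ (i , a) (_ , na) → tt , *-nz (rep-nz i) (*-nz na na))
          λ { (i , a) (_ , na) (j , b) (_ , nb) eq → inj′ i a j b na nb (cong proj₁ eq) (cong proj₂ eq) })
        where
        same-class : ∀ {i j} a b → i ≡ j → sign a ≡ sign b → rep i * (a * a) ≡ rep j * (b * b) → (i , a) ≡ (j , b)
        same-class {i} a b refl s eq = cong (i ,_) (square-sign a b (*-cancel (rep-nz i) eq) s)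
        inj′ : ∀ i a j b → Nz a → Nz b → sign a ≡ sign b → rep i * (a * a) ≡ rep j * (b * b) → (i , a) ≡ (j , b)
        inj′ i a j b na nb s eq = same-class a b (distinct i j (cross (rep-nz i) na nb eq)) s eq

-- Actions of SL₂ by generators and relations; unipotent, torus and Borel orbits.

module Actions where
  open Solver
  open Counting
  open FiniteFields
  open import Data.Fin using (_≟_)
  open import Data.Product using (Σ)
  open ≡

  -- `U x`, `H a` and `W` stand for the unipotent matrix u(x), the diagonal matrix h(a) = diag(a,
  -- 1/a) and the Weyl element w. The laws are relations modulo sign, as `H-neg` and `W-W` show.
  -- Equality of points is a relation because the same theory is applied both to points of `Fin n`
  -- and to classes of group elements.
  record SL2Action {q : ℕ} (F : FiniteField q) (X : Set) (_~_ : X → X → Set) : Set where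
    open FiniteField F
    field
      isEquiv : IsEquivalence _~_
      _~?_    : ∀ P R → Dec (P ~ R)
      U H     : Fin q → X → X
      W       : X → X
      U-cong  : ∀ x {P R} → P ~ R → U x P ~ U x R
      H-cong  : ∀ a {P R} → Nz a → P ~ R → H a P ~ H a R
      W-cong  : ∀ {P R} → P ~ R → W P ~ W R
      U-0     : ∀ P → U 0# P ~ P
      U-+     : ∀ x y P → U x (U y P) ~ U (x + y) P
      H-1     : ∀ P → H 1# P ~ P
      H-neg   : ∀ {a} P → Nz a → H (- a) P ~ H a P
      H-*     : ∀ {a b} P → Nz a → Nz b → H a (H b P) ~ H (a * b) P
      H-U     : ∀ {a} x P → Nz a → H a (U x P) ~ U (a * a * x) (H a P)
      W-H     : ∀ {a} P → Nz a → W (H a P) ~ H (inv a) (W P)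
      W-W     : ∀ P → W (W P) ~ P
      W-U-W   : ∀ {x} P → Nz x → W (U x (W P)) ~ U (- inv x) (H (inv x) (W (U (- inv x) P)))

  module FieldCounting {q : ℕ} (F : FiniteField q) where
    open FiniteField F

    abstract
      nonzero-count : ∃ λ N → Enum Nz N × suc N ≡ q
      nonzero-count with enum-split Nz?
      ... | N , k′ , e , e′ , eq = N , e , trans (ℕP.+-comm 1 N) (trans (cong (N ℕ.+_) (sym k′≡1)) eq)
        where
        single : Enum {Fin 1} (λ _ → ⊤) 1
        single = enum-all 1
        zero! : ∀ x → ¬ Nz x → x ≡ 0#
        zero! x ¬nz with x ≟ 0#
        ... | yes p = p
        ... | no nz = ⊥-elim (¬nz nz)
        k′≡1 : k′ ≡ 1
        k′≡1 = ℕP.≤-antisym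
          (enum-≤ e′ single (λ _ _ → zero) (λ _ _ → tt) (λ x p y p′ _ → trans (zero! x p) (sym (zero! y p′))))
          (enum-≤ single e′ (λ _ _ → 0#) (λ _ _ nz → nz refl) λ { zero _ zero _ _ → refl })

    -- Multiplication by δ is then an injection of the finite set S into itself, hence onto.
    scale-back : ∀ {S : Fin q → Set} → (∀ x → Dec (S x)) → ∀ {δ} → Nz δ →
                 (∀ x → S x → S (δ * x)) → ∀ x → S (δ * x) → S x
    scale-back {S} S? {δ} nδ stable x Sδx with S? x
    ... | yes p = p
    ... | no ¬Sx with enum-split S?
    ...   | v , _ , e , _ = ⊥-elim (ℕP.<-irrefl refl (subst (ℕ._≤ v) (ℕP.+-comm v 1)
      (enum-≤ (enum-⊎ e (enum-all 1)) e (λ y _ → δ * pick y)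
        (λ { (inj₁ y) Sy → stable y Sy ; (inj₂ _) _ → Sδx })
        (λ { (inj₁ y) _ (inj₁ z) _ eq → cong inj₁ (*-cancel nδ eq)
           ; (inj₁ y) Sy (inj₂ _) _ eq → ⊥-elim (¬Sx (subst S (*-cancel nδ eq) Sy))
           ; (inj₂ _) _ (inj₁ z) Sz eq → ⊥-elim (¬Sx (subst S (sym (*-cancel nδ eq)) Sz))
           ; (inj₂ zero) _ (inj₂ zero) _ eq → refl }))))
      where
      pick : Fin q ⊎ Fin 1 → Fin q
      pick (inj₁ y) = y
      pick (inj₂ _) = x

  module PointOrbit {q : ℕ} (F : FiniteField q) {X : Set} {_~_ : X → X → Set} (A : SL2Action F X _~_) where
    open FiniteField F
    open FieldCounting F
    open SL2Action A
    open IsEquivalence isEquiv renaming (refl to refl~; sym to sym~; trans to trans~; reflexive to ≡⇒~) public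

    U-≡ : ∀ {x y} P → x ≡ y → U x P ~ U y P
    U-≡ P refl = refl~

    H-≡ : ∀ {x y} P → x ≡ y → H x P ~ H y P
    H-≡ P refl = refl~

    U-cancel : ∀ x {P R} → U x P ~ U x R → P ~ R
    U-cancel x {P} {R} eq = trans~ (sym~ (back P)) (trans~ (U-cong (- x) eq) (back R))
      where
      back : ∀ P → U (- x) (U x P) ~ P
      back P = trans~ (U-+ (- x) x P) (trans~ (U-≡ P (-‿inverseˡ x)) (U-0 P))

    U-comm : ∀ x y P → U x (U y P) ~ U y (U x P)
    U-comm x y P = trans~ (U-+ x y P) (trans~ (U-≡ P (+-comm x y)) (sym~ (U-+ y x P)))

    H-back : ∀ {a} P → Nz a → H (inv a) (H a P) ~ P
    H-back {a} P na = trans~ (H-* P (inv-nz na) na) (trans~ (H-≡ P (inv-* na)) (H-1 P))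

    H-cancel : ∀ {a P R} → Nz a → H a P ~ H a R → P ~ R
    H-cancel {a} {P} {R} na eq = trans~ (sym~ (H-back P na)) (trans~ (H-cong (inv a) (inv-nz na) eq) (H-back R na))

    H-comm : ∀ {a b} P → Nz a → Nz b → H a (H b P) ~ H b (H a P)
    H-comm {a} {b} P na nb = trans~ (H-* P na nb) (trans~ (H-≡ P (*-comm a b)) (sym~ (H-* P nb na)))

    Stab : X → Fin q → Set
    Stab P x = U x P ~ P

    Stab? : ∀ P x → Dec (Stab P x)
    Stab? P x = U x P ~? P

    UOrbit : X → X → Set
    UOrbit P R = ∃ λ x → R ~ U x P

    UOrbit? : ∀ P R → Dec (UOrbit P R)
    UOrbit? P R = FP.any? λ x → R ~? U x P

    -- The projection to the torus of the stabiliser of `P` in the Borel group: h(a) P lies in the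
    -- U-orbit of P exactly when some u(y) h(a) fixes P.
    D : X → Fin q → Set
    D P a = Nz a × UOrbit P (H a P)

    D? : ∀ P a → Dec (D P a)
    D? P a = Nz? a ×-dec UOrbit? P (H a P)

    BOrbit : X → X → Set
    BOrbit P R = ∃₂ λ a x → Nz a × (R ~ H a (U x P))

    BOrbit? : ∀ P R → Dec (BOrbit P R)
    BOrbit? P R = FP.any? λ a → FP.any? λ x → Nz? a ×-dec (R ~? H a (U x P))

    Fixed : X → Set
    Fixed P = ∀ x → Stab P x

    Fixed? : ∀ P → Dec (Fixed P)
    Fixed? P = FP.all? (Stab? P)

    Stab-resp : ∀ {P R} → P ~ R → ∀ {x} → Stab P x → Stab R x
    Stab-resp eq {x} s = trans~ (U-cong x (sym~ eq)) (trans~ s eq)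

    Stab-0 : ∀ P → Stab P 0#
    Stab-0 = U-0

    Stab-+ : ∀ P {x y} → Stab P x → Stab P y → Stab P (x + y)
    Stab-+ P {x} {y} sx sy = trans~ (sym~ (U-+ x y P)) (trans~ (U-cong x sy) sx)

    Stab-neg : ∀ P {x} → Stab P x → Stab P (- x)
    Stab-neg P {x} sx = U-cancel x (trans~ (U-+ x (- x) P) (trans~ (U-≡ P (-‿inverseʳ x)) (trans~ (U-0 P) (sym~ sx))))

    Stab-minus : ∀ P {x y} → Stab P x → Stab P y → Stab P (x - y)
    Stab-minus P sx sy = Stab-+ P sx (Stab-neg P sy)

    Stab-U : ∀ P y {x} → Stab P x → Stab (U y P) x
    Stab-U P y {x} s = trans~ (U-comm x y P) (U-cong y s)

    Stab-H : ∀ P {a x} → Nz a → Stab P x → Stab (H a P) (a * a * x)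
    Stab-H P {a} {x} na s = trans~ (sym~ (H-U x P na)) (H-cong a na s)

    Stab-H⁻ : ∀ P {a x} → Nz a → Stab (H a P) (a * a * x) → Stab P x
    Stab-H⁻ P {a} {x} na s = H-cancel na (trans~ (H-U x P na) s)

    U-≈ : ∀ P {x y} → U x P ~ U y P → Stab P (x - y)
    U-≈ P {x} {y} eq = U-cancel y (trans~ (U-+ y (x - y) P)
      (trans~ (U-≡ P (solve 2 (λ x y → y :+ (x :- y) := x) refl x y)) eq))

    Stab⇒U : ∀ P {x y} → Stab P (x - y) → U x P ~ U y P
    Stab⇒U P {x} {y} s = trans~ (U-≡ P (solve 2 (λ x y → x := y :+ (x :- y)) refl x y))
      (trans~ (sym~ (U-+ y (x - y) P)) (U-cong y s))

    Stab-D : ∀ P {a x} → D P a → Stab P x → Stab P (a * a * x)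
    Stab-D P {a} {x} (na , y , eq) s =
      U-cancel y (trans~ (U-comm y _ P) (Stab-resp eq (Stab-H P na s)))

    UOrbit-sym : ∀ {P R} → UOrbit P R → UOrbit R P
    UOrbit-sym {P} {R} (x , eq) = - x , U-cancel x (trans~ (sym~ eq)
      (sym~ (trans~ (U-+ x (- x) R) (trans~ (U-≡ R (-‿inverseʳ x)) (U-0 R)))))

    UOrbit-trans : ∀ {P R S} → UOrbit P R → UOrbit R S → UOrbit P S
    UOrbit-trans {P} (x , eq) (y , eq′) = y + x , trans~ eq′ (trans~ (U-cong y eq) (U-+ y x P))

    UOrbit-H : ∀ {P R a} → Nz a → UOrbit P R → UOrbit (H a P) (H a R)
    UOrbit-H {P} {R} {a} na (x , eq) = a * a * x , trans~ (H-cong a na eq) (H-U x P na)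

    UOrbit-~ : ∀ {P R} → P ~ R → UOrbit P R
    UOrbit-~ {P} eq = 0# , trans~ (sym~ eq) (sym~ (U-0 P))

    UOrbit-U : ∀ P x → UOrbit P (U x P)
    UOrbit-U P x = x , refl~

    D-* : ∀ P {a b} → D P a → D P b → D P (a * b)
    D-* P {a} {b} (na , oa) (nb , ob) = *-nz na nb ,
      UOrbit-trans oa (UOrbit-trans (UOrbit-H na ob) (UOrbit-~ (H-* P na nb)))

    D-inv : ∀ P {a} → D P a → D P (inv a)
    D-inv P {a} (na , oa) = inv-nz na ,
      UOrbit-sym (UOrbit-trans (UOrbit-H (inv-nz na) oa) (UOrbit-~ (H-back P na)))

    -- Over a point P: (a , x) ↦ h(a) u(x) P has fibres of size at most |D P| · |Stab P|.
    b-orbit : ∀ {N d v} P → Enum Nz N → Enum (D P) d → Enum (Stab P) v →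
      ∃ λ c → Σ (Fin c → X) λ f → Distinct _~_ _~?_ f × (∀ i → BOrbit P (f i)) × N ℕ.* q ℕ.≤ c ℕ.* (d ℕ.* v)
    b-orbit {N} {d} {v} P eN eD eS = c , (λ i → pt (at pairs (r i))) , r-dist ,
        (λ i → proj₁ (at pairs (r i)) , proj₂ (at pairs (r i)) , proj₁ (sat pairs (r i)) , refl~) ,
        enum-≤ pairs (enum-× (enum-all c) (enum-× eD eS)) f f-ok f-inj
      where
      pairs : Enum {Fin q × Fin q} (λ (a , _) → Nz a × ⊤) (N ℕ.* q)
      pairs = enum-× eN (enum-all q)
      pt : Fin q × Fin q → X
      pt (a , x) = H a (U x P)
      reps = representatives _~_ _~?_ refl~ sym~ (λ k → pt (at pairs k))
      c = proj₁ reps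
      r = proj₁ (proj₂ reps)
      r-dist = proj₁ (proj₂ (proj₂ reps))
      cov : ∀ ax → Nz (proj₁ ax) × ⊤ → ∃ λ i → pt ax ~ pt (at pairs (r i))
      cov ax p = let (k , ek) = idx pairs ax p ; (i , ei) = proj₂ (proj₂ (proj₂ reps)) k in
                 i , trans~ (≡⇒~ (cong pt (sym ek))) ei
      base : Fin c → Fin q × Fin q
      base i = at pairs (r i)
      base-nz : ∀ i → Nz (proj₁ (base i))
      base-nz i = proj₁ (sat pairs (r i))
      -- A chosen y with h(a) P = u(y) P; the default `0#` is taken only outside `D P`.
      shift : Fin q → Fin q
      shift a with UOrbit? P (H a P)
      ... | yes (y , _) = y
      ... | no _        = 0#
      shift-ok : ∀ {a} → D P a → H a P ~ U (shift a) P
      shift-ok {a} (na , o) with UOrbit? P (H a P)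
      ... | yes (y , eq) = eq
      ... | no ¬o = ⊥-elim (¬o o)
      ratio : Fin c → Fin q → Fin q
      ratio i a = inv (proj₁ (base i)) * a
      moved : ∀ i a x → Nz a → H a (U x P) ~ pt (base i) → H (ratio i a) (U x P) ~ U (proj₂ (base i)) P
      moved i a x na eq = trans~ (sym~ (H-* _ (inv-nz (base-nz i)) na))
        (trans~ (H-cong _ (inv-nz (base-nz i)) eq) (H-back _ (base-nz i)))
      inD : ∀ i a x → Nz a → H a (U x P) ~ pt (base i) → D P (ratio i a)
      inD i a x na eq = nr , UOrbit-trans (proj₂ (base i) , moved i a x na eq)
          (UOrbit-sym (UOrbit-H nr (UOrbit-U P x)))
        where nr = *-nz (inv-nz (base-nz i)) na
      -- Write r for the ratio. Then h(r) u(x) P = u(r²x) h(r) P = u(r²x + shift r) P, and this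
      -- equals u(base) P, so the difference of the parameters lies in the stabiliser.
      third : Fin c → Fin q → Fin q → Fin q
      third i a x = (ratio i a * ratio i a * x + shift (ratio i a)) - proj₂ (base i)
      f : ∀ ax → Nz (proj₁ ax) × ⊤ → Fin c × (Fin q × Fin q)
      f ax@(a , x) p = let i = proj₁ (cov ax p) in i , (ratio i a , third i a x)
      f-ok : ∀ ax p → ⊤ × (D P (proj₁ (proj₂ (f ax p))) × Stab P (proj₂ (proj₂ (f ax p))))
      f-ok ax@(a , x) p@(na , _) = tt , dd , U-≈ P
          (trans~ (sym~ (U-+ _ _ P)) (trans~ (U-cong _ (sym~ (shift-ok dd)))
          (trans~ (sym~ (H-U x P (proj₁ dd))) (moved i a x na eq))))
        where
        i = proj₁ (cov ax p)
        eq = proj₂ (cov ax p)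
        dd = inD i a x na eq
      same : ∀ i a x b y → Nz a → Nz b → (ratio i a , third i a x) ≡ (ratio i b , third i b y) → (a , x) ≡ (b , y)
      same i a x b y na nb eq with *-cancel (inv-nz (base-nz i)) (cong proj₁ eq)
      ... | refl = cong (a ,_) (*-cancel (*-nz nr nr) (diff≡0 (trans
          (solve 4 (λ s t u w → s :- t := ((s :+ u) :- w) :- ((t :+ u) :- w)) refl
            (ratio i a * ratio i a * x) (ratio i a * ratio i a * y) (shift (ratio i a)) (proj₂ (base i)))
          (≡⇒diff (cong proj₂ eq)))))
        where nr = *-nz (inv-nz (base-nz i)) na
      f-inj : ∀ ax p by p′ → f ax p ≡ f by p′ → ax ≡ by
      f-inj (a , x) p (b , y) p′ eq = same _ a x b y (proj₁ p) (proj₁ p′)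
        (trans (cong proj₂ eq) (cong (λ i → ratio i b , third i b y) (sym (cong proj₁ eq))))

    -- Squares of elements of D P act freely on the nonzero cosets of Stab P.
    D-coset : ∀ P {a b x s t} → D P a → D P b → ¬ Stab P x → Stab P s → Stab P t →
              a * a * x + s ≡ b * b * x + t → a * a ≡ b * b
    D-coset P {a} {b} {x} {s} {t} da db ¬sx ss st eq with a * a - b * b ≟ 0#
    ... | yes p = diff≡0 p
    -- Multiplication by a² - b² preserves the stabiliser, because a² and b² do. It sends x to t -
    -- s, which lies there, so `scale-back` puts x there as well.
    ... | no nz = ⊥-elim (¬sx (scale-back (Stab? P) nz
        (λ y sy → subst (Stab P) (solve 3 (λ a b y → a :* y :- b :* y := (a :- b) :* y) refl (a * a) (b * b) y)
                    (Stab-minus P (Stab-D P da sy) (Stab-D P db sy)))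
        x (subst (Stab P) lem (Stab-minus P st ss))))
      where
      lem : t - s ≡ (a * a - b * b) * x
      lem = trans (solve 4 (λ u w s t → t :- s := (w :+ t) :- (w :+ s)) refl (a * a * x) (b * b * x) s t)
            (trans (cong (λ z → z - (b * b * x + s)) (sym eq))
                   (solve 4 (λ a b x s → (a :* x :+ s) :- (b :* x :+ s) := (a :- b) :* x) refl (a * a) (b * b) x s))

    -- The elements a²·rep i + s lie outside the stabiliser and determine i, then a² by `D-coset`,
    -- then s. The code `sgn` restores a from a²; it takes two values in general and one when
    -- squaring is injective.
    cosets-≤ : ∀ {d v v′ k m} {Q : Bool → Set} P → Enum (D P) d → Enum (Stab P) v → Enum (λ x → ¬ Stab P x) v′ →
      Enum Q m → (sgn : Fin q → Bool) → (∀ a → Q (sgn a)) → (∀ a b → a * a ≡ b * b → sgn a ≡ sgn b → a ≡ b) →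
      (rep : Fin k → Fin q) → (∀ i → ¬ Stab P (rep i)) →
      (∀ i j a b s t → D P a → D P b → Stab P s → Stab P t → a * a * rep i + s ≡ b * b * rep j + t → i ≡ j) →
      k ℕ.* (d ℕ.* v) ℕ.≤ m ℕ.* v′
    cosets-≤ {k = k} P eD eS eS′ eQ sgn Qsgn sgn-sep rep ¬rep sep =
      enum-≤ (enum-× (enum-all k) (enum-× eD eS)) (enum-× eQ eS′)
        (λ (i , a , s) _ → sgn a , a * a * rep i + s)
        (λ (i , a , s) (_ , da , ss) → Qsgn a , λ bad → ¬rep i (unscale i a s da ss bad))
        λ { (i , a , s) (_ , da , ss) (j , b , t) (_ , db , st) eq →
            inj′ i a s j b t da db ss st (cong proj₁ eq) (cong proj₂ eq) }
      where
      unscale : ∀ i a s → D P a → Stab P s → Stab P (a * a * rep i + s) → Stab P (rep i)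
      unscale i a s da ss bad = subst (Stab P) lem (Stab-D P (D-inv P da) (subst (Stab P)
          (solve 2 (λ x s → (x :+ s) :- s := x) refl (a * a * rep i) s) (Stab-minus P bad ss)))
        where
        lem : inv a * inv a * (a * a * rep i) ≡ rep i
        lem = trans (solve 3 (λ a x i → i :* i :* (a :* a :* x) := (a :* i) :* (a :* i) :* x) refl a (rep i) (inv a))
          (trans (cong (λ z → z * z * rep i) (*-inv a (proj₁ da))) (solve 1 (λ x → con (+ 1) :* con (+ 1) :* x := x) refl (rep i)))
      inj′ : ∀ i a s j b t → D P a → D P b → Stab P s → Stab P t → sgn a ≡ sgn b →
             a * a * rep i + s ≡ b * b * rep j + t → (i , a , s) ≡ (j , b , t)
      inj′ i a s j b t da db ss st sg eq with sep i j a b s t da db ss st eq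
      ... | refl with sgn-sep a b (D-coset P da db (¬rep i) ss st eq) sg
      ... | refl = cong (λ z → i , a , z) (trans (solve 2 (λ x s → s := (x :+ s) :- x) refl (a * a * rep i) s)
            (trans (cong (λ z → z - a * a * rep i) eq) (solve 2 (λ x s → (x :+ s) :- x := s) refl (a * a * rep i) t)))

-- Numerical contradictions that close the counting arguments.

module Inequalities where
  open import Data.Nat
  open import Data.Nat.Properties
  open import Data.Nat.Tactic.RingSolver using (solve-∀)
  open ≡

  -- The slack `k` is supplied explicitly, so a strict polynomial inequality becomes an identity for
  -- the ring solver.
  excess : ∀ {m n} k → m ≤ n → m ≡ suc (n + k) → ⊥
  excess {m} {n} k le eq = <-irrefl refl (≤-trans (s≤s (m≤m+n n k)) (subst (_≤ n) eq le))

  -- The right-hand side is at most (q + 1)(q - 2) = q(q - 1) - 2.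
  single-class-⊥ : ∀ {N q c dv v v′} → suc N ≡ q → N * q ≤ c * dv → c ≤ suc q → dv ≤ v′ → v + v′ ≡ q → 2 ≤ v → ⊥
  single-class-⊥ {N} {q} {c} {dv} {suc (suc u)} {v′} Nq a b d vv (s≤s (s≤s z≤n)) rewrite sym vv | suc-injective Nq =
    excess (u * v′ + (1 + 3 * u + u * u)) (≤-trans a (*-mono-≤ b d)) (lem u v′)
    where
    lem : ∀ u v′ → (1 + (u + v′)) * (2 + (u + v′)) ≡ suc ((3 + (u + v′)) * v′ + (u * v′ + (1 + 3 * u + u * u)))
    lem = solve-∀

  -- Adding the two counts gives 2q(q - 1) ≤ 2(q + 1)(q - 2), which is false.
  two-orbits-⊥ : ∀ {N q M c₁ c₂ e₁ e₂} → suc N ≡ q → N ≡ suc M → N * q ≤ c₁ * e₁ → N * q ≤ c₂ * e₂ →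
    e₁ ≤ 2 * M → e₂ ≤ 2 * M → c₁ + c₂ ≤ suc q → ⊥
  two-orbits-⊥ {M = M} {c₁} {c₂} refl refl a₁ a₂ b₁ b₂ c =
    excess 3 (≤-trans (+-mono-≤ (≤-trans a₁ (*-monoʳ-≤ c₁ b₁)) (≤-trans a₂ (*-monoʳ-≤ c₂ b₂)))
      (≤-trans (≤-reflexive (sym (*-distribʳ-+ (2 * M) c₁ c₂))) (*-monoˡ-≤ (2 * M) c))) (lem M)
    where
    lem : ∀ M → (1 + M) * (2 + M) + (1 + M) * (2 + M) ≡ suc ((3 + M) * (2 * M) + 3)
    lem = solve-∀

  -- The second orbit already has q points, so the first has at most one, and then q(q - 1) ≤ 2(q -
  -- 2).
  regular-orbit-⊥ : ∀ {N q M c₁ c₂ e₁ e₂} → suc N ≡ q → N ≡ suc M → N * q ≤ c₁ * e₁ → N * q ≤ c₂ * e₂ →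
    e₁ ≤ 2 * M → e₂ ≤ N → c₁ + c₂ ≤ suc q → ⊥
  regular-orbit-⊥ {M = M} {c₁} {c₂} {e₁} refl refl a₁ a₂ b₁ b₂ c =
    excess (1 + M + M * M) (≤-trans a₁ (*-mono-≤ c₁≤1 b₁)) (lem M)
    where
    q≤c₂ : suc (suc M) ≤ c₂
    q≤c₂ = *-cancelˡ-≤ (suc M) (≤-trans a₂ (≤-trans (*-monoʳ-≤ c₂ b₂) (≤-reflexive (*-comm c₂ (suc M)))))
    c₁≤1 : c₁ ≤ 1
    c₁≤1 = +-cancelʳ-≤ (suc (suc M)) c₁ 1 (≤-trans (+-monoʳ-≤ c₁ q≤c₂) c)
    lem : ∀ M → (1 + M) * (2 + M) ≡ suc (1 * (2 * M) + (1 + M + M * M))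
    lem = solve-∀

  -- Cancelling q leaves 3(q - 1) ≤ 2(q + 1), hence q ≤ 5.
  trivial-torus-⊥ : ∀ {N q c d v} → suc N ≡ q → N * q ≤ c * (d * v) → c ≤ suc q → d ≤ 2 → 3 * v ≤ q → 12 ≤ q → ⊥
  trivial-torus-⊥ {N} {q} {c} {d} {v} refl a b d≤2 v3 big = <⇒≱ (s≤s (s≤s (s≤s (s≤s (s≤s (z≤n {6})))))) (≤-trans big′ N≤4)
    where
    big′ : 11 ≤ N
    big′ = s≤s⁻¹ big
    3N : q * (3 * N) ≤ q * (2 * suc q)
    3N = begin
      q * (3 * N)           ≡⟨ l1 q N ⟩
      3 * (N * q)           ≤⟨ *-monoʳ-≤ 3 (≤-trans a (*-mono-≤ b (*-monoˡ-≤ v d≤2))) ⟩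
      3 * (suc q * (2 * v)) ≡⟨ l2 (suc q) v ⟩
      suc q * 2 * (3 * v)   ≤⟨ *-monoʳ-≤ (suc q * 2) v3 ⟩
      suc q * 2 * q         ≡⟨ l3 (suc q) q ⟩
      q * (2 * suc q)       ∎
      where
      open ≤-Reasoning
      l1 : ∀ q N → q * (3 * N) ≡ 3 * (N * q)
      l1 = solve-∀
      l2 : ∀ s v → 3 * (s * (2 * v)) ≡ s * 2 * (3 * v)
      l2 = solve-∀
      l3 : ∀ s q → s * 2 * q ≡ q * (2 * s)
      l3 = solve-∀
    N≤4 : N ≤ 4
    N≤4 = +-cancelˡ-≤ (2 * N) N 4 (subst₂ _≤_ (m1 N) (m2 N) (*-cancelˡ-≤ q 3N))
      where
      m1 : ∀ N → 3 * N ≡ 2 * N + N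
      m1 = solve-∀
      m2 : ∀ N → 2 * (2 + N) ≡ 2 * N + 4
      m2 = solve-∀

  -- With v = v₁ + 1, multiplying v′ ≤ v₁ + d by v and using d v ≤ 2v′ gives v′(v - 2) ≤ (v - 1)v.
  -- Since v′ ≥ 2v, this forces v ≤ 3, and v = 3 leaves only v′ ≤ 6, hence q ≤ 9.
  one-class-⊥ : ∀ {q d v₁ v′} → q ≤ suc v₁ + v₁ + d → d * suc v₁ ≤ 2 * v′ → suc v₁ + v′ ≡ q →
    3 * suc v₁ ≤ q → 3 ≤ suc v₁ → 12 ≤ q → ⊥
  one-class-⊥ {q} {d} {suc (suc u)} {v′} a b refl c (s≤s (s≤s (s≤s z≤n))) big = contra u refl
    where
    v = 3 + u
    v′≤ : v′ ≤ (2 + u) + d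
    v′≤ = +-cancelˡ-≤ v v′ ((2 + u) + d) (≤-trans a (≤-reflexive (+-assoc v (2 + u) d)))
    2v≤v′ : 2 * v ≤ v′
    2v≤v′ = +-cancelˡ-≤ v (2 * v) v′ c
    key : v′ * (1 + u) ≤ (2 + u) * v
    key = +-cancelʳ-≤ (2 * v′) _ _ (begin
      v′ * (1 + u) + 2 * v′    ≡⟨ l1 v′ u ⟩
      v′ * (3 + u)             ≤⟨ *-monoˡ-≤ v v′≤ ⟩
      ((2 + u) + d) * v        ≡⟨ *-distribʳ-+ v (2 + u) d ⟩
      (2 + u) * v + d * v      ≤⟨ +-monoʳ-≤ ((2 + u) * v) b ⟩
      (2 + u) * v + 2 * v′     ∎)
      where
      open ≤-Reasoning
      l1 : ∀ v′ u → v′ * (1 + u) + 2 * v′ ≡ v′ * (3 + u)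
      l1 = solve-∀
    contra : ∀ w → u ≡ w → ⊥
    contra (suc w) refl = excess (w * w + 5 * w + 3) (≤-trans (*-monoˡ-≤ (2 + w) 2v≤v′) key) (l2 w)
      where
      l2 : ∀ w → 2 * (4 + w) * (2 + w) ≡ suc ((3 + w) * (4 + w) + (w * w + 5 * w + 3))
      l2 = solve-∀
    contra zero refl = <⇒≱ (s≤s (s≤s (s≤s (s≤s (s≤s (s≤s (s≤s (z≤n {2})))))))) (+-cancelˡ-≤ 3 9 6 (≤-trans big (+-monoʳ-≤ 3 (subst (_≤ 6) (*-identityʳ v′) key))))

-- U acts freely on the points that it does not fix.

module RegularOrbits where
  open Solver
  open Counting
  open FiniteFields
  open Actions
  open Inequalities
  open import Data.Fin using (_≟_; splitAt)
  open import Data.Product using (Σ)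
  open ≡

  module Regularity {q : ℕ} (F : FiniteField q) {X : Set} {_~_ : X → X → Set} (A : SL2Action F X _~_)
    (big : 12 ℕ.≤ q)
    (bound : ∀ {c} (f : Fin c → X) → (∀ i j → f i ~ f j → i ≡ j) → c ℕ.≤ suc q) where
    open FiniteField F
    open FieldCounting F
    open SL2Action A
    open PointOrbit F A public

    N = proj₁ nonzero-count
    eN : Enum Nz N
    eN = proj₁ (proj₂ nonzero-count)
    N+1 : suc N ≡ q
    N+1 = proj₂ (proj₂ nonzero-count)

    -- The numerical data of one Borel orbit. `count` is the orbit-stabiliser inequality, with
    -- `d * v` bounding the fibres of the map from pairs (a, x) to points.
    record Sizes (P : X) : Set where
      field
        {c d v v′} : ℕ
        eD  : Enum (D P) d
        eS  : Enum (Stab P) v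
        eS′ : Enum (λ x → ¬ Stab P x) v′
        v+v′ : v ℕ.+ v′ ≡ q
        pts : Fin c → X
        distinct : ∀ i j → pts i ~ pts j → i ≡ j
        inB : ∀ i → BOrbit P (pts i)
        count : N ℕ.* q ℕ.≤ c ℕ.* (d ℕ.* v)
      c≤ : c ℕ.≤ suc q
      c≤ = bound pts distinct

    assemble : ∀ {P d v v′} → Enum (D P) d → Enum (Stab P) v → Enum (λ x → ¬ Stab P x) v′ → v ℕ.+ v′ ≡ q →
      (∃ λ c → Σ (Fin c → X) λ f → Distinct _~_ _~?_ f × (∀ i → BOrbit P (f i)) × N ℕ.* q ℕ.≤ c ℕ.* (d ℕ.* v)) → Sizes P
    assemble eD eS eS′ v+v′ (_ , pts , distinct , inB , count) =
      record { eD = eD ; eS = eS ; eS′ = eS′ ; v+v′ = v+v′ ; pts = pts ; distinct = distinct ; inB = inB ; count = count }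

    abstract
      sizes : ∀ P → Sizes P
      sizes P = let (_ , _ , eD , _) = enum-split (D? P) ; (_ , _ , eS , eS′ , v+v′) = enum-split (Stab? P) in
        assemble eD eS eS′ v+v′ (b-orbit P eN eD eS)

    2≤v : ∀ {P v x} → Enum (Stab P) v → Nz x → Stab P x → 2 ℕ.≤ v
    2≤v {P} {x = x} eS nx sx = enum-≤ enum-Bool eS (λ b _ → g b)
        (λ { true _ → Stab-0 P ; false _ → sx })
        λ { true _ true _ _ → refl ; true _ false _ eq → ⊥-elim (nx (sym eq)) ; false _ true _ eq → ⊥-elim (nx eq) ; false _ false _ _ → refl }
      where
      g : Bool → Fin q
      g true  = 0#
      g false = x

    -- A single coset outside the stabiliser suffices: the squares of `D P` move it freely, and
    -- squaring is at most two-to-one.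
    dv≤2v′ : ∀ {P} → ¬ Fixed P → (s : Sizes P) → let open Sizes s in d ℕ.* v ℕ.≤ 2 ℕ.* v′
    dv≤2v′ {P} ¬fix s with FP.¬∀⟶∃¬ q _ (Stab? P) ¬fix
    ... | x , ¬sx = subst (ℕ._≤ 2 ℕ.* v′) (ℕP.+-identityʳ _)
        (cosets-≤ P eD eS eS′ enum-Bool sign (λ _ → tt) square-sign (λ (_ : Fin 1) → x) (λ _ → ¬sx)
          (λ { zero zero _ _ _ _ _ _ _ _ _ → refl }))
      where open Sizes s

    Fixed-resp : ∀ {P R} → P ~ R → Fixed P → Fixed R
    Fixed-resp eq fix x = Stab-resp eq (fix x)

    Fixed-U : ∀ {P} x → Fixed (U x P) → Fixed P
    Fixed-U {P} x fix y = U-cancel x (trans~ (U-comm x y P) (fix y))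

    Fixed-H : ∀ {P a} → Nz a → Fixed (H a P) → Fixed P
    Fixed-H {P} {a} na fix x = Stab-H⁻ P na (fix (a * a * x))

    BOrbit-sym : ∀ {P R} → BOrbit P R → BOrbit R P
    BOrbit-sym {P} {R} (a , x , na , eq) = inv a , a * a * (- x) , inv-nz na ,
      sym~ (trans~ (H-cong (inv a) (inv-nz na) (trans~ (U-cong _ eq) (trans~ (sym~ (H-U (- x) (U x P) na)) (H-cong a na
        (trans~ (U-+ (- x) x P) (trans~ (U-≡ P (-‿inverseˡ x)) (U-0 P))))))) (H-back P na))

    BOrbit-trans : ∀ {P R S} → BOrbit P R → BOrbit R S → BOrbit P S
    BOrbit-trans {P} (a , x , na , eq) (b , y , nb , eq′) =
      b * a , inv a * inv a * y + x , *-nz nb na , trans~ eq′ (trans~ (H-cong b nb (trans~ (U-cong y eq)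
        (trans~ (U-≡ _ lem) (trans~ (sym~ (H-U _ (U x P) na)) (H-cong a na (U-+ _ x P)))))) (H-* _ nb na))
      where
      lem : y ≡ a * a * (inv a * inv a * y)
      lem = sym (trans (solve 3 (λ a i y → a :* a :* (i :* i :* y) := (a :* i) :* (a :* i) :* y) refl a (inv a) y)
        (trans (cong (λ z → z * z * y) (*-inv a na)) (solve 1 (λ y → con (+ 1) :* con (+ 1) :* y := y) refl y)))

    UOrbit⇒BOrbit : ∀ {P R} → UOrbit P R → BOrbit P R
    UOrbit⇒BOrbit {P} (x , eq) = 1# , x , 1-nz , trans~ eq (sym~ (H-1 _))

    BOrbit⇒UOrbit-H : ∀ {P R} → BOrbit P R → ∃ λ a → Nz a × UOrbit (H a P) R
    BOrbit⇒UOrbit-H {P} (a , x , na , eq) = a , na , a * a * x , trans~ eq (H-U x P na)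

    -- Two different B-orbits of moved points, one of them with a nontrivial stabiliser in U,
    -- would together exceed the q + 1 points available.
    moved-orbit : ∀ {P R x} → ¬ Fixed P → Nz x → Stab P x → ¬ Fixed R → BOrbit P R
    moved-orbit {P} {R} {x} ¬fixP nx sx ¬fixR with BOrbit? P R
    ... | yes o = o
    ... | no ¬o = ⊥-elim contra
      where
      module p = Sizes (sizes P)
      module r = Sizes (sizes R)
      both : Fin p.c ⊎ Fin r.c → X
      both (inj₁ i) = p.pts i
      both (inj₂ j) = r.pts j
      both-inj : ∀ s t → both s ~ both t → s ≡ t
      both-inj (inj₁ i) (inj₁ j) eq = cong inj₁ (p.distinct i j eq)
      both-inj (inj₂ i) (inj₂ j) eq = cong inj₂ (r.distinct i j eq)
      both-inj (inj₁ i) (inj₂ j) eq = ⊥-elim (¬o (BOrbit-trans (p.inB i) (BOrbit-trans (UOrbit⇒BOrbit (UOrbit-~ eq)) (BOrbit-sym (r.inB j)))))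
      both-inj (inj₂ i) (inj₁ j) eq = ⊥-elim (¬o (BOrbit-trans (p.inB j) (BOrbit-trans (UOrbit⇒BOrbit (UOrbit-~ (sym~ eq))) (BOrbit-sym (r.inB i)))))
      c+c≤ : p.c ℕ.+ r.c ℕ.≤ suc q
      c+c≤ = bound (λ k → both (splitAt p.c k)) λ i j eq →
        trans (sym (FP.join-splitAt p.c r.c i)) (trans (cong (Data.Fin.join p.c r.c) (both-inj (splitAt p.c i) (splitAt p.c j) eq)) (FP.join-splitAt p.c r.c j))
      v′≤ : ∀ {v v′ M} → v ℕ.+ v′ ≡ q → N ≡ suc M → 2 ℕ.≤ v → v′ ℕ.≤ M
      v′≤ {v} {v′} {M} eq N≡ le = ℕP.+-cancelˡ-≤ 2 v′ M
        (ℕP.≤-trans (ℕP.+-monoˡ-≤ v′ le) (ℕP.≤-reflexive (trans eq (trans (sym N+1) (cong suc N≡)))))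
      predN : ∃ λ M → N ≡ suc M
      predN with N | N+1
      ... | zero  | eq = ⊥-elim (ℕP.<⇒≱ (ℕP.<-≤-trans (ℕ.s≤s (ℕ.s≤s ℕ.z≤n)) big) (ℕP.≤-reflexive (sym eq)))
      ... | suc M | _  = M , refl
      M = proj₁ predN
      e≤ : ∀ {Q} → ¬ Fixed Q → (s : Sizes Q) → 2 ℕ.≤ Sizes.v s → Sizes.d s ℕ.* Sizes.v s ℕ.≤ 2 ℕ.* M
      e≤ ¬fix s le = ℕP.≤-trans (dv≤2v′ ¬fix s) (ℕP.*-monoʳ-≤ 2 (v′≤ (Sizes.v+v′ s) (proj₂ predN) le))
      contra : ⊥
      contra with FP.any? (λ y → Nz? y ×-dec Stab? R y)
      -- If R also has a nontrivial stabiliser, both orbits satisfy the bound d v ≤ 2(q - 2).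
      -- Otherwise v ≤ 1 for R, and d v ≤ q - 1.
      ... | yes (y , ny , sy) = two-orbits-⊥ {c₁ = p.c} {r.c} N+1 (proj₂ predN) p.count r.count
              (e≤ ¬fixP (sizes P) (2≤v p.eS nx sx)) (e≤ ¬fixR (sizes R) (2≤v r.eS ny sy)) c+c≤
      ... | no free = regular-orbit-⊥ {c₁ = p.c} {r.c} N+1 (proj₂ predN) p.count r.count
              (e≤ ¬fixP (sizes P) (2≤v p.eS nx sx)) dv≤N c+c≤
        where
        v≤1 : r.v ℕ.≤ 1
        v≤1 = enum-≤ r.eS (enum-all 1) (λ _ _ → zero) (λ _ _ → tt) λ y sy z sz _ → trans (zero! y sy) (sym (zero! z sz))
          where
          zero! : ∀ y → Stab R y → y ≡ 0#
          zero! y sy = decidable-stable (y ≟ 0#) λ ny → free (y , ny , sy)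
        dv≤N : r.d ℕ.* r.v ℕ.≤ N
        dv≤N = ℕP.≤-trans (ℕP.*-mono-≤ (enum-≤ r.eD eN (λ a _ → a) (λ a da → proj₁ da) (λ _ _ _ _ eq → eq)) v≤1)
                          (ℕP.≤-reflexive (ℕP.*-identityʳ N))

    -- Since u(x) P = P, w P = w u(x) w (w P). The relation for w u(x) w, with U fixing w P,
    -- rewrites this as u(-1/x) h(1/x) P. So P is a torus translate of a U-fixed point, and the
    -- torus normalises U.
    W-Fixed : ∀ {P x} → Nz x → Stab P x → Fixed (W P) → Fixed P
    W-Fixed {P} {x} nx sx fix = Fixed-H (inv-nz nx) (Fixed-resp (U-cancel (- inv x) (trans~ (fix _) WP~)) fix)
      where
      WP~ : W P ~ U (- inv x) (H (inv x) P)
      WP~ = trans~ (sym~ (W-cong (trans~ (U-cong x (W-W P)) sx)))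
        (trans~ (W-U-W (W P) nx) (U-cong _ (H-cong _ (inv-nz nx) (trans~ (W-cong (fix _)) (W-W P)))))

    -- A hypothetical point that U moves although a nonzero `x₁` fixes it. The facts collected here
    -- lead to a contradiction in `DFixedPoint`.
    module MovedPoint {P : X} (¬fixP : ¬ Fixed P) {x₁ : Fin q} (nx₁ : Nz x₁) (sx₁ : Stab P x₁) where
      open Sizes (sizes P)

      SameClass : Fin q → Fin q → Set
      SameClass x y = ∃ λ a → D P a × Stab P (y - a * a * x)

      SameClass? : ∀ x y → Dec (SameClass x y)
      SameClass? x y = FP.any? λ a → D? P a ×-dec Stab? P (y - a * a * x)

      -- In characteristic 2 squaring is injective, so the factor 2 of `dv≤2v′` disappears and d v ≤
      -- v′ contradicts the orbit count.
      odd : Nz (1# + 1#)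
      odd 2≡0 = single-class-⊥ {c = c} N+1 count c≤ dv≤v′ v+v′ (2≤v eS nx₁ sx₁)
        where
        enum-true : Enum (_≡ true) 1
        enum-true = record { at = λ _ → true ; sat = λ _ → refl ; inj = λ { zero zero _ → refl } ; idx = λ _ eq → zero , sym eq }
        char2 : ∀ a → - a ≡ a
        char2 a = trans (solve 1 (λ a → :- a := a :- (con (+ 1) :+ con (+ 1)) :* a) refl a)
          (trans (cong (λ z → a - z * a) 2≡0) (solve 1 (λ a → a :- con (+ 0) :* a := a) refl a))
        root-unique : ∀ a b → a * a ≡ b * b → true ≡ true → a ≡ b
        root-unique a b eq _ = [ (λ p → p) , (λ p → trans p (char2 b)) ]′ (squares-≡ a b eq)
        dv≤v′ : d ℕ.* v ℕ.≤ v′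
        dv≤v′ with FP.¬∀⟶∃¬ q _ (Stab? P) ¬fixP
        ... | x , ¬sx = subst₂ ℕ._≤_ (ℕP.+-identityʳ _) (ℕP.+-identityʳ _)
          (cosets-≤ P eD eS eS′ enum-true (λ _ → true) (λ _ → refl) root-unique (λ (_ : Fin 1) → x) (λ _ → ¬sx)
            (λ { zero zero _ _ _ _ _ _ _ _ _ → refl }))

      -- Two classes of nonzero cosets under the squares of `D P` would double the left side of the
      -- coset count, giving d v ≤ v′ and the same contradiction.
      same-class : ∀ x y → ¬ Stab P x → ¬ Stab P y → SameClass x y
      same-class x y ¬sx ¬sy with SameClass? x y | SameClass? y x
      ... | yes p | _ = p
      ... | no _ | yes (a , da , s) = inv a , D-inv P da ,
          subst (Stab P) lem (Stab-neg P (Stab-D P (D-inv P da) s))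
        where
        lem : - (inv a * inv a * (x - a * a * y)) ≡ y - inv a * inv a * x
        lem = trans (solve 4 (λ a i x y → :- (i :* i :* (x :- a :* a :* y)) := (a :* i) :* (a :* i) :* y :- i :* i :* x) refl a (inv a) x y)
          (trans (cong (λ z → z * z * y - inv a * inv a * x) (*-inv a (proj₁ da)))
            (solve 3 (λ i x y → con (+ 1) :* con (+ 1) :* y :- i :* i :* x := y :- i :* i :* x) refl (inv a) x y))
      ... | no ¬xy | no ¬yx = ⊥-elim (single-class-⊥ {c = c} N+1 count c≤
            (ℕP.*-cancelˡ-≤ 2 (cosets-≤ P eD eS eS′ enum-Bool sign (λ _ → tt) square-sign rep ¬rep sep))
            v+v′ (2≤v eS nx₁ sx₁))
        where
        rep : Fin 2 → Fin q
        rep zero    = x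
        rep (suc _) = y
        ¬rep : ∀ i → ¬ Stab P (rep i)
        ¬rep zero    = ¬sx
        ¬rep (suc _) = ¬sy
        meet : ∀ {a b s t} x y → D P a → D P b → Stab P s → Stab P t → a * a * x + s ≡ b * b * y + t → SameClass x y
        meet {a} {b} {s} {t} x y da db ss st eq = inv b * a , D-* P (D-inv P db) da ,
            subst (Stab P) lem (Stab-D P (D-inv P db) (Stab-minus P ss st))
          where
          j = inv b
          lem : j * j * (s - t) ≡ y - (j * a) * (j * a) * x
          lem = begin
            j * j * (s - t)
              ≡⟨ solve 5 (λ j s t a x → j :* j :* (s :- t) := j :* j :* ((a :* a :* x :+ s) :- t) :- (j :* a) :* (j :* a) :* x) refl j s t a x ⟩
            j * j * ((a * a * x + s) - t) - (j * a) * (j * a) * x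
              ≡⟨ cong (λ z → j * j * (z - t) - (j * a) * (j * a) * x) eq ⟩
            j * j * ((b * b * y + t) - t) - (j * a) * (j * a) * x
              ≡⟨ solve 6 (λ j b y t a x → j :* j :* ((b :* b :* y :+ t) :- t) :- (j :* a) :* (j :* a) :* x := (b :* j) :* (b :* j) :* y :- (j :* a) :* (j :* a) :* x) refl j b y t a x ⟩
            (b * j) * (b * j) * y - (j * a) * (j * a) * x
              ≡⟨ cong (λ z → z * z * y - (j * a) * (j * a) * x) (*-inv b (proj₁ db)) ⟩
            1# * 1# * y - (j * a) * (j * a) * x
              ≡⟨ solve 4 (λ j y a x → con (+ 1) :* con (+ 1) :* y :- (j :* a) :* (j :* a) :* x := y :- (j :* a) :* (j :* a) :* x) refl j y a x ⟩
            y - (j * a) * (j * a) * x ∎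
            where open ≡-Reasoning
        sep : ∀ i j a b s t → D P a → D P b → Stab P s → Stab P t → a * a * rep i + s ≡ b * b * rep j + t → i ≡ j
        sep zero zero _ _ _ _ _ _ _ _ _ = refl
        sep zero (suc zero) _ _ _ _ da db ss st eq = ⊥-elim (¬xy (meet x y da db ss st eq))
        sep (suc zero) zero _ _ _ _ da db ss st eq = ⊥-elim (¬yx (meet y x da db ss st eq))
        sep (suc zero) (suc zero) _ _ _ _ _ _ _ _ _ = refl

      double : ∀ {x} → Stab P ((1# + 1#) * x) → Stab P x
      double {x} = scale-back (Stab? P) odd (λ y sy → subst (Stab P)
        (solve 1 (λ y → y :+ y := (con (+ 1) :+ con (+ 1)) :* y) refl y) (Stab-+ P sy sy)) x

      -- For x outside the stabiliser these represent three different cosets, whence 3v ≤ q. For x =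
      -- `x₁` they are three different elements of the stabiliser, whence v ≥ 3.
      three : Fin q → Fin 3 → Fin q
      three x zero          = 0#
      three x (suc zero)    = x
      three x (suc (suc _)) = - x

      three-sep : ∀ x → ¬ Stab P x → ∀ i j → Stab P (three x i - three x j) → i ≡ j
      three-sep x ¬sx zero zero s = refl
      three-sep x ¬sx zero (suc zero) s = ⊥-elim (¬sx (subst (Stab P) (solve 1 (λ x → :- (con (+ 0) :- x) := x) refl x) (Stab-neg P s)))
      three-sep x ¬sx zero (suc (suc zero)) s = ⊥-elim (¬sx (subst (Stab P) (solve 1 (λ x → con (+ 0) :- (:- x) := x) refl x) s))
      three-sep x ¬sx (suc zero) zero s = ⊥-elim (¬sx (subst (Stab P) (solve 1 (λ x → x :- con (+ 0) := x) refl x) s))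
      three-sep x ¬sx (suc zero) (suc zero) s = refl
      three-sep x ¬sx (suc zero) (suc (suc zero)) s = ⊥-elim (¬sx (double (subst (Stab P) (solve 1 (λ x → x :- (:- x) := (con (+ 1) :+ con (+ 1)) :* x) refl x) s)))
      three-sep x ¬sx (suc (suc zero)) zero s = ⊥-elim (¬sx (subst (Stab P) (solve 1 (λ x → :- ((:- x) :- con (+ 0)) := x) refl x) (Stab-neg P s)))
      three-sep x ¬sx (suc (suc zero)) (suc zero) s = ⊥-elim (¬sx (double (subst (Stab P) (solve 1 (λ x → :- ((:- x) :- x) := (con (+ 1) :+ con (+ 1)) :* x) refl x) (Stab-neg P s))))
      three-sep x ¬sx (suc (suc zero)) (suc (suc zero)) s = refl

      3v≤q : 3 ℕ.* v ℕ.≤ q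
      3v≤q with FP.¬∀⟶∃¬ q _ (Stab? P) ¬fixP
      ... | x , ¬sx = enum-≤ (enum-× (enum-all 3) eS) (enum-all q) (λ (i , s) _ → three x i + s) (λ _ _ → tt)
          λ { (i , s) (_ , ss) (j , t) (_ , st) eq → inj′ i s j t ss st eq }
        where
        same-translate : ∀ {i j s t} → i ≡ j → three x i + s ≡ three x j + t → (i , s) ≡ (j , t)
        same-translate {i} {s = s} {t} refl eq = cong (i ,_) (trans (solve 2 (λ s k → s := (k :+ s) :- k) refl s (three x i))
          (trans (cong (_- three x i) eq) (solve 2 (λ s k → (k :+ s) :- k := s) refl t (three x i))))
        inj′ : ∀ i s j t → Stab P s → Stab P t → three x i + s ≡ three x j + t → (i , s) ≡ (j , t)
        inj′ i s j t ss st eq = same-translate (three-sep x ¬sx i j (subst (Stab P) lem (Stab-minus P st ss))) eq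
          where
          lem : t - s ≡ three x i - three x j
          lem = trans (solve 3 (λ s t k → t :- s := (k :+ t) :- (k :+ s)) refl s t (three x j))
            (trans (cong (_- (three x j + s)) (sym eq)) (solve 3 (λ i j s → (i :+ s) :- (j :+ s) := i :- j) refl (three x i) (three x j) s))

      3≤v : 3 ℕ.≤ v
      3≤v = enum-≤ (enum-all 3) eS (λ i _ → three x₁ i)
        (λ { zero _ → Stab-0 P ; (suc zero) _ → sx₁ ; (suc (suc _)) _ → Stab-neg P sx₁ })
        λ i _ j _ eq → inj′ i j eq
        where
        2x : ∀ {y} → y ≡ - y → Nz y → ⊥
        2x {y} eq ny = *-nz odd ny (trans (solve 1 (λ y → (con (+ 1) :+ con (+ 1)) :* y := y :- (:- y)) refl y) (≡⇒diff eq))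
        inj′ : ∀ i j → three x₁ i ≡ three x₁ j → i ≡ j
        inj′ zero zero _ = refl
        inj′ zero (suc zero) eq = ⊥-elim (nx₁ (sym eq))
        inj′ zero (suc (suc zero)) eq = ⊥-elim (neg-nz nx₁ (sym eq))
        inj′ (suc zero) zero eq = ⊥-elim (nx₁ eq)
        inj′ (suc zero) (suc zero) _ = refl
        inj′ (suc zero) (suc (suc zero)) eq = ⊥-elim (2x eq nx₁)
        inj′ (suc (suc zero)) zero eq = ⊥-elim (neg-nz nx₁ eq)
        inj′ (suc (suc zero)) (suc zero) eq = ⊥-elim (2x (sym eq) nx₁)
        inj′ (suc (suc zero)) (suc (suc zero)) _ = refl

      abstract
        -- If all squares from `D P` were 1, there would be at most two such elements, too few for
        -- the orbit count.
        nontrivial-D : ∃ λ a → D P a × a * a ≢ 1#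
        nontrivial-D with FP.any? (λ a → D? P a ×-dec ¬? (a * a ≟ 1#))
        ... | yes p = p
        ... | no none = ⊥-elim (trivial-torus-⊥ {c = c} N+1 count c≤ d≤2 3v≤q big)
          where
          d≤2 : d ℕ.≤ 2
          d≤2 = enum-≤ eD enum-Bool (λ a _ → sign a) (λ _ _ → tt)
            λ a da b db eq → square-sign a b (trans (sq a da) (sym (sq b db))) eq
            where
            sq : ∀ a → D P a → a * a ≡ 1#
            sq a da = decidable-stable (a * a ≟ 1#) λ ne → none (a , da , ne)

      stab-multiple : ∀ {R a x} → D R a → a * a ≢ 1# → Stab R (a * a * x - x) → Stab R x
      stab-multiple {R} {a} {x} da ne s = scale-back (Stab? R) (λ eq → ne (diff≡0 eq))
        (λ y sy → subst (Stab R) (expand y) (Stab-minus R (Stab-D R da sy) sy)) x (subst (Stab R) (expand x) s)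
        where
        expand : ∀ y → a * a * y - y ≡ (a * a - 1#) * y
        expand y = solve 2 (λ b y → b :* y :- y := (b :- con (+ 1)) :* y) refl (a * a) y

      D-U : ∀ {R} y {a} → D R a → D (U y R) a
      D-U {R} y (na , o) = na , UOrbit-trans (UOrbit-trans (UOrbit-sym (UOrbit-U R y)) o) (UOrbit-H na (UOrbit-U R y))

      D-U⁻ : ∀ {R} y {a} → D (U y R) a → D R a
      D-U⁻ {R} y (na , o) = na , UOrbit-trans (UOrbit-U R y) (UOrbit-trans o (UOrbit-sym (UOrbit-H na (UOrbit-U R y))))

      -- One h(a) with a² ≠ 1 is made to fix a point of the U-orbit by solving a linear equation;
      -- the other elements of `D P` commute with h(a) and so must fix the same point.
      D-fixed-point : ∃ λ y → ∀ a → D P a → H a (U y P) ~ U y P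
      D-fixed-point with nontrivial-D
      ... | a , (na , z , eq) , ne = y , λ b db → fixes (proj₁ db) (D-U y db)
        where
        k = a * a - 1#
        nk : Nz k
        nk eq = ne (diff≡0 eq)
        -- As h(a) u(y) P = u(a²y + z) P, the point is fixed once (a² - 1)y = -z.
        y = - (inv k * z)
        R = U y P
        fix₀ : H a R ~ R
        fix₀ = trans~ (H-U y P na) (trans~ (U-cong _ eq) (trans~ (U-+ _ z P) (U-≡ P lem)))
          where
          lem : a * a * y + z ≡ y
          lem = trans (solve 3 (λ b i z → b :* (:- (i :* z)) :+ z := z :- ((b :- con (+ 1)) :* i) :* z :+ (:- (i :* z))) refl (a * a) (inv k) z)
            (trans (cong (λ w → z - w * z + y) (*-inv k nk)) (solve 2 (λ z y → z :- con (+ 1) :* z :+ y := y) refl z y))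
        -- If h(b) R = u(w) R, applying h(a) gives u(a²w) R = u(w) R, so (a² - 1)w, and with it w,
        -- stabilises R.
        fixes : ∀ {b} → Nz b → D R b → H b R ~ R
        fixes {b} nb (_ , w , eqb) = trans~ eqb (stab-multiple {R} (na , UOrbit-~ (sym~ fix₀)) ne (U-≈ R
          (trans~ (U-cong _ (sym~ fix₀)) (trans~ (sym~ (H-U w R na)) (trans~ (H-cong a na (sym~ eqb))
            (trans~ (H-comm R na nb) (trans~ (H-cong b nb fix₀) eqb)))))))

    module DFixedPoint {P : X} (¬fixP : ¬ Fixed P) {x₁ : Fin q} (nx₁ : Nz x₁) (sx₁ : Stab P x₁)
      (fixes : ∀ a → D P a → H a P ~ P) where
      open MovedPoint ¬fixP nx₁ sx₁
      open Sizes (sizes P)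

      -- By `W-Fixed` the point w P is moved, so it lies in the Borel orbit of P, say w P = u(y)
      -- h(t) P. Some h(a) with a² ≠ 1 fixes both w P and h(t) P, which makes u(y) trivial there.
      W-P : ∃ λ t → Nz t × (W P ~ H t P)
      W-P with BOrbit⇒UOrbit-H (moved-orbit ¬fixP nx₁ sx₁ (λ fix → ¬fixP (W-Fixed nx₁ sx₁ fix))) | nontrivial-D
      ... | t , nt , y , eq | a , da@(na , _) , ne = t , nt , trans~ eq (stab-multiple {Q} (na , UOrbit-~ (sym~ a-Q)) ne
            (U-≈ Q (trans~ (U-cong _ (sym~ a-Q)) (trans~ (sym~ (H-U y Q na)) (trans~ (H-cong a na (sym~ eq)) (trans~ a-WP eq))))))
        where
        Q = H t P
        a-Q : H a Q ~ Q
        a-Q = trans~ (H-comm P na nt) (H-cong t nt (fixes a da))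
        a-WP : H a (W P) ~ W P
        a-WP = trans~ (H-≡ (W P) (sym (inv-inv na))) (trans~ (sym~ (W-H P (inv-nz na))) (W-cong (fixes (inv a) (D-inv P da))))

      -- All x outside the stabiliser form one class, so u(x) P = h(a) u(x₀) P for some a in `D P`.
      -- Moving h(a) past w inverts it, and h(1/a) fixes h(κ) P.
      class-of-W : ∃ λ κ → Nz κ × (∀ x → ¬ Stab P x → UOrbit (H κ P) (W (U x P)))
      class-of-W with FP.¬∀⟶∃¬ q _ (Stab? P) ¬fixP
      ... | x₀ , ¬s₀ with BOrbit⇒UOrbit-H (moved-orbit ¬fixP nx₁ sx₁ (λ fix → ¬fixP (Fixed-U x₀ (W-Fixed nx₁ (Stab-U P x₀ sx₁) fix))))
      ... | κ , nκ , o = κ , nκ , λ x ¬s → go x (same-class x₀ x ¬s₀ ¬s)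
        where
        go : ∀ x → SameClass x₀ x → UOrbit (H κ P) (W (U x P))
        go x (a , da@(na , _) , s) = UOrbit-trans (UOrbit-~ (sym~ κ-fixed)) (UOrbit-trans (UOrbit-H (inv-nz na) o)
            (UOrbit-~ (sym~ (trans~ (W-cong (trans~ (Stab⇒U P s) (trans~ (U-cong _ (sym~ (fixes a da))) (sym~ (H-U x₀ P na))))) (W-H _ na)))))
          where
          κ-fixed : H (inv a) (H κ P) ~ H κ P
          κ-fixed = trans~ (H-comm P (inv-nz na) nκ) (H-cong κ nκ (fixes _ (D-inv P da)))

      module WImage {t : Fin q} (nt : Nz t) (WP~ : W P ~ H t P) {κ : Fin q} (nκ : Nz κ)
        (class : ∀ x → ¬ Stab P x → UOrbit (H κ P) (W (U x P))) where

        -- Chosen so that u(-1/x) h(t) P = h(t) u(partner x) P.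
        partner : Fin q → Fin q
        partner x = inv t * inv t * (- inv x)

        partner-nz : ∀ {x} → Nz x → Nz (partner x)
        partner-nz nx = *-nz (*-nz (inv-nz nt) (inv-nz nt)) (neg-nz (inv-nz nx))

        partner-inj : ∀ {x y} → Nz x → Nz y → partner x ≡ partner y → x ≡ y
        partner-inj {x} {y} nx ny eq = trans (sym (inv-inv nx)) (trans (cong inv
          (trans (sym (neg-neg _)) (trans (cong -_ (*-cancel (*-nz (inv-nz nt) (inv-nz nt)) eq)) (neg-neg _)))) (inv-inv ny))

        -- w u(x) w = u(-1/x) h(1/x) w u(-1/x) evaluated at w P = h(t) P.
        in-D : ∀ {x} → Nz x → ¬ Stab P x → ¬ Stab P (partner x) → D P (x * t)
        in-D {x} nx ¬s ¬s′ = subst (D P) (trans (cong inv (sym (inv-mul nx nt))) (inv-inv (*-nz nx nt)))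
            (D-inv P (*-nz ni nj , UOrbit-cancel (UOrbit-trans o′ (UOrbit-trans (UOrbit-sym (class x ¬s)) (UOrbit-~ refl~)))))
          where
          i = inv x
          j = inv t
          ni = inv-nz nx
          nj = inv-nz nt
          UOrbit-cancel : UOrbit (H κ (H (i * j) P)) (H κ P) → UOrbit P (H (i * j) P)
          UOrbit-cancel o = UOrbit-sym (UOrbit-trans (UOrbit-~ (sym~ (H-back _ nκ)))
            (UOrbit-trans (UOrbit-H (inv-nz nκ) o) (UOrbit-~ (H-back _ nκ))))
          slide : U (- i) (H t P) ~ H t (U (partner x) P)
          slide = sym~ (trans~ (H-U _ P nt) (U-≡ _ (trans (solve 3 (λ t j y → t :* t :* (j :* j :* y) := (t :* j) :* (t :* j) :* y) refl t j (- i))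
            (trans (cong (λ z → z * z * - i) (*-inv t nt)) (solve 1 (λ y → con (+ 1) :* con (+ 1) :* y := y) refl (- i))))))
          W-expand : W (U x P) ~ U (- i) (H i (H j (W (U (partner x) P))))
          W-expand = trans~ (W-cong (U-cong x (trans~ (sym~ (W-W P)) (W-cong WP~)))) (trans~ (W-U-W _ nx)
            (U-cong _ (H-cong i ni (trans~ (W-cong slide) (W-H _ nt)))))
          o′ : UOrbit (H κ (H (i * j) P)) (W (U x P))
          o′ = UOrbit-trans (UOrbit-~ (trans~ (H-comm P nκ (*-nz ni nj)) (sym~ (H-* _ ni nj))))
            (UOrbit-trans (UOrbit-H ni (UOrbit-H nj (class (partner x) ¬s′))) (UOrbit-trans (UOrbit-U _ (- i)) (UOrbit-~ (sym~ W-expand))))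

        -- Each x either stabilises P, or has a nonzero `partner` that does, or gives x t in `D P`.
        -- The three alternatives account for at most v + (v - 1) + d elements, and `one-class-⊥`
        -- shows that this is less than q.
        contradiction : ⊥
        contradiction with enum-split (λ x → Stab? P x ×-dec Nz? x)
        ... | v₁ , _ , e₁ , _ = one-class-⊥ {v₁ = v₁} q≤
              (subst (λ w → d ℕ.* w ℕ.≤ 2 ℕ.* v′) v≡ (dv≤2v′ ¬fixP (sizes P))) (trans (cong (ℕ._+ v′) (sym v≡)) v+v′)
              (subst (λ w → 3 ℕ.* w ℕ.≤ q) v≡ 3v≤q) (subst (3 ℕ.≤_) v≡ 3≤v) big
          where
          v≡ : v ≡ suc v₁
          v≡ = ℕP.≤-antisym
            (enum-≤ eS (enum-⊎ (enum-all 1) e₁) (λ x _ → f x) f-ok f-inj)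
            (enum-≤ (enum-⊎ (enum-all 1) e₁) eS (λ s _ → g s) g-ok g-inj)
            where
            f : Fin q → Fin 1 ⊎ Fin q
            f x with x ≟ 0#
            ... | yes _ = inj₁ zero
            ... | no _  = inj₂ x
            f-ok : ∀ x → Stab P x → [ (λ _ → ⊤) , (λ y → Stab P y × Nz y) ]′ (f x)
            f-ok x s with x ≟ 0#
            ... | yes _ = tt
            ... | no nx = s , nx
            f-inj : ∀ x → Stab P x → ∀ y → Stab P y → f x ≡ f y → x ≡ y
            f-inj x _ y _ eq with x ≟ 0# | y ≟ 0#
            ... | yes p | yes r = trans p (sym r)
            f-inj x _ .x _ refl | no _ | no _ = refl
            g : Fin 1 ⊎ Fin q → Fin q
            g (inj₁ _) = 0#
            g (inj₂ x) = x
            g-ok : ∀ s → [ (λ _ → ⊤) , (λ y → Stab P y × Nz y) ]′ s → Stab P (g s)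
            g-ok (inj₁ _) _ = Stab-0 P
            g-ok (inj₂ x) p = proj₁ p
            g-inj : ∀ s → [ (λ _ → ⊤) , (λ y → Stab P y × Nz y) ]′ s → ∀ s′ → [ (λ _ → ⊤) , (λ y → Stab P y × Nz y) ]′ s′ → g s ≡ g s′ → s ≡ s′
            g-inj (inj₁ zero) _ (inj₁ zero) _ _ = refl
            g-inj (inj₁ _) _ (inj₂ x) (_ , nx) eq = ⊥-elim (nx (sym eq))
            g-inj (inj₂ x) (_ , nx) (inj₁ _) _ eq = ⊥-elim (nx eq)
            g-inj (inj₂ x) _ (inj₂ y) _ eq = cong inj₂ eq
          Target : Set
          Target = (Fin q ⊎ Fin q) ⊎ Fin q
          InTarget : Target → Set
          InTarget = [ [ Stab P , (λ y → Stab P y × Nz y) ]′ , D P ]′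
          Codes : Fin q → Target → Set
          Codes x (inj₁ (inj₁ y)) = x ≡ y × Stab P y
          Codes x (inj₁ (inj₂ y)) = (Nz x × partner x ≡ y) × ¬ Stab P x
          Codes x (inj₂ y) = x * t ≡ y
          code : ∀ x → ∃ λ s → InTarget s × Codes x s
          code x with Stab? P x
          ... | yes s = inj₁ (inj₁ x) , s , (refl , s)
          ... | no ¬s = go (Stab? P (partner x))
            where
            nx : Nz x
            nx x0 = ¬s (subst (Stab P) (sym x0) (Stab-0 P))
            go : Dec (Stab P (partner x)) → ∃ λ s → InTarget s × Codes x s
            go (yes s′) = inj₁ (inj₂ (partner x)) , (s′ , partner-nz nx) , ((nx , refl) , ¬s)
            go (no ¬s′) = inj₂ (x * t) , in-D nx ¬s ¬s′ , refl
          decode : ∀ {x y} s → Codes x s → Codes y s → x ≡ y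
          decode (inj₁ (inj₁ z)) (refl , _) (refl , _) = refl
          decode (inj₁ (inj₂ z)) ((nx , ex) , _) ((ny , ey) , _) = partner-inj nx ny (trans ex (sym ey))
          decode {x} {y} (inj₂ z) ex ey = *-cancel nt (trans (*-comm t x) (trans ex (trans (sym ey) (*-comm y t))))
          q≤ : q ℕ.≤ suc v₁ ℕ.+ v₁ ℕ.+ d
          q≤ = subst (λ w → q ℕ.≤ w ℕ.+ v₁ ℕ.+ d) v≡ (enum-≤ (enum-all q) (enum-⊎ (enum-⊎ eS e₁) eD)
            (λ x _ → proj₁ (code x)) (λ x _ → inT (proj₁ (code x)) (proj₁ (proj₂ (code x))))
            (λ x _ y _ eq → decode (proj₁ (code x)) (proj₂ (proj₂ (code x))) (subst (Codes y) (sym eq) (proj₂ (proj₂ (code y))))))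
            where
            inT : ∀ s → InTarget s → [ [ Stab P , (λ y → Stab P y × Nz y) ]′ , D P ]′ s
            inT s p = p

      contradiction-DFixed : ⊥
      contradiction-DFixed = let (_ , nt , WP~) = W-P ; (_ , nκ , class) = class-of-W in WImage.contradiction nt WP~ nκ class

    -- A counterexample is replaced by the torus-fixed point u(y) P of its U-orbit. The stabiliser
    -- and `D` are the same there because U is abelian and u(y) P has the same U-orbit.
    regular : ∀ {P} → ¬ Fixed P → ∀ x → Stab P x → x ≡ 0#
    regular {P} ¬fixP x sx with x ≟ 0#
    ... | yes p = p
    ... | no nx = ⊥-elim (DFixedPoint.contradiction-DFixed {R} ¬fixR nx (Stab-U P y sx) fixes)
      where
      open MovedPoint ¬fixP nx sx
      y = proj₁ D-fixed-point
      R = U y P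
      ¬fixR : ¬ Fixed R
      ¬fixR fix = ¬fixP (Fixed-U y fix)
      fixes : ∀ a → D R a → H a R ~ R
      fixes a da = proj₂ D-fixed-point a (D-U⁻ y da)

-- Excluding actions in which w preserves an affine line.

module AffineActions where
  open Solver
  open Counting
  open FiniteFields
  open Actions
  open RegularOrbits
  open import Data.Fin using (_≟_)
  open ≡

  -- f would be the action of w on a U-orbit preserved by SL₂, in the coordinate u(x) 0 ↦ x.
  module AffineAction {q : ℕ} (F : FiniteField q) (big : 12 ℕ.≤ q) (f : Fin q → Fin q) where
    open FiniteField F

    module _ (f-0 : f 0# ≡ 0#) (f-f : ∀ x → f (f x) ≡ x)
      (f-scale : ∀ {a} x → Nz a → f (a * a * x) ≡ inv a * inv a * f x)
      (f-rel : ∀ {x} y → Nz x → f (x + f y) ≡ - inv x + inv x * inv x * f (y - inv x)) where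

      f-nz : ∀ {x} → Nz x → Nz (f x)
      f-nz {x} nx eq = nx (trans (sym (f-f x)) (trans (cong f eq) f-0))

      -- By `f-scale` this product depends only on the square class of x, so on nonzero x it takes
      -- at most two values.
      g : Fin q → Fin q
      g x = x * f x

      g-nz : ∀ {x} → Nz x → Nz (g x)
      g-nz nx = *-nz nx (f-nz nx)

      g-scale : ∀ {a} x → Nz a → g (a * a * x) ≡ g x
      g-scale {a} x na = begin
        a * a * x * f (a * a * x)             ≡⟨ cong (a * a * x *_) (f-scale x na) ⟩
        a * a * x * (inv a * inv a * f x)     ≡⟨ solve 4 (λ a i x y → a :* a :* x :* (i :* i :* y) := (a :* i) :* (a :* i) :* (x :* y)) refl a (inv a) x (f x) ⟩
        (a * inv a) * (a * inv a) * (x * f x) ≡⟨ cong (λ z → z * z * (x * f x)) (*-inv a na) ⟩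
        1# * 1# * (x * f x)                   ≡⟨ solve 1 (λ x → con (+ 1) :* con (+ 1) :* x := x) refl (x * f x) ⟩
        x * f x                               ∎
        where open ≡-Reasoning

      g-square : ∀ {s} → Square s → g s ≡ g 1#
      g-square (a , na , refl) = trans (cong g (sym (*-identityʳ _))) (g-scale 1# na)

      f-g : ∀ {x} → Nz x → f x ≡ g x * inv x
      f-g {x} nx = sym (trans (solve 3 (λ x y i → x :* y :* i := (x :* i) :* y) refl x (f x) (inv x))
        (trans (cong (_* f x) (*-inv x nx)) (*-identityˡ _)))

      -- The case y = 0 of `f-rel`, multiplied by x; here -1/x = (1/x)²(-x) has the square class of
      -- -x.
      g-neg : ∀ {x} → Nz x → g x ≡ - 1# - g (- x)
      g-neg {x} nx = begin
        x * f x                              ≡⟨ cong (λ z → x * f z) (trans (sym (+-identityʳ x)) (cong (_+_ x) (sym f-0))) ⟩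
        x * f (x + f 0#)                     ≡⟨ cong (x *_) (f-rel 0# nx) ⟩
        x * (- i + i * i * f (0# - i))       ≡⟨ cong (λ z → x * (- i + i * i * f z)) (+-identityˡ (- i)) ⟩
        x * (- i + i * i * f (- i))          ≡⟨ solve 3 (λ x i y → x :* (:- i :+ i :* i :* y) := :- (x :* i) :+ (x :* i) :* (i :* y)) refl x i (f (- i)) ⟩
        - (x * i) + (x * i) * (i * f (- i))  ≡⟨ cong (λ z → - z + z * (i * f (- i))) (*-inv x nx) ⟩
        - 1# + 1# * (i * f (- i))            ≡⟨ solve 2 (λ i y → :- con (+ 1) :+ con (+ 1) :* (i :* y) := :- con (+ 1) :- (:- i) :* y) refl i (f (- i)) ⟩
        - 1# - g (- i)                       ≡⟨ cong (λ z → - 1# - g z) (sym i≡) ⟩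
        - 1# - g (i * i * - x)               ≡⟨ cong (λ z → - 1# - z) (g-scale (- x) (inv-nz nx)) ⟩
        - 1# - g (- x)                       ∎
        where
        i = inv x
        open ≡-Reasoning
        i≡ : i * i * - x ≡ - i
        i≡ = trans (solve 2 (λ x i → i :* i :* (:- x) := :- (i :* (x :* i))) refl x i) (cong -_ (trans (cong (i *_) (*-inv x nx)) (*-identityʳ i)))

      -- The case x = 1 of `f-rel` with each f z replaced by g z / z and denominators cleared. As g
      -- takes few values, y is a root of one of a few quadratics.
      quadratic : ∀ {y} → Nz y → Nz (y - 1#) →
        (g (1# + f y) + 1#) * (y * y) + (g y - g (1# + f y) - g (y - 1#) - 1#) * y - g y * (g (y - 1#) + 1#) ≡ 0#
      quadratic {y} ny ny′ = begin
        (c₁ + 1#) * (y * y) + (c - c₁ - c₂ - 1#) * y - c * (c₂ + 1#)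
          ≡⟨ solve 4 (λ y c c₁ c₂ → (c₁ :+ con (+ 1)) :* (y :* y) :+ (c :- c₁ :- c₂ :- con (+ 1)) :* y :- c :* (c₂ :+ con (+ 1))
                       := y :* (y :- con (+ 1)) :* c₁ :- (y :+ c) :* (:- (y :- con (+ 1)) :+ c₂)) refl y c c₁ c₂ ⟩
        y * (y - 1#) * c₁ - (y + c) * (- (y - 1#) + c₂)
          ≡⟨ cong (λ z → y * (y - 1#) * ((1# + f y) * z) - (y + c) * (- (y - 1#) + c₂)) rel ⟩
        y * (y - 1#) * ((1# + f y) * (- 1# + f (y - 1#))) - (y + y * f y) * (- (y - 1#) + (y - 1#) * f (y - 1#))
          ≡⟨ solve 3 (λ y a b → y :* (y :- con (+ 1)) :* ((con (+ 1) :+ a) :* (:- con (+ 1) :+ b)) :- (y :+ y :* a) :* (:- (y :- con (+ 1)) :+ (y :- con (+ 1)) :* b) := con (+ 0)) refl y (f y) (f (y - 1#)) ⟩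
        0# ∎
        where
        c = g y
        c₁ = g (1# + f y)
        c₂ = g (y - 1#)
        open ≡-Reasoning
        rel : f (1# + f y) ≡ - 1# + f (y - 1#)
        rel = trans (f-rel y 1-nz) (trans (cong (λ i → - i + i * i * f (y - i)) inv-1)
          (solve 1 (λ z → :- con (+ 1) :+ con (+ 1) :* con (+ 1) :* z := :- con (+ 1) :+ z) refl (f (y - 1#))))

      -- With g constant the quadratic reduces to y² - y = γ, which has at most two roots. With the
      -- exceptions 0, 1 and -γ that makes at most five elements.
      constant-⊥ : ∀ γ → (∀ {x} → Nz x → g x ≡ γ) → ⊥
      constant-⊥ γ gγ = ℕP.<⇒≱ (ℕP.<-≤-trans (ℕ.s≤s (ℕ.s≤s (ℕ.s≤s (ℕ.s≤s (ℕ.s≤s (ℕ.s≤s ℕ.z≤n)))))) big)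
          (coding-≤ (enum-all q) (enum-⊎ enum-Bool (enum-all 3)) (λ { (inj₁ _) → tt ; (inj₂ _) → tt })
            R (λ x _ → code x) (λ {x} {y} → decode {x} {y}))
        where
        nγ : Nz γ
        nγ = subst Nz (gγ 1-nz) (g-nz 1-nz)
        γ+1 : γ + 1# ≡ - γ
        γ+1 = trans (cong (_+ 1#) (trans (sym (gγ 1-nz)) (trans (g-neg 1-nz) (cong (λ z → - 1# - z) (gγ (neg-nz 1-nz))))))
          (solve 1 (λ c → (:- con (+ 1) :- c) :+ con (+ 1) := :- c) refl γ)
        odd : Nz (1# + 1#)
        odd 2≡0 = 0≢1 (trans (solve 1 (λ c → con (+ 0) := (c :+ con (+ 1)) :- (c :+ con (+ 1))) refl γ) (trans (cong (λ z → (γ + 1#) - z) γ+1)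
          (trans (solve 1 (λ c → (c :+ con (+ 1)) :- (:- c) := (con (+ 1) :+ con (+ 1)) :* c :+ con (+ 1)) refl γ)
          (trans (cong (λ z → z * γ + 1#) 2≡0) (solve 1 (λ c → con (+ 0) :* c :+ con (+ 1) := con (+ 1)) refl γ)))))
        root : ∀ {y} → Nz y → Nz (y - 1#) → Nz (y + γ) → y * y - y ≡ γ
        root {y} ny ny′ ny″ = diff≡0 (*-cancel (neg-nz nγ) (trans (trans (cong (_* (y * y - y - γ)) (sym γ+1))
          (trans (solve 2 (λ y c → (c :+ con (+ 1)) :* (y :* y :- y :- c) := (c :+ con (+ 1)) :* (y :* y) :+ (c :- c :- c :- con (+ 1)) :* y :- c :* (c :+ con (+ 1))) refl y γ)
          (trans (cong₂ (λ u v → (u + 1#) * (y * y) + (γ - u - v - 1#) * y - γ * (v + 1#)) (sym (gγ n1)) (sym (gγ ny′)))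
          (trans (cong (λ w → (g (1# + f y) + 1#) * (y * y) + (w - g (1# + f y) - g (y - 1#) - 1#) * y - w * (g (y - 1#) + 1#)) (sym (gγ ny)))
            (quadratic ny ny′))))) (sym (zeroʳ _))))
          where
          n1 : Nz (1# + f y)
          n1 eq = ny″ (trans (solve 3 (λ y c d → y :+ c := y :* (con (+ 1) :+ d) :- (y :* d :- c)) refl y γ (f y))
            (trans (cong₂ (λ u v → y * u - v) eq (≡⇒diff (gγ ny))) (solve 1 (λ y → y :* con (+ 0) :- con (+ 0) := con (+ 0)) refl y)))
        R : Fin q → Bool ⊎ Fin 3 → Set
        R y (inj₁ b)                = sign (y + y - 1#) ≡ b × y * y - y ≡ γ
        R y (inj₂ zero)             = y ≡ 0#
        R y (inj₂ (suc zero))       = y ≡ 1#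
        R y (inj₂ (suc (suc zero))) = y ≡ - γ
        code : ∀ y → ∃ (R y)
        code y with y ≟ 0# | y - 1# ≟ 0# | y + γ ≟ 0#
        ... | yes p | _ | _ = inj₂ zero , p
        ... | _ | yes p | _ = inj₂ (suc zero) , diff≡0 p
        ... | _ | _ | yes p = inj₂ (suc (suc zero)) , diff≡0 (trans (cong (_+_ y) (neg-neg γ)) p)
        ... | no n | no n′ | no n″ = inj₁ _ , refl , root n n′ n″
        half : ∀ x → (1# + 1#) * x ≡ (x + x - 1#) + 1#
        half = solve 1 (λ x → (con (+ 1) :+ con (+ 1)) :* x := (x :+ x :- con (+ 1)) :+ con (+ 1)) refl
        complete : ∀ x → (x + x - 1#) * (x + x - 1#) ≡ (1# + 1#) * (1# + 1#) * (x * x - x) + 1#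
        complete = solve 1 (λ x → (x :+ x :- con (+ 1)) :* (x :+ x :- con (+ 1)) := (con (+ 1) :+ con (+ 1)) :* (con (+ 1) :+ con (+ 1)) :* (x :* x :- x) :+ con (+ 1)) refl
        decode : ∀ {x y} s → R x s → R y s → x ≡ y
        decode {x} {y} (inj₁ _) (b , ex) (b′ , ey) = *-cancel odd (trans (half x) (trans (cong (_+ 1#)
          (square-sign (x + x - 1#) (y + y - 1#) (trans (complete x) (trans (cong (λ z → (1# + 1#) * (1# + 1#) * z + 1#) (trans ex (sym ey)))
            (sym (complete y)))) (trans b (sym b′)))) (sym (half y))))
        decode (inj₂ zero) p r = trans p (sym r)
        decode (inj₂ (suc zero)) p r = trans p (sym r)
        decode (inj₂ (suc (suc zero))) p r = trans p (sym r)

      -- If -1 is a square, `g-neg` reads 2 g x = -1 and g is constant. If not, either the values α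
      -- and β on the two classes coincide, or both are squares and the quadratics have too few
      -- square roots.
      no-affine-action : ⊥
      no-affine-action with Square? (- 1#) | Square? (g 1#) | Square? (g (- 1#))
      ... | yes s-1 | _ | _ = constant-⊥ (g 1#) const
        where
        n2 : Nz (1# + 1#)
        n2 2≡0 = 0≢1 (trans (solve 1 (λ c → con (+ 0) := c :- c) refl (g 1#)) (trans (cong (_- g 1#) (trans (g-neg 1-nz) (cong (λ z → - 1# - z) (g-square s-1))))
          (trans (solve 1 (λ c → (:- con (+ 1) :- c) :- c := con (+ 1) :- (con (+ 1) :+ con (+ 1)) :* (con (+ 1) :+ c)) refl (g 1#))
          (trans (cong (λ z → 1# - z * (1# + g 1#)) 2≡0) (solve 1 (λ c → con (+ 1) :- con (+ 0) :* c := con (+ 1)) refl (1# + g 1#))))))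
        twice : ∀ {x} → Nz x → (1# + 1#) * g x ≡ - 1#
        twice {x} nx = trans (solve 1 (λ c → (con (+ 1) :+ con (+ 1)) :* c := c :+ c) refl (g x)) (trans (cong (_+_ (g x)) (trans (g-neg nx) (cong (λ z → - 1# - z) even)))
            (solve 1 (λ c → c :+ (:- con (+ 1) :- c) := :- con (+ 1)) refl (g x)))
          where
          even : g (- x) ≡ g x
          even = trans (cong g (trans (solve 1 (λ x → :- x := :- con (+ 1) :* x) refl x) (cong (_* x) (sym (proj₂ (proj₂ s-1))))))
                       (g-scale x (proj₁ (proj₂ s-1)))
        const : ∀ {x} → Nz x → g x ≡ g 1#
        const nx = *-cancel n2 (trans (twice nx) (sym (twice 1-nz)))
      ... | no ¬-1 | sα | sβ = cases sα sβ
        where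
        α = g 1#
        β = g (- 1#)
        α+1 : α + 1# ≡ - β
        α+1 = trans (cong (_+ 1#) (g-neg 1-nz)) (solve 1 (λ c → (:- con (+ 1) :- c) :+ con (+ 1) := :- c) refl β)
        β+1 : β + 1# ≡ - α
        β+1 = trans (cong (_+ 1#) (trans (g-neg (neg-nz 1-nz)) (cong (λ z → - 1# - g z) (neg-neg 1#)))) (solve 1 (λ c → (:- con (+ 1) :- c) :+ con (+ 1) := :- c) refl α)
        g-nonsquare : ∀ {x} → Nz x → ¬ Square x → g x ≡ β
        g-nonsquare {x} nx ¬s with nonsquare-* (neg-nz 1-nz) nx ¬-1 ¬s
        ... | a , na , a² = trans (cong g (trans (solve 1 (λ x → x := :- con (+ 1) :* x :* (:- con (+ 1))) refl x) (cong (_* - 1#) (sym a²)))) (g-scale (- 1#) na)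
        collapse : α ≡ β → ⊥
        collapse eq = constant-⊥ α const
          where
          const : ∀ {x} → Nz x → g x ≡ α
          const {x} nx with Square? x
          ... | yes s = g-square s
          ... | no ¬s = trans (g-nonsquare nx ¬s) (sym eq)
        f-α : f α ≡ 1#
        f-α = trans (cong f (*-identityˡ (f 1#))) (f-f 1#)
        f-β : f (- β) ≡ - 1#
        f-β = trans (cong f (solve 1 (λ y → :- (:- con (+ 1) :* y) := y) refl (f (- 1#)))) (f-f (- 1#))
        main : Square α → Square β → ⊥
        cases : Dec (Square α) → Dec (Square β) → ⊥
        -- Since f α = 1, g α = α. If α is a nonsquare, g α is also β.
        cases (no ¬sα) _ = collapse (trans (sym (*-identityʳ α)) (trans (cong (α *_) (sym f-α)) (g-nonsquare (g-nz 1-nz) ¬sα)))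
        cases (yes sα) (no ¬sβ) = collapse (sym (trans (solve 1 (λ b → b := (:- b) :* (:- con (+ 1))) refl β)
          (trans (cong (- β *_) (sym f-β)) (g-square (subst Square (solve 1 (λ b → :- con (+ 1) :* b := :- b) refl β)
            (nonsquare-* (neg-nz 1-nz) (g-nz (neg-nz 1-nz)) ¬-1 ¬sβ))))))
        cases (yes sα) (yes sβ) = main sα sβ
        -- Only squares y = a² are tested. Each of the four quadratics has at most one square root
        -- y, so at most two values of a; with a = 0, 1, -1 this makes 8 + 3 = 11 codes. The
        -- exceptional action of L₂(11) on 11 points shows that 12 cannot be lowered here.
        main sα sβ = ℕP.<⇒≱ big (coding-≤ (enum-all q) (enum-⊎ (enum-× enum-Bool (enum-× enum-Bool enum-Bool)) (enum-all 3))
            (λ { (inj₁ _) → tt , tt , tt ; (inj₂ _) → tt }) R (λ x _ → code x) (λ {x} {y} → decode {x} {y}))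
          where
          value : Bool → Fin q
          value true  = α
          value false = β
          covalue : Bool → Fin q
          covalue true  = β
          covalue false = α
          covalue-square : ∀ b → Square (covalue b)
          covalue-square true  = sβ
          covalue-square false = sα
          value+1 : ∀ b → value b + 1# ≡ - covalue b
          value+1 true  = α+1
          value+1 false = β+1
          Root : Bool → Bool → Fin q → Set
          Root b₁ b₂ y = - covalue b₁ * (y * y) + (α - value b₁ - value b₂ - 1#) * y - α * - covalue b₂ ≡ 0#
          R : Fin q → (Bool × Bool × Bool) ⊎ Fin 3 → Set
          R a (inj₁ (b₁ , b₂ , s))    = Nz a × sign a ≡ s × Root b₁ b₂ (a * a)
          R a (inj₂ zero)             = a ≡ 0#
          R a (inj₂ (suc zero))       = a ≡ 1#
          R a (inj₂ (suc (suc zero))) = a ≡ - 1#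
          kind : ∀ {x} → Nz x → ∃ λ b → g x ≡ value b
          kind {x} nx with Square? x
          ... | yes s = true , g-square s
          ... | no ¬s = false , g-nonsquare nx ¬s
          code : ∀ a → ∃ (R a)
          code a with a ≟ 0# | a ≟ 1# | a ≟ - 1#
          ... | yes p | _ | _ = inj₂ zero , p
          ... | _ | yes p | _ = inj₂ (suc zero) , p
          ... | _ | _ | yes p = inj₂ (suc (suc zero)) , p
          ... | no n | no n′ | no n″ = inj₁ (b₁ , b₂ , sign a) , n , refl , root
            where
            y = a * a
            sy : Square y
            sy = a , n , refl
            ny = square-nz sy
            ny′ : Nz (y - 1#)
            ny′ eq = [ n′ , n″ ]′ (squares-≡ a 1# (trans (diff≡0 eq) (sym (*-identityˡ 1#))))
            fy-square : Square (f y)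
            fy-square = subst Square (sym (trans (f-g ny) (cong (_* inv y) (g-square sy)))) (square-* sα (square-inv sy))
            n1 : Nz (1# + f y)
            n1 eq = ¬-1 (subst Square (trans (solve 1 (λ z → z := (con (+ 1) :+ z) :- con (+ 1)) refl (f y)) (trans (cong (_- 1#) eq) (+-identityˡ (- 1#)))) fy-square)
            b₁ = proj₁ (kind n1)
            e₁ = proj₂ (kind n1)
            b₂ = proj₁ (kind ny′)
            e₂ = proj₂ (kind ny′)
            root : Root b₁ b₂ y
            root = trans (cong₂ (λ u v → u * (y * y) + (α - value b₁ - value b₂ - 1#) * y - α * v) (sym (value+1 b₁)) (sym (value+1 b₂)))
              (trans (cong₂ (λ u v → (u + 1#) * (y * y) + (α - u - v - 1#) * y - α * (v + 1#)) (sym e₁) (sym e₂))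
              (trans (cong (λ w → (g (1# + f y) + 1#) * (y * y) + (w - g (1# + f y) - g (y - 1#) - 1#) * y - w * (g (y - 1#) + 1#)) (sym (g-square sy)))
                (quadratic ny ny′)))
          -- Two distinct roots have product αs₂/(-s₁) with s₁ and s₂ squares, which is not a square.
          unique-root : ∀ b₁ b₂ {y z} → Square y → Square z → Root b₁ b₂ y → Root b₁ b₂ z → y ≡ z
          unique-root b₁ b₂ {y} {z} sy sz ry rz with y ≟ z
          ... | yes p = p
          ... | no ne = ⊥-elim (¬-1 (square-div (square-* (covalue-square b₁) (square-* sy sz))
                (subst Square (trans (sym vieta) (solve 3 (λ s y z → (:- s) :* (y :* z) := s :* (y :* z) :* (:- con (+ 1))) refl s₁ y z)) (square-* sα (covalue-square b₂)))))
            where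
            s₁ = covalue b₁
            s₂ = covalue b₂
            m = α - value b₁ - value b₂ - 1#
            total : - s₁ * (y + z) + m ≡ 0#
            total = *-cancel {y - z} (λ eq → ne (diff≡0 eq))
              (trans (solve 5 (λ y z s m k → (y :- z) :* (:- s :* (y :+ z) :+ m) := (:- s :* (y :* y) :+ m :* y :- k) :- (:- s :* (z :* z) :+ m :* z :- k)) refl y z s₁ m (α * - s₂))
              (trans (cong₂ _-_ ry rz) (solve 1 (λ w → con (+ 0) :- con (+ 0) := w :* con (+ 0)) refl (y - z))))
            vieta : - s₁ * (y * z) ≡ α * s₂
            vieta = trans (solve 5 (λ y z s m k → :- s :* (y :* z) := k :+ y :* (:- s :* (y :+ z) :+ m) :- (:- s :* (y :* y) :+ m :* y :+ k)) refl y z s₁ m (α * s₂))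
              (trans (cong₂ (λ u v → α * s₂ + y * u - v) total (trans (solve 3 (λ a b s → a :+ b :* s := a :- b :* (:- s)) refl (- s₁ * (y * y) + m * y) α s₂) ry))
                (solve 2 (λ k y → k :+ y :* con (+ 0) :- con (+ 0) := k) refl (α * s₂) y))
          decode : ∀ {a b} s → R a s → R b s → a ≡ b
          decode {a} {b} (inj₁ (b₁ , b₂ , _)) (na , sa , ra) (nb , sb , rb) =
            square-sign a b (unique-root b₁ b₂ (a , na , refl) (b , nb , refl) ra rb) (trans sa (sym sb))
          decode (inj₂ zero) p r = trans p (sym r)
          decode (inj₂ (suc zero)) p r = trans p (sym r)
          decode (inj₂ (suc (suc zero))) p r = trans p (sym r)

-- Recognising the projective line; triviality of actions on at most q points.

module ProjectiveLines where
  open Solver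
  open Counting
  open FiniteFields
  open Actions
  open RegularOrbits
  open AffineActions
  open import Data.Fin using (_≟_)
  open ≡

  -- The projective line with its affine coordinate x ↦ u(x) O.
  record IsProjectiveLine {q : ℕ} {F : FiniteField q} {X : Set} {_~_ : X → X → Set}
                          (A : SL2Action F X _~_) (O ∞ : X) : Set where
    open FiniteField F
    open SL2Action A
    field
      U-∞     : ∀ x → U x ∞ ~ ∞
      H-O     : ∀ {a} → Nz a → H a O ~ O
      H-∞     : ∀ {a} → Nz a → H a ∞ ~ ∞
      W-O     : W O ~ ∞
      W-∞     : W ∞ ~ O
      W-U     : ∀ {x} → Nz x → W (U x O) ~ U (- inv x) O
      U-inj   : ∀ {x y} → U x O ~ U y O → x ≡ y
      affine≁ : ∀ x → ¬ (U x O ~ ∞)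
      cover   : ∀ P → (P ~ ∞) ⊎ (∃ λ x → P ~ U x O)

  module ProjectiveLine {q : ℕ} (F : FiniteField q) {X : Set} {_~_ : X → X → Set} (A : SL2Action F X _~_)
    (big : 12 ℕ.≤ q)
    (bound : ∀ {c} (f : Fin c → X) → (∀ i j → f i ~ f j → i ≡ j) → c ℕ.≤ suc q) where
    open FiniteField F
    open SL2Action A
    open Regularity F A big bound

    big-N : 11 ℕ.≤ N
    big-N = ℕ.s≤s⁻¹ (subst (12 ℕ.≤_) (sym N+1) big)

    generic : ∃ λ a → Nz a × a * a ≢ 1#
    generic with FP.any? (λ a → Nz? a ×-dec ¬? (a * a ≟ 1#))
    ... | yes p = p
    ... | no none = ⊥-elim (ℕP.<⇒≱ (ℕ.s≤s (ℕ.s≤s (ℕ.s≤s ℕ.z≤n))) (ℕP.≤-trans big-N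
        (enum-≤ eN enum-Bool (λ a _ → sign a) (λ _ _ → tt)
          λ a na b nb eq → square-sign a b (trans (sq a na) (sym (sq b nb))) eq)))
      where
      sq : ∀ a → Nz a → a * a ≡ 1#
      sq a na = decidable-stable (a * a ≟ 1#) λ ne → none (a , na , ne)

    module Orbit {P : X} (¬fixP : ¬ Fixed P) where

      U-injective : ∀ {x y} → U x P ~ U y P → x ≡ y
      U-injective eq = diff≡0 (regular ¬fixP _ (U-≈ _ eq))

      -- The U-orbit of P has q points by `regular`, so two further points would make q + 2.
      outside : ∀ {R S} → ¬ UOrbit P R → ¬ UOrbit P S → R ~ S
      outside {R} {S} ¬oR ¬oS with R ~? S
      ... | yes eq = eq
      ... | no ne = ⊥-elim (ℕP.<-irrefl refl (bound f f-inj))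
        where
        f : Fin (suc (suc q)) → X
        f zero          = R
        f (suc zero)    = S
        f (suc (suc x)) = U x P
        f-inj : ∀ i j → f i ~ f j → i ≡ j
        f-inj zero          zero          _  = refl
        f-inj zero          (suc zero)    eq = ⊥-elim (ne eq)
        f-inj zero          (suc (suc x)) eq = ⊥-elim (¬oR (x , eq))
        f-inj (suc zero)    zero          eq = ⊥-elim (ne (sym~ eq))
        f-inj (suc zero)    (suc zero)    _  = refl
        f-inj (suc zero)    (suc (suc x)) eq = ⊥-elim (¬oS (x , eq))
        f-inj (suc (suc x)) zero          eq = ⊥-elim (¬oR (x , sym~ eq))
        f-inj (suc (suc x)) (suc zero)    eq = ⊥-elim (¬oS (x , sym~ eq))
        f-inj (suc (suc x)) (suc (suc y)) eq = cong (λ z → suc (suc z)) (U-injective eq)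

      outside-fixed : ∀ {R} → ¬ UOrbit P R → Fixed R
      outside-fixed {R} ¬o x = outside (λ o → ¬o (UOrbit-trans o (UOrbit-sym (UOrbit-U R x)))) ¬o

      H-inside : ∀ {a} → Nz a → UOrbit P (H a P)
      H-inside {a} na = decidable-stable (UOrbit? P (H a P)) λ ¬o → ¬fixP (Fixed-H na (outside-fixed ¬o))

    module TorusFixed {O : X} (¬fixO : ¬ Fixed O) {s : Fin q} (ns : Nz s) (nk : Nz (s * s - 1#)) (H-s-O : H s O ~ O) where
      open Orbit ¬fixO

      unit-fixed : ∀ {x} → s * s * x ≡ x → x ≡ 0#
      unit-fixed {x} eq = *-cancel nk (trans (solve 2 (λ b x → (b :- con (+ 1)) :* x := b :* x :- x) refl (s * s) x)
        (trans (≡⇒diff eq) (sym (zeroʳ _))))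

      torus-fixed : ∀ {x} → H s (U x O) ~ U x O → x ≡ 0#
      torus-fixed {x} eq = unit-fixed (U-injective (trans~ (U-cong _ (sym~ H-s-O)) (trans~ (sym~ (H-U x O ns)) eq)))

      inside-fixed : ∀ {R} → UOrbit O R → H s R ~ R → R ~ O
      inside-fixed (x , eq) fix = trans~ eq (trans~ (U-≡ O (torus-fixed (trans~ (H-cong s ns (sym~ eq)) (trans~ fix eq)))) (U-0 O))

      H-O : ∀ {a} → Nz a → H a O ~ O
      H-O {a} na = inside-fixed (H-inside na) (trans~ (H-comm O ns na) (H-cong a na H-s-O))

      H-s-W : ∀ {R} → H s R ~ R → H s (W R) ~ W R
      H-s-W {R} eq = trans~ (H-≡ (W R) (sym (inv-inv ns))) (trans~ (sym~ (W-H R (inv-nz ns)))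
        (W-cong (trans~ (H-cong (inv s) (inv-nz ns) (sym~ eq)) (H-back R ns))))

      -- O is the only point of its orbit fixed by h(s), and w maps points fixed by h(s) to such
      -- points. So w O inside the orbit means w O = O. A point outside is fixed by h(s) too, hence
      -- w maps the whole orbit into itself, contrary to `no-affine-action`.
      W-O-outside : ¬ UOrbit O (W O)
      W-O-outside o = AffineAction.no-affine-action F big f f-0 f-f f-scale f-rel
        where
        W-O : W O ~ O
        W-O = inside-fixed o (H-s-W H-s-O)
        W-inside : ∀ x → UOrbit O (W (U x O))
        W-inside x = decidable-stable (UOrbit? O (W (U x O))) λ ¬o →
            ¬o (subst (λ z → UOrbit O (W (U z O))) (sym (x≡0 ¬o)) (UOrbit-~ (sym~ (trans~ (W-cong (U-0 O)) W-O))))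
          where
          s-fix : ¬ UOrbit O (W (U x O)) → H s (W (U x O)) ~ W (U x O)
          s-fix ¬o = outside (λ o → ¬o (UOrbit-trans (H-inside (inv-nz ns)) (UOrbit-trans (UOrbit-H (inv-nz ns) o) (UOrbit-~ (H-back _ ns))))) ¬o
          x≡0 : ¬ UOrbit O (W (U x O)) → x ≡ 0#
          x≡0 ¬o = torus-fixed (trans~ (H-cong s ns (sym~ (W-W _))) (trans~ (H-s-W (s-fix ¬o)) (W-W _)))
        f : Fin q → Fin q
        f x = proj₁ (W-inside x)
        f-W : ∀ x → W (U x O) ~ U (f x) O
        f-W x = proj₂ (W-inside x)
        f-0 : f 0# ≡ 0#
        f-0 = U-injective (trans~ (sym~ (f-W 0#)) (trans~ (W-cong (U-0 O)) (trans~ W-O (sym~ (U-0 O)))))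
        f-f : ∀ x → f (f x) ≡ x
        f-f x = U-injective (trans~ (sym~ (f-W (f x))) (trans~ (W-cong (sym~ (f-W x))) (W-W _)))
        H-affine : ∀ {a} y → Nz a → H a (U y O) ~ U (a * a * y) O
        H-affine y na = trans~ (H-U y O na) (U-cong _ (H-O na))
        f-scale : ∀ {a} x → Nz a → f (a * a * x) ≡ inv a * inv a * f x
        f-scale {a} x na = U-injective (trans~ (sym~ (f-W _)) (trans~ (W-cong (sym~ (H-affine x na)))
          (trans~ (W-H _ na) (trans~ (H-cong _ (inv-nz na) (f-W x)) (H-affine (f x) (inv-nz na))))))
        f-rel : ∀ {x} y → Nz x → f (x + f y) ≡ - inv x + inv x * inv x * f (y - inv x)
        f-rel {x} y nx = U-injective (trans~ (sym~ (f-W _)) (trans~ (W-cong (sym~ (trans~ (U-cong x (f-W y)) (U-+ x (f y) O))))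
          (trans~ (W-U-W (U y O) nx) (trans~ (U-cong _ (trans~ (H-cong _ (inv-nz nx)
            (trans~ (W-cong (trans~ (U-+ _ y O) (U-≡ O (+-comm _ y)))) (f-W _))) (H-affine _ (inv-nz nx)))) (U-+ _ _ O)))))

      isProjectiveLine : IsProjectiveLine A O (W O)
      isProjectiveLine = record
        { U-∞ = U-∞
        ; H-O = H-O
        ; H-∞ = λ {a} na → trans~ (H-≡ _ (sym (inv-inv na))) (trans~ (sym~ (W-H O (inv-nz na))) (W-cong (H-O (inv-nz na))))
        ; W-O = refl~
        ; W-∞ = W-W O
        ; W-U = λ {x} nx → trans~ (W-cong (U-cong x (sym~ (W-W O)))) (trans~ (W-U-W (W O) nx)
                  (U-cong _ (trans~ (H-cong _ (inv-nz nx) (trans~ (W-cong (U-∞ _)) (W-W O))) (H-O (inv-nz nx)))))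
        ; U-inj = U-injective
        ; affine≁ = λ x eq → W-O-outside (x , sym~ eq)
        ; cover = cover }
        where
        U-∞ : ∀ x → U x (W O) ~ W O
        U-∞ = outside-fixed W-O-outside
        cover : ∀ R → (R ~ W O) ⊎ (∃ λ x → R ~ U x O)
        cover R with UOrbit? O R
        ... | yes o = inj₂ o
        ... | no ¬o = inj₁ (outside ¬o W-O-outside)

    -- Any h(s) with s² ≠ 1 acts on the U-orbit as an affine map with multiplier s², and its unique
    -- fixed point `y₀` is taken as origin.
    projective-line : ∀ {P} → ¬ Fixed P → ∃₂ λ O ∞ → IsProjectiveLine A O ∞
    projective-line {P} ¬fixP with generic
    ... | s , ns , s²≢1 = _ , _ , TorusFixed.isProjectiveLine (λ fix → ¬fixP (Fixed-U y₀ fix)) ns nk H-s-O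
      where
      nk : Nz (s * s - 1#)
      nk eq = s²≢1 (diff≡0 eq)
      shift = proj₁ (Orbit.H-inside ¬fixP ns)
      y₀ = - (inv (s * s - 1#) * shift)
      H-s-O : H s (U y₀ P) ~ U y₀ P
      H-s-O = trans~ (H-U y₀ P ns) (trans~ (U-cong _ (proj₂ (Orbit.H-inside ¬fixP ns))) (trans~ (U-+ _ shift P) (U-≡ P
        (trans (solve 3 (λ b i z → b :* (:- (i :* z)) :+ z := z :- ((b :- con (+ 1)) :* i) :* z :+ (:- (i :* z))) refl (s * s) (inv (s * s - 1#)) shift)
        (trans (cong (λ w → shift - w * shift + y₀) (*-inv _ nk)) (solve 2 (λ z y → z :- con (+ 1) :* z :+ y := y) refl shift y₀))))))

  -- With at most q points there is no room for a projective line.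
  module SmallAction {q : ℕ} (F : FiniteField q) {X : Set} {_~_ : X → X → Set} (A : SL2Action F X _~_)
    (big : 12 ℕ.≤ q)
    (bound : ∀ {c} (f : Fin c → X) → (∀ i j → f i ~ f j → i ≡ j) → c ℕ.≤ q) where
    open FiniteField F
    open SL2Action A
    open Regularity F A big (λ f d → ℕP.m≤n⇒m≤1+n (bound f d))
    open ProjectiveLine F A big (λ f d → ℕP.m≤n⇒m≤1+n (bound f d)) using (projective-line)

    no-line : ∀ {O ∞} → ¬ IsProjectiveLine A O ∞
    no-line {O} {∞} line = ℕP.<-irrefl refl (bound f f-inj)
      where
      open IsProjectiveLine line
      f : Fin (suc q) → X
      f zero    = ∞
      f (suc x) = U x O
      f-inj : ∀ i j → f i ~ f j → i ≡ j
      f-inj zero    zero    _  = refl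
      f-inj zero    (suc y) eq = ⊥-elim (affine≁ y (sym~ eq))
      f-inj (suc x) zero    eq = ⊥-elim (affine≁ x eq)
      f-inj (suc x) (suc y) eq = cong suc (U-inj eq)

    U-trivial : ∀ x P → U x P ~ P
    U-trivial x P = decidable-stable (Fixed? P) (λ ¬fix → no-line (proj₂ (proj₂ (projective-line ¬fix)))) x

    -- When U acts trivially, w u(1) w = u(-1) w u(-1) reduces to 1 = w. `H-trivial` reads h off the
    -- same relation.
    W-trivial : ∀ P → W P ~ P
    W-trivial P = sym~ (trans~ (sym~ (trans~ (W-cong (U-trivial 1# _)) (W-W P))) (trans~ (W-U-W P 1-nz)
      (trans~ (U-trivial _ _) (trans~ (H-≡ _ inv-1) (trans~ (H-1 _) (W-cong (U-trivial _ P)))))))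

    H-trivial : ∀ {a} P → Nz a → H a P ~ P
    H-trivial {a} P na = trans~ (H-≡ P (sym (inv-inv na))) (trans~ (sym~ (trans~ (trans~ (U-trivial _ _)
        (H-cong _ (inv-nz ni) (trans~ (W-trivial _) (U-trivial _ P)))) refl~))
      (trans~ (sym~ (W-U-W P ni)) (trans~ (W-trivial _) (trans~ (U-trivial _ _) (W-trivial P)))))
      where ni = inv-nz na

-- Roots of polynomials, finite representations and generated normal subrings.

module Representations where
  open Counting
  open import Algebra.Bundles using (AbelianGroup)
  import Algebra.Properties.Monoid.Mult as Mult
  import Algebra.Properties.CommutativeMonoid.Sum as Sum
  open import Data.Nat.Divisibility using (_∣_)
  open import Data.Fin using (funToFin; finToFun)
  open import Data.Vec using (Vec; []; _∷_)
  open import Data.Product using (Σ)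

  module Roots (R : CommutativeRing 0ℓ 0ℓ) where
    open CommutativeRing R hiding (zero)
    open Solver
    open IntegerCoefficientSolver R using (solve; _:=_; _:+_; _:*_; _:-_; :-_)
    open import Data.Vec.Relation.Unary.All using (All; []; _∷_)

    eval : ∀ {m} → Vec Carrier m → Carrier → Carrier
    eval []       x = 0#
    eval (c ∷ cs) x = c + x * eval cs x

    quot : ∀ {m} → Vec Carrier (suc m) → Carrier → Vec Carrier m
    quot (c ∷ [])          a = []
    quot (c ∷ cs@(_ ∷ _))  a = eval cs a ∷ quot cs a

    quot-eval : ∀ {m} (cs : Vec Carrier (suc m)) x a → eval cs x - eval cs a ≈ (x - a) * eval (quot cs a) x
    quot-eval (c ∷ []) x a = trans (+-cong (+-congˡ (zeroʳ x)) (-‿cong (+-congˡ (zeroʳ a)))) (trans (-‿inverseʳ _) (sym (zeroʳ _)))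
    quot-eval (c ∷ cs@(_ ∷ _)) x a = begin
      (c + x * eval cs x) - (c + a * eval cs a)
        ≈⟨ solve 5 (λ c x a u v → (c :+ x :* u) :- (c :+ a :* v) := (x :- a) :* v :+ x :* (u :- v)) refl c x a (eval cs x) (eval cs a) ⟩
      (x - a) * eval cs a + x * (eval cs x - eval cs a)
        ≈⟨ +-congˡ (*-congˡ (quot-eval cs x a)) ⟩
      (x - a) * eval cs a + x * ((x - a) * eval (quot cs a) x)
        ≈⟨ solve 4 (λ d x v w → d :* v :+ x :* (d :* w) := d :* (v :+ x :* w)) refl (x - a) x (eval cs a) (eval (quot cs a) x) ⟩
      (x - a) * (eval cs a + x * eval (quot cs a) x) ∎
      where open import Relation.Binary.Reasoning.Setoid setoid

    unquot : ∀ {m} (cs : Vec Carrier (suc m)) a → eval cs a ≈ 0# → All (_≈ 0#) (quot cs a) → All (_≈ 0#) cs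
    unquot (c ∷ []) a eq [] = trans (sym (trans (+-congˡ (zeroʳ a)) (+-identityʳ c))) eq ∷ []
    unquot (c ∷ cs@(_ ∷ _)) a eq (e ∷ es) =
      trans (sym (trans (+-congˡ (trans (*-congˡ e) (zeroʳ a))) (+-identityʳ c))) eq ∷ unquot cs a e es

    -- A vector of m coefficients is a polynomial of degree below m. Dividing by x minus the first
    -- root leaves a quotient vanishing at the other points, and `unquot` recovers the coefficients
    -- from it.
    too-many-roots : (∀ {x y} → ¬ x ≈ 0# → x * y ≈ 0# → y ≈ 0#) →
      ∀ {m} (cs : Vec Carrier m) (z : Fin m → Carrier) → (∀ i j → ¬ i ≡ j → ¬ z i - z j ≈ 0#) →
      (∀ i → eval cs (z i) ≈ 0#) → All (_≈ 0#) cs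
    too-many-roots domain [] z distinct roots = []
    too-many-roots domain cs@(_ ∷ _) z distinct roots = unquot cs (z zero) (roots zero)
      (too-many-roots domain (quot cs (z zero)) (λ i → z (suc i)) (λ i j ne → distinct _ _ (λ eq → ne (FP.suc-injective eq)))
        (λ i → domain (distinct (suc i) zero λ ()) (trans (sym (quot-eval cs (z (suc i)) (z zero)))
          (trans (+-cong (roots (suc i)) (-‿cong (roots zero))) (-‿inverseʳ 0#)))))

  -- Exactly what the Clifford argument uses. `torsion` and `dependent` express that the space has
  -- dimension at most q over the field of p elements, with natural numbers as scalars. `small` says
  -- that a left-invariant equivalence on `Γ` which identifies elements acting equally has one class
  -- if it has at most q. The decidability fields make the arguments constructive.
  record Representation (q p : ℕ) : Set₁ where
    field
      V : AbelianGroup 0ℓ 0ℓ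
    open AbelianGroup V public
      renaming (Carrier to ∣V∣; _∙_ to infixl 6 _+_; ε to 0v; _⁻¹ to -_; ∙-cong to +-cong; ∙-congˡ to +-congˡ; ∙-congʳ to +-congʳ; ⁻¹-cong to -‿cong;
                assoc to +-assoc; comm to +-comm; identityˡ to +-identityˡ; identityʳ to +-identityʳ; inverseˡ to -‿inverseˡ; inverseʳ to -‿inverseʳ;
                _-_ to _−_)
      using (_≈_; refl; sym; trans; reflexive; setoid; isEquivalence; commutativeMonoid; monoid)
    open Mult monoid public using () renaming (_×_ to _⋆_; ×-congʳ to ⋆-congʳ)
    open Sum commutativeMonoid public using (sum; sum-cong-≋)
    infix 4 _≈?_
    infixl 7 _·_
    field
      _≈?_     : ∀ u v → Dec (u ≈ v)
      size     : ℕ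
      enum     : Fin size → ∣V∣
      enum-sur : ∀ v → ∃ λ i → v ≈ enum i
      Γ        : Set
      one      : Γ
      _·_      : Γ → Γ → Γ
      _⁻       : Γ → Γ
      ρ        : Γ → ∣V∣ → ∣V∣
      ρ-cong   : ∀ g {u v} → u ≈ v → ρ g u ≈ ρ g v
      ρ-+      : ∀ g u v → ρ g (u + v) ≈ ρ g u + ρ g v
      ρ-one    : ∀ v → ρ one v ≈ v
      ρ-·      : ∀ g h v → ρ (g · h) v ≈ ρ g (ρ h v)
      ρ-invˡ   : ∀ g v → ρ (g ⁻) (ρ g v) ≈ v
      ρ-invʳ   : ∀ g v → ρ g (ρ (g ⁻) v) ≈ v
      search   : ∀ (P : Γ → Set) → (∀ g → Dec (P g)) → Dec (∃ P)
      torsion  : ∀ n v → ¬ p ∣ n → n ⋆ v ≈ 0v → v ≈ 0v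
      nonzero  : ∃ λ v → ¬ v ≈ 0v
      dependent : ∀ (f : Fin (suc q) → ∣V∣) →
        Σ (Fin (suc q) → ℕ) λ c → (∃ λ i → ¬ p ∣ c i) × sum (λ i → c i ⋆ f i) ≈ 0v
      irreducible : ∀ (S : ∣V∣ → Set) → (∀ {u v} → u ≈ v → S u → S v) → (∀ {u v} → S u → S v → S (u + v)) →
        (∀ {u} → S u → S (- u)) → (∀ g {u} → S u → S (ρ g u)) → ∀ v → ¬ v ≈ 0v → S v → ∀ u → S u
      small : ∀ (_~_ : Γ → Γ → Set) → IsEquivalence _~_ → (∀ g h → Dec (g ~ h)) →
        (∀ {g h} → (∀ v → ρ g v ≈ ρ h v) → g ~ h) → (∀ k {g h} → g ~ h → (k · g) ~ (k · h)) →
        (∀ {c} (f : Fin c → Γ) → (∀ i j → f i ~ f j → i ≡ j) → c ℕ.≤ q) → ∀ g h → g ~ h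

  module Endomorphisms {q p : ℕ} (rep : Representation q p) where
    open Representation rep
    open import Relation.Binary.Reasoning.Setoid setoid
    open import Algebra.Properties.AbelianGroup V public using ()
      renaming (x∙y⁻¹≈ε⇒x≈y to diff≈0; ⁻¹-∙-comm to neg-+; inverseʳ-unique to neg-unique; ε⁻¹≈ε to neg-0; ⁻¹-involutive to neg-neg; xyx⁻¹≈y to conj-+)

    record End : Set where
      field
        fun  : ∣V∣ → ∣V∣
        cong : ∀ {u v} → u ≈ v → fun u ≈ fun v
        hom  : ∀ u v → fun (u + v) ≈ fun u + fun v

    open End public

    infix 4 _≗_
    _≗_ : End → End → Set
    φ ≗ ψ = ∀ v → fun φ v ≈ fun ψ v

    ≗-sym : ∀ {φ ψ} → φ ≗ ψ → ψ ≗ φ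
    ≗-sym eq v = sym (eq v)

    ≗-trans : ∀ {φ ψ χ} → φ ≗ ψ → ψ ≗ χ → φ ≗ χ
    ≗-trans eq eq′ v = trans (eq v) (eq′ v)

    hom-0 : ∀ φ → fun φ 0v ≈ 0v
    hom-0 φ = begin
      x              ≈⟨ +-identityʳ x ⟨
      x + 0v         ≈⟨ +-congˡ (-‿inverseʳ x) ⟨
      x + (x + - x)  ≈⟨ +-assoc x x (- x) ⟨
      (x + x) + - x  ≈⟨ +-congʳ (trans (sym (hom φ 0v 0v)) (cong φ (+-identityˡ 0v))) ⟩
      x + - x        ≈⟨ -‿inverseʳ x ⟩
      0v             ∎
      where x = fun φ 0v

    hom-neg : ∀ φ v → fun φ (- v) ≈ - fun φ v
    hom-neg φ v = neg-unique _ _ (trans (sym (hom φ v (- v))) (trans (cong φ (-‿inverseʳ v)) (hom-0 φ)))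

    hom-⋆ : ∀ φ n v → fun φ (n ⋆ v) ≈ n ⋆ fun φ v
    hom-⋆ φ zero    v = hom-0 φ
    hom-⋆ φ (suc n) v = trans (hom φ v (n ⋆ v)) (+-congˡ (hom-⋆ φ n v))

    hom-sum : ∀ φ {m} (f : Fin m → ∣V∣) → fun φ (sum f) ≈ sum (λ i → fun φ (f i))
    hom-sum φ {zero}  f = hom-0 φ
    hom-sum φ {suc m} f = trans (hom φ _ _) (+-congˡ (hom-sum φ (λ i → f (suc i))))

    interchange : ∀ a b c d → (a + b) + (c + d) ≈ (a + c) + (b + d)
    interchange a b c d = begin
      (a + b) + (c + d)  ≈⟨ +-assoc a b (c + d) ⟩
      a + (b + (c + d))  ≈⟨ +-congˡ (+-assoc b c d) ⟨
      a + ((b + c) + d)  ≈⟨ +-congˡ (+-congʳ (+-comm b c)) ⟩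
      a + ((c + b) + d)  ≈⟨ +-congˡ (+-assoc c b d) ⟩
      a + (c + (b + d))  ≈⟨ +-assoc a c (b + d) ⟨
      (a + c) + (b + d)  ∎

    idₑ : End
    idₑ = record { fun = λ v → v ; cong = λ eq → eq ; hom = λ _ _ → refl }

    infixl 6 _⊕_
    infixr 7 _⊙_
    _⊕_ : End → End → End
    φ ⊕ ψ = record
      { fun  = λ v → fun φ v + fun ψ v
      ; cong = λ eq → +-cong (cong φ eq) (cong ψ eq)
      ; hom  = λ u v → trans (+-cong (hom φ u v) (hom ψ u v)) (interchange _ _ _ _) }

    ⊖_ : End → End
    ⊖ φ = record
      { fun  = λ v → - fun φ v
      ; cong = λ eq → -‿cong (cong φ eq)
      ; hom  = λ u v → trans (-‿cong (hom φ u v)) (sym (neg-+ _ _)) }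

    _⊙_ : End → End → End
    φ ⊙ ψ = record
      { fun  = λ v → fun φ (fun ψ v)
      ; cong = λ eq → cong φ (cong ψ eq)
      ; hom  = λ u v → trans (cong φ (hom ψ u v)) (hom φ _ _) }

    0ₑ : End
    0ₑ = record { fun = λ _ → 0v ; cong = λ _ → refl ; hom = λ _ _ → sym (+-identityˡ 0v) }

    ρₑ : Γ → End
    ρₑ g = record { fun = ρ g ; cong = ρ-cong g ; hom = ρ-+ g }

    conj : Γ → End → End
    conj g φ = ρₑ g ⊙ φ ⊙ ρₑ (g ⁻)

    conj-ρ : ∀ g φ v → fun (conj g φ) (ρ g v) ≈ ρ g (fun φ v)
    conj-ρ g φ v = ρ-cong g (cong φ (ρ-invˡ g v))

    ∀V? : ∀ {P : ∣V∣ → Set} → (∀ {u v} → u ≈ v → P u → P v) → (∀ v → Dec (P v)) → Dec (∀ v → P v)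
    ∀V? resp P? = map′ (λ all v → resp (sym (proj₂ (enum-sur v))) (all _)) (λ all i → all (enum i)) (FP.all? λ i → P? (enum i))

    _≗?_ : ∀ φ ψ → Dec (φ ≗ ψ)
    φ ≗? ψ = ∀V? (λ eq e → trans (cong φ (sym eq)) (trans e (cong ψ eq))) (λ v → fun φ v ≈? fun ψ v)

    End-bound : ∀ {c} (r : Fin c → End) → (∀ i j → r i ≗ r j → i ≡ j) → c ℕ.≤ size ℕ.^ size
    End-bound r r-inj = FP.injective⇒≤ {f = code} λ {i} {j} eq → r-inj i j λ v →
        let (k , ek) = enum-sur v in
        trans (cong (r i) ek) (trans (val i k) (trans (reflexive (≡.cong enum
          (≡.trans (≡.sym (FP.finToFun-funToFin (table i) k)) (≡.trans (≡.cong (λ z → finToFun z k) eq) (FP.finToFun-funToFin (table j) k)))))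
          (trans (sym (val j k)) (cong (r j) (sym ek)))))
      where
      table : Fin _ → Fin size → Fin size
      table i k = proj₁ (enum-sur (fun (r i) (enum k)))
      code : Fin _ → Fin (size ℕ.^ size)
      code i = funToFin (table i)
      val : ∀ i k → fun (r i) (enum k) ≈ enum (table i k)
      val i k = proj₂ (enum-sur (fun (r i) (enum k)))

    record IsNormalSubring (R : End → Set) : Set where
      field
        resp : ∀ {φ ψ} → φ ≗ ψ → R φ → R ψ
        id∈  : R idₑ
        +∈   : ∀ {φ ψ} → R φ → R ψ → R (φ ⊕ ψ)
        neg∈ : ∀ {φ} → R φ → R (⊖ φ)
        ∘∈   : ∀ {φ ψ} → R φ → R ψ → R (φ ⊙ ψ)
        conj∈ : ∀ g {φ} → R φ → R (conj g φ)

    -- The normal subring generated by f. Only conjugates of f itself are generators; closure under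
    -- conjugation is proved in `Gen-conj`.
    data Gen (f : End) : End → Set where
      gen  : ∀ g → Gen f (conj g f)
      resp : ∀ {φ ψ} → φ ≗ ψ → Gen f φ → Gen f ψ
      id∈  : Gen f idₑ
      +∈   : ∀ {φ ψ} → Gen f φ → Gen f ψ → Gen f (φ ⊕ ψ)
      neg∈ : ∀ {φ} → Gen f φ → Gen f (⊖ φ)
      ∘∈   : ∀ {φ ψ} → Gen f φ → Gen f ψ → Gen f (φ ⊙ ψ)

    Gen-⊆ : ∀ {R f} → IsNormalSubring R → R f → ∀ {φ} → Gen f φ → R φ
    Gen-⊆ isR Rf (gen g)      = IsNormalSubring.conj∈ isR g Rf
    Gen-⊆ isR Rf (resp eq φ)  = IsNormalSubring.resp isR eq (Gen-⊆ isR Rf φ)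
    Gen-⊆ isR Rf id∈          = IsNormalSubring.id∈ isR
    Gen-⊆ isR Rf (+∈ φ ψ)     = IsNormalSubring.+∈ isR (Gen-⊆ isR Rf φ) (Gen-⊆ isR Rf ψ)
    Gen-⊆ isR Rf (neg∈ φ)     = IsNormalSubring.neg∈ isR (Gen-⊆ isR Rf φ)
    Gen-⊆ isR Rf (∘∈ φ ψ)     = IsNormalSubring.∘∈ isR (Gen-⊆ isR Rf φ) (Gen-⊆ isR Rf ψ)

    inv-· : ∀ g h v → ρ ((g · h) ⁻) v ≈ ρ (h ⁻) (ρ (g ⁻) v)
    inv-· g h v = begin
      ρ ((g · h) ⁻) v                                   ≈⟨ ρ-cong _ (ρ-invʳ g v) ⟨
      ρ ((g · h) ⁻) (ρ g (ρ (g ⁻) v))                   ≈⟨ ρ-cong _ (ρ-cong g (ρ-invʳ h _)) ⟨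
      ρ ((g · h) ⁻) (ρ g (ρ h (ρ (h ⁻) (ρ (g ⁻) v))))   ≈⟨ ρ-cong _ (ρ-· g h _) ⟨
      ρ ((g · h) ⁻) (ρ (g · h) (ρ (h ⁻) (ρ (g ⁻) v)))   ≈⟨ ρ-invˡ (g · h) _ ⟩
      ρ (h ⁻) (ρ (g ⁻) v)                               ∎

    inv-one : ∀ v → ρ (one ⁻) v ≈ v
    inv-one v = trans (ρ-cong _ (sym (ρ-one v))) (ρ-invˡ one v)

    conj-one : ∀ φ → conj one φ ≗ φ
    conj-one φ v = trans (ρ-one _) (cong φ (inv-one v))

    conj-conj : ∀ g h φ → conj g (conj h φ) ≗ conj (g · h) φ
    conj-conj g h φ v = trans (sym (ρ-· g h _)) (ρ-cong (g · h) (cong φ (sym (inv-· g h v))))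

    conj-cong : ∀ g {φ ψ} → φ ≗ ψ → conj g φ ≗ conj g ψ
    conj-cong g eq v = ρ-cong g (eq _)

    conj-⊙ : ∀ g φ ψ → conj g (φ ⊙ ψ) ≗ conj g φ ⊙ conj g ψ
    conj-⊙ g φ ψ v = ρ-cong g (cong φ (sym (ρ-invˡ g _)))

    Gen-conj : ∀ {f} g {φ} → Gen f φ → Gen f (conj g φ)
    Gen-conj {f} g (gen h)     = resp (≗-sym {conj g (conj h f)} {conj (g · h) f} (conj-conj g h f)) (gen (g · h))
    Gen-conj g (resp {φ} {ψ} eq r) = resp (conj-cong g {φ} {ψ} eq) (Gen-conj g r)
    Gen-conj g id∈             = resp (λ v → sym (ρ-invʳ g v)) id∈
    Gen-conj g (+∈ {φ} {ψ} r s) = resp (λ v → sym (ρ-+ g _ _)) (+∈ (Gen-conj g r) (Gen-conj g s))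
    Gen-conj g (neg∈ r)        = resp (λ v → sym (hom-neg (ρₑ g) _)) (neg∈ (Gen-conj g r))
    Gen-conj g (∘∈ {φ} {ψ} r s) = resp (≗-sym {conj g (φ ⊙ ψ)} {conj g φ ⊙ conj g ψ} (conj-⊙ g φ ψ)) (∘∈ (Gen-conj g r) (Gen-conj g s))

    Gen-normal : ∀ f → IsNormalSubring (Gen f)
    Gen-normal f = record { resp = resp ; id∈ = id∈ ; +∈ = +∈ ; neg∈ = neg∈ ; ∘∈ = ∘∈ ; conj∈ = Gen-conj }

    Gen-self : ∀ f → Gen f f
    Gen-self f = resp (conj-one f) (gen one)

    record Listed (f : End) : Set where
      field
        {c}   : ℕ
        elt   : Fin c → End
        elt∈  : ∀ i → Gen f (elt i)
        cover : ∀ {φ} → Gen f φ → ∃ λ i → elt i ≗ φ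

    -- Start from the empty list and add missing elements; the number of endomorphisms bounds the process.
    listed : ∀ f → Listed f
    listed f = grow (suc (size ℕ.^ size)) {0} (λ ()) (λ ()) (λ ()) (ℕP.+-identityʳ _)
      where
      grow : ∀ fuel {c} (r : Fin c → End) → (∀ i → Gen f (r i)) → (∀ i j → r i ≗ r j → i ≡ j) →
             fuel ℕ.+ c ≡ suc (size ℕ.^ size) → Listed f
      grow zero r r∈ r-inj eq = ⊥-elim (ℕP.<-irrefl ≡.refl (≡.subst (ℕ._≤ size ℕ.^ size) eq (End-bound r r-inj)))
      grow (suc fuel) {c} r r∈ r-inj eq = step
        where
        Has : End → Set
        Has φ = ∃ λ i → r i ≗ φ
        Has? : ∀ φ → Dec (Has φ)
        Has? φ = FP.any? λ i → r i ≗? φ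
        Has-resp : ∀ {φ ψ} → φ ≗ ψ → Has φ → Has ψ
        Has-resp {φ} {ψ} eq (i , e) = i , ≗-trans {r i} {φ} {ψ} e eq
        add : ∀ φ → Gen f φ → ¬ Has φ → Listed f
        add φ φ∈ new = grow fuel r′ r′∈ r′-inj (≡.trans (ℕP.+-suc fuel c) eq)
          where
          r′ : Fin (suc c) → End
          r′ zero    = φ
          r′ (suc i) = r i
          r′∈ : ∀ i → Gen f (r′ i)
          r′∈ zero    = φ∈
          r′∈ (suc i) = r∈ i
          r′-inj : ∀ i j → r′ i ≗ r′ j → i ≡ j
          r′-inj zero    zero    _  = ≡.refl
          r′-inj zero    (suc j) eq = ⊥-elim (new (j , ≗-sym {φ} {r j} eq))
          r′-inj (suc i) zero    eq = ⊥-elim (new (i , eq))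
          r′-inj (suc i) (suc j) eq = ≡.cong suc (r-inj i j eq)
        step : Listed f
        step with Has? idₑ
        ... | no new = add idₑ id∈ new
        ... | yes has-id with search (λ g → ¬ Has (conj g f)) (λ g → ¬? (Has? (conj g f)))
        ... | yes (g , new) = add (conj g f) (gen g) new
        ... | no all-gen with FP.any? (λ i → ¬? (Has? (⊖ r i)))
        ... | yes (i , new) = add (⊖ r i) (neg∈ (r∈ i)) new
        ... | no all-neg with FP.any? (λ i → FP.any? λ j → ¬? (Has? (r i ⊕ r j)))
        ... | yes (i , j , new) = add (r i ⊕ r j) (+∈ (r∈ i) (r∈ j)) new
        ... | no all-+ with FP.any? (λ i → FP.any? λ j → ¬? (Has? (r i ⊙ r j)))
        ... | yes (i , j , new) = add (r i ⊙ r j) (∘∈ (r∈ i) (r∈ j)) new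
        ... | no all-∘ = record { elt = r ; elt∈ = r∈ ; cover = cover }
          where
          cover : ∀ {φ} → Gen f φ → Has φ
          cover (gen g) = decidable-stable (Has? (conj g f)) λ new → all-gen (g , new)
          cover (resp {φ} {ψ} eq φ∈) = Has-resp {φ} {ψ} eq (cover φ∈)
          cover id∈ = has-id
          cover (+∈ {φ} {ψ} φ∈ ψ∈) = let (i , ei) = cover φ∈ ; (j , ej) = cover ψ∈ in
            Has-resp {r i ⊕ r j} {φ ⊕ ψ} (λ v → +-cong (ei v) (ej v)) (decidable-stable (Has? (r i ⊕ r j)) λ new → all-+ (i , j , new))
          cover (neg∈ {φ} φ∈) = let (i , ei) = cover φ∈ in
            Has-resp {⊖ r i} {⊖ φ} (λ v → -‿cong (ei v)) (decidable-stable (Has? (⊖ r i)) λ new → all-neg (i , new))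
          cover (∘∈ {φ} {ψ} φ∈ ψ∈) = let (i , ei) = cover φ∈ ; (j , ej) = cover ψ∈ in
            Has-resp {r i ⊙ r j} {φ ⊙ ψ} (λ v → trans (cong (r i) (ej v)) (ei _)) (decidable-stable (Has? (r i ⊙ r j)) λ new → all-∘ (i , j , new))

-- Clifford theory: normal subrings are simple.

module NormalSubrings where
  open Counting
  open Representations
  open import Data.Fin using (_≟_; inject≤)

  module Clifford {q p : ℕ} (rep : Representation q p) where
    open Representation rep
    open Endomorphisms rep
    open import Relation.Binary.Reasoning.Setoid setoid

    module Generated {f : End} (list : Listed f) where
      open Listed list

      Orbit : ∣V∣ → ∣V∣ → Set
      Orbit w v = ∃ λ i → fun (elt i) w ≈ v

      Orbit? : ∀ w v → Dec (Orbit w v)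
      Orbit? w v = FP.any? λ i → fun (elt i) w ≈? v

      orbit : ∀ {φ} w → Gen f φ → Orbit w (fun φ w)
      orbit w φ∈ = let (i , e) = cover φ∈ in i , e w

      Orbit-resp : ∀ {w v v′} → v ≈ v′ → Orbit w v → Orbit w v′
      Orbit-resp eq (i , e) = i , trans e eq

      Orbit-trans : ∀ {u v w} → Orbit u v → Orbit v w → Orbit u w
      Orbit-trans {u} (i , e) (j , e′) = Orbit-resp (trans (cong (elt j) e) e′) (orbit u (∘∈ (elt∈ j) (elt∈ i)))

      Orbit-self : ∀ w → Orbit w w
      Orbit-self w = orbit w id∈

      -- The cyclic module generated by w is simple: each of its nonzero vectors generates w again.
      Simple : ∣V∣ → Set
      Simple w = ¬ w ≈ 0v × (∀ v → ¬ v ≈ 0v → Orbit w v → Orbit v w)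

      -- While some nonzero vector of the cyclic module fails to generate w, it replaces w; its
      -- module omits w and is strictly smaller.
      simple-vector : ∃ Simple
      simple-vector = let (w , w≉0) = nonzero ; (k , _ , e , _) = enum-split (λ i → Orbit? w (enum i)) in
        descend k w w≉0 e ℕP.≤-refl
        where
        descend : ∀ fuel w → ¬ w ≈ 0v → ∀ {k} → Enum (λ i → Orbit w (enum i)) k → k ℕ.≤ fuel → ∃ Simple
        descend zero w _ e le with idx e (proj₁ (enum-sur w)) (Orbit-resp (proj₂ (enum-sur w)) (Orbit-self w))
        descend zero w _ {zero} e le | () , _
        descend (suc fuel) w w≉0 {k} e le
          with FP.any? (λ i → ¬? (enum i ≈? 0v) ×-dec Orbit? w (enum i) ×-dec ¬? (Orbit? (enum i) w))
        ... | no none = w , w≉0 , λ v v≉0 o → let (i , ei) = enum-sur v in decidable-stable (Orbit? v w)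
                λ ¬o → none (i , (λ eq → v≉0 (trans ei eq)) , Orbit-resp ei o ,
                  λ o′ → ¬o (Orbit-trans (Orbit-resp ei (Orbit-self v)) o′))
        ... | yes (i , v≉0 , o , ¬o) with enum-split (λ j → Orbit? (enum i) (enum j))
        ...   | k′ , _ , e′ , _ = descend fuel (enum i) v≉0 e′ (ℕ.s≤s⁻¹ (ℕP.≤-trans smaller le))
          where
          w′ = proj₁ (enum-sur w)
          member : Fin 1 ⊎ Fin size → Fin size
          member (inj₁ _) = w′
          member (inj₂ j) = j
          ¬w′ : ¬ Orbit (enum i) (enum w′)
          ¬w′ o = ¬o (Orbit-resp (sym (proj₂ (enum-sur w))) o)
          smaller : suc k′ ℕ.≤ k
          smaller = enum-≤ (enum-⊎ (enum-all 1) e′) e (λ j _ → member j)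
            (λ { (inj₁ _) _ → Orbit-resp (proj₂ (enum-sur w)) (Orbit-self w) ; (inj₂ j) o′ → Orbit-trans o o′ })
            λ { (inj₁ zero) _ (inj₁ zero) _ _ → ≡.refl
              ; (inj₁ _) _ (inj₂ j) o eq → ⊥-elim (¬w′ (≡.subst (λ z → Orbit (enum i) (enum z)) (≡.sym eq) o))
              ; (inj₂ j) o (inj₁ _) _ eq → ⊥-elim (¬w′ (≡.subst (λ z → Orbit (enum i) (enum z)) eq o))
              ; (inj₂ j) _ (inj₂ k) _ eq → ≡.cong inj₂ eq }

      Orbit-ρ : ∀ g {w v} → Orbit w v → Orbit (ρ g w) (ρ g v)
      Orbit-ρ g {w} (i , e) = Orbit-resp (trans (conj-ρ g (elt i) w) (ρ-cong g e)) (orbit (ρ g w) (Gen-conj g (elt∈ i)))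

      Orbit-respˡ : ∀ {w w′ v} → w ≈ w′ → Orbit w v → Orbit w′ v
      Orbit-respˡ eq (i , e) = i , trans (cong (elt i) (sym eq)) e

      ρ-0 : ∀ g {v} → ρ g v ≈ 0v → v ≈ 0v
      ρ-0 g {v} eq = trans (sym (ρ-invˡ g v)) (trans (ρ-cong _ eq) (hom-0 (ρₑ (g ⁻))))

      Simple-ρ : ∀ g {w} → Simple w → Simple (ρ g w)
      Simple-ρ g {w} (w≉0 , s) = (λ eq → w≉0 (ρ-0 g eq)) , λ v v≉0 o →
        Orbit-respˡ (ρ-invʳ g v) (Orbit-ρ g (s (ρ (g ⁻) v) (λ eq → v≉0 (ρ-0 (g ⁻) eq))
          (Orbit-respˡ (ρ-invˡ g w) (Orbit-ρ (g ⁻) o))))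

      record IsIdealOf (J : End → Set) : Set where
        field
          J⊆   : ∀ {φ} → J φ → Gen f φ
          J+   : ∀ {φ ψ} → J φ → J ψ → J (φ ⊕ ψ)
          Jneg : ∀ {φ} → J φ → J (⊖ φ)
          Jˡ   : ∀ {φ ψ} → Gen f φ → J ψ → J (φ ⊙ ψ)
          Jʳ   : ∀ {φ ψ} → J φ → Gen f ψ → J (φ ⊙ ψ)

      Identity : End → ∣V∣ → Set
      Identity φ w = ∀ v → Orbit w v → fun φ v ≈ v

      -- Jacobson density for the simple module generated by w, one vector at a time: an element e fixing some
      -- vectors is corrected at a further vector x by a multiple of a(e - 1), which kills the earlier ones.
      density : ∀ {J} → IsIdealOf J → ∀ {w} → Simple w → ∀ {a s} → J a → Gen f s → ¬ fun a (fun s w) ≈ 0v →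
                ∃ λ e → J e × Identity e w
      density {J} isJ {w} (w≉0 , simple) {a} {s} Ja s∈ asw≉0 = globalise (go size enum)
        where
        open IsIdealOf isJ
        go : ∀ n (x : Fin n → ∣V∣) → ∃ λ e → J e × (∀ i → Orbit w (x i) → fun e (x i) ≈ x i)
        -- The zero element of `J`, obtained as a - a.
        go zero x = a ⊕ ⊖ a , J+ Ja (Jneg Ja) , λ ()
        go (suc n) x with go n (λ i → x (suc i))
        ... | e , Je , fix with Orbit? w (x zero)
        ...   | no ¬o = e , Je , λ { zero o → ⊥-elim (¬o o) ; (suc i) o → fix i o }
        ...   | yes o with fun e (x zero) ≈? x zero
        ...     | yes eq = e , Je , λ { zero _ → eq ; (suc i) o → fix i o }
        ...     | no ne = e ⊕ ⊖ κ , J+ Je (Jneg Jκ) , λ { zero _ → at-0 ; (suc i) o → at-suc i o }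
          where
          x₀ = x zero
          y = fun e x₀ + - x₀
          y≉0 : ¬ y ≈ 0v
          y≉0 eq = ne (diff≈0 _ _ eq)
          e-1 = e ⊕ ⊖ idₑ
          w→y : Orbit w y
          w→y = Orbit-trans o (orbit x₀ (+∈ (J⊆ Je) (neg∈ id∈)))
          y→w : Orbit y w
          y→w = simple y y≉0 w→y
          t = elt (proj₁ y→w)
          -- e - 1 sends x₀ to y, t sends y to w, and a s w is nonzero, so simplicity leads back to
          -- w and on to y. The resulting κ has κ x₀ = y = e x₀ - x₀, and e - κ fixes x₀.
          b = (a ⊙ (s ⊙ t)) ⊙ e-1
          Jb : J b
          Jb = Jʳ (Jʳ Ja (∘∈ s∈ (elt∈ (proj₁ y→w)))) (+∈ (J⊆ Je) (neg∈ id∈))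
          b-x₀ : fun b x₀ ≈ fun a (fun s w)
          b-x₀ = cong a (cong s (proj₂ y→w))
          bx→w : Orbit (fun b x₀) w
          bx→w = simple _ (λ eq → asw≉0 (trans (sym b-x₀) eq)) (Orbit-trans o (orbit x₀ (J⊆ Jb)))
          κ′ = elt (proj₁ w→y) ⊙ (elt (proj₁ bx→w) ⊙ (a ⊙ (s ⊙ t)))
          κ = elt (proj₁ w→y) ⊙ (elt (proj₁ bx→w) ⊙ b)
          Jκ : J κ
          Jκ = Jˡ (elt∈ _) (Jˡ (elt∈ _) Jb)
          κ-x₀ : fun κ x₀ ≈ y
          κ-x₀ = trans (cong (elt (proj₁ w→y)) (proj₂ bx→w)) (proj₂ w→y)
          at-0 : fun e x₀ + - fun κ x₀ ≈ x₀
          at-0 = begin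
            fun e x₀ + - fun κ x₀            ≈⟨ +-congˡ (-‿cong κ-x₀) ⟩
            fun e x₀ + - (fun e x₀ + - x₀)   ≈⟨ +-congˡ (neg-+ _ _) ⟨
            fun e x₀ + (- fun e x₀ + - - x₀) ≈⟨ +-assoc _ _ _ ⟨
            (fun e x₀ + - fun e x₀) + - - x₀ ≈⟨ +-cong (-‿inverseʳ _) (neg-neg x₀) ⟩
            0v + x₀                          ≈⟨ +-identityˡ x₀ ⟩
            x₀                               ∎
          at-suc : ∀ i → Orbit w (x (suc i)) → fun e (x (suc i)) + - fun κ (x (suc i)) ≈ x (suc i)
          at-suc i o = trans (+-cong (fix i o) (trans (-‿cong (trans (cong κ′ vanish) (hom-0 κ′))) neg-0)) (+-identityʳ _)
            where
            vanish : fun e-1 (x (suc i)) ≈ 0v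
            vanish = trans (+-congʳ (fix i o)) (-‿inverseʳ _)
        globalise : (∃ λ e → J e × (∀ i → Orbit w (enum i) → fun e (enum i) ≈ enum i)) → ∃ λ e → J e × Identity e w
        globalise (e , Je , fix) = e , Je , λ v o → let (i , ei) = enum-sur v in
          trans (cong e ei) (trans (fix i (Orbit-resp ei o)) (sym ei))

      Kills : End → ∣V∣ → Set
      Kills φ w = ∀ v → Orbit w v → fun φ v ≈ 0v

      Kills? : ∀ φ w → Dec (Kills φ w)
      Kills? φ w = map′ (λ k v (i , e) → trans (cong φ (sym e)) (k i)) (λ k i → k _ (i , refl))
        (FP.all? λ i → fun φ (fun (elt i) w) ≈? 0v)

      ¬Kills : ∀ φ w → ¬ Kills φ w → ∃ λ i → ¬ fun φ (fun (elt i) w) ≈ 0v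
      ¬Kills φ w ¬k with FP.any? (λ i → ¬? (fun φ (fun (elt i) w) ≈? 0v))
      ... | yes p = p
      ... | no none = ⊥-elim (¬k λ v (i , e) → trans (cong φ (sym e)) (decidable-stable (_ ≈? 0v) λ ne → none (i , ne)))

      Kills-resp : ∀ {φ ψ w w′} → φ ≗ ψ → w ≈ w′ → Kills φ w → Kills ψ w′
      Kills-resp eq eq′ k v o = trans (sym (eq v)) (k v (Orbit-respˡ (sym eq′) o))

      Kills-conj : ∀ k {φ w} → Kills φ w → Kills (conj k φ) (ρ k w)
      Kills-conj k {φ} {w} kill v o = trans (ρ-cong k (kill _ (Orbit-respˡ (ρ-invˡ k w) (Orbit-ρ (k ⁻) o)))) (hom-0 (ρₑ k))

      annihilator : ∀ w → IsIdealOf (λ φ → Gen f φ × Kills φ w)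
      annihilator w = record
        { J⊆ = proj₁
        ; J+ = λ { (φ∈ , k) (ψ∈ , k′) → +∈ φ∈ ψ∈ , λ v o → trans (+-cong (k v o) (k′ v o)) (+-identityˡ 0v) }
        ; Jneg = λ { (φ∈ , k) → neg∈ φ∈ , λ v o → trans (-‿cong (k v o)) neg-0 }
        ; Jˡ = λ { {φ} φ∈ (ψ∈ , k) → ∘∈ φ∈ ψ∈ , λ v o → trans (cong φ (k v o)) (hom-0 φ) }
        ; Jʳ = λ { (φ∈ , k) ψ∈ → ∘∈ φ∈ ψ∈ , λ v o → k _ (Orbit-trans o (orbit v ψ∈)) } }

      complement-kills : ∀ {e w} → Identity e w → Kills (idₑ ⊕ ⊖ e) w
      complement-kills {e} ident v o = trans (+-congˡ (-‿cong (ident v o))) (-‿inverseʳ v)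

      complement-identity : ∀ {e w} → Kills e w → Identity (idₑ ⊕ ⊖ e) w
      complement-identity kill v o = trans (+-congˡ (trans (-‿cong (kill v o)) neg-0)) (+-identityʳ v)

      module Translates {w : ∣V∣} (simple : Simple w) where

        -- The simple modules generated by the two translates have the same annihilator in `Gen f`.
        -- Comparing annihilators over the finite list keeps the relation decidable.
        _~_ : Γ → Γ → Set
        g ~ h = ∀ j → (Kills (elt j) (ρ g w) → Kills (elt j) (ρ h w)) × (Kills (elt j) (ρ h w) → Kills (elt j) (ρ g w))

        transport : ∀ {g h φ} → g ~ h → Gen f φ → Kills φ (ρ g w) → Kills φ (ρ h w)
        transport {g} {h} {φ} eq φ∈ k = let (j , ej) = cover φ∈ in
          Kills-resp {elt j} {φ} ej refl (proj₁ (eq j) (Kills-resp {φ} {elt j} (≗-sym {elt j} {φ} ej) refl k))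

        ~-equiv : IsEquivalence _~_
        ~-equiv = record
          { refl  = λ j → (λ k → k) , (λ k → k)
          ; sym   = λ eq j → proj₂ (eq j) , proj₁ (eq j)
          ; trans = λ eq eq′ j → (λ k → proj₁ (eq′ j) (proj₁ (eq j) k)) , (λ k → proj₂ (eq j) (proj₂ (eq′ j) k)) }

        ~-dec : ∀ g h → Dec (g ~ h)
        ~-dec g h = FP.all? λ j → (Kills? (elt j) (ρ g w) →-dec Kills? (elt j) (ρ h w)) ×-dec (Kills? (elt j) (ρ h w) →-dec Kills? (elt j) (ρ g w))

        -- Conjugation by k preserves `Gen f` and carries the annihilator of a translate to that of
        -- its k-translate, so the group acts on the classes.
        ~-translate : ∀ k {g h} → g ~ h → (k · g) ~ (k · h)
        ~-translate k {g} {h} eq j = move eq , move (IsEquivalence.sym ~-equiv eq)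
          where
          φ = elt j
          back : conj k (conj (k ⁻) φ) ≗ φ
          back v = trans (ρ-invʳ k _) (cong φ (ρ-invˡ (k ⁻) v))
          move : ∀ {g h} → g ~ h → Kills φ (ρ (k · g) w) → Kills φ (ρ (k · h) w)
          move {g} {h} eq kill = Kills-resp {conj k (conj (k ⁻) φ)} {φ} back (sym (ρ-· k h w))
            (Kills-conj k {conj (k ⁻) φ} (transport eq (Gen-conj (k ⁻) (elt∈ j))
              (Kills-resp {conj (k ⁻) φ} {conj (k ⁻) φ} (λ _ → refl) (trans (ρ-cong _ (ρ-· k g w)) (ρ-invˡ k _)) (Kills-conj (k ⁻) {φ} kill))))

        -- An element killing one module but not the other feeds `density` in the annihilator ideal
        -- of the killed module. This gives e that is 1 on one and 0 on the other; in the reversed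
        -- case 1 - e is taken.
        separate : ∀ g h → ¬ g ~ h → ∃ λ e → Gen f e × Identity e (ρ g w) × Kills e (ρ h w)
        separate g h ¬eq with FP.any? (λ j → Kills? (elt j) (ρ h w) ×-dec ¬? (Kills? (elt j) (ρ g w)))
        ... | yes (j , kh , ¬kg) =
          let (s , ne) = ¬Kills (elt j) _ ¬kg
              (e , (e∈ , k) , ident) = density (annihilator (ρ h w)) (Simple-ρ g simple) (elt∈ j , kh) (elt∈ s) ne
          in e , e∈ , ident , k
        ... | no none₁ with FP.any? (λ j → Kills? (elt j) (ρ g w) ×-dec ¬? (Kills? (elt j) (ρ h w)))
        ...   | yes (j , kg , ¬kh) =
          let (s , ne) = ¬Kills (elt j) _ ¬kh
              (e , (e∈ , k) , ident) = density (annihilator (ρ g w)) (Simple-ρ h simple) (elt∈ j , kg) (elt∈ s) ne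
          in idₑ ⊕ ⊖ e , +∈ id∈ (neg∈ e∈) , complement-identity {e} k , complement-kills {e} ident
        ...   | no none₂ = ⊥-elim (¬eq λ j →
          (λ kg → decidable-stable (Kills? (elt j) (ρ h w)) λ ¬kh → none₂ (j , kg , ¬kh)) ,
          (λ kh → decidable-stable (Kills? (elt j) (ρ g w)) λ ¬kg → none₁ (j , kh , ¬kg)))

        compose : ∀ {m} → (Fin m → End) → End
        compose {zero}  φ = idₑ
        compose {suc m} φ = φ zero ⊙ compose (λ i → φ (suc i))

        compose∈ : ∀ {m} (φ : Fin m → End) → (∀ i → Gen f (φ i)) → Gen f (compose φ)
        compose∈ {zero}  φ φ∈ = id∈
        compose∈ {suc m} φ φ∈ = ∘∈ (φ∈ zero) (compose∈ _ (λ i → φ∈ (suc i)))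

        compose-id : ∀ {m} (φ : Fin m → End) {v} → (∀ i → fun (φ i) v ≈ v) → fun (compose φ) v ≈ v
        compose-id {zero}  φ fix = refl
        compose-id {suc m} φ fix = trans (cong (φ zero) (compose-id _ (λ i → fix (suc i)))) (fix zero)

        compose-0 : ∀ {m} (φ : Fin m → End) → (∀ i → Gen f (φ i)) → ∀ {v} j → Kills (φ j) v → fun (compose φ) v ≈ 0v
        compose-0 φ φ∈ {v} zero    k = k _ (orbit v (compose∈ _ (λ i → φ∈ (suc i))))
        compose-0 φ φ∈ {v} (suc j) k = trans (cong (φ zero) (compose-0 _ (λ i → φ∈ (suc i)) j k)) (hom-0 (φ zero))

        sum-0 : ∀ {m} (t : Fin m → ∣V∣) → (∀ j → t j ≈ 0v) → sum t ≈ 0v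
        sum-0 {zero}  t z = refl
        sum-0 {suc m} t z = trans (+-cong (z zero) (sum-0 _ (λ j → z (suc j)))) (+-identityˡ 0v)

        sum-single : ∀ {m} (t : Fin m → ∣V∣) i → (∀ j → ¬ j ≡ i → t j ≈ 0v) → sum t ≈ t i
        sum-single t zero    z = trans (+-congˡ (sum-0 _ (λ j → z (suc j) λ ()))) (+-identityʳ _)
        sum-single t (suc i) z = trans (+-cong (z zero λ ()) (sum-single _ i λ j ne → z (suc j) λ eq → ne (FP.suc-injective eq))) (+-identityˡ _)

        -- Modules with different annihilators are independent.
        ~-bound : ∀ {c} (h : Fin c → Γ) → (∀ i j → h i ~ h j → i ≡ j) → c ℕ.≤ q
        ~-bound {c} h h-inj with c ℕ.≤? q
        ... | yes le = le
        ... | no ¬le = ⊥-elim (proj₁ (Simple-ρ (g i₀) simple) (torsion (coef i₀) _ (proj₂ (proj₁ (proj₂ relation))) vanish))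
          where
          g : Fin (suc q) → Γ
          g i = h (inject≤ i (ℕP.≰⇒> ¬le))
          g-inj : ∀ i j → g i ~ g j → i ≡ j
          g-inj i j eq = FP.inject≤-injective _ _ i j (h-inj _ _ eq)
          relation = dependent (λ i → ρ (g i) w)
          coef = proj₁ relation
          i₀ = proj₁ (proj₁ (proj₂ relation))
          sep : ∀ j → ∃ λ e → Gen f e × fun e (ρ (g i₀) w) ≈ ρ (g i₀) w × (¬ j ≡ i₀ → Kills e (ρ (g j) w))
          sep j with j ≟ i₀
          ... | yes eq = idₑ , id∈ , refl , λ ne → ⊥-elim (ne eq)
          ... | no ne = let (e , e∈ , ident , k) = separate (g i₀) (g j) (λ eq → ne (≡.sym (g-inj i₀ j eq))) in
                        e , e∈ , ident _ (Orbit-self _) , λ _ → k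
          factor : Fin (suc q) → End
          factor j = proj₁ (sep j)
          -- E fixes the translate with index i₀ and kills all others, so applied to the relation it
          -- leaves one term, whose coefficient is prime to p.
          E = compose factor
          zero⋆ : ∀ n {v} → v ≈ 0v → n ⋆ v ≈ 0v
          zero⋆ zero    eq = refl
          zero⋆ (suc n) eq = trans (+-cong eq (zero⋆ n eq)) (+-identityˡ 0v)
          vanish : coef i₀ ⋆ ρ (g i₀) w ≈ 0v
          vanish = begin
            coef i₀ ⋆ ρ (g i₀) w                     ≈⟨ ⋆-congʳ (coef i₀) (compose-id factor (λ j → proj₁ (proj₂ (proj₂ (sep j))))) ⟨
            coef i₀ ⋆ fun E (ρ (g i₀) w)             ≈⟨ sum-single (λ i → coef i ⋆ fun E (ρ (g i) w)) i₀
              (λ j ne → zero⋆ (coef j) (compose-0 factor (λ k → proj₁ (proj₂ (sep k))) j (proj₂ (proj₂ (proj₂ (sep j))) ne))) ⟨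
            sum (λ i → coef i ⋆ fun E (ρ (g i) w))   ≈⟨ sum-cong-≋ (λ i → hom-⋆ E (coef i) (ρ (g i) w)) ⟨
            sum (λ i → fun E (coef i ⋆ ρ (g i) w))   ≈⟨ hom-sum E (λ i → coef i ⋆ ρ (g i) w) ⟨
            fun E (sum (λ i → coef i ⋆ ρ (g i) w))   ≈⟨ cong E (proj₂ (proj₂ relation)) ⟩
            fun E 0v                                 ≈⟨ hom-0 E ⟩
            0v                                       ∎

        -- There are at most q classes, and the group has no nontrivial action on so few points.
        equivalent : ∀ g h → g ~ h
        equivalent = small _~_ ~-equiv ~-dec
          (λ eq j → Kills-resp {elt j} {elt j} (λ _ → refl) (eq w) , Kills-resp {elt j} {elt j} (λ _ → refl) (sym (eq w)))
          ~-translate ~-bound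

      -- The vectors all of whose translates are killed by φ form an invariant subspace, so
      -- irreducibility applies.
      faithful : ∀ {φ w} → ¬ w ≈ 0v → (∀ g → fun φ (ρ g w) ≈ 0v) → ∀ v → fun φ v ≈ 0v
      faithful {φ} {w} w≉0 kill v = trans (cong φ (sym (ρ-one v))) (irreducible (λ v → ∀ g → fun φ (ρ g v) ≈ 0v)
        (λ eq s g → trans (cong φ (ρ-cong g (sym eq))) (s g))
        (λ s s′ g → trans (cong φ (ρ-+ g _ _)) (trans (hom φ _ _) (trans (+-cong (s g) (s′ g)) (+-identityˡ 0v))))
        (λ s g → trans (cong φ (hom-neg (ρₑ g) _)) (trans (hom-neg φ _) (trans (-‿cong (s g)) neg-0)))
        (λ h s g → trans (cong φ (sym (ρ-· g h _))) (s (g · h)))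
        w w≉0 kill v one)

      -- Some translate is not killed by f, and density gives e in `J` that is 1 on its module. Then
      -- 1 - e kills this translate, hence every equivalent one, which is all of them, and
      -- `faithful` gives e = 1.
      ideal-identity : ∀ {J} → IsIdealOf J → J f → ¬ f ≗ 0ₑ → ∃ λ e → J e × e ≗ idₑ
      ideal-identity {J} isJ Jf f≉0 with simple-vector
      ... | w , simple with search (λ g → ¬ fun f (ρ g w) ≈ 0v) (λ g → ¬? (fun f (ρ g w) ≈? 0v))
      ... | no none = ⊥-elim (f≉0 (faithful {f} (proj₁ simple) λ g → decidable-stable (_ ≈? 0v) λ ne → none (g , ne)))
      ... | yes (g , ne) = let (e , Je , ident) = density isJ (Simple-ρ g simple) Jf id∈ ne in
            e , Je , λ v → sym (diff≈0 _ _ (faithful {idₑ ⊕ ⊖ e} (proj₁ simple) (λ h → transport {g} {h} {idₑ ⊕ ⊖ e} (equivalent g h)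
              (+∈ id∈ (neg∈ (IsIdealOf.J⊆ isJ Je))) (complement-kills {e} ident) _ (Orbit-self _)) v))
        where open Translates simple

    record IsIdealIn (R I : End → Set) : Set where
      field
        I-resp : ∀ {φ ψ} → φ ≗ ψ → I φ → I ψ
        I+   : ∀ {φ ψ} → I φ → I ψ → I (φ ⊕ ψ)
        Ineg : ∀ {φ} → I φ → I (⊖ φ)
        Iˡ   : ∀ {φ ψ} → R φ → I ψ → I (φ ⊙ ψ)
        Iʳ   : ∀ {φ ψ} → I φ → R ψ → I (φ ⊙ ψ)

    -- The work is done in the finite ring `Gen f` with the ideal of those elements that lie in `I`;
    -- `R` and `I` remain arbitrary predicates.
    simplicity : ∀ {R I} → IsNormalSubring R → IsIdealIn R I → ∀ {f} → R f → I f → ¬ f ≗ 0ₑ → I idₑ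
    simplicity {R} {I} isR isI {f} Rf If f≉0 =
      let (e , (_ , Ie) , eq) = ideal-identity isJ (Gen-self f , If) f≉0 in I-resp {e} {idₑ} eq Ie
      where
      open Generated (listed f)
      open IsIdealIn isI
      isJ : IsIdealOf (λ φ → Gen f φ × I φ)
      isJ = record
        { J⊆ = proj₁
        ; J+ = λ { (a , b) (c , d) → +∈ a c , I+ b d }
        ; Jneg = λ { (a , b) → neg∈ a , Ineg b }
        ; Jˡ = λ { a (c , d) → ∘∈ a c , Iˡ (Gen-⊆ isR Rf a) d }
        ; Jʳ = λ { (a , b) c → ∘∈ a c , Iʳ b (Gen-⊆ isR Rf c) } }

-- Central elements of a normal subring commute with the group.

module Centres where
  open Counting
  open Representations
  open NormalSubrings
  open import Data.Fin using (inject≤)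
  open import Data.Vec using (Vec; _∷_; tabulate)
  open import Data.Vec.Relation.Unary.All using (All; _∷_)
  open import Data.Product using (Σ)

  module Centre {q p : ℕ} (rep : Representation q p) where
    open Representation rep
    open Endomorphisms rep
    open Clifford rep

    module Central {R : End → Set} (isR : IsNormalSubring R) {z : End} (Rz : R z)
      (commutes : ∀ r → R r → z ⊙ r ≗ r ⊙ z) where

      -- A conjugate of z commutes with r because z commutes with the inverse conjugate of r, which
      -- lies in R by normality.
      Gen-central : ∀ {φ} → Gen z φ → ∀ r → R r → φ ⊙ r ≗ r ⊙ φ
      Gen-central (gen g) r Rr v = trans (ρ-cong g (trans (cong z (sym (conj-ρ (g ⁻) r v))) (commutes _ (IsNormalSubring.conj∈ isR (g ⁻) Rr) _)))
        (trans (ρ-cong g (cong (conj (g ⁻) r) (sym (ρ-invˡ g _)))) (trans (ρ-cong g (conj-ρ (g ⁻) r _)) (ρ-invʳ g _)))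
      Gen-central (resp eq φ∈) r Rr v = trans (sym (eq _)) (trans (Gen-central φ∈ r Rr v) (cong r (eq v)))
      Gen-central id∈ r Rr v = refl
      Gen-central (+∈ φ∈ ψ∈) r Rr v = trans (+-cong (Gen-central φ∈ r Rr v) (Gen-central ψ∈ r Rr v)) (sym (hom r _ _))
      Gen-central (neg∈ φ∈) r Rr v = trans (-‿cong (Gen-central φ∈ r Rr v)) (sym (hom-neg r _))
      Gen-central (∘∈ {φ} {ψ} φ∈ ψ∈) r Rr v = trans (cong φ (Gen-central ψ∈ r Rr v)) (Gen-central φ∈ r Rr _)

      comm : ∀ {φ ψ} → Gen z φ → Gen z ψ → φ ⊙ ψ ≗ ψ ⊙ φ
      comm φ∈ ψ∈ = Gen-central φ∈ _ (Gen-⊆ isR Rz ψ∈)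

      Z : CommutativeRing 0ℓ 0ℓ
      Z = record
        { Carrier = Σ End (Gen z)
        ; _≈_ = λ x y → proj₁ x ≗ proj₁ y
        ; _+_ = λ { (φ , φ∈) (ψ , ψ∈) → φ ⊕ ψ , +∈ φ∈ ψ∈ }
        ; _*_ = λ { (φ , φ∈) (ψ , ψ∈) → φ ⊙ ψ , ∘∈ φ∈ ψ∈ }
        ; -_ = λ { (φ , φ∈) → ⊖ φ , neg∈ φ∈ }
        ; 0# = 0ₑ , resp {z} {idₑ ⊕ ⊖ idₑ} {0ₑ} (λ v → -‿inverseʳ v) (+∈ id∈ (neg∈ id∈))
        ; 1# = idₑ , id∈
        ; isCommutativeRing = record
          { isRing = record
            { +-isAbelianGroup = record
              { isGroup = record
                { isMonoid = record
                  { isSemigroup = record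
                    { isMagma = record
                      { isEquivalence = record { refl = λ _ → refl ; sym = λ eq v → sym (eq v) ; trans = λ eq eq′ v → trans (eq v) (eq′ v) }
                      ; ∙-cong = λ eq eq′ v → +-cong (eq v) (eq′ v) }
                    ; assoc = λ _ _ _ v → +-assoc _ _ _ }
                  ; identity = (λ _ v → +-identityˡ _) , (λ _ v → +-identityʳ _) }
                ; inverse = (λ _ v → -‿inverseˡ _) , (λ _ v → -‿inverseʳ _)
                ; ⁻¹-cong = λ eq v → -‿cong (eq v) }
              ; comm = λ _ _ v → +-comm _ _ }
            ; *-cong = λ { {φ , _} {_} {_} {ψ′ , _} eq eq′ v → trans (cong φ (eq′ v)) (eq (fun ψ′ v)) }
            ; *-assoc = λ _ _ _ v → refl
            ; *-identity = (λ _ v → refl) , (λ _ v → refl)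
            ; distrib = (λ { (φ , _) _ _ v → hom φ _ _ }) , (λ _ _ _ v → refl) }
          ; *-comm = λ { (_ , φ∈) (_ , ψ∈) → comm φ∈ ψ∈ } } }

      open CommutativeRing Z using (1#) renaming (_≈_ to _≈Z_; _*_ to _*Z_; _+_ to _+Z_; 0# to 0Z; _-_ to _-Z_)
      open Roots Z

      -- Simplicity of `Gen z`, applied to the principal ideal generated by φ: a commutative simple
      -- ring is a field.
      invertible : ∀ {φ} → Gen z φ → ¬ φ ≗ 0ₑ → ∃ λ s → s ⊙ φ ≗ idₑ
      invertible {φ} φ∈ φ≉0 = let (s , _ , eq) = simplicity {Gen z} {I} (Gen-normal z) isI {φ} φ∈ (idₑ , id∈ , λ _ → refl) φ≉0 in s , λ v → sym (eq v)
        where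
        I : End → Set
        I ψ = ∃ λ s → Gen z s × ψ ≗ s ⊙ φ
        isI : IsIdealIn (Gen z) I
        isI = record
          { I-resp = λ { eq (s , s∈ , e) → s , s∈ , λ v → trans (sym (eq v)) (e v) }
          ; I+ = λ { (s , s∈ , e) (t , t∈ , e′) → s ⊕ t , +∈ s∈ t∈ , λ v → +-cong (e v) (e′ v) }
          ; Ineg = λ { (s , s∈ , e) → ⊖ s , neg∈ s∈ , λ v → -‿cong (e v) }
          ; Iˡ = λ { {ψ} ψ∈ (s , s∈ , e) → ψ ⊙ s , ∘∈ ψ∈ s∈ , λ v → cong ψ (e v) }
          ; Iʳ = λ { {_} {ψ} (s , s∈ , e) ψ∈ → s ⊙ ψ , ∘∈ s∈ ψ∈ , λ v → trans (e _) (cong s (comm φ∈ ψ∈ v)) } }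

      domain : ∀ {x y} → ¬ x ≈Z 0Z → (x *Z y) ≈Z 0Z → y ≈Z 0Z
      domain {_ , φ∈} x≉0 xy≈0 v = let (s , inv) = invertible φ∈ x≉0 in trans (sym (inv _)) (trans (cong s (xy≈0 v)) (hom-0 s))

      nat : ℕ → Σ End (Gen z)
      nat zero    = 0Z
      nat (suc n) = 1# +Z nat n

      nat-⋆ : ∀ n v → fun (proj₁ (nat n)) v ≈ n ⋆ v
      nat-⋆ zero    v = refl
      nat-⋆ (suc n) v = +-congˡ (nat-⋆ n v)

      coefficients : ∀ {m} → (Fin m → ℕ) → Vec (Σ End (Gen z)) m
      coefficients c = tabulate (λ i → nat (c i))

      power : ∀ {m} → End → ∣V∣ → Fin m → ∣V∣
      power φ v zero    = v
      power φ v (suc k) = fun φ (power φ v k)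

      eval-sum : ∀ {m} (c : Fin m → ℕ) x v → fun (proj₁ (eval (coefficients c) x)) v ≈ sum (λ k → c k ⋆ power (proj₁ x) v k)
      eval-sum {zero}  c x v = refl
      eval-sum {suc m} c x@(φ , _) v = +-cong (nat-⋆ (c zero) v)
        (trans (cong φ (eval-sum (λ k → c (suc k)) x v)) (trans (hom-sum φ (λ k → c (suc k) ⋆ power φ v k)) (sum-cong-≋ λ k → hom-⋆ φ (c (suc k)) (power φ v k))))

      conjugate : Γ → Σ End (Gen z)
      conjugate g = conj g z , gen g

      z₁ : Σ End (Gen z)
      z₁ = z , Gen-self z

      eval-conj : ∀ {m} g (c : Fin m → ℕ) v → fun (proj₁ (eval (coefficients c) (conjugate g))) (ρ g v) ≈ ρ g (fun (proj₁ (eval (coefficients c) z₁)) v)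
      eval-conj {zero}  g c v = sym (hom-0 (ρₑ g))
      eval-conj {suc m} g c v = trans (+-cong
          (trans (nat-⋆ (c zero) _) (trans (sym (hom-⋆ (ρₑ g) (c zero) v)) (ρ-cong g (sym (nat-⋆ (c zero) v)))))
          (trans (cong (conj g z) (eval-conj g (λ k → c (suc k)) v)) (conj-ρ g z _)))
        (sym (ρ-+ g _ _))

      _~_ : Γ → Γ → Set
      g ~ h = conj g z ≗ conj h z

      ρ-inverse : ∀ {g h} → (∀ v → ρ g v ≈ ρ h v) → ∀ v → ρ (g ⁻) v ≈ ρ (h ⁻) v
      ρ-inverse {g} {h} eq v = trans (ρ-cong (g ⁻) (trans (sym (ρ-invʳ h v)) (sym (eq _)))) (ρ-invˡ g _)

      -- The conjugates of z are roots of a polynomial of degree at most q over the prime field.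
      ~-bound : ∀ {c} (h : Fin c → Γ) → (∀ i j → h i ~ h j → i ≡ j) → c ℕ.≤ q
      ~-bound {c} h h-inj with c ℕ.≤? q
      ... | yes le = le
      ... | no ¬le = ⊥-elim (v≉0 (torsion (coef i₀) v ¬p∣ (trans (sym (nat-⋆ (coef i₀) v)) (zeros coef i₀ all-zero v))))
        where
        v = proj₁ nonzero
        v≉0 = proj₂ nonzero
        g : Fin (suc q) → Γ
        g i = h (inject≤ i (ℕP.≰⇒> ¬le))
        relation = dependent (power z v)
        coef = proj₁ relation
        i₀ = proj₁ (proj₁ (proj₂ relation))
        ¬p∣ = proj₂ (proj₁ (proj₂ relation))
        E = eval (coefficients coef) z₁
        -- The q + 1 vectors v, z v, ..., z^q v are dependent, so a polynomial in z kills v. A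
        -- nonzero element of the field `Z` would be invertible and could not kill v.
        E≈0 : E ≈Z 0Z
        E≈0 with proj₁ E ≗? 0ₑ
        ... | yes eq = eq
        ... | no ne = let (s , inv) = invertible (proj₂ E) ne in
              ⊥-elim (v≉0 (trans (sym (inv v)) (trans (cong s (trans (eval-sum coef z₁ v) (proj₂ (proj₂ relation)))) (hom-0 s))))
        zeros : ∀ {m} (c : Fin m → ℕ) i → All (_≈Z 0Z) (coefficients c) → nat (c i) ≈Z 0Z
        zeros c zero    (e ∷ _)  = e
        zeros c (suc i) (_ ∷ es) = zeros (λ i → c (suc i)) i es
        -- The coefficients are integers, so evaluating at a conjugate of z conjugates the value at
        -- z, which is zero.
        root : ∀ i → eval (coefficients coef) (conjugate (g i)) ≈Z 0Z
        root i v = trans (cong (proj₁ (eval (coefficients coef) (conjugate (g i)))) (sym (ρ-invʳ (g i) v)))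
          (trans (eval-conj (g i) coef _) (trans (ρ-cong (g i) (E≈0 _)) (hom-0 (ρₑ (g i)))))
        all-zero : All (_≈Z 0Z) (coefficients coef)
        all-zero = too-many-roots (λ {x} {y} → domain {x} {y}) (coefficients coef) (λ i → conjugate (g i))
          (λ i j i≢j eq → i≢j (FP.inject≤-injective _ _ i j (h-inj _ _ λ v → diff≈0 _ _ (eq v)))) root

      -- The conjugates of z are at most q in number and are permuted by the group, so all of them
      -- equal z.
      commutes-with-Γ : ∀ g v → fun z (ρ g v) ≈ ρ g (fun z v)
      commutes-with-Γ g v = trans (sym (trans (all g one _) (conj-one z _))) (conj-ρ g z v)
        where
        all : ∀ g h → g ~ h
        all = small _~_
          (record { refl = λ _ → refl ; sym = λ eq v → sym (eq v) ; trans = λ eq eq′ v → trans (eq v) (eq′ v) })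
          (λ g h → conj g z ≗? conj h z)
          (λ {g} {h} eq v → trans (eq _) (ρ-cong h (cong z (ρ-inverse {g} {h} eq v))))
          (λ k {g} {h} eq v → trans (sym (conj-conj k g z v)) (trans (conj-cong k {conj g z} {conj h z} eq v) (conj-conj k h z v)))
          ~-bound

-- Integers modulo p.

module ModularArithmetic where
  open import Defs using (_≡[mod_]_)
  open import Data.Nat.Primality using (prime⇒irreducible)
  import Data.Nat.Divisibility as ℕD
  open import Data.Nat.Coprimality using (Coprime; coprime-Bézout)
  open import Data.Nat.GCD using (module Bézout)
  open import Data.Integer.Divisibility.Signed using (_∣_; divides; ∣ᵤ⇒∣; ∣⇒∣ᵤ; ∣m∣n⇒∣m+n; ∣m⇒∣-m; ∣n⇒∣m*n)
  open import Data.Integer.Tactic.RingSolver using (solve-∀)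

  module ModularIntegers (p : ℕ) where
    infix 4 _≃_ _≃?_

    -- A record, so that both sides can be inferred from a proof; the irrelevant field makes all proofs equal.
    record _≃_ (x y : ℤ) : Set where
      constructor mod
      field .congruence : x ≡[mod p ] y

    unmod : ∀ {x y} → x ≃ y → x ≡[mod p ] y
    unmod {x} {y} (mod d) = recompute (p ℕD.∣? ℤ.∣ x ℤ.- y ∣) d

    _≃?_ : ∀ x y → Dec (x ≃ y)
    x ≃? y = map′ (λ d → mod d) unmod (p ℕD.∣? ℤ.∣ x ℤ.- y ∣)

    to : ∀ {x y} → x ≃ y → + p ∣ x ℤ.- y
    to eq = ∣ᵤ⇒∣ (unmod eq)

    private
      via : ∀ {x y z} → z ≡ x ℤ.- y → + p ∣ z → x ≃ y
      via eq d = mod (∣⇒∣ᵤ (≡.subst (+ p ∣_) eq d))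

    ≃-refl : ∀ {x} → x ≃ x
    ≃-refl {x} = via (≡.sym (ℤP.+-inverseʳ x)) (divides (+ 0) ≡.refl)

    ring : CommutativeRing 0ℓ 0ℓ
    ring = record
      { Carrier = ℤ ; _≈_ = _≃_ ; _+_ = ℤ._+_ ; _*_ = ℤ._*_ ; -_ = ℤ.-_ ; 0# = + 0 ; 1# = + 1
      ; isCommutativeRing = record
        { isRing = record
          { +-isAbelianGroup = record
            { isGroup = record
              { isMonoid = record
                { isSemigroup = record
                  { isMagma = record
                    { isEquivalence = record
                      { refl = ≃-refl
                      ; sym = λ {x} {y} d → via (l₁ x y) (∣m⇒∣-m (to d))
                      ; trans = λ {x} {y} {z} d d′ → via (l₂ x y z) (∣m∣n⇒∣m+n (to d) (to d′)) }
                    ; ∙-cong = λ {x} {y} {u} {v} d d′ → via (l₃ x y u v) (∣m∣n⇒∣m+n (to d) (to d′)) }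
                  ; assoc = λ x y z → ≡⇒≃ (ℤP.+-assoc x y z) }
                ; identity = (λ x → ≡⇒≃ (ℤP.+-identityˡ x)) , (λ x → ≡⇒≃ (ℤP.+-identityʳ x)) }
              ; inverse = (λ x → ≡⇒≃ (ℤP.+-inverseˡ x)) , (λ x → ≡⇒≃ (ℤP.+-inverseʳ x))
              ; ⁻¹-cong = λ {x} {y} d → via (l₄ x y) (∣m⇒∣-m (to d)) }
            ; comm = λ x y → ≡⇒≃ (ℤP.+-comm x y) }
          ; *-cong = λ {x} {y} {u} {v} d d′ → via (l₅ x y u v) (∣m∣n⇒∣m+n (∣n⇒∣m*n u (to d)) (∣n⇒∣m*n y (to d′)))
          ; *-assoc = λ x y z → ≡⇒≃ (ℤP.*-assoc x y z)
          ; *-identity = (λ x → ≡⇒≃ (ℤP.*-identityˡ x)) , (λ x → ≡⇒≃ (ℤP.*-identityʳ x))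
          ; distrib = (λ x y z → ≡⇒≃ (ℤP.*-distribˡ-+ x y z)) , (λ x y z → ≡⇒≃ (ℤP.*-distribʳ-+ x y z)) }
        ; *-comm = λ x y → ≡⇒≃ (ℤP.*-comm x y) } }
      where
      ≡⇒≃ : ∀ {x y} → x ≡ y → x ≃ y
      ≡⇒≃ {x} ≡.refl = ≃-refl {x}
      l₁ : ∀ x y → ℤ.- (x ℤ.- y) ≡ y ℤ.- x
      l₁ = solve-∀
      l₂ : ∀ x y z → (x ℤ.- y) ℤ.+ (y ℤ.- z) ≡ x ℤ.- z
      l₂ = solve-∀
      l₃ : ∀ x y u v → (x ℤ.- y) ℤ.+ (u ℤ.- v) ≡ (x ℤ.+ u) ℤ.- (y ℤ.+ v)
      l₃ = solve-∀
      l₄ : ∀ x y → ℤ.- (x ℤ.- y) ≡ ℤ.- x ℤ.- (ℤ.- y)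
      l₄ = solve-∀
      l₅ : ∀ x y u v → u ℤ.* (x ℤ.- y) ℤ.+ y ℤ.* (u ℤ.- v) ≡ x ℤ.* u ℤ.- y ℤ.* v
      l₅ = solve-∀

    open CommutativeRing ring public using () renaming (sym to ≃-sym; trans to ≃-trans; reflexive to ≡⇒≃; setoid to ≃-setoid;
      +-cong to ≃-+; -‿cong to ≃-neg; *-cong to ≃-*; +-commutativeMonoid to ≃-commutativeMonoid)

    p≃0 : + p ≃ + 0
    p≃0 = via (≡.sym (ℤP.+-identityʳ (+ p))) (divides (+ 1) (≡.sym (ℤP.*-identityˡ (+ p))))

    ∣⇒≃0 : ∀ {m} → p ℕD.∣ m → + m ≃ + 0
    ∣⇒≃0 {m} d = mod (≡.subst (λ z → p ℕD.∣ ℤ.∣ z ∣) (≡.sym (ℤP.+-identityʳ (+ m))) d)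

    ≃0⇒∣ : ∀ {m} → + m ≃ + 0 → p ℕD.∣ m
    ≃0⇒∣ {m} eq = ≡.subst (λ z → p ℕD.∣ ℤ.∣ z ∣) (ℤP.+-identityʳ (+ m)) (unmod eq)

    module PrimeModulus (prime : Prime p) where

      inverse : ∀ {x} → ¬ x ≃ + 0 → ∃ λ y → x ℤ.* y ≃ + 1
      inverse {x} x≄0 = signed x x≄0 ≡.refl
        where
        coprime : ∀ k → ¬ p ℕD.∣ k → Coprime k p
        coprime k ¬p∣k (d∣k , d∣p) with prime⇒irreducible prime d∣p
        ... | inj₁ d≡1 = d≡1
        ... | inj₂ ≡.refl = ⊥-elim (¬p∣k d∣k)
        natural : ∀ k → ¬ p ℕD.∣ k → ∃ λ y → + k ℤ.* y ≃ + 1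
        natural k ¬p∣k with coprime-Bézout (coprime k ¬p∣k)
        ... | Bézout.+- a b eq = + a , via {+ k ℤ.* + a} {+ 1} (lem a b eq) (divides (+ b) ≡.refl)
          where
          lem : ∀ a b → 1 ℕ.+ b ℕ.* p ≡ a ℕ.* k → + b ℤ.* + p ≡ + k ℤ.* + a ℤ.- + 1
          lem a b eq = ≡.trans (r (+ b ℤ.* + p)) (≡.cong (ℤ._- + 1) (≡.trans (≡.cong (λ z → + 1 ℤ.+ z) (≡.sym (ℤP.pos-* b p)))
            (≡.trans (≡.cong +_ eq) (≡.trans (ℤP.pos-* a k) (ℤP.*-comm (+ a) (+ k))))))
            where
            r : ∀ z → z ≡ (+ 1 ℤ.+ z) ℤ.- + 1
            r = solve-∀
        ... | Bézout.-+ a b eq = ℤ.- + a , via {+ k ℤ.* (ℤ.- + a)} {+ 1} (lem a b eq) (divides (ℤ.- + b) ≡.refl)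
          where
          lem : ∀ a b → 1 ℕ.+ a ℕ.* k ≡ b ℕ.* p → ℤ.- + b ℤ.* + p ≡ + k ℤ.* (ℤ.- + a) ℤ.- + 1
          lem a b eq = ≡.trans (≡.sym (ℤP.neg-distribˡ-* (+ b) (+ p))) (≡.trans (≡.cong ℤ.-_ (≡.trans (≡.sym (ℤP.pos-* b p)) (≡.trans (≡.cong +_ (≡.sym eq))
            (≡.cong (λ z → + 1 ℤ.+ z) (ℤP.pos-* a k))))) (r (+ a) (+ k)))
            where
            r : ∀ a k → ℤ.- (+ 1 ℤ.+ a ℤ.* k) ≡ k ℤ.* (ℤ.- a) ℤ.- + 1
            r = solve-∀
        signed : ∀ z → ¬ z ≃ + 0 → x ≡ z → ∃ λ y → x ℤ.* y ≃ + 1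
        signed (+ k) ne ≡.refl = natural k λ d → ne (∣⇒≃0 d)
        signed -[1+ k ] ne ≡.refl = let (y , eq) = natural (suc k) (λ d → ne (mod d)) in
          ℤ.- y , ≃-trans (≡⇒≃ (r (+ suc k) y)) eq
          where
          r : ∀ k y → (ℤ.- k) ℤ.* (ℤ.- y) ≡ k ℤ.* y
          r = solve-∀

      cancel : ∀ {x y} → ¬ x ≃ + 0 → x ℤ.* y ≃ + 0 → y ≃ + 0
      cancel {x} {y} x≄0 xy≃0 = let (z , xz) = inverse x≄0 in begin
        y                  ≈⟨ ≡⇒≃ (≡.sym (ℤP.*-identityˡ y)) ⟩
        + 1 ℤ.* y          ≈⟨ ≃-* (≃-sym xz) ≃-refl ⟩
        (x ℤ.* z) ℤ.* y    ≈⟨ ≡⇒≃ (r x y z) ⟩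
        z ℤ.* (x ℤ.* y)    ≈⟨ ≃-* (≃-refl {z}) xy≃0 ⟩
        z ℤ.* + 0          ≈⟨ ≡⇒≃ (ℤP.*-zeroʳ z) ⟩
        + 0                ∎
        where
        open import Relation.Binary.Reasoning.Setoid ≃-setoid
        r : ∀ x y z → (x ℤ.* z) ℤ.* y ≡ z ℤ.* (x ℤ.* y)
        r = solve-∀

-- Coordinates of the heart on the projective line; the group algebra.

module HeartCoordinates where
  open import Defs using (sumℤ)
  open Solver
  open Counting
  open FiniteFields
  open Actions
  open ProjectiveLines
  open ModularArithmetic
  open import Data.Fin.Permutation using (permutation)
  import Algebra.Properties.CommutativeMonoid.Sum as Sum
  import Algebra.Properties.Semiring.Sum as SemiringSum

  module ModularSums (p : ℕ) where
    open ModularIntegers p public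
    open Sum ≃-commutativeMonoid public using (sum; sum-cong-≋; sum-permute; ∑-distrib-+; ∑-comm)
    open SemiringSum (CommutativeRing.semiring ring) public using (*-distribˡ-sum)

    sum-0 : ∀ {m} (t : Fin m → ℤ) → (∀ j → t j ≃ + 0) → sum t ≃ + 0
    sum-0 {zero}  t z = ≃-refl
    sum-0 {suc m} t z = ≃-trans (≃-+ (z zero) (sum-0 (λ j → t (suc j)) (λ j → z (suc j)))) ≃-refl

    sum-single : ∀ {m} (t : Fin m → ℤ) i → (∀ j → j ≢ i → t j ≃ + 0) → sum t ≃ t i
    sum-single t zero    z = ≃-trans (≃-+ (≃-refl {t zero}) (sum-0 (λ j → t (suc j)) (λ j → z (suc j) λ ()))) (≡⇒≃ (ℤP.+-identityʳ _))
    sum-single t (suc i) z = ≃-trans (≃-+ (z zero λ ()) (sum-single (λ j → t (suc j)) i λ j ne → z (suc j) λ eq → ne (FP.suc-injective eq))) (≡⇒≃ (ℤP.+-identityˡ _))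

    sum-const : ∀ m c → sum {m} (λ _ → c) ≃ + m ℤ.* c
    sum-const zero    c = ≃-refl
    sum-const (suc m) c = ≃-trans (≃-+ (≃-refl {c}) (sum-const m c)) (≡⇒≃ (≡.sym (ℤP.suc-* (+ m) c)))

    sum-neg : ∀ {m} (t : Fin m → ℤ) → sum (λ i → ℤ.- t i) ≃ ℤ.- sum t
    sum-neg {zero}  t = ≃-refl
    sum-neg {suc m} t = ≃-trans (≃-+ (≃-refl {ℤ.- t zero}) (sum-neg (λ j → t (suc j)))) (≡⇒≃ (≡.sym (ℤP.neg-distrib-+ (t zero) (sum (λ j → t (suc j))))))

    sum-scale : ∀ {m} c (t : Fin m → ℤ) → sum (λ i → c ℤ.* t i) ≃ c ℤ.* sum t
    sum-scale c t = ≃-sym (*-distribˡ-sum c t)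

    sum-bij : ∀ {m k} (t : Fin m → ℤ) (f : Fin k → Fin m) (g : Fin m → Fin k) →
              (∀ x → f (g x) ≡ x) → (∀ x → g (f x) ≡ x) → sum (λ i → t (f i)) ≃ sum t
    sum-bij t f g fg gf = ≃-sym (sum-permute t (permutation f g fg gf))

    sumℤ≡sum : ∀ {m} (t : Fin m → ℤ) → sumℤ t ≡ sum t
    sumℤ≡sum {zero}  t = ≡.refl
    sumℤ≡sum {suc m} t = ≡.cong (λ z → t zero ℤ.+ z) (sumℤ≡sum (λ j → t (suc j)))

  module Coordinates {q : ℕ} (F : FiniteField q) {n : ℕ} (A : SL2Action F (Fin n) _≡_) {O ∞ : Fin n}
    (line : IsProjectiveLine A O ∞) (p : ℕ) where
    open FiniteField F
    open SL2Action A
    open IsProjectiveLine line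
    open ModularSums p public
    private module K = IntegerCoefficientSolver ring
    open ≡ using (sym; trans; cong; refl; subst)

    Vec : Set
    Vec = Fin n → ℤ

    pt : Fin q → Fin n
    pt x = U x O

    on-line : ∀ {P : Fin n → Set} → P ∞ → (∀ x → P (pt x)) → ∀ b → P b
    on-line {P} P∞ Pₓ b with cover b
    ... | inj₁ eq       = subst P (sym eq) P∞
    ... | inj₂ (x , eq) = subst P (sym eq) (Pₓ x)

    pt-0 : pt 0# ≡ O
    pt-0 = U-0 O

    U-pt : ∀ x y → U x (pt y) ≡ pt (x + y)
    U-pt x y = U-+ x y O

    H-pt : ∀ {a} x → Nz a → H a (pt x) ≡ pt (a * a * x)
    H-pt x na = trans (H-U x O na) (cong (U _) (H-O na))

    W-pt-0 : W (pt 0#) ≡ ∞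
    W-pt-0 = trans (cong W pt-0) W-O

    vec : ℤ → (Fin q → ℤ) → Vec
    vec a f b with cover b
    ... | inj₁ _       = a
    ... | inj₂ (x , _) = f x

    vec-∞ : ∀ a f → vec a f ∞ ≡ a
    vec-∞ a f with cover ∞
    ... | inj₁ _ = refl
    ... | inj₂ (x , eq) = ⊥-elim (affine≁ x (sym eq))

    vec-pt : ∀ a f x → vec a f (pt x) ≡ f x
    vec-pt a f x with cover (pt x)
    ... | inj₁ eq = ⊥-elim (affine≁ x eq)
    ... | inj₂ (y , eq) = cong f (sym (U-inj eq))

    total : ∀ v → sum v ≃ v ∞ ℤ.+ sum (λ x → v (pt x))
    total v = ≃-sym (sum-bij v f g fg gf)
      where
      f : Fin (suc q) → Fin n
      f zero    = ∞
      f (suc x) = pt x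
      g : Fin n → Fin (suc q)
      g b with cover b
      ... | inj₁ _       = zero
      ... | inj₂ (x , _) = suc x
      fg : ∀ b → f (g b) ≡ b
      fg b with cover b
      ... | inj₁ eq       = sym eq
      ... | inj₂ (x , eq) = sym eq
      gf : ∀ i → g (f i) ≡ i
      gf zero with cover ∞
      ... | inj₁ _ = refl
      ... | inj₂ (x , eq) = ⊥-elim (affine≁ x (sym eq))
      gf (suc x) with cover (pt x)
      ... | inj₁ eq = ⊥-elim (affine≁ x eq)
      ... | inj₂ (y , eq) = cong suc (sym (U-inj eq))

    ZeroSum : Vec → Set
    ZeroSum v = sum v ≃ + 0

    affine-sum : ∀ {v} → ZeroSum v → sum (λ x → v (pt x)) ≃ ℤ.- v ∞
    affine-sum {v} z = ≃-trans (≡⇒≃ (K-lem (v ∞) _)) (≃-trans (≃-+ (≃-trans (≃-sym (total v)) z) (≃-refl {ℤ.- v ∞})) (≡⇒≃ (ℤP.+-identityˡ _)))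
      where
      open import Data.Integer.Tactic.RingSolver using (solve-∀)
      K-lem : ∀ a s → s ≡ (a ℤ.+ s) ℤ.+ (ℤ.- a)
      K-lem = solve-∀

    infix 4 _≋_
    -- Equality modulo constants, used in both cases of the definition of the heart. When p does not
    -- divide n, two vectors of sum zero that differ by a constant agree modulo p, so nothing is
    -- lost.
    record _≋_ (v w : Vec) : Set where
      constructor differ-by
      field
        constant : ℤ
        differs  : ∀ b → v b ℤ.- w b ≃ constant

    open _≋_ public

    infixl 6 _⊹_
    infixr 7 _•_
    _⊹_ : Vec → Vec → Vec
    (v ⊹ w) b = v b ℤ.+ w b

    _•_ : ℤ → Vec → Vec
    (c • v) b = c ℤ.* v b

    𝟘 : Vec
    𝟘 _ = + 0

    pointwise : ∀ {v w} → (∀ b → v b ≃ w b) → v ≋ w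
    pointwise {v} {w} eq = differ-by (+ 0) λ b → ≃-trans (≃-+ (eq b) (≃-refl {ℤ.- w b})) (≡⇒≃ (ℤP.+-inverseʳ (w b)))

    ≋-refl : ∀ {v} → v ≋ v
    ≋-refl = pointwise (λ b → ≃-refl)

    ≋-sym : ∀ {v w} → v ≋ w → w ≋ v
    ≋-sym {v} {w} (differ-by c d) = differ-by (ℤ.- c) λ b →
      ≃-trans (K.solve 2 (λ x y → y K.:- x K.:= K.:- (x K.:- y)) ≃-refl (v b) (w b)) (≃-neg (d b))

    ≋-trans : ∀ {u v w} → u ≋ v → v ≋ w → u ≋ w
    ≋-trans {u} {v} {w} (differ-by c d) (differ-by c′ d′) = differ-by (c ℤ.+ c′) λ b →
      ≃-trans (K.solve 3 (λ x y z → x K.:- z K.:= (x K.:- y) K.:+ (y K.:- z)) ≃-refl (u b) (v b) (w b)) (≃-+ (d b) (d′ b))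

    ≋-+ : ∀ {u v w z} → u ≋ v → w ≋ z → u ⊹ w ≋ v ⊹ z
    ≋-+ {u} {v} {w} {z} (differ-by c d) (differ-by c′ d′) = differ-by (c ℤ.+ c′) λ b →
      ≃-trans (K.solve 4 (λ x y s t → (x K.:+ s) K.:- (y K.:+ t) K.:= (x K.:- y) K.:+ (s K.:- t)) ≃-refl (u b) (v b) (w b) (z b)) (≃-+ (d b) (d′ b))

    ≋-• : ∀ k {u v} → u ≋ v → k • u ≋ k • v
    ≋-• k {u} {v} (differ-by c d) = differ-by (k ℤ.* c) λ b →
      ≃-trans (K.solve 3 (λ k x y → (k K.:* x) K.:- (k K.:* y) K.:= k K.:* (x K.:- y)) ≃-refl k (u b) (v b)) (≃-* (≃-refl {k}) (d b))

    ≋-dec : Fin n → ∀ v w → Dec (v ≋ w)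
    ≋-dec b₀ v w with FP.all? (λ b → (v b ℤ.- w b) ≃? (v b₀ ℤ.- w b₀))
    ... | yes all = yes (differ-by _ all)
    ... | no ¬all = no λ (differ-by c d) → ¬all λ b → ≃-trans (d b) (≃-sym (d b₀))

    ZeroSum-+ : ∀ {v w} → ZeroSum v → ZeroSum w → ZeroSum (v ⊹ w)
    ZeroSum-+ {v} {w} zv zw = ≃-trans (∑-distrib-+ v w) (≃-trans (≃-+ zv zw) ≃-refl)

    ZeroSum-• : ∀ c {v} → ZeroSum v → ZeroSum (c • v)
    ZeroSum-• c {v} z = ≃-trans (sum-scale c v) (≃-trans (≃-* (≃-refl {c}) z) (≡⇒≃ (ℤP.*-zeroʳ c)))

    ZeroSum-0 : ZeroSum 𝟘
    ZeroSum-0 = sum-0 𝟘 λ _ → ≃-refl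

    -- Formal elements of the group algebra. Linearity, preservation of the heart, stability of
    -- invariant subspaces and commutation with equivariant maps are then each proved once, by
    -- induction on the expression.
    data Op : Set where
      u    : Fin q → Op
      h    : ∀ a → Nz a → Op
      w    : Op
      ∑ₒ   : ∀ {m} → (Fin m → Op) → Op
      _⊞_  : Op → Op → Op
      _⊠_  : ℤ → Op → Op
      _⊡_  : Op → Op → Op

    infixl 6 _⊞_
    infixr 7 _⊠_
    infixr 8 _⊡_

    ⟦_⟧ : Op → Vec → Vec
    ⟦ u x ⟧    v b = v (U (- x) b)
    ⟦ h a _ ⟧  v b = v (H (inv a) b)
    ⟦ w ⟧      v b = v (W b)
    ⟦ ∑ₒ o ⟧   v b = sum (λ i → ⟦ o i ⟧ v b)
    ⟦ o ⊞ o′ ⟧ v = ⟦ o ⟧ v ⊹ ⟦ o′ ⟧ v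
    ⟦ c ⊠ o ⟧  v = c • ⟦ o ⟧ v
    ⟦ o ⊡ o′ ⟧ v = ⟦ o ⟧ (⟦ o′ ⟧ v)

    op-cong : ∀ o {v v′} → (∀ b → v b ≃ v′ b) → ∀ b → ⟦ o ⟧ v b ≃ ⟦ o ⟧ v′ b
    op-cong (u x)     eq b = eq _
    op-cong (h a _)   eq b = eq _
    op-cong w         eq b = eq _
    op-cong (∑ₒ o)    eq b = sum-cong-≋ (λ i → op-cong (o i) eq b)
    op-cong (o ⊞ o′)  eq b = ≃-+ (op-cong o eq b) (op-cong o′ eq b)
    op-cong (c ⊠ o)   eq b = ≃-* (≃-refl {c}) (op-cong o eq b)
    op-cong (o ⊡ o′)  eq b = op-cong o (op-cong o′ eq) b

    op-linear : ∀ o s v t v′ b → ⟦ o ⟧ (s • v ⊹ t • v′) b ≃ s ℤ.* ⟦ o ⟧ v b ℤ.+ t ℤ.* ⟦ o ⟧ v′ b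
    op-linear (u x)     s v t v′ b = ≃-refl
    op-linear (h a _)   s v t v′ b = ≃-refl
    op-linear w         s v t v′ b = ≃-refl
    op-linear (∑ₒ o)    s v t v′ b = ≃-trans (sum-cong-≋ (λ i → op-linear (o i) s v t v′ b))
      (≃-trans (∑-distrib-+ (λ i → s ℤ.* ⟦ o i ⟧ v b) (λ i → t ℤ.* ⟦ o i ⟧ v′ b)) (≃-+ (sum-scale s (λ i → ⟦ o i ⟧ v b)) (sum-scale t (λ i → ⟦ o i ⟧ v′ b))))
    op-linear (o ⊞ o′)  s v t v′ b = ≃-trans (≃-+ (op-linear o s v t v′ b) (op-linear o′ s v t v′ b))
      (K.solve 6 (λ s t a b c d → (s K.:* a K.:+ t K.:* b) K.:+ (s K.:* c K.:+ t K.:* d) K.:= s K.:* (a K.:+ c) K.:+ t K.:* (b K.:+ d)) ≃-refl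
        s t (⟦ o ⟧ v b) (⟦ o ⟧ v′ b) (⟦ o′ ⟧ v b) (⟦ o′ ⟧ v′ b))
    op-linear (c ⊠ o)   s v t v′ b = ≃-trans (≃-* (≃-refl {c}) (op-linear o s v t v′ b))
      (K.solve 5 (λ c s t a b → c K.:* (s K.:* a K.:+ t K.:* b) K.:= s K.:* (c K.:* a) K.:+ t K.:* (c K.:* b)) ≃-refl c s t (⟦ o ⟧ v b) (⟦ o ⟧ v′ b))
    op-linear (o ⊡ o′)  s v t v′ b = ≃-trans (op-cong o (op-linear o′ s v t v′) b) (op-linear o s (⟦ o′ ⟧ v) t (⟦ o′ ⟧ v′) b)

    -- Constants go to constants, which is why every expression acts modulo constants (`op-≋`).
    op-constant : ∀ o → ∃ λ k → ∀ b → ⟦ o ⟧ (λ _ → + 1) b ≃ k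
    op-constant (u x)     = + 1 , λ b → ≃-refl
    op-constant (h a _)   = + 1 , λ b → ≃-refl
    op-constant w         = + 1 , λ b → ≃-refl
    op-constant (∑ₒ o)    = sum (λ i → proj₁ (op-constant (o i))) , λ b → sum-cong-≋ (λ i → proj₂ (op-constant (o i)) b)
    op-constant (o ⊞ o′)  = _ , λ b → ≃-+ (proj₂ (op-constant o) b) (proj₂ (op-constant o′) b)
    op-constant (c ⊠ o)   = _ , λ b → ≃-* (≃-refl {c}) (proj₂ (op-constant o) b)
    op-constant (o ⊡ o′)  with op-constant o | op-constant o′
    ... | k , e | k′ , e′ = k′ ℤ.* k ℤ.+ + 0 ℤ.* k , λ b → ≃-trans (op-cong o (λ b → ≃-trans (e′ b)
          (K.solve 1 (λ k → k K.:= k K.:* K.con (+ 1) K.:+ K.con (+ 0) K.:* K.con (+ 1)) ≃-refl k′)) b)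
        (≃-trans (op-linear o k′ (λ _ → + 1) (+ 0) (λ _ → + 1) b) (≃-+ (≃-* (≃-refl {k′}) (e b)) (≃-* (≃-refl {+ 0}) (e b))))

    op-≋ : ∀ o {v v′} → v ≋ v′ → ⟦ o ⟧ v ≋ ⟦ o ⟧ v′
    op-≋ o {v} {v′} (differ-by c d) with op-constant o
    ... | k , e = differ-by (c ℤ.* k) λ b → ≃-trans
      (≃-+ (≃-trans (op-cong o (λ b → ≃-trans (K.solve 2 (λ x y → x K.:= K.con (+ 1) K.:* y K.:+ (x K.:- y) K.:* K.con (+ 1)) ≃-refl (v b) (v′ b))
          (≃-+ (≃-refl {+ 1 ℤ.* v′ b}) (≃-* (d b) (≃-refl {+ 1})))) b)
        (≃-trans (op-linear o (+ 1) v′ c (λ _ → + 1) b) (≃-+ (≃-refl {+ 1 ℤ.* ⟦ o ⟧ v′ b}) (≃-* (≃-refl {c}) (e b))))) (≃-refl {ℤ.- ⟦ o ⟧ v′ b}))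
      (K.solve 3 (λ y c k → (K.con (+ 1) K.:* y K.:+ c K.:* k) K.:- y K.:= c K.:* k) ≃-refl (⟦ o ⟧ v′ b) c k)

    op-ZeroSum : ∀ o {v} → ZeroSum v → ZeroSum (⟦ o ⟧ v)
    op-ZeroSum (u x)     {v} z = ≃-trans (sum-bij v (U (- x)) (U x)
      (λ b → trans (U-+ _ _ b) (trans (cong (λ y → U y b) (-‿inverseˡ x)) (U-0 b)))
      (λ b → trans (U-+ _ _ b) (trans (cong (λ y → U y b) (-‿inverseʳ x)) (U-0 b)))) z
    op-ZeroSum (h a na)  {v} z = ≃-trans (sum-bij v (H (inv a)) (H a)
      (λ b → trans (H-* b (inv-nz na) na) (trans (cong (λ y → H y b) (inv-* na)) (H-1 b)))
      (λ b → trans (H-* b na (inv-nz na)) (trans (cong (λ y → H y b) (*-inv a na)) (H-1 b)))) z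
    op-ZeroSum w         {v} z = ≃-trans (sum-bij v W W W-W W-W) z
    op-ZeroSum (∑ₒ o)    {v} z = ≃-trans (∑-comm (λ b i → ⟦ o i ⟧ v b)) (sum-0 _ λ i → op-ZeroSum (o i) z)
    op-ZeroSum (o ⊞ o′)  {v} z = ZeroSum-+ {⟦ o ⟧ v} {⟦ o′ ⟧ v} (op-ZeroSum o z) (op-ZeroSum o′ z)
    op-ZeroSum (c ⊠ o)   {v} z = ZeroSum-• c {⟦ o ⟧ v} (op-ZeroSum o z)
    op-ZeroSum (o ⊡ o′)  z = op-ZeroSum o (op-ZeroSum o′ z)

    record Invariant (S : Vec → Set) : Set where
      field
        S-zero : ∀ {v} → S v → ZeroSum v
        S-resp : ∀ {v v′} → ZeroSum v′ → v ≋ v′ → S v → S v′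
        S-+    : ∀ {v v′} → S v → S v′ → S (v ⊹ v′)
        S-neg  : ∀ {v} → S v → S ((ℤ.- + 1) • v)
        S-u    : ∀ x {v} → S v → S (⟦ u x ⟧ v)
        S-h    : ∀ a (na : Nz a) {v} → S v → S (⟦ h a na ⟧ v)
        S-w    : ∀ {v} → S v → S (⟦ w ⟧ v)

      S-𝟘 : ∀ {v} → S v → S 𝟘
      S-𝟘 {v} s = S-resp ZeroSum-0 (pointwise λ b → K.solve 1 (λ x → x K.:+ (K.:- K.con (+ 1)) K.:* x K.:= K.con (+ 0)) ≃-refl (v b)) (S-+ s (S-neg s))

      S-ℕ : ∀ m {v} → S v → S (+ m • v)
      S-ℕ zero    {v} s = S-𝟘 s
      S-ℕ (suc m) {v} s = S-resp (ZeroSum-• (+ suc m) {v} (S-zero s)) (pointwise λ b → ≡⇒≃ (≡.sym (ℤP.suc-* (+ m) (v b)))) (S-+ s (S-ℕ m s))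

      S-• : ∀ c {v} → S v → S (c • v)
      S-• (+ m)    s = S-ℕ m s
      S-• -[1+ m ] {v} s = S-resp (ZeroSum-• -[1+ m ] {v} (S-zero s)) (pointwise λ b →
        K.solve 2 (λ k x → (K.:- K.con (+ 1)) K.:* (k K.:* x) K.:= (K.:- k) K.:* x) ≃-refl (+ suc m) (v b)) (S-neg (S-ℕ (suc m) s))

      S-sum : ∀ {m} (t : Fin m → Vec) {v} → S v → (∀ i → S (t i)) → S (λ b → sum (λ i → t i b))
      S-sum {zero}  t s st = S-𝟘 s
      S-sum {suc m} t s st = S-+ (st zero) (S-sum (λ i → t (suc i)) s (λ i → st (suc i)))

      S-op : ∀ o {v} → S v → S (⟦ o ⟧ v)
      S-op (u x)     s = S-u x s
      S-op (h a na)  s = S-h a na s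
      S-op w         s = S-w s
      S-op (∑ₒ o)    {v} s = S-sum (λ i → ⟦ o i ⟧ v) s (λ i → S-op (o i) s)
      S-op (o ⊞ o′)  s = S-+ (S-op o s) (S-op o′ s)
      S-op (c ⊠ o)   s = S-• c (S-op o s)
      S-op (o ⊡ o′)  s = S-op o (S-op o′ s)

    record Equivariant (φ : Vec → Vec) : Set where
      field
        φ-zero : ∀ {v} → ZeroSum v → ZeroSum (φ v)
        φ-cong : ∀ {v v′} → ZeroSum v → ZeroSum v′ → v ≋ v′ → φ v ≋ φ v′
        φ-+    : ∀ {v v′} → ZeroSum v → ZeroSum v′ → φ (v ⊹ v′) ≋ φ v ⊹ φ v′
        φ-•    : ∀ c {v} → ZeroSum v → φ (c • v) ≋ c • φ v
        φ-u    : ∀ x {v} → ZeroSum v → φ (⟦ u x ⟧ v) ≋ ⟦ u x ⟧ (φ v)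
        φ-h    : ∀ a (na : Nz a) {v} → ZeroSum v → φ (⟦ h a na ⟧ v) ≋ ⟦ h a na ⟧ (φ v)
        φ-w    : ∀ {v} → ZeroSum v → φ (⟦ w ⟧ v) ≋ ⟦ w ⟧ (φ v)

      φ-𝟘 : φ 𝟘 ≋ 𝟘
      φ-𝟘 = ≋-trans (φ-cong ZeroSum-0 (ZeroSum-• (+ 0) {𝟘} ZeroSum-0) (pointwise λ b → ≃-refl)) (≋-trans (φ-• (+ 0) ZeroSum-0) (pointwise λ b → ≃-refl))

      φ-sum : ∀ {m} (t : Fin m → Vec) → (∀ i → ZeroSum (t i)) → φ (λ b → sum (λ i → t i b)) ≋ (λ b → sum (λ i → φ (t i) b))
      φ-sum {zero}  t z = φ-𝟘
      φ-sum {suc m} t z = ≋-trans (φ-+ (z zero) (≃-trans (∑-comm (λ b i → t (suc i) b)) (sum-0 _ (λ i → z (suc i)))))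
        (≋-+ (≋-refl {φ (t zero)}) (φ-sum (λ i → t (suc i)) (λ i → z (suc i))))

      sum-≋ : ∀ {m} (s t : Fin m → Vec) → (∀ i → s i ≋ t i) → (λ b → sum (λ i → s i b)) ≋ (λ b → sum (λ i → t i b))
      sum-≋ {zero}  s t eq = ≋-refl
      sum-≋ {suc m} s t eq = ≋-+ (eq zero) (sum-≋ _ _ (λ i → eq (suc i)))

      φ-op : ∀ o {v} → ZeroSum v → φ (⟦ o ⟧ v) ≋ ⟦ o ⟧ (φ v)
      φ-op (u x)     z = φ-u x z
      φ-op (h a na)  z = φ-h a na z
      φ-op w         z = φ-w z
      φ-op (∑ₒ o)    {v} z = ≋-trans (φ-sum (λ i → ⟦ o i ⟧ v) (λ i → op-ZeroSum (o i) z)) (sum-≋ _ _ (λ i → φ-op (o i) z))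
      φ-op (o ⊞ o′)  z = ≋-trans (φ-+ (op-ZeroSum o z) (op-ZeroSum o′ z)) (≋-+ (φ-op o z) (φ-op o′ z))
      φ-op (c ⊠ o)   z = ≋-trans (φ-• c (op-ZeroSum o z)) (≋-• c (φ-op o z))
      φ-op (o ⊡ o′)  z = ≋-trans (φ-op o (op-ZeroSum o′ z)) (op-≋ o (φ-op o′ z))

      eigenspace : ∀ c → Invariant (λ v → ZeroSum v × φ v ≋ c • v)
      eigenspace c = record
        { S-zero = proj₁
        ; S-resp = λ { z′ eq (z , e) → z′ , ≋-trans (φ-cong z′ z (≋-sym eq)) (≋-trans e (≋-• c eq)) }
        ; S-+ = λ { {v} {v′} (z , e) (z′ , e′) → ZeroSum-+ {v} {v′} z z′ , ≋-trans (φ-+ z z′) (≋-trans (≋-+ e e′)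
            (pointwise λ b → ≡⇒≃ (≡.sym (ℤP.*-distribˡ-+ c (v b) (v′ b))))) }
        ; S-neg = λ { {v} (z , e) → ZeroSum-• (ℤ.- + 1) {v} z , ≋-trans (φ-• (ℤ.- + 1) z) (≋-trans (≋-• (ℤ.- + 1) e)
            (pointwise λ b → K.solve 2 (λ c x → (K.:- K.con (+ 1)) K.:* (c K.:* x) K.:= c K.:* ((K.:- K.con (+ 1)) K.:* x)) ≃-refl c (v b))) }
        ; S-u = λ { x (z , e) → op-ZeroSum (u x) z , ≋-trans (φ-u x z) (op-≋ (u x) e) }
        ; S-h = λ { a na (z , e) → op-ZeroSum (h a na) z , ≋-trans (φ-h a na z) (op-≋ (h a na) e) }
        ; S-w = λ { (z , e) → op-ZeroSum w z , ≋-trans (φ-w z) (op-≋ w e) } }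

-- Irreducibility and scalars when p does not divide q + 1.

module PrimeHearts where
  open Solver
  open FiniteFields
  open Actions
  open ProjectiveLines
  open ModularArithmetic
  open HeartCoordinates
  open import Data.Fin using (_≟_)

  module PrimeHeart {q : ℕ} (F : FiniteField q) {n : ℕ} (A : SL2Action F (Fin n) _≡_) {O ∞ : Fin n}
    (line : IsProjectiveLine A O ∞) (p : ℕ) (prime : Prime p) where
    open FiniteField F hiding (solve; _:=_; _:+_; _:*_; _:-_; :-_; con)
    open SL2Action A
    open IsProjectiveLine line
    open Coordinates F A line p public
    open PrimeModulus prime public
    open ≡ using (sym; trans; cong; refl; subst)
    open import Relation.Binary.Reasoning.Setoid ≃-setoid
    open IntegerCoefficientSolver ring using (solve; _:=_; _:+_; _:*_; _:-_; :-_; con)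

    Irreducible : Set₁
    Irreducible = ∀ {S} → Invariant S → ∀ {v} → ¬ v ≋ 𝟘 → S v → ∀ {v′} → ZeroSum v′ → S v′

    Schur : Set
    Schur = ∀ {φ} → Equivariant φ → ∃ λ c → ∀ {v} → ZeroSum v → φ v ≋ c • v

    -- An eigenspace of an equivariant map is an invariant subspace, so one eigenvector that is
    -- nonzero in the heart settles the whole map.
    eigenvector⇒scalar : Irreducible → ∀ {φ} (eq : Equivariant φ) {v} → ZeroSum v → ¬ v ≋ 𝟘 → ∀ c → φ v ≋ c • v →
                         ∀ {v′} → ZeroSum v′ → φ v′ ≋ c • v′
    eigenvector⇒scalar irr eq z v≉0 c e z′ = proj₂ (irr (Equivariant.eigenspace eq c) v≉0 (z , e) z′)

    δ : Fin q → Fin q → ℤ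
    δ x y with x ≟ y
    ... | yes _ = + 1
    ... | no _  = + 0

    δ-≡ : ∀ {x y} → x ≡ y → δ x y ≡ + 1
    δ-≡ {x} {y} eq with x ≟ y
    ... | yes _ = refl
    ... | no ne = ⊥-elim (ne eq)

    δ-≢ : ∀ {x y} → x ≢ y → δ x y ≡ + 0
    δ-≢ {x} {y} ne with x ≟ y
    ... | yes eq = ⊥-elim (ne eq)
    ... | no _   = refl

    sum-scaleʳ : ∀ {m} (t : Fin m → ℤ) c → sum (λ i → t i ℤ.* c) ≃ c ℤ.* sum t
    sum-scaleʳ t c = ≃-trans (sum-cong-≋ (λ i → ≡⇒≃ (ℤP.*-comm (t i) c))) (sum-scale c t)

    sum-shift : ∀ y (t : Fin q → ℤ) → sum (λ x → t (- x + y)) ≃ sum t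
    sum-shift y t = sum-bij t (λ x → - x + y) (λ x → - x + y) inv′ inv′
      where
      open FiniteField F using () renaming (solve to solveF; _:=_ to _:=′_; _:+_ to _:+′_; :-_ to :-′_)
      inv′ : ∀ x → - (- x + y) + y ≡ x
      inv′ x = solveF 2 (λ x y → :-′ (:-′ x :+′ y) :+′ y :=′ x) refl x y

    nonzero-coordinate : ∀ {v} → ¬ v ≋ 𝟘 → ∃ λ b → ¬ v b ≃ + 0
    nonzero-coordinate {v} v≉0 with FP.any? (λ b → ¬? (v b ≃? + 0))
    ... | yes p = p
    ... | no none = ⊥-elim (v≉0 (pointwise λ b → decidable-stable (v b ≃? + 0) λ ne → none (b , ne)))

    •-inverse : ∀ {k} → ¬ k ≃ + 0 → ∀ {v v′} → k • v ≋ v′ → ∃ λ l → v ≋ l • v′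
    •-inverse {k} nk {v} {v′} eq = let (l , kl) = inverse nk in l ,
      ≋-trans (pointwise λ b → ≃-trans (≃-trans (≡⇒≃ (sym (ℤP.*-identityˡ (v b)))) (≃-* (≃-sym kl) (≃-refl {v b})))
        (solve 3 (λ k l x → (k :* l) :* x := l :* (k :* x)) ≃-refl k l (v b))) (≋-• l eq)

    module InvariantScaling {S : Vec → Set} (inv : Invariant S) where
      open Invariant inv public

      S-unscale : ∀ {k v} → ¬ k ≃ + 0 → ZeroSum v → S (k • v) → S v
      S-unscale {k} {v} nk z s = let (l , eq) = •-inverse nk {v} (≋-refl {k • v}) in S-resp z (≋-sym eq) (S-• l s)

    module NonDivisible (q+1≄0 : ¬ + suc q ≃ + 0) where

      -- (q + 1)[infinity] minus the all-ones vector: a vector of sum zero fixed by U.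
      ξ : Vec
      ξ = vec (+ q) (λ _ → ℤ.- + 1)

      ξ-zero : ZeroSum ξ
      ξ-zero = begin
        sum ξ                                       ≈⟨ total ξ ⟩
        ξ ∞ ℤ.+ sum (λ x → ξ (pt x))                ≈⟨ ≃-+ (≡⇒≃ (vec-∞ (+ q) (λ _ → ℤ.- + 1))) (sum-cong-≋ λ x → ≡⇒≃ (vec-pt (+ q) (λ _ → ℤ.- + 1) x)) ⟩
        + q ℤ.+ sum {q} (λ _ → ℤ.- + 1)             ≈⟨ ≃-+ (≃-refl {+ q}) (sum-const q (ℤ.- + 1)) ⟩
        + q ℤ.+ + q ℤ.* (ℤ.- + 1)                   ≈⟨ solve 1 (λ q → q :+ q :* (:- con (+ 1)) := con (+ 0)) ≃-refl (+ q) ⟩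
        + 0                                         ∎

      ξ-∞ : ξ ∞ ≡ + q
      ξ-∞ = vec-∞ (+ q) (λ _ → ℤ.- + 1)

      ξ-pt : ∀ x → ξ (pt x) ≡ ℤ.- + 1
      ξ-pt = vec-pt (+ q) (λ _ → ℤ.- + 1)

      average : Op
      average = ∑ₒ u

      -- Averaging makes v constant on affine points, and the zero sum fixes that constant as
      -- -v(infinity).
      average-ξ : ∀ {v} → ZeroSum v → ∀ b → ⟦ average ⟧ v b ≃ v ∞ ℤ.* ξ b
      average-ξ {v} z = on-line
        (begin
          sum (λ x → v (U (- x) ∞))   ≈⟨ sum-cong-≋ (λ x → ≡⇒≃ (cong v (U-∞ (- x)))) ⟩
          sum {q} (λ _ → v ∞)         ≈⟨ sum-const q (v ∞) ⟩
          + q ℤ.* v ∞                 ≈⟨ ≡⇒≃ (ℤP.*-comm (+ q) (v ∞)) ⟩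
          v ∞ ℤ.* + q                 ≈⟨ ≡⇒≃ (cong (v ∞ ℤ.*_) (sym ξ-∞)) ⟩
          v ∞ ℤ.* ξ ∞                 ∎)
        λ y → begin
          sum (λ x → v (U (- x) (pt y)))  ≈⟨ sum-cong-≋ (λ x → ≡⇒≃ (cong v (U-pt (- x) y))) ⟩
          sum (λ x → v (pt (- x + y)))    ≈⟨ sum-shift y (λ x → v (pt x)) ⟩
          sum (λ x → v (pt x))            ≈⟨ affine-sum z ⟩
          ℤ.- v ∞                         ≈⟨ solve 1 (λ a → :- a := a :* (:- con (+ 1))) ≃-refl (v ∞) ⟩
          v ∞ ℤ.* (ℤ.- + 1)               ≈⟨ ≡⇒≃ (cong (v ∞ ℤ.*_) (sym (ξ-pt y))) ⟩
          v ∞ ℤ.* ξ (pt y)                ∎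

      to-∞ : ∀ {v} → ¬ v ≋ 𝟘 → ∃ λ o → ¬ ⟦ o ⟧ v ∞ ≃ + 0
      to-∞ {v} v≉0 with nonzero-coordinate v≉0
      ... | b , ne with cover b
      ...   | inj₁ eq = u 0# , λ z → ne (≃-trans (≡⇒≃ (cong v (trans eq (sym (U-∞ _))))) z)
      ...   | inj₂ (x , eq) = w ⊡ u (- x) , λ z → ne (≃-trans (≡⇒≃ (cong v (trans eq (trans (cong (λ y → U y O) (sym (neg-neg x))) (cong (U (- - x)) (sym W-∞)))))) z)

      translates : Vec → Op
      translates v = ∑ₒ (λ x → v (pt x) ⊠ (u x ⊡ w))

      -- The translate u(x) w ξ is (q + 1)[x] minus the all-ones vector. With the values of v as
      -- weights the all-ones vectors cancel, since v has sum zero.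
      expansion : ∀ {v} → ZeroSum v → ∀ b → v ∞ ℤ.* ξ b ℤ.+ ⟦ translates v ⟧ ξ b ≃ + suc q ℤ.* v b
      expansion {v} z = on-line
        (begin
          v ∞ ℤ.* ξ ∞ ℤ.+ sum (λ x → v (pt x) ℤ.* ξ (W (U (- x) ∞)))
            ≈⟨ ≃-+ (≡⇒≃ (cong (v ∞ ℤ.*_) ξ-∞)) (sum-cong-≋ λ x → ≡⇒≃ (cong (v (pt x) ℤ.*_) (trans (cong ξ (trans (cong W (U-∞ _)) (trans W-∞ (sym pt-0)))) (ξ-pt 0#)))) ⟩
          v ∞ ℤ.* + q ℤ.+ sum (λ x → v (pt x) ℤ.* (ℤ.- + 1))
            ≈⟨ ≃-+ (≃-refl {v ∞ ℤ.* + q}) (≃-trans (sum-scaleʳ (λ x → v (pt x)) (ℤ.- + 1)) (≃-* (≃-refl {ℤ.- + 1}) (affine-sum z))) ⟩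
          v ∞ ℤ.* + q ℤ.+ (ℤ.- + 1) ℤ.* (ℤ.- v ∞)
            ≈⟨ solve 2 (λ a q → a :* q :+ (:- con (+ 1)) :* (:- a) := (con (+ 1) :+ q) :* a) ≃-refl (v ∞) (+ q) ⟩
          + suc q ℤ.* v ∞ ∎)
        λ y → begin
          v ∞ ℤ.* ξ (pt y) ℤ.+ sum (λ x → v (pt x) ℤ.* ξ (W (U (- x) (pt y))))
            ≈⟨ ≃-+ (≡⇒≃ (cong (v ∞ ℤ.*_) (ξ-pt y))) (sum-cong-≋ λ x → ≃-* (≃-refl {v (pt x)}) (value x y)) ⟩
          v ∞ ℤ.* (ℤ.- + 1) ℤ.+ sum (λ x → v (pt x) ℤ.* (ℤ.- + 1 ℤ.+ + suc q ℤ.* δ x y))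
            ≈⟨ ≃-+ (≃-refl {v ∞ ℤ.* (ℤ.- + 1)}) (≃-trans (sum-cong-≋ λ x → ≡⇒≃ (ℤP.*-distribˡ-+ (v (pt x)) (ℤ.- + 1) (+ suc q ℤ.* δ x y)))
                (≃-trans (∑-distrib-+ (λ x → v (pt x) ℤ.* (ℤ.- + 1)) (λ x → v (pt x) ℤ.* (+ suc q ℤ.* δ x y)))
                (≃-+ (≃-trans (sum-scaleʳ (λ x → v (pt x)) (ℤ.- + 1)) (≃-* (≃-refl {ℤ.- + 1}) (affine-sum z)))
                  (≃-trans (sum-single (λ x → v (pt x) ℤ.* (+ suc q ℤ.* δ x y)) y (λ x ne → ≃-trans (≡⇒≃ (cong (λ d → v (pt x) ℤ.* (+ suc q ℤ.* d)) (δ-≢ ne)))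
                      (solve 2 (λ a b → a :* (b :* con (+ 0)) := con (+ 0)) ≃-refl (v (pt x)) (+ suc q))))
                    (≡⇒≃ (cong (λ d → v (pt y) ℤ.* (+ suc q ℤ.* d)) (δ-≡ refl))))))) ⟩
          v ∞ ℤ.* (ℤ.- + 1) ℤ.+ ((ℤ.- + 1) ℤ.* (ℤ.- v ∞) ℤ.+ v (pt y) ℤ.* (+ suc q ℤ.* + 1))
            ≈⟨ solve 3 (λ a b q → a :* (:- con (+ 1)) :+ ((:- con (+ 1)) :* (:- a) :+ b :* (q :* con (+ 1))) := q :* b) ≃-refl (v ∞) (v (pt y)) (+ suc q) ⟩
          + suc q ℤ.* v (pt y) ∎
        where
        value : ∀ x y → ξ (W (U (- x) (pt y))) ≃ ℤ.- + 1 ℤ.+ + suc q ℤ.* δ x y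
        value x y with x ≟ y
        ... | yes refl = ≃-trans (≡⇒≃ (trans (cong ξ (trans (cong W (trans (U-pt (- x) x) (cong pt (-‿inverseˡ x)))) W-pt-0)) ξ-∞))
              (solve 1 (λ q → q := (:- con (+ 1)) :+ (con (+ 1) :+ q) :* con (+ 1)) ≃-refl (+ q))
        ... | no ne = ≃-trans (≡⇒≃ (trans (cong ξ (trans (cong W (U-pt (- x) y)) (W-U (λ eq → ne (sym (diff≡0 (trans (+-comm _ _) eq))))))) (ξ-pt _)))
              (solve 1 (λ q → :- con (+ 1) := (:- con (+ 1)) :+ (con (+ 1) :+ q) :* con (+ 0)) ≃-refl (+ q))

      -- A nonzero vector has a translate with nonzero value at infinity. Its average is a nonzero
      -- multiple of ξ, and `expansion` generates everything from ξ.
      irreducible : Irreducible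
      irreducible {S} inv {v} v≉0 s {v′} z′ = S-unscale q+1≄0 z′ (S-resp (ZeroSum-• (+ suc q) {v′} z′) (pointwise (expansion z′))
          (S-+ (S-• (v′ ∞) S-ξ) (S-op (translates v′) S-ξ)))
        where
        open InvariantScaling inv
        o = proj₁ (to-∞ v≉0)
        y = ⟦ o ⟧ v
        S-ξ : S ξ
        S-ξ = S-unscale (proj₂ (to-∞ v≉0)) ξ-zero (S-resp (ZeroSum-• (y ∞) {ξ} ξ-zero)
          (pointwise (average-ξ (S-zero (S-op o s)))) (S-op average (S-op o s)))

      -- The image of ξ is again fixed by U modulo constants, and this forces it to be a multiple of
      -- ξ.
      schur : Schur
      schur {φ} eqv = m , λ z → eigenvector⇒scalar irreducible eqv ξ-zero ξ≉0 m φξ z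
        where
        open Equivariant eqv
        ζ = φ ξ
        m = ℤ.- ζ (pt 0#)
        ξ≉0 : ¬ ξ ≋ 𝟘
        ξ≉0 (differ-by c d) = q+1≄0 (begin
          + suc q                                    ≈⟨ solve 1 (λ q → con (+ 1) :+ q := (q :- con (+ 0)) :- (:- con (+ 1) :- con (+ 0))) ≃-refl (+ q) ⟩
          (+ q ℤ.- + 0) ℤ.- (ℤ.- + 1 ℤ.- + 0)        ≈⟨ ≡⇒≃ (≡.cong₂ (λ a b → (a ℤ.- + 0) ℤ.- (b ℤ.- + 0)) (sym ξ-∞) (sym (ξ-pt 0#))) ⟩
          (ξ ∞ ℤ.- + 0) ℤ.- (ξ (pt 0#) ℤ.- + 0)      ≈⟨ ≃-+ (d ∞) (≃-neg (d (pt 0#))) ⟩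
          c ℤ.- c                                    ≈⟨ ≡⇒≃ (ℤP.+-inverseʳ c) ⟩
          + 0                                        ∎)
        ξ-fixed : ∀ x → ⟦ u x ⟧ ξ ≋ ξ
        ξ-fixed x = pointwise (on-line (≡⇒≃ (cong ξ (U-∞ _))) λ y → ≡⇒≃ (trans (cong ξ (U-pt _ y)) (trans (ξ-pt _) (sym (ξ-pt y)))))
        ζ-fixed : ∀ y → ζ (pt y) ≃ ζ (pt 0#)
        ζ-fixed y = begin
          ζ (pt y)                                     ≈⟨ ≡⇒≃ (cong (λ z → ζ (pt z)) (sym (trans (+-identityʳ _) (neg-neg y)))) ⟩
          ζ (pt (- - y + 0#))                          ≈⟨ ≡⇒≃ (cong ζ (sym (U-pt (- - y) 0#))) ⟩
          ζ (U (- - y) (pt 0#))                        ≈⟨ solve 2 (λ a b → a := (a :- b) :+ b) ≃-refl (ζ (U (- - y) (pt 0#))) (ζ (pt 0#)) ⟩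
          (ζ (U (- - y) (pt 0#)) ℤ.- ζ (pt 0#)) ℤ.+ ζ (pt 0#)
            -- The constant by which ζ and its translate differ is read off at infinity, which U
            -- fixes, and is zero.
            ≈⟨ ≃-+ (≃-trans (differs fix (pt 0#)) (≃-trans (≃-sym (differs fix ∞)) (≃-trans (≃-+ (≡⇒≃ (cong ζ (U-∞ (- - y)))) (≃-refl {ℤ.- ζ ∞})) (≡⇒≃ (ℤP.+-inverseʳ (ζ ∞)))))) (≃-refl {ζ (pt 0#)}) ⟩
          + 0 ℤ.+ ζ (pt 0#)                            ≈⟨ ≡⇒≃ (ℤP.+-identityˡ _) ⟩
          ζ (pt 0#)                                    ∎
          where
          fix : ⟦ u (- y) ⟧ ζ ≋ ζ
          fix = ≋-trans (≋-sym (φ-u (- y) ξ-zero)) (φ-cong (op-ZeroSum (u (- y)) ξ-zero) ξ-zero (ξ-fixed (- y)))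
        φξ : ζ ≋ m • ξ
        φξ = pointwise (on-line
          (begin
            ζ ∞                                          ≈⟨ solve 1 (λ a → a := :- (:- a)) ≃-refl (ζ ∞) ⟩
            ℤ.- (ℤ.- ζ ∞)                                ≈⟨ ≃-neg (≃-sym (affine-sum (φ-zero ξ-zero))) ⟩
            ℤ.- sum (λ x → ζ (pt x))                     ≈⟨ ≃-neg (≃-trans (sum-cong-≋ ζ-fixed) (sum-const q (ζ (pt 0#)))) ⟩
            ℤ.- (+ q ℤ.* ζ (pt 0#))                      ≈⟨ solve 2 (λ q z → :- (q :* z) := (:- z) :* q) ≃-refl (+ q) (ζ (pt 0#)) ⟩
            m ℤ.* + q                                    ≈⟨ ≡⇒≃ (cong (m ℤ.*_) (sym ξ-∞)) ⟩
            m ℤ.* ξ ∞                                    ∎)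
          λ y → ≃-trans (ζ-fixed y) (≃-trans (solve 1 (λ z → z := (:- z) :* (:- con (+ 1))) ≃-refl (ζ (pt 0#))) (≡⇒≃ (cong (m ℤ.*_) (sym (ξ-pt y))))))

-- The heart when p divides q + 1: averaging over the torus.

module DivisibleHearts where
  open Solver
  open FiniteFields
  open Actions
  open ProjectiveLines
  open ModularArithmetic
  open HeartCoordinates
  open PrimeHearts
  open import Data.Fin using (_≟_)

  module DivisibleHeart {q : ℕ} (F : FiniteField q) {n : ℕ} (A : SL2Action F (Fin n) _≡_) {O ∞ : Fin n}
    (line : IsProjectiveLine A O ∞) (p : ℕ) (prime : Prime p) where
    open FiniteField F hiding (solve; _:=_; _:+_; _:*_; _:-_; :-_; con)
    open SL2Action A
    open IsProjectiveLine line
    open PrimeHeart F A line p prime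
    open ≡ using (sym; trans; cong; cong₂; refl; subst)
    open import Relation.Binary.Reasoning.Setoid ≃-setoid
    open IntegerCoefficientSolver ring using (solve; _:=_; _:+_; _:*_; _:-_; :-_; con)
    private module FS = FiniteField F

    ν : Fin q → ℤ
    ν a = + 1 ℤ.- δ a 0#

    ν-nz : ∀ {a} → Nz a → ν a ≡ + 1
    ν-nz na = cong (λ d → + 1 ℤ.- d) (δ-≢ na)

    ν-0 : ν 0# ≡ + 0
    ν-0 = cong (λ d → + 1 ℤ.- d) (δ-≡ {0#} refl)

    -- The character is described by counting: a nonzero y has 1 + χ y square roots. In even
    -- characteristic the zero function satisfies this, so both parities are treated together.
    record QuadraticCharacter : Set where
      field
        χ       : Fin q → ℤ
        χ-0     : χ 0# ≡ + 0
        χ-count : ∀ {y} → Nz y → sum (λ a → ν a ℤ.* δ (a * a) y) ≃ + 1 ℤ.+ χ y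
        χ-*     : ∀ x y → χ (x * y) ≡ χ x ℤ.* χ y
        χ-inv   : ∀ {x} → Nz x → χ (inv x) ≡ χ x

    sum-δ : ∀ (f : Fin q → ℤ) y → sum (λ x → f x ℤ.* δ x y) ≃ f y
    sum-δ f y = ≃-trans (sum-single (λ x → f x ℤ.* δ x y) y λ x ne → ≃-trans (≡⇒≃ (cong (f x ℤ.*_) (δ-≢ ne))) (≡⇒≃ (ℤP.*-zeroʳ (f x))))
      (≡⇒≃ (trans (cong (f y ℤ.*_) (δ-≡ refl)) (ℤP.*-identityʳ (f y))))

    δ-sym : ∀ x y → δ x y ≡ δ y x
    δ-sym x y with x ≟ y
    ... | yes refl = sym (δ-≡ refl)
    ... | no ne    = sym (δ-≢ (λ eq → ne (sym eq)))

    δ-iff : ∀ {x y z w} → (x ≡ y → z ≡ w) → (z ≡ w → x ≡ y) → δ x y ≡ δ z w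
    δ-iff {x} {y} f g with x ≟ y
    ... | yes eq = sym (δ-≡ (f eq))
    ... | no ne  = sym (δ-≢ (λ eq → ne (g eq)))

    sum-ν : ∀ (f : Fin q → ℤ) → sum (λ x → ν x ℤ.* f x) ≃ sum f ℤ.- f 0#
    sum-ν f = begin
      sum (λ x → ν x ℤ.* f x)                          ≈⟨ sum-cong-≋ (λ x → solve 2 (λ d a → (con (+ 1) :- d) :* a := a :+ :- (a :* d)) ≃-refl (δ x 0#) (f x)) ⟩
      sum (λ x → f x ℤ.+ (ℤ.- (f x ℤ.* δ x 0#)))       ≈⟨ ∑-distrib-+ f (λ x → ℤ.- (f x ℤ.* δ x 0#)) ⟩
      sum f ℤ.+ sum (λ x → ℤ.- (f x ℤ.* δ x 0#))       ≈⟨ ≃-+ (≃-refl {sum f}) (≃-trans (sum-neg (λ x → f x ℤ.* δ x 0#)) (≃-neg (sum-δ f 0#))) ⟩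
      sum f ℤ.- f 0#                                   ∎

    total-ν : sum ν ≃ + q ℤ.- + 1
    total-ν = ≃-trans (sum-cong-≋ (λ x → ≡⇒≃ (sym (ℤP.*-identityʳ (ν x))))) (≃-trans (sum-ν (λ _ → + 1))
      (≃-+ (≃-trans (sum-const q (+ 1)) (≡⇒≃ (ℤP.*-identityʳ (+ q)))) (≃-refl {ℤ.- + 1})))

    module Divisible (q+1≃0 : + suc q ≃ + 0) (2≄0 : ¬ + 2 ≃ + 0) (character : QuadraticCharacter) where
      open QuadraticCharacter character

      count : ∀ y → sum (λ a → ν a ℤ.* δ (a * a) y) ≃ ν y ℤ.+ χ y
      count y = by-cases (y ≟ 0#)
        where
        vanish : ∀ a → Dec (a ≡ 0#) → ν a ℤ.* δ (a * a) 0# ≃ + 0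
        vanish a (yes refl) = ≡⇒≃ (trans (cong (ℤ._* δ (0# * 0#) 0#) ν-0) (ℤP.*-zeroˡ (δ (0# * 0#) 0#)))
        vanish a (no na)    = ≡⇒≃ (trans (cong (ν a ℤ.*_) (δ-≢ (*-nz na na))) (ℤP.*-zeroʳ (ν a)))
        by-cases : Dec (y ≡ 0#) → sum (λ a → ν a ℤ.* δ (a * a) y) ≃ ν y ℤ.+ χ y
        by-cases (yes refl) = ≃-trans (sum-0 (λ a → ν a ℤ.* δ (a * a) 0#) (λ a → vanish a (a ≟ 0#))) (≡⇒≃ (sym (cong₂ ℤ._+_ ν-0 χ-0)))
        by-cases (no ny) = ≃-trans (χ-count ny) (≡⇒≃ (cong (ℤ._+ χ y) (sym (ν-nz ny))))

      -- The vector [0] - [infinity].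
      e : Vec
      e = vec (ℤ.- + 1) (λ x → δ x 0#)

      e-∞ : e ∞ ≡ ℤ.- + 1
      e-∞ = vec-∞ (ℤ.- + 1) (λ x → δ x 0#)

      e-pt : ∀ x → e (pt x) ≡ δ x 0#
      e-pt = vec-pt (ℤ.- + 1) (λ x → δ x 0#)

      c : Vec
      c = vec (+ 0) χ

      c-∞ : c ∞ ≡ + 0
      c-∞ = vec-∞ (+ 0) χ

      c-pt : ∀ x → c (pt x) ≡ χ x
      c-pt = vec-pt (+ 0) χ

      e-zero : ZeroSum e
      e-zero = ≃-trans (total e) (≃-+ (≡⇒≃ e-∞) (≃-trans (sum-cong-≋ (λ x → ≡⇒≃ (trans (e-pt x) (sym (ℤP.*-identityˡ (δ x 0#)))))) (sum-δ (λ _ → + 1) 0#)))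

      sum-χ : sum χ ≃ + 0
      sum-χ = ≃-trans (solve 2 (λ s t → s := (t :+ s) :- t) ≃-refl (sum χ) (sum ν)) (≃-trans (≃-+ (begin
        sum ν ℤ.+ sum χ                                           ≈⟨ ∑-distrib-+ ν χ ⟨
        sum (λ y → ν y ℤ.+ χ y)                                   ≈⟨ sum-cong-≋ (λ y → count y) ⟨
        sum (λ y → sum (λ a → ν a ℤ.* δ (a * a) y))               ≈⟨ ∑-comm (λ y a → ν a ℤ.* δ (a * a) y) ⟩
        sum (λ a → sum (λ y → ν a ℤ.* δ (a * a) y))               ≈⟨ sum-cong-≋ (λ a → ≃-trans (sum-cong-≋ (λ y → ≡⇒≃ (cong (ν a ℤ.*_) (δ-sym (a * a) y)))) (sum-δ (λ _ → ν a) (a * a))) ⟩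
        sum ν                                                     ∎) (≃-refl {ℤ.- sum ν})) (≡⇒≃ (ℤP.+-inverseʳ (sum ν))))

      c-zero : ZeroSum c
      c-zero = ≃-trans (total c) (≃-+ (≡⇒≃ c-∞) (≃-trans (sum-cong-≋ (λ x → ≡⇒≃ (c-pt x))) sum-χ))

      -- Arranged so that `τ a` evaluates its argument at h(a) b; for a = 0 it is the zero operator,
      -- so the sum `T` can range over the whole field.
      τ : Fin q → Op
      τ a with Nz? a
      ... | yes na = h (inv a) (inv-nz na)
      ... | no _   = + 0 ⊠ u 0#

      T : Op
      T = ∑ₒ τ

      not-nz : ∀ {a} → ¬ Nz a → a ≡ 0#
      not-nz {a} = decidable-stable (a ≟ 0#)

      τ-∞ : ∀ v a → ⟦ τ a ⟧ v ∞ ≃ ν a ℤ.* v ∞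
      τ-∞ v a with Nz? a
      ... | yes na = ≡⇒≃ (trans (cong v (H-∞ (inv-nz (inv-nz na)))) (sym (trans (cong (ℤ._* v ∞) (ν-nz na)) (ℤP.*-identityˡ (v ∞)))))
      ... | no ¬na = ≡⇒≃ (trans (ℤP.*-zeroˡ (v (U (- 0#) ∞))) (sym (trans (cong (ℤ._* v ∞) (trans (cong ν (not-nz ¬na)) ν-0)) (ℤP.*-zeroˡ (v ∞)))))

      τ-pt : ∀ v a x → ⟦ τ a ⟧ v (pt x) ≃ ν a ℤ.* v (pt (a * a * x))
      τ-pt v a x with Nz? a
      ... | yes na = ≡⇒≃ (trans (cong v (trans (H-pt x (inv-nz (inv-nz na))) (cong (λ i → pt (i * i * x)) (inv-inv na))))
              (sym (trans (cong (ℤ._* v (pt (a * a * x))) (ν-nz na)) (ℤP.*-identityˡ (v (pt (a * a * x)))))))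
      ... | no ¬na = ≡⇒≃ (trans (ℤP.*-zeroˡ (v (U (- 0#) (pt x)))) (sym (trans (cong (ℤ._* v (pt (a * a * x))) (trans (cong ν (not-nz ¬na)) ν-0)) (ℤP.*-zeroˡ (v (pt (a * a * x)))))))

      ⟨_⟩ : Vec → ℤ
      ⟨ v ⟩ = sum (λ x → χ x ℤ.* v (pt x))

      -- Each z ≠ 0 is of the form a²x for 1 + χ(xz) values of a.
      square-sum : ∀ (f : Fin q → ℤ) {x} → Nz x → sum (λ a → ν a ℤ.* f (a * a * x)) ≃ (sum f ℤ.- f 0#) ℤ.+ χ x ℤ.* sum (λ z → χ z ℤ.* f z)
      square-sum f {x} nx = begin
        sum (λ a → ν a ℤ.* f (a * a * x))
          ≈⟨ sum-cong-≋ (λ a → ≃-trans (≃-* (≃-refl {ν a}) (≃-sym (sum-δ f (a * a * x)))) (≃-sym (sum-scale (ν a) (λ z → f z ℤ.* δ z (a * a * x))))) ⟩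
        sum (λ a → sum (λ z → ν a ℤ.* (f z ℤ.* δ z (a * a * x))))
          ≈⟨ ∑-comm (λ a z → ν a ℤ.* (f z ℤ.* δ z (a * a * x))) ⟩
        sum (λ z → sum (λ a → ν a ℤ.* (f z ℤ.* δ z (a * a * x))))
          ≈⟨ sum-cong-≋ (λ z → ≃-trans (sum-cong-≋ (λ a → ≃-trans (≡⇒≃ (cong (λ d → ν a ℤ.* (f z ℤ.* d)) (move a z)))
                (solve 3 (λ a b d → a :* (b :* d) := b :* (a :* d)) ≃-refl (ν a) (f z) (δ (a * a) (z * inv x)))))
              (≃-trans (sum-scale (f z) (λ a → ν a ℤ.* δ (a * a) (z * inv x))) (≃-* (≃-refl {f z}) (≃-trans (count (z * inv x)) (≡⇒≃ (cong₂ ℤ._+_ (ν-div z) (χ-div z))))))) ⟩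
        sum (λ z → f z ℤ.* (ν z ℤ.+ χ z ℤ.* χ x))
          ≈⟨ sum-cong-≋ (λ z → solve 4 (λ f a b c → f :* (a :+ b :* c) := a :* f :+ c :* (b :* f)) ≃-refl (f z) (ν z) (χ z) (χ x)) ⟩
        sum (λ z → ν z ℤ.* f z ℤ.+ χ x ℤ.* (χ z ℤ.* f z))
          ≈⟨ ∑-distrib-+ (λ z → ν z ℤ.* f z) (λ z → χ x ℤ.* (χ z ℤ.* f z)) ⟩
        sum (λ z → ν z ℤ.* f z) ℤ.+ sum (λ z → χ x ℤ.* (χ z ℤ.* f z))
          ≈⟨ ≃-+ (sum-ν f) (sum-scale (χ x) (λ z → χ z ℤ.* f z)) ⟩
        (sum f ℤ.- f 0#) ℤ.+ χ x ℤ.* sum (λ z → χ z ℤ.* f z) ∎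
        where
        there : ∀ {z y} → z ≡ y * x → y ≡ z * inv x
        there {z} {y} eq = sym (trans (cong (_* inv x) eq) (trans (*-assoc y x (inv x)) (trans (cong (y *_) (*-inv x nx)) (*-identityʳ y))))
        back : ∀ {z y} → y ≡ z * inv x → z ≡ y * x
        back {z} {y} eq = sym (trans (cong (_* x) eq) (trans (*-assoc z (inv x) x) (trans (cong (z *_) (inv-* nx)) (*-identityʳ z))))
        move : ∀ a z → δ z (a * a * x) ≡ δ (a * a) (z * inv x)
        move a z = δ-iff there back
        ν-div : ∀ z → ν (z * inv x) ≡ ν z
        ν-div z = cong (λ d → + 1 ℤ.- d) (δ-iff (λ eq → trans (back (sym eq)) (zeroˡ x)) (λ eq → trans (cong (_* inv x) eq) (zeroˡ (inv x))))
        χ-div : ∀ z → χ (z * inv x) ≡ χ z ℤ.* χ x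
        χ-div z = trans (χ-* z (inv x)) (cong (χ z ℤ.*_) (χ-inv nx))

      -- As q is -1 modulo p, the torus contributes weight -2 at the fixed points 0 and infinity. At
      -- x ≠ 0, `square-sum` gives -(v∞ + v₀) + χ(x)⟨ v ⟩. Adding the constant v∞ + v₀ leaves a
      -- combination of `e` and `c`.
      T-formula : ∀ {v} → ZeroSum v → ∀ {α β} → v ∞ ℤ.- v (pt 0#) ≃ α → ⟨ v ⟩ ≃ β → ⟦ T ⟧ v ≋ α • e ⊹ β • c
      T-formula {v} z {α} {β} eα eβ = ≋-trans formula (pointwise λ b → ≃-+ (≃-* eα (≃-refl {e b})) (≃-* eβ (≃-refl {c b})))
        where
        v₀ = v (pt 0#)
        v∞ = v ∞
        q≃ : + q ≃ ℤ.- + 1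
        q≃ = ≃-trans (solve 1 (λ q → q := (con (+ 1) :+ q) :- con (+ 1)) ≃-refl (+ q)) (≃-+ q+1≃0 (≃-refl {ℤ.- + 1}))
        weight : ∀ x → sum (λ a → ν a ℤ.* x) ≃ (ℤ.- + 2) ℤ.* x
        weight x = ≃-trans (sum-scaleʳ ν x) (≃-trans (≃-* (≃-refl {x}) (≃-trans total-ν (≃-+ q≃ (≃-refl {ℤ.- + 1})))) (≡⇒≃ (ℤP.*-comm x (ℤ.- + 2))))
        formula : ⟦ T ⟧ v ≋ (v∞ ℤ.- v₀) • e ⊹ ⟨ v ⟩ • c
        formula = differ-by (ℤ.- (v∞ ℤ.+ v₀)) (on-line
          (begin
            sum (λ a → ⟦ τ a ⟧ v ∞) ℤ.- ((v∞ ℤ.- v₀) ℤ.* e ∞ ℤ.+ ⟨ v ⟩ ℤ.* c ∞)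
              ≈⟨ ≃-+ (≃-trans (sum-cong-≋ (τ-∞ v)) (weight v∞)) (≡⇒≃ (cong₂ (λ s t → ℤ.- ((v∞ ℤ.- v₀) ℤ.* s ℤ.+ ⟨ v ⟩ ℤ.* t)) e-∞ c-∞)) ⟩
            (ℤ.- + 2) ℤ.* v∞ ℤ.- ((v∞ ℤ.- v₀) ℤ.* (ℤ.- + 1) ℤ.+ ⟨ v ⟩ ℤ.* + 0)
              ≈⟨ solve 3 (λ a b s → (:- con (+ 2)) :* a :- ((a :- b) :* (:- con (+ 1)) :+ s :* con (+ 0)) := :- (a :+ b)) ≃-refl v∞ v₀ ⟨ v ⟩ ⟩
            ℤ.- (v∞ ℤ.+ v₀) ∎)
          at-pt)
          where
          at-pt : ∀ x → ⟦ T ⟧ v (pt x) ℤ.- ((v∞ ℤ.- v₀) ℤ.* e (pt x) ℤ.+ ⟨ v ⟩ ℤ.* c (pt x)) ≃ ℤ.- (v∞ ℤ.+ v₀)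
          at-pt x = by-cases (x ≟ 0#)
            where
            by-cases : Dec (x ≡ 0#) → ⟦ T ⟧ v (pt x) ℤ.- ((v∞ ℤ.- v₀) ℤ.* e (pt x) ℤ.+ ⟨ v ⟩ ℤ.* c (pt x)) ≃ ℤ.- (v∞ ℤ.+ v₀)
            by-cases (yes refl) = begin
              sum (λ a → ⟦ τ a ⟧ v (pt 0#)) ℤ.- ((v∞ ℤ.- v₀) ℤ.* e (pt 0#) ℤ.+ ⟨ v ⟩ ℤ.* c (pt 0#))
                ≈⟨ ≃-+ (≃-trans (sum-cong-≋ (λ a → ≃-trans (τ-pt v a 0#) (≡⇒≃ (cong (λ y → ν a ℤ.* v (pt y)) (zeroʳ (a * a)))))) (weight v₀))
                     (≡⇒≃ (cong₂ (λ s t → ℤ.- ((v∞ ℤ.- v₀) ℤ.* s ℤ.+ ⟨ v ⟩ ℤ.* t)) (trans (e-pt 0#) (δ-≡ refl)) (trans (c-pt 0#) χ-0))) ⟩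
              (ℤ.- + 2) ℤ.* v₀ ℤ.- ((v∞ ℤ.- v₀) ℤ.* + 1 ℤ.+ ⟨ v ⟩ ℤ.* + 0)
                ≈⟨ solve 3 (λ a b s → (:- con (+ 2)) :* b :- ((a :- b) :* con (+ 1) :+ s :* con (+ 0)) := :- (a :+ b)) ≃-refl v∞ v₀ ⟨ v ⟩ ⟩
              ℤ.- (v∞ ℤ.+ v₀) ∎
            by-cases (no nx) = begin
              sum (λ a → ⟦ τ a ⟧ v (pt x)) ℤ.- ((v∞ ℤ.- v₀) ℤ.* e (pt x) ℤ.+ ⟨ v ⟩ ℤ.* c (pt x))
                ≈⟨ ≃-+ (≃-trans (sum-cong-≋ (λ a → τ-pt v a x)) (≃-trans (square-sum (λ y → v (pt y)) nx) (≃-+ (≃-+ (affine-sum z) (≃-refl {ℤ.- v₀})) (≃-refl {χ x ℤ.* ⟨ v ⟩}))))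
                     (≡⇒≃ (cong₂ (λ s t → ℤ.- ((v∞ ℤ.- v₀) ℤ.* s ℤ.+ ⟨ v ⟩ ℤ.* t)) (trans (e-pt x) (δ-≢ nx)) (c-pt x))) ⟩
              ((ℤ.- v∞ ℤ.- v₀) ℤ.+ χ x ℤ.* ⟨ v ⟩) ℤ.- ((v∞ ℤ.- v₀) ℤ.* + 0 ℤ.+ ⟨ v ⟩ ℤ.* χ x)
                ≈⟨ solve 4 (λ a b s t → ((:- a :- b) :+ t :* s) :- ((a :- b) :* con (+ 0) :+ s :* t) := :- (a :+ b)) ≃-refl v∞ v₀ ⟨ v ⟩ (χ x) ⟩
              ℤ.- (v∞ ℤ.+ v₀) ∎

      e-multiple : ∀ {k} → k • e ≋ 𝟘 → k ≃ + 0
      e-multiple {k} (differ-by d dif) = begin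
        k                                          ≈⟨ solve 1 (λ k → k := (k :* con (+ 1) :- con (+ 0)) :- (k :* con (+ 0) :- con (+ 0))) ≃-refl k ⟩
        (k ℤ.* + 1 ℤ.- + 0) ℤ.- (k ℤ.* + 0 ℤ.- + 0) ≈⟨ ≡⇒≃ (cong₂ (λ s t → (k ℤ.* s ℤ.- + 0) ℤ.- (k ℤ.* t ℤ.- + 0)) (sym (trans (e-pt 0#) (δ-≡ refl))) (sym (trans (e-pt 1#) (δ-≢ 1-nz)))) ⟩
        (k ℤ.* e (pt 0#) ℤ.- + 0) ℤ.- (k ℤ.* e (pt 1#) ℤ.- + 0) ≈⟨ ≃-+ (dif (pt 0#)) (≃-neg (dif (pt 1#))) ⟩
        d ℤ.- d                                    ≈⟨ ≡⇒≃ (ℤP.+-inverseʳ d) ⟩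
        + 0                                        ∎

      e≉0 : ¬ e ≋ 𝟘
      e≉0 eq = 2≄0 (≃-trans (≃-* (≃-refl {+ 2}) (e-multiple {+ 1} (≋-trans (pointwise λ b → ≡⇒≃ (ℤP.*-identityˡ (e b))) eq))) (≡⇒≃ (ℤP.*-zeroʳ (+ 2))))

      op-combination : ∀ o α β {v v′} → ⟦ o ⟧ (α • v ⊹ β • v′) ≋ α • ⟦ o ⟧ v ⊹ β • ⟦ o ⟧ v′
      op-combination o α β {v} {v′} = pointwise (op-linear o α v β v′)

      op-• : ∀ o k {v} → ⟦ o ⟧ (k • v) ≋ k • ⟦ o ⟧ v
      op-• o k {v} = ≋-trans (op-≋ o (pointwise λ b → solve 2 (λ k a → k :* a := k :* a :+ con (+ 0) :* a) ≃-refl k (v b)))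
        (≋-trans (op-combination o k (+ 0) {v} {v}) (pointwise λ b → solve 2 (λ k a → k :* a :+ con (+ 0) :* a := k :* a) ≃-refl k (⟦ o ⟧ v b)))

      -- What remains after torus averaging. `extract` recovers `e` from a combination in which it
      -- occurs, and drives irreducibility; `test` kills `e` but detects `c`, and drives the scalar
      -- statement.
      record Separation : Set where
        field
          extract  : ∀ μ λ′ → ¬ μ ≃ + 0 → ∃₂ λ o k → ¬ k ≃ + 0 × ⟦ o ⟧ (μ • e ⊹ λ′ • c) ≋ k • e
          test     : Op
          test-e   : ⟦ test ⟧ e ≋ 𝟘
          test-c   : ∀ λ′ → λ′ • ⟦ test ⟧ c ≋ 𝟘 → λ′ • c ≋ 𝟘

      module _ (separation : Separation) where
        open Separation separation

        generation : Vec → Op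
        generation v = ∑ₒ (λ x → v (pt x) ⊠ u x)

        -- u(x) e is [x] - [infinity], and these vectors span the sum-zero vectors.
        generate : ∀ {v} → ZeroSum v → ∀ b → ⟦ generation v ⟧ e b ≃ v b
        generate {v} z = on-line
          (begin
            sum (λ x → v (pt x) ℤ.* e (U (- x) ∞))   ≈⟨ sum-cong-≋ (λ x → ≡⇒≃ (cong (v (pt x) ℤ.*_) (trans (cong e (U-∞ (- x))) e-∞))) ⟩
            sum (λ x → v (pt x) ℤ.* (ℤ.- + 1))       ≈⟨ ≃-trans (sum-scaleʳ (λ x → v (pt x)) (ℤ.- + 1)) (≃-* (≃-refl {ℤ.- + 1}) (affine-sum z)) ⟩
            (ℤ.- + 1) ℤ.* (ℤ.- v ∞)                  ≈⟨ solve 1 (λ a → (:- con (+ 1)) :* (:- a) := a) ≃-refl (v ∞) ⟩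
            v ∞                                      ∎)
          λ y → begin
            sum (λ x → v (pt x) ℤ.* e (U (- x) (pt y)))  ≈⟨ sum-cong-≋ (λ x → ≡⇒≃ (cong (v (pt x) ℤ.*_) (trans (cong e (U-pt (- x) y)) (trans (e-pt (- x + y))
               (δ-iff (λ eq → sym (diff≡0 (trans (+-comm y (- x)) eq))) (λ { refl → -‿inverseˡ x })))))) ⟩
            sum (λ x → v (pt x) ℤ.* δ x y)               ≈⟨ sum-δ (λ x → v (pt x)) y ⟩
            v (pt y)                                     ∎

        to-O : ∀ {v} → ¬ v ≋ 𝟘 → ∃ λ o → ¬ ⟦ o ⟧ v ∞ ℤ.- ⟦ o ⟧ v (pt 0#) ≃ + 0
        to-O {v} v≉0 with FP.any? (λ b → ¬? ((v ∞ ℤ.- v b) ≃? + 0))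
        ... | no none = ⊥-elim (v≉0 (differ-by (v ∞) λ b → begin
                v b ℤ.- + 0                          ≈⟨ solve 2 (λ a b → b :- con (+ 0) := a :- (a :- b)) ≃-refl (v ∞) (v b) ⟩
                v ∞ ℤ.- (v ∞ ℤ.- v b)                ≈⟨ ≃-+ (≃-refl {v ∞}) (≃-neg (decidable-stable ((v ∞ ℤ.- v b) ≃? + 0) λ ne → none (b , ne))) ⟩
                v ∞ ℤ.+ + 0                          ≈⟨ ≡⇒≃ (ℤP.+-identityʳ (v ∞)) ⟩
                v ∞                                  ∎))
        ... | yes (b , ne) with cover b
        ...   | inj₁ refl = ⊥-elim (ne (≡⇒≃ (ℤP.+-inverseʳ (v ∞))))
        ...   | inj₂ (x , refl) = u (- x) , λ z → ne (≃-trans (≡⇒≃ (cong₂ (λ P R → v P ℤ.- v R) (sym (U-∞ (- - x)))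
                  (sym (trans (U-pt (- - x) 0#) (cong pt (trans (+-identityʳ _) (neg-neg x))))))) z)

        -- After translation v takes different values at infinity and 0, so `T` yields a combination
        -- with `e` present; `extract` then produces `e`, which generates.
        irreducible : Irreducible
        irreducible {S} inv {v} v≉0 s {v′} z′ = S-resp z′ (pointwise (generate z′)) (S-op (generation v′) S-e)
          where
          open InvariantScaling inv
          o = proj₁ (to-O v≉0)
          y = ⟦ o ⟧ v
          S-y : S (⟦ T ⟧ y)
          S-y = S-op T (S-op o s)
          S-e : S e
          S-e = let (o′ , k , nk , eq) = extract (y ∞ ℤ.- y (pt 0#)) ⟨ y ⟩ (proj₂ (to-O v≉0)) in
                S-unscale nk e-zero (S-resp (ZeroSum-• k {e} e-zero)
                (≋-trans (op-≋ o′ (T-formula (S-zero (S-op o s)) ≃-refl ≃-refl)) eq) (S-op o′ S-y))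

        -- Since T e = -2e, the image φ e satisfies -2 φ e = μ e + λ c. As `test` kills e, it kills
        -- φ e, which removes the c-component; 2 is invertible.
        schur : Schur
        schur {φ} eqv = proj₁ scalar , λ z → eigenvector⇒scalar irreducible eqv e-zero e≉0 (proj₁ scalar) (proj₂ scalar) z
          where
          open Equivariant eqv
          μ = φ e ∞ ℤ.- φ e (pt 0#)
          λ′ = ⟨ φ e ⟩
          T-e : ⟦ T ⟧ e ≋ (ℤ.- + 2) • e
          T-e = ≋-trans (T-formula e-zero {ℤ.- + 2} {+ 0}
              (≡⇒≃ (cong₂ ℤ._-_ e-∞ (trans (e-pt 0#) (δ-≡ refl))))
              (≃-trans (sum-cong-≋ (λ x → ≡⇒≃ (cong (χ x ℤ.*_) (e-pt x)))) (≃-trans (sum-δ χ 0#) (≡⇒≃ χ-0))))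
            (pointwise λ b → solve 2 (λ a b → (:- con (+ 2)) :* a :+ con (+ 0) :* b := (:- con (+ 2)) :* a) ≃-refl (e b) (c b))
          two-φe : (ℤ.- + 2) • φ e ≋ μ • e ⊹ λ′ • c
          two-φe = ≋-trans (≋-sym (φ-• (ℤ.- + 2) e-zero)) (≋-trans (φ-cong (ZeroSum-• (ℤ.- + 2) {e} e-zero) (op-ZeroSum T e-zero) (≋-sym T-e))
            (≋-trans (φ-op T e-zero) (T-formula (φ-zero e-zero) ≃-refl ≃-refl)))
          test-φe : ⟦ test ⟧ (φ e) ≋ 𝟘
          test-φe = ≋-trans (≋-sym (φ-op test e-zero)) (≋-trans (φ-cong (op-ZeroSum test e-zero) ZeroSum-0 test-e) φ-𝟘)
          step₁ : λ′ • ⟦ test ⟧ c ≋ μ • 𝟘 ⊹ λ′ • ⟦ test ⟧ c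
          step₁ = pointwise λ b → solve 2 (λ m k → k := m :* con (+ 0) :+ k) ≃-refl μ (λ′ ℤ.* ⟦ test ⟧ c b)
          step₂ : μ • 𝟘 ⊹ λ′ • ⟦ test ⟧ c ≋ μ • ⟦ test ⟧ e ⊹ λ′ • ⟦ test ⟧ c
          step₂ = ≋-+ {μ • 𝟘} {μ • ⟦ test ⟧ e} {λ′ • ⟦ test ⟧ c} (≋-• μ (≋-sym test-e)) ≋-refl
          step₃ : ⟦ test ⟧ (μ • e ⊹ λ′ • c) ≋ ⟦ test ⟧ ((ℤ.- + 2) • φ e)
          step₃ = op-≋ test (≋-sym two-φe)
          step₄ : (ℤ.- + 2) • ⟦ test ⟧ (φ e) ≋ 𝟘
          step₄ = ≋-trans (≋-• (ℤ.- + 2) test-φe) (pointwise λ b → ≡⇒≃ (ℤP.*-zeroʳ (ℤ.- + 2)))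
          λc≋0 : λ′ • c ≋ 𝟘
          λc≋0 = test-c λ′ (≋-trans step₁ (≋-trans step₂ (≋-trans (≋-sym (op-combination test μ λ′ {e} {c})) (≋-trans step₃ (≋-trans (op-• test (ℤ.- + 2) {φ e}) step₄)))))
          -2≄0 : ¬ ℤ.- + 2 ≃ + 0
          -2≄0 eq = 2≄0 (≃-neg eq)
          scalar : ∃ λ k → φ e ≋ k • e
          scalar = let (l , eq) = •-inverse -2≄0 {φ e} {μ • e} (≋-trans two-φe (≋-trans (≋-+ {μ • e} {μ • e} {λ′ • c} {𝟘} ≋-refl λc≋0) (pointwise λ b → ≡⇒≃ (ℤP.+-identityʳ (μ ℤ.* e b)))))
                   in l ℤ.* μ , ≋-trans eq (pointwise λ b → ≡⇒≃ (sym (ℤP.*-assoc l μ (e b))))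

-- The quadratic character, and separating it from [0] - [infinity].

module HeartIrreducibility where
  open Solver
  open Counting
  open FiniteFields
  open Actions
  open ProjectiveLines
  open ModularArithmetic
  open HeartCoordinates
  open PrimeHearts
  open DivisibleHearts
  open import Data.Fin using (_≟_)

  injective⇒surjective : ∀ {q} (f : Fin q → Fin q) → (∀ x y → f x ≡ f y → x ≡ y) → ∀ y → ∃ λ x → f x ≡ y
  injective⇒surjective {q} f f-inj y with FP.any? (λ x → f x ≟ y)
  ... | yes p = p
  ... | no none = ⊥-elim (ℕP.<-irrefl ≡.refl (≡.subst (ℕ._≤ q) (ℕP.+-comm q 1)
      (enum-≤ (enum-⊎ (enum-all q) (enum-all 1)) (enum-all q) (λ x _ → g x) (λ _ _ → tt) λ s _ t _ → g-inj s t)))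
    where
    g : Fin q ⊎ Fin 1 → Fin q
    g (inj₁ x) = f x
    g (inj₂ _) = y
    g-inj : ∀ s t → g s ≡ g t → s ≡ t
    g-inj (inj₁ x) (inj₁ z) eq = ≡.cong inj₁ (f-inj x z eq)
    g-inj (inj₁ x) (inj₂ _) eq = ⊥-elim (none (x , eq))
    g-inj (inj₂ _) (inj₁ z) eq = ⊥-elim (none (z , ≡.sym eq))
    g-inj (inj₂ zero) (inj₂ zero) eq = ≡.refl

  module SquareClasses {q : ℕ} (F : FiniteField q) where
    open FiniteField F
    open ≡ using (sym; trans; cong; cong₂; refl; subst)

    classify : ∀ x → x ≡ 0# ⊎ Square x ⊎ (Nz x × ¬ Square x)
    classify x with x ≟ 0# | Square? x
    ... | yes p | _ = inj₁ p
    ... | no nx | yes s = inj₂ (inj₁ s)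
    ... | no nx | no ¬s = inj₂ (inj₂ (nx , ¬s))

    legendre : Fin q → ℤ
    legendre x with classify x
    ... | inj₁ _        = + 0
    ... | inj₂ (inj₁ _) = + 1
    ... | inj₂ (inj₂ _) = ℤ.- + 1

    legendre-0 : legendre 0# ≡ + 0
    legendre-0 with classify 0#
    ... | inj₁ _ = refl
    ... | inj₂ (inj₁ s) = ⊥-elim (square-nz s refl)
    ... | inj₂ (inj₂ (nz , _)) = ⊥-elim (nz refl)

    legendre-square : ∀ {x} → Square x → legendre x ≡ + 1
    legendre-square {x} s with classify x
    ... | inj₁ p = ⊥-elim (square-nz s p)
    ... | inj₂ (inj₁ _) = refl
    ... | inj₂ (inj₂ (_ , ¬s)) = ⊥-elim (¬s s)

    legendre-nonsquare : ∀ {x} → Nz x → ¬ Square x → legendre x ≡ ℤ.- + 1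
    legendre-nonsquare {x} nx ¬s with classify x
    ... | inj₁ p = ⊥-elim (nx p)
    ... | inj₂ (inj₁ s) = ⊥-elim (¬s s)
    ... | inj₂ (inj₂ _) = refl

    legendre-* : ∀ x y → legendre (x * y) ≡ legendre x ℤ.* legendre y
    legendre-* x y = go (classify x) (classify y)
      where
      go : x ≡ 0# ⊎ Square x ⊎ (Nz x × ¬ Square x) → y ≡ 0# ⊎ Square y ⊎ (Nz y × ¬ Square y) → legendre (x * y) ≡ legendre x ℤ.* legendre y
      go (inj₁ refl) _ = trans (cong legendre (zeroˡ y)) (trans legendre-0 (sym (trans (cong (ℤ._* legendre y) legendre-0) (ℤP.*-zeroˡ (legendre y)))))
      go _ (inj₁ refl) = trans (cong legendre (zeroʳ x)) (trans legendre-0 (sym (trans (cong (legendre x ℤ.*_) legendre-0) (ℤP.*-zeroʳ (legendre x)))))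
      go (inj₂ (inj₁ s)) (inj₂ (inj₁ t)) = trans (legendre-square (square-* s t)) (sym (cong₂ ℤ._*_ (legendre-square s) (legendre-square t)))
      go (inj₂ (inj₁ s)) (inj₂ (inj₂ (ny , ¬t))) = trans (legendre-nonsquare (*-nz (square-nz s) ny) (λ st → ¬t (square-div s st)))
        (sym (cong₂ ℤ._*_ (legendre-square s) (legendre-nonsquare ny ¬t)))
      go (inj₂ (inj₂ (nx , ¬s))) (inj₂ (inj₁ t)) = trans (legendre-nonsquare (*-nz nx (square-nz t)) (λ st → ¬s (square-div t (subst Square (*-comm x y) st))))
        (sym (cong₂ ℤ._*_ (legendre-nonsquare nx ¬s) (legendre-square t)))
      go (inj₂ (inj₂ (nx , ¬s))) (inj₂ (inj₂ (ny , ¬t))) = trans (legendre-square (nonsquare-* nx ny ¬s ¬t))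
        (sym (cong₂ ℤ._*_ (legendre-nonsquare nx ¬s) (legendre-nonsquare ny ¬t)))

    legendre-inv : ∀ {x} → Nz x → legendre (inv x) ≡ legendre x
    legendre-inv {x} nx = go (Square? x)
      where
      go : Dec (Square x) → legendre (inv x) ≡ legendre x
      go (yes s) = trans (legendre-square (square-inv s)) (sym (legendre-square s))
      go (no ¬s) = trans (legendre-nonsquare (inv-nz nx) (λ s → ¬s (subst Square (inv-inv nx) (square-inv s)))) (sym (legendre-nonsquare nx ¬s))

    -- The factors are -(z + 1)/z and the same expression in -1 - z, which is -z/(z + 1).
    reciprocal : ∀ {z} → Nz z → Nz (- 1# - z) → (- 1# + - inv z) * (- 1# + - inv (- 1# - z)) ≡ 1#
    reciprocal {z} nz nz′ = begin
      (- 1# + - i) * (- 1# + - j)                ≡⟨ solve 2 (λ i j → (:- con (+ 1) :+ :- i) :* (:- con (+ 1) :+ :- j) := con (+ 1) :+ (i :* con (+ 1) :+ j :+ i :* j)) refl i j ⟩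
      1# + (i * 1# + j + i * j)                  ≡⟨ cong (λ k → 1# + (i * k + j + i * j)) (sym (*-inv (- 1# - z) nz′)) ⟩
      1# + (i * ((- 1# - z) * j) + j + i * j)    ≡⟨ solve 3 (λ i j z → con (+ 1) :+ (i :* ((:- con (+ 1) :- z) :* j) :+ j :+ i :* j) := con (+ 1) :+ (j :- (z :* i) :* j)) refl i j z ⟩
      1# + (j - z * i * j)                       ≡⟨ cong (λ k → 1# + (j - k * j)) (*-inv z nz) ⟩
      1# + (j - 1# * j)                          ≡⟨ solve 1 (λ j → con (+ 1) :+ (j :- con (+ 1) :* j) := con (+ 1)) refl j ⟩
      1#                                         ∎
      where
      open ≡.≡-Reasoning
      i = inv z
      j = inv (- 1# - z)

    multiple : ℕ → Fin q
    multiple zero    = 0#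
    multiple (suc k) = multiple k + 1#

    multiple-+ : ∀ i j → multiple (i ℕ.+ j) ≡ multiple i + multiple j
    multiple-+ zero    j = sym (+-identityˡ _)
    multiple-+ (suc i) j = trans (cong (_+ 1#) (multiple-+ i j)) (solve 3 (λ a b c → (a :+ b) :+ c := (a :+ c) :+ b) refl (multiple i) (multiple j) 1#)

    -- Otherwise every multiple of 1 would be a nonzero square.
    square-then-nonsquare : ¬ Square (- 1#) → ∃ λ b → Square (b - 1#) × Nz b × ¬ Square b
    square-then-nonsquare ¬-1 with FP.any? (λ b → Square? (b - 1#) ×-dec Nz? b ×-dec ¬? (Square? b))
    ... | yes p = p
    ... | no none = ⊥-elim (collision (FP.pigeonhole (ℕP.n<1+n q) (λ k → multiple (Data.Fin.toℕ k))))
      where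
      step : ∀ x → Square x → Square (x + 1#)
      step x s = decidable-stable (Square? (x + 1#)) λ ¬t → none (x + 1# , subst Square (solve 2 (λ x y → x := (x :+ y) :- y) refl x 1#) s ,
        (λ eq → ¬-1 (subst Square (trans (solve 2 (λ x y → x := (x :+ y) :- y) refl x 1#) (trans (cong (_- 1#) eq) (+-identityˡ (- 1#)))) s)) , ¬t)
      multiples : ∀ k → Square (multiple (suc k))
      multiples zero    = subst Square (sym (+-identityˡ 1#)) square-1
      multiples (suc k) = step _ (multiples k)
      collision : (∃₂ λ i j → i Data.Fin.< j × multiple (Data.Fin.toℕ i) ≡ multiple (Data.Fin.toℕ j)) → ⊥
      collision (i , j , i<j , eq) with ℕP.m≤n⇒∃[o]m+o≡n i<j
      ... | o , i+o = square-nz (multiples o) (trans (solve 2 (λ x y → y := (x :+ y) :- x) refl (multiple (Data.Fin.toℕ i)) (multiple (suc o)))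
          (trans (cong (_- multiple (Data.Fin.toℕ i)) (trans (sym (multiple-+ (Data.Fin.toℕ i) (suc o))) (trans (cong multiple (trans (ℕP.+-suc (Data.Fin.toℕ i) o) i+o)) (sym eq)))) (-‿inverseʳ _)))

  module HeartTheorem {q : ℕ} (F : FiniteField q) {n : ℕ} (A : SL2Action F (Fin n) _≡_) {O ∞ : Fin n}
    (line : IsProjectiveLine A O ∞) (p : ℕ) (prime : Prime p) (p≢2 : p ≢ 2) where
    open FiniteField F hiding (solve; _:=_; _:+_; _:*_; _:-_; :-_; con)
    open SL2Action A
    open IsProjectiveLine line
    open PrimeHeart F A line p prime public
    open DivisibleHeart F A line p prime
    open SquareClasses F
    open ≡ using (sym; trans; cong; cong₂; refl; subst)
    open import Relation.Binary.Reasoning.Setoid ≃-setoid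
    open IntegerCoefficientSolver ring using (solve; _:=_; _:+_; _:*_; _:-_; :-_; con)
    private module K = FiniteField F

    2≄0 : ¬ + 2 ≃ + 0
    2≄0 eq = odd (≃0⇒∣ eq)
      where
      open import Data.Nat.Divisibility using (∣⇒≤) renaming (_∣_ to _∣ℕ_)
      import Data.Nat.Primality as Primality
      odd : ¬ p ∣ℕ 2
      odd d with Primality.prime⇒irreducible Primality.prime[2] d
      ... | inj₁ refl = Primality.¬prime[1] prime
      ... | inj₂ p≡2 = p≢2 p≡2

    k≄0 : ∀ k → ¬ k ≃ + 0 → ¬ (+ 2 ℤ.* k) ≃ + 0
    k≄0 k nk eq = nk (cancel 2≄0 eq)

    ⟦u0⟧ : ∀ v b → ⟦ u 0# ⟧ v b ≡ v b
    ⟦u0⟧ v b = cong v (trans (cong (λ x → U x b) (K.solve 0 (K.:-_ (K.con (+ 0)) K.:= K.con (+ 0)) refl)) (U-0 b))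

    -- Squaring is bijective, so the character is zero, `c` vanishes, and the separation is
    -- immediate.
    module Even (2≡0 : 1# + 1# ≡ 0#) where

      neg≡ : ∀ a → - a ≡ a
      neg≡ a = trans (K.solve 1 (λ a → K.:-_ a K.:= a K.:- (K.con (+ 1) K.:+ K.con (+ 1)) K.:* a) refl a)
        (trans (cong (λ z → a - z * a) 2≡0) (K.solve 1 (λ a → a K.:- K.con (+ 0) K.:* a K.:= a) refl a))

      square-injective : ∀ a b → a * a ≡ b * b → a ≡ b
      square-injective a b eq = [ (λ p → p) , (λ p → trans p (neg≡ b)) ]′ (squares-≡ a b eq)

      character : QuadraticCharacter
      character = record
        { χ = λ _ → + 0 ; χ-0 = refl ; χ-count = count′ ; χ-* = λ _ _ → refl ; χ-inv = λ _ → refl }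
        where
        count′ : ∀ {y} → Nz y → sum (λ a → ν a ℤ.* δ (a * a) y) ≃ + 1 ℤ.+ + 0
        count′ {y} ny = ≃-trans (sum-single (λ a → ν a ℤ.* δ (a * a) y) s λ a ne → ≡⇒≃ (trans (cong (ν a ℤ.*_)
            (δ-≢ (λ eq → ne (square-injective a s (trans eq (sym s²)))))) (ℤP.*-zeroʳ (ν a))))
          (≡⇒≃ (cong₂ ℤ._*_ (ν-nz ns) (δ-≡ s²)))
          where
          root = injective⇒surjective (λ a → a * a) square-injective y
          s = proj₁ root
          s² = proj₂ root
          ns : Nz s
          ns eq = ny (trans (sym s²) (trans (cong (_* s) eq) (zeroˡ s)))

      module _ (q+1≃0 : + suc q ≃ + 0) where
        open Divisible q+1≃0 2≄0 character

        c≋0 : ∀ k b → k ℤ.* c b ≃ + 0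
        c≋0 k = on-line (≡⇒≃ (trans (cong (k ℤ.*_) c-∞) (ℤP.*-zeroʳ k))) λ x → ≡⇒≃ (trans (cong (k ℤ.*_) (c-pt x)) (ℤP.*-zeroʳ k))

        separation : Separation
        separation = record
          { extract = λ μ λ′ nμ → u 0# , μ , nμ , pointwise λ b → ≃-trans (≡⇒≃ (⟦u0⟧ (μ • e ⊹ λ′ • c) b))
              (≃-trans (≃-+ (≃-refl {μ ℤ.* e b}) (c≋0 λ′ b)) (≡⇒≃ (ℤP.+-identityʳ (μ ℤ.* e b))))
          ; test = + 0 ⊠ u 0#
          ; test-e = pointwise λ b → ≡⇒≃ (ℤP.*-zeroˡ (⟦ u 0# ⟧ e b))
          ; test-c = λ λ′ _ → pointwise (c≋0 λ′) }

    module Odd (odd : Nz (1# + 1#)) where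

      character : QuadraticCharacter
      character = record
        { χ = legendre ; χ-0 = legendre-0 ; χ-count = λ {y} ny → count′ ny (Square? y) ; χ-* = legendre-* ; χ-inv = legendre-inv }
        where
        count′ : ∀ {y} → Nz y → Dec (Square y) → sum (λ a → ν a ℤ.* δ (a * a) y) ≃ + 1 ℤ.+ legendre y
        count′ {y} ny (no ¬s) = ≃-trans (sum-0 (λ a → ν a ℤ.* δ (a * a) y) (λ a → vanish a (a ≟ 0#)))
            (≡⇒≃ (sym (cong (λ z → + 1 ℤ.+ z) (legendre-nonsquare ny ¬s))))
          where
          vanish : ∀ a → Dec (a ≡ 0#) → ν a ℤ.* δ (a * a) y ≃ + 0
          vanish a (yes refl) = ≡⇒≃ (trans (cong (ℤ._* δ (0# * 0#) y) ν-0) (ℤP.*-zeroˡ (δ (0# * 0#) y)))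
          vanish a (no na) = ≡⇒≃ (trans (cong (ν a ℤ.*_) (δ-≢ (λ eq → ¬s (a , na , eq)))) (ℤP.*-zeroʳ (ν a)))
        count′ {y} ny (yes sq@(s , ns , s²)) = begin
          sum (λ a → ν a ℤ.* δ (a * a) y)             ≈⟨ sum-cong-≋ (λ a → two-roots a (a ≟ s) (a ≟ - s)) ⟩
          sum (λ a → + 1 ℤ.* δ a s ℤ.+ + 1 ℤ.* δ a (- s)) ≈⟨ ∑-distrib-+ (λ a → + 1 ℤ.* δ a s) (λ a → + 1 ℤ.* δ a (- s)) ⟩
          sum (λ a → + 1 ℤ.* δ a s) ℤ.+ sum (λ a → + 1 ℤ.* δ a (- s)) ≈⟨ ≃-+ (sum-δ (λ _ → + 1) s) (sum-δ (λ _ → + 1) (- s)) ⟩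
          + 1 ℤ.+ + 1                                 ≈⟨ ≡⇒≃ (sym (cong (λ z → + 1 ℤ.+ z) (legendre-square sq))) ⟩
          + 1 ℤ.+ legendre y                          ∎
          where
          s≢-s : s ≢ - s
          s≢-s eq = *-nz odd ns (trans (K.solve 1 (λ s → (K.con (+ 1) K.:+ K.con (+ 1)) K.:* s K.:= s K.:- (K.:-_ s)) refl s) (≡⇒diff eq))
          two-roots : ∀ a → Dec (a ≡ s) → Dec (a ≡ - s) → ν a ℤ.* δ (a * a) y ≃ + 1 ℤ.* δ a s ℤ.+ + 1 ℤ.* δ a (- s)
          two-roots a (yes refl) _ = ≡⇒≃ (trans (cong₂ ℤ._*_ (ν-nz ns) (δ-≡ s²)) (sym (cong₂ (λ i j → + 1 ℤ.* i ℤ.+ + 1 ℤ.* j) (δ-≡ {s} refl) (δ-≢ s≢-s))))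
          two-roots a (no ne) (yes refl) = ≡⇒≃ (trans (cong₂ ℤ._*_ (ν-nz (neg-nz ns)) (δ-≡ (trans (K.solve 1 (λ s → (K.:-_ s) K.:* (K.:-_ s) K.:= s K.:* s) refl s) s²)))
            (sym (cong₂ (λ i j → + 1 ℤ.* i ℤ.+ + 1 ℤ.* j) (δ-≢ ne) (δ-≡ { - s} refl))))
          two-roots a (no ne) (no ne′) = ≡⇒≃ (trans (cong (ν a ℤ.*_) (δ-≢ (λ eq → [ ne , ne′ ]′ (squares-≡ a s (trans eq (sym s²)))))) (trans (ℤP.*-zeroʳ (ν a))
            (sym (cong₂ (λ i j → + 1 ℤ.* i ℤ.+ + 1 ℤ.* j) (δ-≢ ne) (δ-≢ ne′)))))

      module _ (q+1≃0 : + suc q ≃ + 0) where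
        open Divisible q+1≃0 2≄0 character

        e-O : e (pt 0#) ≡ + 1
        e-O = trans (e-pt 0#) (δ-≡ {0#} refl)

        c-O : c (pt 0#) ≡ + 0
        c-O = trans (c-pt 0#) legendre-0

        -- w fixes c and negates e.
        module SquareMinusOne (s-1 : Square (- 1#)) where

          W-e : ∀ b → ⟦ w ⟧ e b ≃ (ℤ.- + 1) ℤ.* e b
          W-e = on-line
            (≡⇒≃ (trans (cong e (trans W-∞ (sym pt-0))) (trans e-O (sym (cong ((ℤ.- + 1) ℤ.*_) e-∞)))))
            λ x → at-pt x (x ≟ 0#)
            where
            at-pt : ∀ x → Dec (x ≡ 0#) → e (W (pt x)) ≃ (ℤ.- + 1) ℤ.* e (pt x)
            at-pt x (yes refl) = ≡⇒≃ (trans (cong e W-pt-0) (trans e-∞ (sym (cong ((ℤ.- + 1) ℤ.*_) e-O))))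
            at-pt x (no nx) = ≡⇒≃ (trans (cong e (W-U nx)) (trans (e-pt _) (trans (δ-≢ (neg-nz (inv-nz nx))) (sym (cong ((ℤ.- + 1) ℤ.*_) (trans (e-pt x) (δ-≢ nx)))))))

          W-c : ∀ b → ⟦ w ⟧ c b ≃ c b
          W-c = on-line (≡⇒≃ (trans (cong c (trans W-∞ (sym pt-0))) (trans c-O (sym c-∞)))) λ x → at-pt x (x ≟ 0#)
            where
            at-pt : ∀ x → Dec (x ≡ 0#) → c (W (pt x)) ≃ c (pt x)
            at-pt x (yes refl) = ≡⇒≃ (trans (cong c W-pt-0) (trans c-∞ (sym c-O)))
            at-pt x (no nx) = ≡⇒≃ (trans (cong c (W-U nx)) (trans (c-pt _) (trans (cong legendre (K.solve 1 (λ i → K.:-_ i K.:= K.:-_ (K.con (+ 1)) K.:* i) refl (inv x)))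
              (trans (legendre-* (- 1#) (inv x)) (trans (cong₂ ℤ._*_ (legendre-square s-1) (legendre-inv nx)) (trans (ℤP.*-identityˡ _) (sym (c-pt x))))))))

          separation : Separation
          separation = record
            -- 1 - w kills c and doubles e; the test 1 + w kills e and doubles c.
            { extract = λ μ λ′ nμ → u 0# ⊞ ((ℤ.- + 1) ⊠ w) , + 2 ℤ.* μ , k≄0 μ nμ , pointwise λ b →
                ≃-trans (≃-+ (≡⇒≃ (⟦u0⟧ (μ • e ⊹ λ′ • c) b)) (≃-* (≃-refl {ℤ.- + 1}) (≃-+ (≃-* (≃-refl {μ}) (W-e b)) (≃-* (≃-refl {λ′}) (W-c b)))))
                  (solve 4 (λ m l a d → (m :* a :+ l :* d) :+ (:- con (+ 1)) :* (m :* ((:- con (+ 1)) :* a) :+ l :* d) := (con (+ 2) :* m) :* a) ≃-refl μ λ′ (e b) (c b))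
            ; test = u 0# ⊞ w
            ; test-e = pointwise λ b → ≃-trans (≃-+ (≡⇒≃ (⟦u0⟧ e b)) (W-e b)) (solve 1 (λ a → a :+ (:- con (+ 1)) :* a := con (+ 0)) ≃-refl (e b))
            ; test-c = unscale }
            where
            unscale : ∀ λ′ → λ′ • ⟦ u 0# ⊞ w ⟧ c ≋ 𝟘 → λ′ • c ≋ 𝟘
            unscale λ′ eq = ≋-trans (proj₂ scaled) (pointwise λ b → ≡⇒≃ (ℤP.*-zeroʳ (proj₁ scaled)))
              where
              doubled : + 2 • λ′ • c ≋ λ′ • ⟦ u 0# ⊞ w ⟧ c
              doubled = pointwise λ b → ≃-trans (solve 2 (λ k d → con (+ 2) :* (k :* d) := k :* (d :+ d)) ≃-refl λ′ (c b))
                (≃-* (≃-refl {λ′}) (≃-+ (≡⇒≃ (sym (⟦u0⟧ c b))) (≃-sym (W-c b))))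
              scaled : ∃ λ l → λ′ • c ≋ l • 𝟘
              scaled = •-inverse 2≄0 {λ′ • c} {𝟘} (≋-trans doubled eq)

        -- Here w negates both e and c, so it cannot separate them. The separation comes from torus
        -- averages of u(β) w u(1) and of u(1), u(-1). Their action on the span of e and c involves
        -- character sums whose values stay unknown; these are arranged to cancel.
        module NonsquareMinusOne (¬-1 : ¬ Square (- 1#)) where

          legendre-neg : ∀ x → legendre (- x) ≡ ℤ.- legendre x
          legendre-neg x = trans (cong legendre (K.solve 1 (λ x → K.:-_ x K.:= K.:-_ (K.con (+ 1)) K.:* x) refl x)) (trans (legendre-* (- 1#) x)
            (trans (cong (ℤ._* legendre x) (legendre-nonsquare (neg-nz 1-nz) ¬-1)) (ℤP.-1*i≡-i (legendre x))))

          γ : Fin q → Fin n → Fin n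
          γ β P = U (- 1#) (W (U (- β) P))

          g : Fin q → Op
          g β = u β ⊡ (w ⊡ u 1#)

          γ-∞ : ∀ β → γ β ∞ ≡ pt (- 1# + 0#)
          γ-∞ β = trans (cong (λ P → U (- 1#) (W P)) (U-∞ (- β))) (trans (cong (U (- 1#)) (trans W-∞ (sym pt-0))) (U-pt (- 1#) 0#))

          image : Fin q → Fin n
          image z = U (- 1#) (W (pt z))

          γ-pt : ∀ β x → γ β (pt x) ≡ image (- β + x)
          γ-pt β x = cong (λ P → U (- 1#) (W P)) (U-pt (- β) x)

          image-0 : image 0# ≡ ∞
          image-0 = trans (cong (U (- 1#)) W-pt-0) (U-∞ (- 1#))

          image-nz : ∀ {z} → Nz z → image z ≡ pt (- 1# + - inv z)
          image-nz nz = trans (cong (U (- 1#)) (W-U nz)) (U-pt (- 1#) _)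

          inv-neg-1 : inv (- 1#) ≡ - 1#
          inv-neg-1 = trans (inv-neg 1-nz) (cong -_ inv-1)

          image-zero : ∀ {z} → Nz z → - 1# + - inv z ≡ 0# → z ≡ - 1#
          image-zero {z} nz eq = trans (sym (inv-inv nz)) (trans (cong inv (trans (K.solve 1 (λ i → i K.:= (K.:-_ (K.con (+ 1))) K.:- (K.:-_ (K.con (+ 1)) K.:+ K.:-_ i)) refl (inv z))
            (trans (cong (λ k → - 1# - k) eq) (K.solve 0 ((K.:-_ (K.con (+ 1))) K.:- K.con (+ 0) K.:= K.:-_ (K.con (+ 1))) refl)))) inv-neg-1)

          record Transition (β : Fin q) : Set where
            field
              before : Square (β - 1#)
              nz     : Nz β
              after  : ¬ Square β

          m : Fin q → ℤ
          m z = c (image z)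

          m-0 : m 0# ≡ + 0
          m-0 = trans (cong c image-0) c-∞

          m-nz : ∀ {z} → Nz z → m z ≡ legendre (- 1# + - inv z)
          m-nz nz = trans (cong c (image-nz nz)) (c-pt _)

          m-neg-1 : m (- 1#) ≡ + 0
          m-neg-1 = trans (m-nz (neg-nz 1-nz)) (trans (cong legendre (trans (cong (λ i → - 1# + - i) inv-neg-1) (K.solve 0 (K.:-_ (K.con (+ 1)) K.:+ K.:-_ (K.:-_ (K.con (+ 1))) K.:= K.con (+ 0)) refl))) legendre-0)

          -- For z other than 0 and -1, `reciprocal` makes the two arguments of the character
          -- mutually inverse. At 0 and -1 both values are zero.
          m-sym : ∀ z → m (- 1# - z) ≡ m z
          m-sym z = go (z ≟ 0#) ((- 1# - z) ≟ 0#)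
            where
            go : Dec (z ≡ 0#) → Dec (- 1# - z ≡ 0#) → m (- 1# - z) ≡ m z
            go (yes refl) _ = trans (cong m (K.solve 0 (K.:-_ (K.con (+ 1)) K.:- K.con (+ 0) K.:= K.:-_ (K.con (+ 1))) refl)) (trans m-neg-1 (sym m-0))
            go (no _) (yes eq) = trans (cong m eq) (trans m-0 (sym (trans (cong m (trans (K.solve 1 (λ z → z K.:= K.:-_ (K.con (+ 1)) K.:- (K.:-_ (K.con (+ 1)) K.:- z)) refl z)
              (trans (cong (λ k → - 1# - k) eq) (K.solve 0 (K.:-_ (K.con (+ 1)) K.:- K.con (+ 0) K.:= K.:-_ (K.con (+ 1))) refl)))) m-neg-1)))
            go (no nz) (no nz′) = trans (m-nz nz′) (trans (cong legendre (inv-unique ns st)) (trans (legendre-inv ns) (sym (m-nz nz))))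
              where
              i = inv z
              i′ = inv (- 1# - z)
              s = - 1# + - i
              st : s * (- 1# + - i′) ≡ 1#
              st = reciprocal nz nz′
              ns : Nz s
              ns eq = 0≢1 (trans (sym (zeroˡ _)) (trans (cong (_* (- 1# + - i′)) (sym eq)) st))

          Σm : Fin q → ℤ
          Σm β = sum (λ z → legendre (z + β) ℤ.* m z)

          -- The substitution of -1 - z for z preserves m and turns z + (1 - β) into -(z + β), where
          -- the character changes sign.
          Σm-reflect : ∀ β → Σm (1# - β) ≃ ℤ.- Σm β
          Σm-reflect β = begin
            sum (λ z → legendre (z + (1# - β)) ℤ.* m z)
              ≈⟨ sum-bij (λ z → legendre (z + (1# - β)) ℤ.* m z) (λ z → - 1# - z) (λ z → - 1# - z) involutive involutive ⟨
            sum (λ z → legendre ((- 1# - z) + (1# - β)) ℤ.* m (- 1# - z))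
              ≈⟨ sum-cong-≋ (λ z → ≡⇒≃ (trans (cong₂ ℤ._*_ (trans (cong legendre (K.solve 2 (λ z b → (K.:-_ (K.con (+ 1)) K.:- z) K.:+ (K.con (+ 1) K.:- b) K.:= K.:-_ (z K.:+ b)) refl z β)) (legendre-neg (z + β))) (m-sym z))
                   (sym (ℤP.neg-distribˡ-* (legendre (z + β)) (m z))))) ⟩
            sum (λ z → ℤ.- (legendre (z + β) ℤ.* m z))
              ≈⟨ sum-neg (λ z → legendre (z + β) ℤ.* m z) ⟩
            ℤ.- Σm β ∎
            where
            involutive : ∀ x → - 1# - (- 1# - x) ≡ x
            involutive = K.solve 1 (λ x → K.:-_ (K.con (+ 1)) K.:- (K.:-_ (K.con (+ 1)) K.:- x) K.:= x) refl

          ⟨g⟩-c : ∀ β → ⟨ ⟦ g β ⟧ c ⟩ ≃ Σm β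
          ⟨g⟩-c β = begin
            sum (λ x → legendre x ℤ.* c (γ β (pt x)))
              ≈⟨ sum-cong-≋ (λ x → ≡⇒≃ (cong₂ ℤ._*_ (cong legendre (K.solve 2 (λ x b → x K.:= (K.:-_ b K.:+ x) K.:+ b) refl x β)) (cong c (γ-pt β x)))) ⟩
            sum (λ x → legendre ((- β + x) + β) ℤ.* m (- β + x))
              ≈⟨ sum-bij (λ z → legendre (z + β) ℤ.* m z) (λ x → - β + x) (λ z → β + z)
                   (λ x → K.solve 2 (λ x b → K.:-_ b K.:+ (b K.:+ x) K.:= x) refl x β) (λ x → K.solve 2 (λ x b → b K.:+ (K.:-_ b K.:+ x) K.:= x) refl x β) ⟩
            Σm β ∎

          module _ {β : Fin q} (tr : Transition β) where
            open Transition tr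

            -β-nz : Nz (- β + 0#)
            -β-nz eq = neg-nz nz (trans (sym (+-identityʳ (- β))) eq)

            γ-O : γ β (pt 0#) ≡ pt (- 1# + - inv (- β + 0#))
            γ-O = trans (γ-pt β 0#) (image-nz -β-nz)

            β≢1 : - β + 0# ≢ - 1#
            β≢1 eq = square-nz before (trans (K.solve 1 (λ b → b K.:- K.con (+ 1) K.:= K.:-_ (K.:-_ b K.:+ K.con (+ 0)) K.:- K.con (+ 1)) refl β)
              (trans (cong (λ k → - k - 1#) eq) (K.solve 0 (K.:-_ (K.:-_ (K.con (+ 1))) K.:- K.con (+ 1) K.:= K.con (+ 0)) refl)))

            e-γ : ∀ x → e (γ β (pt x)) ≃ δ x (β - 1#) ℤ.- δ x β
            e-γ x = go (x ≟ β) (x ≟ (β - 1#))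
              where
              β≢β-1 : β ≢ β - 1#
              β≢β-1 eq = 1-nz (trans (K.solve 1 (λ b → K.con (+ 1) K.:= b K.:- (b K.:- K.con (+ 1))) refl β) (≡⇒diff eq))
              go : Dec (x ≡ β) → Dec (x ≡ β - 1#) → e (γ β (pt x)) ≃ δ x (β - 1#) ℤ.- δ x β
              go (yes refl) _ = ≡⇒≃ (trans (cong e (trans (γ-pt β β) (trans (cong image (-‿inverseˡ β)) image-0))) (trans e-∞
                (sym (cong₂ ℤ._-_ (δ-≢ β≢β-1) (δ-≡ {β} refl)))))
              go (no _) (yes refl) = ≡⇒≃ (trans (cong e (trans (γ-pt β _) (trans (cong image (K.solve 1 (λ b → K.:-_ b K.:+ (b K.:- K.con (+ 1)) K.:= K.:-_ (K.con (+ 1))) refl β)) (image-nz (neg-nz 1-nz)))))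
                (trans (e-pt _) (trans (δ-≡ (trans (cong (λ i → - 1# + - i) inv-neg-1) (K.solve 0 (K.:-_ (K.con (+ 1)) K.:+ K.:-_ (K.:-_ (K.con (+ 1))) K.:= K.con (+ 0)) refl)))
                  (sym (cong₂ ℤ._-_ (δ-≡ {β - 1#} refl) (δ-≢ (λ eq → β≢β-1 (sym eq))))))))
              go (no ne) (no ne′) = ≡⇒≃ (trans (cong e (trans (γ-pt β x) (image-nz nz′))) (trans (e-pt _) (trans (δ-≢ (λ eq → ne′ (x≡ (image-zero nz′ eq))))
                (sym (cong₂ ℤ._-_ (δ-≢ ne′) (δ-≢ ne))))))
                where
                nz′ : Nz (- β + x)
                nz′ eq = ne (diff≡0 (trans (+-comm x (- β)) eq))
                x≡ : - β + x ≡ - 1# → x ≡ β - 1#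
                x≡ eq = trans (K.solve 2 (λ b x → x K.:= b K.:+ (K.:-_ b K.:+ x)) refl β x) (cong (_+_ β) eq)

            -- On affine points the translate of e is [β - 1] - [β], so its pairing with the
            -- character is 1 - (-1) = 2. It takes the value 0 at both 0 and infinity.
            T-e : ⟦ T ⊡ g β ⟧ e ≋ + 0 • e ⊹ + 2 • c
            T-e = T-formula (op-ZeroSum (g β) e-zero)
              (≡⇒≃ (cong₂ ℤ._-_ (trans (cong e (γ-∞ β)) (trans (e-pt _) (δ-≢ (λ eq → neg-nz 1-nz (trans (sym (+-identityʳ (- 1#))) eq)))))
                (trans (cong e γ-O) (trans (e-pt _) (δ-≢ (λ eq → β≢1 (image-zero -β-nz eq)))))))
              (begin
                sum (λ x → legendre x ℤ.* e (γ β (pt x)))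
                  ≈⟨ sum-cong-≋ (λ x → ≃-trans (≃-* (≃-refl {legendre x}) (e-γ x)) (solve 3 (λ l a b → l :* (a :- b) := l :* a :+ :- (l :* b)) ≃-refl (legendre x) (δ x (β - 1#)) (δ x β))) ⟩
                sum (λ x → legendre x ℤ.* δ x (β - 1#) ℤ.+ ℤ.- (legendre x ℤ.* δ x β))
                  ≈⟨ ∑-distrib-+ (λ x → legendre x ℤ.* δ x (β - 1#)) (λ x → ℤ.- (legendre x ℤ.* δ x β)) ⟩
                sum (λ x → legendre x ℤ.* δ x (β - 1#)) ℤ.+ sum (λ x → ℤ.- (legendre x ℤ.* δ x β))
                  ≈⟨ ≃-+ (sum-δ legendre (β - 1#)) (≃-trans (sum-neg (λ x → legendre x ℤ.* δ x β)) (≃-neg (sum-δ legendre β))) ⟩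
                legendre (β - 1#) ℤ.- legendre β
                  ≈⟨ ≡⇒≃ (cong₂ ℤ._-_ (legendre-square before) (legendre-nonsquare nz after)) ⟩
                + 2 ∎)

            -- The coefficient of e is χ(-1) - χ((1 - β)/β) = -1 - 1 by the choice of β; the
            -- coefficient of c is the unevaluated sum.
            T-c : ⟦ T ⊡ g β ⟧ c ≋ (ℤ.- + 2) • e ⊹ Σm β • c
            T-c = T-formula (op-ZeroSum (g β) c-zero)
              (≡⇒≃ (cong₂ ℤ._-_ (trans (cong c (γ-∞ β)) (trans (c-pt _) (trans (cong legendre (+-identityʳ (- 1#))) (legendre-nonsquare (neg-nz 1-nz) ¬-1))))
                (trans (cong c γ-O) (trans (c-pt _) at-O))))
              (⟨g⟩-c β)
              where
              at-O : legendre (- 1# + - inv (- β + 0#)) ≡ + 1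
              at-O = trans (cong legendre factor) (trans (legendre-neg (inv β * (β - 1#))) (trans (cong ℤ.-_ (legendre-* (inv β) (β - 1#)))
                (cong ℤ.-_ (cong₂ ℤ._*_ (trans (legendre-inv nz) (legendre-nonsquare nz after)) (legendre-square before)))))
                where
                factor : - 1# + - inv (- β + 0#) ≡ - (inv β * (β - 1#))
                factor = trans (cong (λ z → - 1# + - inv z) (+-identityʳ (- β))) (trans (cong (λ i → - 1# + - i) (inv-neg nz))
                  (trans (cong (λ k → - k + - - inv β) (sym (*-inv β nz))) (K.solve 2 (λ b i → K.:-_ (b K.:* i) K.:+ K.:-_ (K.:-_ i) K.:= K.:-_ (i K.:* (b K.:- K.con (+ 1)))) refl β (inv β))))

          reflect : ∀ {β} → Transition β → Transition (1# - β)
          reflect {β} tr = record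
            { before = subst Square (K.solve 1 (λ b → K.:-_ (K.con (+ 1)) K.:* b K.:= (K.con (+ 1) K.:- b) K.:- K.con (+ 1)) refl β) (nonsquare-* (neg-nz 1-nz) nz ¬-1 after)
            ; nz = λ eq → square-nz before (trans (K.solve 1 (λ b → b K.:- K.con (+ 1) K.:= K.:-_ (K.con (+ 1) K.:- b)) refl β) (trans (cong -_ eq) (K.solve 0 (K.:-_ (K.con (+ 0)) K.:= K.con (+ 0)) refl)))
            ; after = λ s → ¬-1 (square-div before (subst Square (K.solve 1 (λ b → K.con (+ 1) K.:- b K.:= (b K.:- K.con (+ 1)) K.:* K.:-_ (K.con (+ 1))) refl β) s)) }
            where open Transition tr

          J : ℤ
          J = sum (λ x → legendre x ℤ.* legendre (- 1# + x))

          shifted-e : ∀ s → Nz (- s + 0#) → ⟦ T ⊡ u s ⟧ e ≋ (ℤ.- + 1) • e ⊹ legendre s • c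
          shifted-e s ns = T-formula (op-ZeroSum (u s) e-zero)
            (≡⇒≃ (cong₂ ℤ._-_ (trans (cong e (U-∞ (- s))) e-∞) (trans (cong e (U-pt (- s) 0#)) (trans (e-pt _) (δ-≢ ns)))))
            (≃-trans (sum-cong-≋ (λ x → ≡⇒≃ (cong (legendre x ℤ.*_) (trans (cong e (U-pt (- s) x)) (trans (e-pt _)
              (δ-iff (λ eq → diff≡0 (trans (+-comm x (- s)) eq)) (λ { refl → -‿inverseˡ s }))))))) (sum-δ legendre s))

          shifted-c : ∀ s {α} → ℤ.- legendre (- s + 0#) ≃ α → sum (λ x → legendre x ℤ.* legendre (- s + x)) ≃ J → ⟦ T ⊡ u s ⟧ c ≋ α • e ⊹ J • c
          shifted-c s eα eJ = T-formula (op-ZeroSum (u s) c-zero)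
            (≃-trans (≡⇒≃ (trans (cong₂ ℤ._-_ (trans (cong c (U-∞ (- s))) c-∞) (trans (cong c (U-pt (- s) 0#)) (c-pt _))) (ℤP.+-identityˡ (ℤ.- legendre (- s + 0#))))) eα)
            (≃-trans (sum-cong-≋ (λ x → ≡⇒≃ (cong (legendre x ℤ.*_) (trans (cong c (U-pt (- s) x)) (c-pt _))))) eJ)

          legendre-1 : legendre 1# ≡ + 1
          legendre-1 = legendre-square square-1

          legendre-minus-1 : legendre (- 1#) ≡ ℤ.- + 1
          legendre-minus-1 = legendre-nonsquare (neg-nz 1-nz) ¬-1

          T-u₊-e : ⟦ T ⊡ u 1# ⟧ e ≋ (ℤ.- + 1) • e ⊹ legendre 1# • c
          T-u₊-e = shifted-e 1# (λ eq → neg-nz 1-nz (trans (sym (+-identityʳ (- 1#))) eq))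

          T-u₋-e : ⟦ T ⊡ u (- 1#) ⟧ e ≋ (ℤ.- + 1) • e ⊹ legendre (- 1#) • c
          T-u₋-e = shifted-e (- 1#) (λ eq → 1-nz (trans (sym (trans (+-identityʳ (- - 1#)) (neg-neg 1#))) eq))

          T-u₊-c : ⟦ T ⊡ u 1# ⟧ c ≋ + 1 • e ⊹ J • c
          T-u₊-c = shifted-c 1# (≡⇒≃ (cong ℤ.-_ (trans (cong legendre (+-identityʳ (- 1#))) legendre-minus-1))) ≃-refl

          T-u₋-c : ⟦ T ⊡ u (- 1#) ⟧ c ≋ (ℤ.- + 1) • e ⊹ J • c
          T-u₋-c = shifted-c (- 1#) (≡⇒≃ (cong ℤ.-_ (trans (cong legendre (trans (+-identityʳ (- - 1#)) (neg-neg 1#))) legendre-1)))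
            (≃-trans (sum-cong-≋ (λ x → ≡⇒≃ (trans (ℤP.*-comm (legendre x) (legendre (- - 1# + x))) (cong₂ (λ y z → legendre y ℤ.* legendre z) (cong (_+ x) (neg-neg 1#))
                (K.solve 1 (λ x → x K.:= K.:-_ (K.con (+ 1)) K.:+ (K.con (+ 1) K.:+ x)) refl x)))))
              (sum-bij (λ x → legendre x ℤ.* legendre (- 1# + x)) (_+_ 1#) (_+_ (- 1#))
                (K.solve 1 (λ x → K.con (+ 1) K.:+ (K.:-_ (K.con (+ 1)) K.:+ x) K.:= x) refl) (K.solve 1 (λ x → K.:-_ (K.con (+ 1)) K.:+ (K.con (+ 1) K.:+ x) K.:= x) refl)))

          β₀ : Fin q
          β₀ = proj₁ (square-then-nonsquare ¬-1)

          tr₀ : Transition β₀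
          tr₀ = let (before , nz , after) = proj₂ (square-then-nonsquare ¬-1) in record { before = before ; nz = nz ; after = after }

          -- On the span of e and c, T u(1) - T u(-1) doubles the exchange of e and c, and the unknown character
          -- sums Σm cancel in T g(β) + T g(1 - β).
          X : Op
          X = (T ⊡ g β₀ ⊞ T ⊡ g (1# - β₀)) ⊞ (ℤ.- + 2) ⊠ (T ⊡ u 1# ⊞ (ℤ.- + 1) ⊠ T ⊡ u (- 1#))

          X-e : ⟦ X ⟧ e ≋ 𝟘
          X-e = ≋-trans (≋-+ (≋-+ (T-e tr₀) (T-e (reflect tr₀))) (≋-• (ℤ.- + 2) (≋-+ T-u₊-e (≋-• (ℤ.- + 1) T-u₋-e))))
            (pointwise λ b → ≃-trans (≡⇒≃ (cong₂ (λ k l → ((+ 0 • e ⊹ + 2 • c) ⊹ (+ 0 • e ⊹ + 2 • c) ⊹ (ℤ.- + 2) • (((ℤ.- + 1) • e ⊹ k • c) ⊹ (ℤ.- + 1) • ((ℤ.- + 1) • e ⊹ l • c))) b) legendre-1 legendre-minus-1))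
              (solve 2 (λ a d → ((con (+ 0) :* a :+ con (+ 2) :* d) :+ (con (+ 0) :* a :+ con (+ 2) :* d))
                  :+ (:- con (+ 2)) :* (((:- con (+ 1)) :* a :+ con (+ 1) :* d) :+ (:- con (+ 1)) :* ((:- con (+ 1)) :* a :+ (:- con (+ 1)) :* d)) := con (+ 0)) ≃-refl (e b) (c b)))

          X-c : ⟦ X ⟧ c ≋ (ℤ.- + 8) • e
          X-c = ≋-trans (≋-+ (≋-+ (T-c tr₀) (T-c (reflect tr₀))) (≋-• (ℤ.- + 2) (≋-+ T-u₊-c (≋-• (ℤ.- + 1) T-u₋-c))))
            (pointwise λ b → ≃-trans (≃-+ (≃-+ (≃-refl {((ℤ.- + 2) • e ⊹ Σm β₀ • c) b}) (≃-+ (≃-refl {(ℤ.- + 2) ℤ.* e b}) (≃-* (Σm-reflect β₀) (≃-refl {c b}))))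
                (≃-refl {((ℤ.- + 2) • ((+ 1 • e ⊹ J • c) ⊹ (ℤ.- + 1) • ((ℤ.- + 1) • e ⊹ J • c))) b}))
              (solve 4 (λ a d s j → (((:- con (+ 2)) :* a :+ s :* d) :+ ((:- con (+ 2)) :* a :+ (:- s) :* d))
                  :+ (:- con (+ 2)) :* ((con (+ 1) :* a :+ j :* d) :+ (:- con (+ 1)) :* ((:- con (+ 1)) :* a :+ j :* d)) := (:- con (+ 8)) :* a) ≃-refl (e b) (c b) (Σm β₀) J))

          eight : ∀ k → ¬ k ≃ + 0 → ¬ ((ℤ.- + 8) ℤ.* k) ≃ + 0
          eight k nk eq = k≄0 _ (k≄0 _ (k≄0 k nk)) (≃-trans (solve 1 (λ k → con (+ 2) :* (con (+ 2) :* (con (+ 2) :* k)) := :- ((:- con (+ 8)) :* k)) ≃-refl k) (≃-neg eq))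

          separation : Separation
          separation = record { extract = λ μ λ′ nμ → extract μ λ′ nμ (λ′ ≃? + 0) ; test = X ; test-e = X-e ; test-c = test-c }
            where
            -- If c is absent the vector is already a multiple of e; otherwise `X` removes e and
            -- turns c into -8e, which is nonzero for odd p.
            extract : ∀ μ λ′ → ¬ μ ≃ + 0 → Dec (λ′ ≃ + 0) → ∃₂ λ o k → ¬ k ≃ + 0 × ⟦ o ⟧ (μ • e ⊹ λ′ • c) ≋ k • e
            extract μ λ′ nμ (yes λ≃0) = u 0# , μ , nμ , pointwise λ b → ≃-trans (≡⇒≃ (⟦u0⟧ (μ • e ⊹ λ′ • c) b))
              (≃-trans (≃-+ (≃-refl {μ ℤ.* e b}) (≃-* λ≃0 (≃-refl {c b}))) (solve 2 (λ a d → a :+ con (+ 0) :* d := a) ≃-refl (μ ℤ.* e b) (c b)))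
            extract μ λ′ nμ (no nλ) = X , (ℤ.- + 8) ℤ.* λ′ , eight λ′ nλ , ≋-trans (op-combination X μ λ′ {e} {c}) (≋-trans (≋-+ (≋-• μ X-e) (≋-• λ′ X-c))
              (pointwise λ b → solve 3 (λ m l a → m :* con (+ 0) :+ l :* ((:- con (+ 8)) :* a) := ((:- con (+ 8)) :* l) :* a) ≃-refl μ λ′ (e b)))
            test-c : ∀ λ′ → λ′ • ⟦ X ⟧ c ≋ 𝟘 → λ′ • c ≋ 𝟘
            test-c λ′ eq = pointwise λ b → ≃-trans (≃-* λ≃0 (≃-refl {c b})) (≡⇒≃ (ℤP.*-zeroˡ (c b)))
              where
              λ≃0 : λ′ ≃ + 0
              λ≃0 = decidable-stable (λ′ ≃? + 0) λ nλ → eight λ′ nλ (e-multiple (≋-trans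
                (pointwise λ b → solve 2 (λ l a → ((:- con (+ 8)) :* l) :* a := l :* ((:- con (+ 8)) :* a)) ≃-refl λ′ (e b)) (≋-trans (≋-• λ′ (≋-sym X-c)) eq)))

    irreducible-and-schur : Irreducible × Schur
    irreducible-and-schur = cases (+ suc q ≃? + 0) (Nz? (1# + 1#)) (Square? (- 1#))
      where
      cases : Dec (+ suc q ≃ + 0) → Dec (Nz (1# + 1#)) → Dec (Square (- 1#)) → Irreducible × Schur
      cases (no ne) _ _ = NonDivisible.irreducible ne , NonDivisible.schur ne
      cases (yes eq) (no even) _ = Divisible.irreducible eq 2≄0 (Even.character 2≡0) (Even.separation 2≡0 eq) , Divisible.schur eq 2≄0 (Even.character 2≡0) (Even.separation 2≡0 eq)
        where
        2≡0 : 1# + 1# ≡ 0#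
        2≡0 = decidable-stable ((1# + 1#) ≟ 0#) even
      cases (yes eq) (yes odd) (yes s) = Divisible.irreducible eq 2≄0 (Odd.character odd) sep , Divisible.schur eq 2≄0 (Odd.character odd) sep
        where sep = Odd.SquareMinusOne.separation odd eq s
      cases (yes eq) (yes odd) (no ¬s) = Divisible.irreducible eq 2≄0 (Odd.character odd) sep , Divisible.schur eq 2≄0 (Odd.character odd) sep
        where sep = Odd.NonsquareMinusOne.separation odd eq ¬s

-- Matrices over the field transported to `Fin q`; the Bruhat decomposition.

module SpecialLinear where
  import Defs
  open Defs using (Field; HasCard)
  open FiniteFields
  open Actions
  open import Algebra.Bundles using (RawRing)
  open import Algebra.Morphism.Structures using (IsRingMonomorphism)
  import Algebra.Morphism.RingMonomorphism as RingMonomorphism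
  open import Data.Fin using (_≟_)
  open import Data.Product using (Σ)

  module Transport {q : ℕ} (K : Field) (card : HasCard K q) where
    private module K = Field K
    open import Relation.Binary.Reasoning.Setoid K.setoid

    emb : Fin q → K.Carrier
    emb = proj₁ card

    index : K.Carrier → Fin q
    index x = proj₁ (proj₁ (proj₂ card) x)

    emb-index : ∀ x → emb (index x) K.≈ x
    emb-index x = proj₂ (proj₁ (proj₂ card) x)

    emb-inj : ∀ {i j} → emb i K.≈ emb j → i ≡ j
    emb-inj = proj₂ (proj₂ card) _ _

    rawRing : RawRing 0ℓ 0ℓ
    rawRing = record
      { Carrier = Fin q ; _≈_ = _≡_
      ; _+_ = λ x y → index (emb x K.+ emb y) ; _*_ = λ x y → index (emb x K.* emb y) ; -_ = λ x → index (K.- emb x)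
      ; 0# = index K.0# ; 1# = index K.1# }

    monomorphism : IsRingMonomorphism rawRing (CommutativeRing.rawRing K.cring) emb
    monomorphism = record
      { isRingHomomorphism = record
        { isSemiringHomomorphism = record
          { isNearSemiringHomomorphism = record
            { +-isMonoidHomomorphism = record
              { isMagmaHomomorphism = record
                { isRelHomomorphism = record { cong = λ eq → K.reflexive (≡.cong emb eq) }
                ; homo = λ x y → emb-index _ }
              ; ε-homo = emb-index _ }
            ; *-homo = λ x y → emb-index _ }
          ; 1#-homo = emb-index _ }
        ; -‿homo = λ x → emb-index _ }
      ; injective = emb-inj }

    open RawRing rawRing using (0#; 1#; _*_)

    emb-nz : ∀ {x} → x ≢ 0# → ¬ emb x K.≈ K.0#
    emb-nz nx eq = nx (emb-inj (K.trans eq (K.sym (emb-index K.0#))))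

    invert : ∀ x → Dec (x ≡ 0#) → Fin q
    invert x (yes _) = 0#
    invert x (no nx) = index (proj₁ (K.inverse (emb x) (emb-nz nx)))

    *-invert : ∀ x (d : Dec (x ≡ 0#)) → x ≢ 0# → x * invert x d ≡ 1#
    *-invert x (yes eq) nx = ⊥-elim (nx eq)
    *-invert x (no nx′) nx = emb-inj (begin
      emb (x * index y)      ≈⟨ emb-index _ ⟩
      emb x K.* emb (index y) ≈⟨ K.*-cong K.refl (emb-index y) ⟩
      emb x K.* y            ≈⟨ proj₂ (K.inverse (emb x) (emb-nz nx′)) ⟩
      K.1#                   ≈⟨ emb-index K.1# ⟨
      emb 1#                 ∎)
      where y = proj₁ (K.inverse (emb x) (emb-nz nx′))

    finiteField : FiniteField q
    finiteField = record
      { _+_ = RawRing._+_ rawRing ; _*_ = _*_ ; -_ = RawRing.-_ rawRing ; inv = λ x → invert x (x ≟ 0#) ; 0# = 0# ; 1# = 1#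
      ; isCommutativeRing = RingMonomorphism.isCommutativeRing monomorphism K.isCommutativeRing
      ; 0≢1 = λ eq → K.0≉1 (K.trans (K.sym (emb-index K.0#)) (K.trans (K.reflexive (≡.cong emb eq)) (emb-index K.1#)))
      ; *-inv = λ x → *-invert x (x ≟ 0#) }

  module Matrices {q : ℕ} (F : FiniteField q) where
    open FiniteField F
    open ≡ using (sym; trans; cong; cong₂; refl; subst)

    -- The determinant condition is irrelevant, so a matrix is determined by its four entries; `det`
    -- recovers the proof by decidability.
    record SL₂ : Set where
      constructor matrix
      field
        a b c d : Fin q
        .unimodular : a * d - b * c ≡ 1#

    open SL₂ public using (a; b; c; d)

    det : ∀ g → a g * d g - b g * c g ≡ 1#
    det (matrix a b c d D) = recompute (a * d - b * c ≟ 1#) D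

    abstract
      det-· : ∀ g h → (a g * a h + b g * c h) * (c g * b h + d g * d h) - (a g * b h + b g * d h) * (c g * a h + d g * c h) ≡ 1#
      det-· g h = trans (solve 8 (λ a b c d x y z t → (a :* x :+ b :* z) :* (c :* y :+ d :* t) :- (a :* y :+ b :* t) :* (c :* x :+ d :* z)
          := (a :* d :- b :* c) :* (x :* t :- y :* z)) refl (a g) (b g) (c g) (d g) (a h) (b h) (c h) (d h))
        (trans (cong₂ _*_ (det g) (det h)) (*-identityˡ 1#))

      det-⁻ : ∀ g → d g * a g - (- b g) * (- c g) ≡ 1#
      det-⁻ g = trans (solve 4 (λ a b c d → d :* a :- (:- b) :* (:- c) := a :* d :- b :* c) refl (a g) (b g) (c g) (d g)) (det g)

      det-upper : ∀ x → 1# * 1# - x * 0# ≡ 1#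
      det-upper = solve 1 (λ x → con (+ 1) :* con (+ 1) :- x :* con (+ 0) := con (+ 1)) refl

      det-diagonal : ∀ {a} → Nz a → a * inv a - 0# * 0# ≡ 1#
      det-diagonal {a} na = trans (solve 2 (λ a i → a :* i :- con (+ 0) :* con (+ 0) := a :* i) refl a (inv a)) (*-inv a na)

      det-weyl : 0# * 0# - 1# * (- 1#) ≡ 1#
      det-weyl = solve 0 (con (+ 0) :* con (+ 0) :- con (+ 1) :* (:- con (+ 1)) := con (+ 1)) refl

    infixl 7 _·_
    _·_ : SL₂ → SL₂ → SL₂
    g · h = matrix (a g * a h + b g * c h) (a g * b h + b g * d h) (c g * a h + d g * c h) (c g * b h + d g * d h) (det-· g h)

    _⁻ : SL₂ → SL₂
    g ⁻ = matrix (d g) (- b g) (- c g) (a g) (det-⁻ g)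

    𝟙 : SL₂
    𝟙 = matrix 1# 0# 0# 1# (det-upper 0#)

    upper : Fin q → SL₂
    upper x = matrix 1# x 0# 1# (det-upper x)

    diagonal : ∀ a → Nz a → SL₂
    diagonal a na = matrix a 0# 0# (inv a) (det-diagonal na)

    weyl : SL₂
    weyl = matrix 0# 1# (- 1#) 0# det-weyl

    infix 4 _≈±_
    _≈±_ : SL₂ → SL₂ → Set
    g ≈± h = (a g ≡ a h × b g ≡ b h × c g ≡ c h × d g ≡ d h) ⊎ (a g ≡ - a h × b g ≡ - b h × c g ≡ - c h × d g ≡ - d h)

    𝟙-idempotent : 𝟙 · 𝟙 ≈± 𝟙
    𝟙-idempotent = inj₁
      ( solve 0 (con (+ 1) :* con (+ 1) :+ con (+ 0) :* con (+ 0) := con (+ 1)) refl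
      , solve 0 (con (+ 1) :* con (+ 0) :+ con (+ 0) :* con (+ 1) := con (+ 0)) refl
      , solve 0 (con (+ 0) :* con (+ 1) :+ con (+ 1) :* con (+ 0) := con (+ 0)) refl
      , solve 0 (con (+ 0) :* con (+ 0) :+ con (+ 1) :* con (+ 1) := con (+ 1)) refl)

    ·-inverseʳ : ∀ g → g · (g ⁻) ≈± 𝟙
    ·-inverseʳ g = inj₁
      ( trans (solve 4 (λ a b c d → a :* d :+ b :* (:- c) := a :* d :- b :* c) refl (a g) (b g) (c g) (d g)) (det g)
      , solve 4 (λ a b c d → a :* (:- b) :+ b :* a := con (+ 0)) refl (a g) (b g) (c g) (d g)
      , solve 4 (λ a b c d → c :* d :+ d :* (:- c) := con (+ 0)) refl (a g) (b g) (c g) (d g)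
      , trans (solve 4 (λ a b c d → c :* (:- b) :+ d :* a := a :* d :- b :* c) refl (a g) (b g) (c g) (d g)) (det g))

    ⁻-involutive : ∀ g → (g ⁻) ⁻ ≈± g
    ⁻-involutive g = inj₁ (refl , neg-neg (b g) , neg-neg (c g) , refl)

    ⁻-± : ∀ {g h} → g ≈± h → (g ⁻) ≈± (h ⁻)
    ⁻-± (inj₁ (ea , eb , ec , ed)) = inj₁ (ed , cong -_ eb , cong -_ ec , ea)
    ⁻-± (inj₂ (ea , eb , ec , ed)) = inj₂ (ed , cong -_ eb , cong -_ ec , ea)

    neg-0 : - 0# ≡ 0#
    neg-0 = solve 0 (:- con (+ 0) := con (+ 0)) refl

    SL₂-search : ∀ (P : SL₂ → Set) → (∀ g → Dec (P g)) → Dec (∃ P)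
    SL₂-search P P? = map′ (λ (a , b , c , d , D , p) → matrix a b c d D , p) (λ { (g@(matrix a b c d _) , p) → a , b , c , d , det g , p })
      (FP.any? λ a → FP.any? λ b → FP.any? λ c → FP.any? λ d → with-det a b c d (a * d - b * c ≟ 1#))
      where
      with-det : ∀ a b c d → Dec (a * d - b * c ≡ 1#) → Dec (Σ (a * d - b * c ≡ 1#) λ D → P (matrix a b c d D))
      with-det a b c d (no ¬D)  = no λ (D , _) → ¬D D
      with-det a b c d (yes D) with P? (matrix a b c d D)
      ... | yes p = yes (D , p)
      ... | no ¬p = no λ (D′ , p) → ¬p p

    upper-0 : upper 0# ≈± 𝟙
    upper-0 = inj₁ (refl , refl , refl , refl)

    upper-+ : ∀ x y → upper x · upper y ≈± upper (x + y)
    upper-+ x y = inj₁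
      ( solve 1 (λ x → con (+ 1) :* con (+ 1) :+ x :* con (+ 0) := con (+ 1)) refl x
      , solve 2 (λ x y → con (+ 1) :* y :+ x :* con (+ 1) := x :+ y) refl x y
      , solve 0 (con (+ 0) :* con (+ 1) :+ con (+ 1) :* con (+ 0) := con (+ 0)) refl
      , solve 1 (λ y → con (+ 0) :* y :+ con (+ 1) :* con (+ 1) := con (+ 1)) refl y)

    diagonal-1 : diagonal 1# 1-nz ≈± 𝟙
    diagonal-1 = inj₁ (refl , refl , refl , inv-1)

    diagonal-neg : ∀ {a} (na : Nz a) → diagonal (- a) (neg-nz na) ≈± diagonal a na
    diagonal-neg na = inj₂ (refl , sym neg-0 , sym neg-0 , inv-neg na)

    diagonal-* : ∀ {a b} (na : Nz a) (nb : Nz b) → diagonal a na · diagonal b nb ≈± diagonal (a * b) (*-nz na nb)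
    diagonal-* {a} {b} na nb = inj₁
      ( solve 2 (λ a b → a :* b :+ con (+ 0) :* con (+ 0) := a :* b) refl a b
      , solve 2 (λ a j → a :* con (+ 0) :+ con (+ 0) :* j := con (+ 0)) refl a (inv b)
      , solve 2 (λ b i → con (+ 0) :* b :+ i :* con (+ 0) := con (+ 0)) refl b (inv a)
      , trans (solve 2 (λ i j → con (+ 0) :* con (+ 0) :+ i :* j := i :* j) refl (inv a) (inv b)) (sym (inv-mul na nb)))

    diagonal-upper : ∀ {a} (na : Nz a) x → diagonal a na · upper x ≈± upper (a * a * x) · diagonal a na
    diagonal-upper {a} na x = inj₁
      ( solve 2 (λ a x → a :* con (+ 1) :+ con (+ 0) :* con (+ 0) := con (+ 1) :* a :+ (a :* a :* x) :* con (+ 0)) refl a x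
      , trans (solve 2 (λ a x → a :* x :+ con (+ 0) :* con (+ 1) := con (+ 1) :* a :* x) refl a x)
          (trans (cong (λ z → z * a * x) (sym (*-inv a na))) (solve 3 (λ a i x → a :* i :* a :* x := con (+ 1) :* con (+ 0) :+ (a :* a :* x) :* i) refl a (inv a) x))
      , solve 2 (λ a i → con (+ 0) :* con (+ 1) :+ i :* con (+ 0) := con (+ 0) :* a :+ con (+ 1) :* con (+ 0)) refl a (inv a)
      , solve 2 (λ x i → con (+ 0) :* x :+ i :* con (+ 1) := con (+ 0) :* con (+ 0) :+ con (+ 1) :* i) refl x (inv a))

    weyl-diagonal : ∀ {a} (na : Nz a) → weyl · diagonal a na ≈± diagonal (inv a) (inv-nz na) · weyl
    weyl-diagonal {a} na = inj₁
      ( solve 2 (λ a i → con (+ 0) :* a :+ con (+ 1) :* con (+ 0) := i :* con (+ 0) :+ con (+ 0) :* (:- con (+ 1))) refl a (inv a)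
      , solve 1 (λ i → con (+ 0) :* con (+ 0) :+ con (+ 1) :* i := i :* con (+ 1) :+ con (+ 0) :* con (+ 0)) refl (inv a)
      , trans (solve 1 (λ a → (:- con (+ 1)) :* a :+ con (+ 0) :* con (+ 0) := con (+ 0) :* con (+ 0) :+ a :* (:- con (+ 1))) refl a)
          (cong (λ z → 0# * 0# + z * - 1#) (sym (inv-inv na)))
      , solve 2 (λ i j → (:- con (+ 1)) :* con (+ 0) :+ con (+ 0) :* i := con (+ 0) :* con (+ 1) :+ j :* con (+ 0)) refl (inv a) (inv (inv a)))

    weyl-weyl : weyl · weyl ≈± 𝟙
    weyl-weyl = inj₂
      ( solve 0 (con (+ 0) :* con (+ 0) :+ con (+ 1) :* (:- con (+ 1)) := :- con (+ 1)) refl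
      , solve 0 (con (+ 0) :* con (+ 1) :+ con (+ 1) :* con (+ 0) := :- con (+ 0)) refl
      , solve 0 ((:- con (+ 1)) :* con (+ 0) :+ con (+ 0) :* (:- con (+ 1)) := :- con (+ 0)) refl
      , solve 0 ((:- con (+ 1)) :* con (+ 1) :+ con (+ 0) :* con (+ 0) := :- con (+ 1)) refl)

    weyl-upper-weyl : ∀ {x} (nx : Nz x) →
      weyl · (upper x · weyl) ≈± upper (- inv x) · (diagonal (inv x) (inv-nz nx) · (weyl · upper (- inv x)))
    weyl-upper-weyl {x} nx = inj₂ (ea , eb , ec , ed)
      where
      i = inv x
      j = inv i
      h = upper (- i) · (diagonal i (inv-nz nx) · (weyl · upper (- i)))
      ij : i * j ≡ 1#
      ij = *-inv i (inv-nz nx)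
      jx : j ≡ x
      jx = inv-inv nx
      ea : a (weyl · (upper x · weyl)) ≡ - a h
      ea = trans (solve 1 (λ x → con (+ 0) :* (con (+ 1) :* con (+ 0) :+ x :* (:- con (+ 1))) :+ con (+ 1) :* (con (+ 0) :* con (+ 0) :+ con (+ 1) :* (:- con (+ 1))) := :- con (+ 1)) refl x)
        (trans (cong -_ (sym ij)) (solve 2 (λ i j → :- (i :* j) := :- (con (+ 1) :* (i :* (con (+ 0) :* con (+ 1) :+ con (+ 1) :* con (+ 0)) :+ con (+ 0) :* ((:- con (+ 1)) :* con (+ 1) :+ con (+ 0) :* con (+ 0)))
          :+ (:- i) :* (con (+ 0) :* (con (+ 0) :* con (+ 1) :+ con (+ 1) :* con (+ 0)) :+ j :* ((:- con (+ 1)) :* con (+ 1) :+ con (+ 0) :* con (+ 0))))) refl i j))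
      eb : b (weyl · (upper x · weyl)) ≡ - b h
      eb = trans (solve 2 (λ x i → con (+ 0) :* (con (+ 1) :* con (+ 1) :+ x :* con (+ 0)) :+ con (+ 1) :* (con (+ 0) :* con (+ 1) :+ con (+ 1) :* con (+ 0)) := i :* con (+ 1) :- i) refl x i)
        (trans (cong (λ k → i * k - i) (sym ij)) (solve 2 (λ i j → i :* (i :* j) :- i := :- (con (+ 1) :* (i :* (con (+ 0) :* (:- i) :+ con (+ 1) :* con (+ 1)) :+ con (+ 0) :* ((:- con (+ 1)) :* (:- i) :+ con (+ 0) :* con (+ 1)))
          :+ (:- i) :* (con (+ 0) :* (con (+ 0) :* (:- i) :+ con (+ 1) :* con (+ 1)) :+ j :* ((:- con (+ 1)) :* (:- i) :+ con (+ 0) :* con (+ 1))))) refl i j))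
      ec : c (weyl · (upper x · weyl)) ≡ - c h
      ec = trans (solve 1 (λ x → (:- con (+ 1)) :* (con (+ 1) :* con (+ 0) :+ x :* (:- con (+ 1))) :+ con (+ 0) :* (con (+ 0) :* con (+ 0) :+ con (+ 1) :* (:- con (+ 1))) := x) refl x)
        (trans (sym jx) (solve 2 (λ i j → j := :- (con (+ 0) :* (i :* (con (+ 0) :* con (+ 1) :+ con (+ 1) :* con (+ 0)) :+ con (+ 0) :* ((:- con (+ 1)) :* con (+ 1) :+ con (+ 0) :* con (+ 0)))
          :+ con (+ 1) :* (con (+ 0) :* (con (+ 0) :* con (+ 1) :+ con (+ 1) :* con (+ 0)) :+ j :* ((:- con (+ 1)) :* con (+ 1) :+ con (+ 0) :* con (+ 0))))) refl i j))
      ed : d (weyl · (upper x · weyl)) ≡ - d h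
      ed = trans (solve 1 (λ x → (:- con (+ 1)) :* (con (+ 1) :* con (+ 1) :+ x :* con (+ 0)) :+ con (+ 0) :* (con (+ 0) :* con (+ 1) :+ con (+ 1) :* con (+ 0)) := :- con (+ 1)) refl x)
        (trans (cong -_ (sym ij)) (solve 2 (λ i j → :- (i :* j) := :- (con (+ 0) :* (i :* (con (+ 0) :* (:- i) :+ con (+ 1) :* con (+ 1)) :+ con (+ 0) :* ((:- con (+ 1)) :* (:- i) :+ con (+ 0) :* con (+ 1)))
          :+ con (+ 1) :* (con (+ 0) :* (con (+ 0) :* (:- i) :+ con (+ 1) :* con (+ 1)) :+ j :* ((:- con (+ 1)) :* (:- i) :+ con (+ 0) :* con (+ 1))))) refl i j))

    -- The big cell: g = u(a/c) h(-1/c) w u(d/c), with b = (ad - 1)/c supplied by the determinant.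
    bruhat : ∀ g (nc : Nz (c g)) →
      g ≈± upper (a g * inv (c g)) · (diagonal (- inv (c g)) (neg-nz (inv-nz nc)) · (weyl · upper (d g * inv (c g))))
    bruhat g nc = inj₁ (ea , eb , ec , ed)
      where
      k = inv (c g)
      t = - k
      nt : Nz t
      nt = neg-nz (inv-nz nc)
      j = inv t
      h = upper (a g * k) · (diagonal t nt · (weyl · upper (d g * k)))
      j≡ : j ≡ - c g
      j≡ = trans (inv-neg (inv-nz nc)) (cong -_ (inv-inv nc))
      ck : c g * k ≡ 1#
      ck = *-inv (c g) nc
      ec : c g ≡ c h
      ec = trans (trans (solve 1 (λ c → c := :- (:- c)) refl (c g)) (cong -_ (sym j≡)))
        (solve 3 (λ t j y → :- j := con (+ 0) :* (t :* (con (+ 0) :* con (+ 1) :+ con (+ 1) :* con (+ 0)) :+ con (+ 0) :* ((:- con (+ 1)) :* con (+ 1) :+ con (+ 0) :* con (+ 0)))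
          :+ con (+ 1) :* (con (+ 0) :* (con (+ 0) :* con (+ 1) :+ con (+ 1) :* con (+ 0)) :+ j :* ((:- con (+ 1)) :* con (+ 1) :+ con (+ 0) :* con (+ 0)))) refl t j (d g * k))
      ea : a g ≡ a h
      ea = trans (trans (solve 1 (λ a → a := a :* con (+ 1)) refl (a g)) (trans (cong (a g *_) (sym ck)) (trans (solve 3 (λ a c k → a :* (c :* k) := (a :* k) :* (:- (:- c))) refl (a g) (c g) k)
          (cong (λ z → (a g * k) * - z) (sym j≡)))))
        (solve 3 (λ x t j → x :* (:- j) := con (+ 1) :* (t :* (con (+ 0) :* con (+ 1) :+ con (+ 1) :* con (+ 0)) :+ con (+ 0) :* ((:- con (+ 1)) :* con (+ 1) :+ con (+ 0) :* con (+ 0)))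
          :+ x :* (con (+ 0) :* (con (+ 0) :* con (+ 1) :+ con (+ 1) :* con (+ 0)) :+ j :* ((:- con (+ 1)) :* con (+ 1) :+ con (+ 0) :* con (+ 0)))) refl (a g * k) t j)
      ed : d g ≡ d h
      ed = trans (trans (solve 1 (λ d → d := con (+ 1) :* d) refl (d g)) (trans (cong (_* d g) (sym ck)) (trans (solve 3 (λ d c k → (c :* k) :* d := (:- (:- c)) :* (d :* k)) refl (d g) (c g) k)
          (cong (λ z → - z * (d g * k)) (sym j≡)))))
        (solve 3 (λ t j y → (:- j) :* y := con (+ 0) :* (t :* (con (+ 0) :* y :+ con (+ 1) :* con (+ 1)) :+ con (+ 0) :* ((:- con (+ 1)) :* y :+ con (+ 0) :* con (+ 1)))
          :+ con (+ 1) :* (con (+ 0) :* (con (+ 0) :* y :+ con (+ 1) :* con (+ 1)) :+ j :* ((:- con (+ 1)) :* y :+ con (+ 0) :* con (+ 1)))) refl t j (d g * k))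
      eb : b g ≡ b h
      eb = trans (trans (solve 1 (λ b → b := b :* con (+ 1)) refl (b g)) (trans (cong (b g *_) (sym ck)) (trans
          (solve 5 (λ a b c d k → b :* (c :* k) := (:- ((a :* d :- b :* c) :* k)) :+ (a :* k) :* d) refl (a g) (b g) (c g) (d g) k)
          (trans (cong₂ (λ z y → - (z * k) + (a g * k) * y) (det g) ed-simple) refl))))
        (solve 4 (λ k x j y → :- (con (+ 1) :* k) :+ x :* ((:- j) :* y) := con (+ 1) :* ((:- k) :* (con (+ 0) :* y :+ con (+ 1) :* con (+ 1)) :+ con (+ 0) :* ((:- con (+ 1)) :* y :+ con (+ 0) :* con (+ 1)))
          :+ x :* (con (+ 0) :* (con (+ 0) :* y :+ con (+ 1) :* con (+ 1)) :+ j :* ((:- con (+ 1)) :* y :+ con (+ 0) :* con (+ 1)))) refl k (a g * k) j (d g * k))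
        where
        ed-simple : d g ≡ (- j) * (d g * k)
        ed-simple = trans (solve 1 (λ d → d := con (+ 1) :* d) refl (d g)) (trans (cong (_* d g) (sym ck)) (trans (solve 3 (λ d c k → (c :* k) :* d := (:- (:- c)) :* (d :* k)) refl (d g) (c g) k)
          (cong (λ z → - z * (d g * k)) (sym j≡))))

    triangular : ∀ g → c g ≡ 0# → ∃ λ na → g ≈± diagonal (a g) na · upper (inv (a g) * b g)
    triangular g c≡0 = na , inj₁ (ea , eb , ec , ed)
      where
      ad : a g * d g ≡ 1#
      ad = trans (trans (solve 3 (λ a b d → a :* d := a :* d :- b :* con (+ 0)) refl (a g) (b g) (d g)) (cong (λ z → a g * d g - b g * z) (sym c≡0))) (det g)
      na : Nz (a g)
      na eq = 0≢1 (trans (sym (zeroˡ (d g))) (trans (cong (_* d g) (sym eq)) ad))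
      i = inv (a g)
      h = diagonal (a g) na · upper (i * b g)
      ea : a g ≡ a h
      ea = solve 1 (λ a → a := a :* con (+ 1) :+ con (+ 0) :* con (+ 0)) refl (a g)
      eb : b g ≡ b h
      eb = trans (solve 1 (λ b → b := con (+ 1) :* b) refl (b g)) (trans (cong (_* b g) (sym (*-inv (a g) na)))
        (solve 3 (λ a i b → a :* i :* b := a :* (i :* b) :+ con (+ 0) :* con (+ 1)) refl (a g) i (b g)))
      ec : c g ≡ c h
      ec = trans c≡0 (solve 1 (λ i → con (+ 0) := con (+ 0) :* con (+ 1) :+ i :* con (+ 0)) refl i)
      ed : d g ≡ d h
      ed = trans (inv-unique na ad) (solve 2 (λ i y → i := con (+ 0) :* y :+ i :* con (+ 1)) refl i (i * b g))

    record ProjectiveAction (X : Set) (_~_ : X → X → Set) (_⋆_ : SL₂ → X → X) : Set where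
      field
        isEquiv : IsEquivalence _~_
        _~?_    : ∀ P R → Dec (P ~ R)
        ⋆-cong  : ∀ g {P R} → P ~ R → (g ⋆ P) ~ (g ⋆ R)
        ⋆-±     : ∀ {g h} P → g ≈± h → (g ⋆ P) ~ (h ⋆ P)
        ⋆-·     : ∀ g h P → ((g · h) ⋆ P) ~ (g ⋆ (h ⋆ P))
        ⋆-𝟙     : ∀ P → (𝟙 ⋆ P) ~ P

    module Generators {X : Set} {_~_ : X → X → Set} {_⋆_ : SL₂ → X → X} (A : ProjectiveAction X _~_ _⋆_) where
      open ProjectiveAction A
      open IsEquivalence isEquiv renaming (refl to refl~; sym to sym~; trans to trans~)

      torus : ∀ a → Dec (Nz a) → X → X
      torus a (yes na) P = diagonal a na ⋆ P
      torus a (no _)   P = P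

      torus-nz : ∀ {a} (na : Nz a) P (d : Dec (Nz a)) → torus a d P ~ (diagonal a na ⋆ P)
      torus-nz na P (yes na′) = ⋆-± P (inj₁ (refl , refl , refl , refl))
      torus-nz na P (no ¬na)  = ⊥-elim (¬na na)

      Hₐ : Fin q → X → X
      Hₐ a = torus a (Nz? a)

      H-diag : ∀ {a} (na : Nz a) P → Hₐ a P ~ (diagonal a na ⋆ P)
      H-diag {a} na P = torus-nz na P (Nz? a)

      law : ∀ {g h k} P → g · h ≈± k → (g ⋆ (h ⋆ P)) ~ (k ⋆ P)
      law {g} {h} {k} P eq = trans~ (sym~ (⋆-· g h P)) (⋆-± {g · h} {k} P eq)

      law′ : ∀ {g h k l} P → g · h ≈± k · l → (g ⋆ (h ⋆ P)) ~ (k ⋆ (l ⋆ P))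
      law′ {g} {h} {k} {l} P eq = trans~ (law {g} {h} {k · l} P eq) (⋆-· k l P)

      action : SL2Action F X _~_
      action = record
        { isEquiv = isEquiv
        ; _~?_ = _~?_
        ; U = λ x P → upper x ⋆ P
        ; H = Hₐ
        ; W = λ P → weyl ⋆ P
        ; U-cong = λ x → ⋆-cong (upper x)
        ; H-cong = λ a na → H-cong na
        ; W-cong = ⋆-cong weyl
        ; U-0 = λ P → trans~ (⋆-± {upper 0#} {𝟙} P upper-0) (⋆-𝟙 P)
        ; U-+ = λ x y P → law {upper x} {upper y} P (upper-+ x y)
        ; H-1 = λ P → trans~ (H-diag 1-nz P) (trans~ (⋆-± {diagonal 1# 1-nz} {𝟙} P diagonal-1) (⋆-𝟙 P))
        ; H-neg = λ {a} P na → trans~ (H-diag (neg-nz na) P)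
            (trans~ (⋆-± {diagonal (- a) (neg-nz na)} {diagonal a na} P (diagonal-neg na)) (sym~ (H-diag na P)))
        ; H-* = λ {a} {b} P na nb → trans~ (H-diag na _) (trans~ (⋆-cong (diagonal a na) (H-diag nb P))
            (trans~ (law {diagonal a na} {diagonal b nb} P (diagonal-* na nb)) (sym~ (H-diag (*-nz na nb) P))))
        ; H-U = λ {a} x P na → trans~ (H-diag na _)
            (trans~ (law′ {diagonal a na} {upper x} {upper (a * a * x)} {diagonal a na} P (diagonal-upper na x)) (⋆-cong (upper (a * a * x)) (sym~ (H-diag na P))))
        ; W-H = λ {a} P na → trans~ (⋆-cong weyl (H-diag na P))
            (trans~ (law′ {weyl} {diagonal a na} {diagonal (inv a) (inv-nz na)} {weyl} P (weyl-diagonal na)) (sym~ (H-diag (inv-nz na) _)))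
        ; W-W = λ P → trans~ (law {weyl} {weyl} P weyl-weyl) (⋆-𝟙 P)
        ; W-U-W = W-U-W }
        where
        H-cong : ∀ {a P R} (na : Nz a) → P ~ R → Hₐ a P ~ Hₐ a R
        H-cong {a} na eq = trans~ (H-diag na _) (trans~ (⋆-cong (diagonal a na) eq) (sym~ (H-diag na _)))
        W-U-W : ∀ {x} P → Nz x → (weyl ⋆ (upper x ⋆ (weyl ⋆ P))) ~ (upper (- inv x) ⋆ Hₐ (inv x) (weyl ⋆ (upper (- inv x) ⋆ P)))
        W-U-W {x} P nx = trans~ (⋆-cong weyl (sym~ (⋆-· (upper x) weyl P)))
          (trans~ (law′ {weyl} {upper x · weyl} {u} {h · (weyl · u)} P (weyl-upper-weyl nx))
          (⋆-cong u (trans~ (⋆-· h (weyl · u) P) (trans~ (sym~ (H-diag (inv-nz nx) _)) (H-cong (inv-nz nx) (⋆-· weyl u P))))))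
          where
          u = upper (- inv x)
          h = diagonal (inv x) (inv-nz nx)

      -- By `bruhat` or `triangular`, according to whether c vanishes, every matrix is a product of
      -- generators up to sign.
      trivial-on-generators : (∀ x P → (upper x ⋆ P) ~ P) → (∀ {a} P → Nz a → Hₐ a P ~ P) → (∀ P → (weyl ⋆ P) ~ P) → ∀ g P → (g ⋆ P) ~ P
      trivial-on-generators trivU trivH trivW g P = go (Nz? (c g))
        where
        trivD : ∀ {a} (na : Nz a) P → (diagonal a na ⋆ P) ~ P
        trivD na P = trans~ (sym~ (H-diag na P)) (trivH P na)
        go : Dec (Nz (c g)) → (g ⋆ P) ~ P
        go (yes nc) = trans~ (⋆-± {g} {u · (h · (weyl · u′))} P (bruhat g nc))
            (trans~ (⋆-· u (h · (weyl · u′)) P) (trans~ (trivU _ _) (trans~ (⋆-· h (weyl · u′) P)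
            (trans~ (trivD nt _) (trans~ (⋆-· weyl u′ P) (trans~ (trivW _) (trivU _ P)))))))
          where
          u = upper (a g * inv (c g))
          u′ = upper (d g * inv (c g))
          nt = neg-nz (inv-nz nc)
          h = diagonal (- inv (c g)) nt
        go (no ¬nc) = let (na , eq) = triangular g (decidable-stable (c g ≟ 0#) ¬nc) in
          trans~ (⋆-± {g} {diagonal (a g) na · upper (inv (a g) * b g)} P eq)
          (trans~ (⋆-· (diagonal (a g) na) (upper (inv (a g) * b g)) P) (trans~ (trivD na _) (trivU _ P)))

-- The permutation action and the heart as a finite representation.

module HeartRepresentations where
  open import Defs using (Field; HasCard; IsoPSL2; Perm)
  import Defs
  open Solver
  open Counting
  open FiniteFields
  open Actions
  open RegularOrbits
  open ProjectiveLines
  open ModularArithmetic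
  open HeartCoordinates
  open PrimeHearts
  open HeartIrreducibility
  open Representations
  open SpecialLinear
  open import Algebra.Bundles using (AbelianGroup)
  import Data.Nat.Divisibility as ℕD
  open import Data.Nat.Primality using (prime⇒nonZero; prime⇒nonTrivial)
  open import Data.Integer.DivMod using (_/ℕ_; a≡a%ℕn+[a/ℕn]*n; n%ℕd<d)
  open import Data.Fin using (_≟_; toℕ; fromℕ<; funToFin; finToFun)
  open import Data.Fin.Permutation as P using (_⟨$⟩ʳ_; _⟨$⟩ˡ_)
  open import Data.Product using (Σ)

  module PermutationAction {q n : ℕ} (K : Field) (card : HasCard K q) (H : Perm n → Set) (iso : IsoPSL2 K H) where
    private
      module K = Field K
      module M = Defs.Mat K
    open IsoPSL2 iso renaming (inj to φ-inj)
    open Transport K card public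
    open FiniteField finiteField using (0#; 1#; _+_; _*_; -_; _-_; 1-nz)
    open Matrices finiteField public
    open ≡ using (sym; trans; cong; cong₂; refl)

    emb-+ : ∀ x y → emb (x + y) K.≈ emb x K.+ emb y
    emb-+ x y = emb-index _

    emb-* : ∀ x y → emb (x * y) K.≈ emb x K.* emb y
    emb-* x y = emb-index _

    emb-neg : ∀ x → emb (- x) K.≈ K.- emb x
    emb-neg x = emb-index _

    toK : SL₂ → M.M2
    toK g = M.mat (emb (a g)) (emb (b g)) (emb (c g)) (emb (d g))

    toK-SL : ∀ g → M.IsSL (toK g)
    toK-SL g = K.trans (K.sym (K.trans (emb-+ _ _) (K.+-cong (emb-* _ _) (K.trans (emb-neg _) (K.-‿cong (emb-* _ _))))))
      (K.trans (K.reflexive (cong emb (det g))) (emb-index K.1#))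

    toK-· : ∀ g h → toK (g · h) M.≈ₘ (toK g M.·ₘ toK h)
    toK-· g h = entry _ _ _ _ , entry _ _ _ _ , entry _ _ _ _ , entry _ _ _ _
      where
      entry : ∀ x y z t → emb (x * y + z * t) K.≈ emb x K.* emb y K.+ emb z K.* emb t
      entry x y z t = K.trans (emb-+ _ _) (K.+-cong (emb-* _ _) (emb-* _ _))

    toK-·-SL : ∀ g h → M.IsSL (toK g M.·ₘ toK h)
    toK-·-SL g h = let (ea , eb , ec , ed) = toK-· g h in
      K.trans (K.sym (K.+-cong (K.*-cong ea ed) (K.-‿cong (K.*-cong eb ec)))) (toK-SL (g · h))

    perm : SL₂ → Perm n
    perm g = φ (toK g)

    infixr 6 _⋆_
    _⋆_ : SL₂ → Fin n → Fin n
    g ⋆ P = perm g ⟨$⟩ʳ P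

    ⋆-± : ∀ {g h} P → g ≈± h → g ⋆ P ≡ h ⋆ P
    ⋆-± {g} {h} P (inj₁ (ea , eb , ec , ed)) = wd (toK g) (toK h) (toK-SL g) (toK-SL h)
      (inj₁ (K.reflexive (cong emb ea) , K.reflexive (cong emb eb) , K.reflexive (cong emb ec) , K.reflexive (cong emb ed))) P
    ⋆-± {g} {h} P (inj₂ (ea , eb , ec , ed)) = wd (toK g) (toK h) (toK-SL g) (toK-SL h) (inj₂ (neg ea , neg eb , neg ec , neg ed)) P
      where
      neg : ∀ {x y} → x ≡ - y → emb x K.≈ K.- emb y
      neg {y = y} eq = K.trans (K.reflexive (cong emb eq)) (emb-neg y)

    ⋆-· : ∀ g h P → (g · h) ⋆ P ≡ g ⋆ h ⋆ P
    ⋆-· g h P = trans (wd (toK (g · h)) (toK g M.·ₘ toK h) (toK-SL (g · h)) (toK-·-SL g h) (inj₁ (toK-· g h)) P)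
      (hom (toK g) (toK h) (toK-SL g) (toK-SL h) P)

    -- The homomorphism law makes the permutation of `𝟙` idempotent, and an invertible idempotent is
    -- the identity.
    ⋆-𝟙 : ∀ P → 𝟙 ⋆ P ≡ P
    ⋆-𝟙 P = trans (sym (P.inverseˡ (perm 𝟙))) (trans (cong (perm 𝟙 ⟨$⟩ˡ_) (trans (sym (⋆-· 𝟙 𝟙 P)) (⋆-± {𝟙 · 𝟙} {𝟙} P 𝟙-idempotent))) (P.inverseˡ (perm 𝟙)))

    projective : ProjectiveAction (Fin n) _≡_ _⋆_
    projective = record { isEquiv = ≡.isEquivalence ; _~?_ = _≟_ ; ⋆-cong = λ g → cong (g ⋆_) ; ⋆-± = λ {g} {h} → ⋆-± {g} {h} ; ⋆-· = ⋆-· ; ⋆-𝟙 = ⋆-𝟙 }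

    -- The upper right entry of u(1) is 1, so u(1) differs from plus and minus the identity and by
    -- injectivity acts nontrivially.
    moved-point : ∃ λ P → upper 1# ⋆ P ≢ P
    moved-point with FP.any? (λ P → ¬? (upper 1# ⋆ P ≟ P))
    ... | yes p = p
    ... | no none = ⊥-elim (differ (φ-inj (toK (upper 1#)) (toK 𝟙) (toK-SL (upper 1#)) (toK-SL 𝟙)
            λ P → trans (decidable-stable (upper 1# ⋆ P ≟ P) λ ne → none (P , ne)) (sym (⋆-𝟙 P))))
      where
      1≉0 : ¬ emb 1# K.≈ emb 0#
      1≉0 eq = 1-nz (emb-inj eq)
      differ : ¬ (toK (upper 1#) M.≈ₚₛₗ toK 𝟙)
      differ (inj₁ (_ , eq , _)) = 1≉0 eq
      differ (inj₂ (_ , eq , _)) = 1≉0 (K.trans eq (K.trans (K.sym (emb-neg 0#)) (K.reflexive (cong emb neg-0))))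

  module HeartRepresentation {q n : ℕ} (F : FiniteField q) {_⋆_ : Matrices.SL₂ F → Fin n → Fin n}
    (projective : Matrices.ProjectiveAction F (Fin n) _≡_ _⋆_) {O ∞ : Fin n}
    (line : IsProjectiveLine (Matrices.Generators.action F projective) O ∞)
    (big : 12 ℕ.≤ q) (p : ℕ) (prime : Prime p) (p≢2 : p ≢ 2) where
    open Matrices F public
    open FiniteField F using (0#; 1#; -_; inv; Nz; inv-nz; inv-inv; Nz?; 1-nz)
    open ≡ using (sym; trans; cong; cong₂; refl; subst)
    open ProjectiveAction projective using (⋆-±; ⋆-·; ⋆-𝟙)

    A : SL2Action F (Fin n) _≡_
    A = Generators.action projective

    ⋆-invʳ : ∀ g P → g ⋆ ((g ⁻) ⋆ P) ≡ P
    ⋆-invʳ g P = trans (sym (⋆-· g (g ⁻) P)) (trans (⋆-± P (·-inverseʳ g)) (⋆-𝟙 P))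

    ⋆-invˡ : ∀ g P → (g ⁻) ⋆ (g ⋆ P) ≡ P
    ⋆-invˡ g P = trans (cong ((g ⁻) ⋆_) (sym (⋆-± P (⁻-involutive g)))) (⋆-invʳ (g ⁻) P)

    open HeartTheorem F A line p prime p≢2 public
    open IntegerCoefficientSolver ring using () renaming (solve to solveℤ; _:=_ to _:=′_; _:+_ to _:+′_; _:*_ to _:*′_; _:-_ to _:-′_; :-_ to :-′_; con to con′)

    instance
      p-nonZero : ℕ.NonZero p
      p-nonZero = prime⇒nonZero prime

    Element : Set
    Element = Σ Vec ZeroSum

    heart : AbelianGroup 0ℓ 0ℓ
    heart = record
      { Carrier = Element
      ; _≈_ = λ x y → proj₁ x ≋ proj₁ y
      ; _∙_ = λ x y → proj₁ x ⊹ proj₁ y , ZeroSum-+ {proj₁ x} {proj₁ y} (proj₂ x) (proj₂ y)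
      ; ε = 𝟘 , ZeroSum-0
      ; _⁻¹ = λ x → (ℤ.- + 1) • proj₁ x , ZeroSum-• (ℤ.- + 1) {proj₁ x} (proj₂ x)
      ; isAbelianGroup = record
        { isGroup = record
          { isMonoid = record
            { isSemigroup = record
              { isMagma = record
                { isEquivalence = record { refl = ≋-refl ; sym = ≋-sym ; trans = ≋-trans }
                ; ∙-cong = ≋-+ }
              ; assoc = λ x y z → pointwise λ b → ≡⇒≃ (ℤP.+-assoc (proj₁ x b) (proj₁ y b) (proj₁ z b)) }
            ; identity = (λ x → pointwise λ b → ≡⇒≃ (ℤP.+-identityˡ (proj₁ x b))) , (λ x → pointwise λ b → ≡⇒≃ (ℤP.+-identityʳ (proj₁ x b))) }
          ; inverse = (λ x → pointwise λ b → solveℤ 1 (λ a → (:-′ con′ (+ 1)) :*′ a :+′ a :=′ con′ (+ 0)) ≃-refl (proj₁ x b))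
                    , (λ x → pointwise λ b → solveℤ 1 (λ a → a :+′ (:-′ con′ (+ 1)) :*′ a :=′ con′ (+ 0)) ≃-refl (proj₁ x b))
          ; ⁻¹-cong = ≋-• (ℤ.- + 1) }
        ; comm = λ x y → pointwise λ b → ≡⇒≃ (ℤP.+-comm (proj₁ x b) (proj₁ y b)) } }

    open AbelianGroup heart using (_≈_; monoid; commutativeMonoid)
    open import Algebra.Properties.Monoid.Mult monoid using () renaming (_×_ to _⋆ₙ_)
    import Algebra.Properties.CommutativeMonoid.Sum commutativeMonoid as VSum

    translate : SL₂ → Vec → Vec
    translate g v b = v ((g ⁻) ⋆ b)

    translate-zero : ∀ g {v} → ZeroSum v → ZeroSum (translate g v)
    translate-zero g {v} z = ≃-trans (sum-bij v ((g ⁻) ⋆_) (g ⋆_) (⋆-invˡ g) (⋆-invʳ g)) z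

    ρ : SL₂ → Element → Element
    ρ g (v , z) = translate g v , translate-zero g {v} z

    ρ-± : ∀ {g h} → g ≈± h → ∀ v → ρ g v ≈ ρ h v
    ρ-± {g} {l} eq (v , _) = pointwise λ b → ≡⇒≃ (cong v (⋆-± b (⁻-± {g} {l} eq)))

    ⋆-inverse-· : ∀ g l b → ((g · l) ⁻) ⋆ b ≡ (l ⁻) ⋆ ((g ⁻) ⋆ b)
    ⋆-inverse-· g l b = trans (cong (((g · l) ⁻) ⋆_) (sym there)) (⋆-invˡ (g · l) P)
      where
      P = (l ⁻) ⋆ ((g ⁻) ⋆ b)
      there : (g · l) ⋆ P ≡ b
      there = trans (⋆-· g l P) (trans (cong (g ⋆_) (⋆-invʳ l ((g ⁻) ⋆ b))) (⋆-invʳ g b))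

    ρ-· : ∀ g h v → ρ (g · h) v ≈ ρ g (ρ h v)
    ρ-· g l (v , _) = pointwise λ b → ≡⇒≃ (cong v (⋆-inverse-· g l b))

    ρ-𝟙 : ∀ v → ρ 𝟙 v ≈ v
    ρ-𝟙 (v , _) = pointwise λ b → ≡⇒≃ (cong v (trans (sym (⋆-𝟙 _)) (⋆-invʳ 𝟙 b)))

    translate-u : ∀ x v b → translate (upper x) v b ≡ ⟦ u x ⟧ v b
    translate-u x v b = cong v (⋆-± b (inj₁ (refl , refl , neg-0 , refl)))

    translate-h : ∀ a (na : Nz a) v b → translate (diagonal a na) v b ≡ ⟦ h a na ⟧ v b
    translate-h a na v b = cong v (trans (⋆-± b (inj₁ (refl , neg-0 , neg-0 , sym (inv-inv na)))) (sym (Generators.H-diag projective (inv-nz na) b)))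

    translate-w : ∀ v b → translate weyl v b ≡ ⟦ w ⟧ v b
    translate-w v b = cong v (⋆-± b (inj₂ (sym neg-0 , refl , refl , sym neg-0)))

    decide : ∀ x y → Dec (x ≈ y)
    decide x y = ≋-dec ∞ (proj₁ x) (proj₁ y)

    digit : ℤ → Fin p
    digit z = fromℕ< (n%ℕd<d z p)

    value : Fin p → ℤ
    value k = + toℕ k

    value-digit : ∀ z → value (digit z) ≃ z
    value-digit z = ≃-sym (≃-trans (≡⇒≃ (a≡a%ℕn+[a/ℕn]*n z p)) (≃-trans (≃-+ (≡⇒≃ (cong +_ (sym (FP.toℕ-fromℕ< (n%ℕd<d z p)))))
      (≃-* (≃-refl {z /ℕ p}) p≃0)) (solveℤ 2 (λ a b → a :+′ b :*′ con′ (+ 0) :=′ a) ≃-refl (value (digit z)) (z /ℕ p))))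

    candidate : Fin (p ℕ.^ n) → Vec
    candidate k b = value (finToFun k b)

    decode : Fin (p ℕ.^ n) → Element
    decode k = choose (sum (candidate k) ≃? + 0)
      where
      choose : Dec (ZeroSum (candidate k)) → Element
      choose (yes z) = candidate k , z
      choose (no _)  = 𝟘 , ZeroSum-0

    decode-≈ : ∀ k → ZeroSum (candidate k) → proj₁ (decode k) ≋ candidate k
    decode-≈ k z with sum (candidate k) ≃? + 0
    ... | yes _ = ≋-refl
    ... | no ¬z = ⊥-elim (¬z z)

    decode-sur : ∀ v → ∃ λ k → v ≈ decode k
    decode-sur (v , z) = k , ≋-sym (≋-trans (decode-≈ k (≃-trans (sum-cong-≋ close) z)) (pointwise close))
      where
      k = funToFin (λ b → digit (v b))
      close : ∀ b → candidate k b ≃ v b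
      close b = ≃-trans (≡⇒≃ (cong value (FP.finToFun-funToFin (λ b → digit (v b)) b))) (value-digit (v b))

    multiple-at : ∀ m x b → proj₁ (m ⋆ₙ x) b ≃ + m ℤ.* proj₁ x b
    multiple-at zero    x b = ≡⇒≃ (sym (ℤP.*-zeroˡ (proj₁ x b)))
    multiple-at (suc m) x b = ≃-trans (≃-+ (≃-refl {proj₁ x b}) (multiple-at m x b)) (≡⇒≃ (sym (ℤP.suc-* (+ m) (proj₁ x b))))

    sum-at : ∀ {m} (t : Fin m → Element) b → proj₁ (VSum.sum t) b ≡ sum (λ i → proj₁ (t i) b)
    sum-at {zero}  t b = refl
    sum-at {suc m} t b = cong (λ z → proj₁ (t zero) b ℤ.+ z) (sum-at (λ i → t (suc i)) b)

    torsion : ∀ m x → ¬ p ℕD.∣ m → (m ⋆ₙ x) ≈ (𝟘 , ZeroSum-0) → x ≈ (𝟘 , ZeroSum-0)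
    torsion m x ¬p∣m eq = ≋-trans (proj₂ scaled) (pointwise λ b → ≡⇒≃ (ℤP.*-zeroʳ (proj₁ scaled)))
      where
      scaled : ∃ λ l → proj₁ x ≋ l • 𝟘
      scaled = •-inverse (λ m≃0 → ¬p∣m (≃0⇒∣ m≃0)) {proj₁ x} {𝟘} (≋-trans (pointwise λ b → ≃-sym (multiple-at m x b)) eq)

    -- Two of the p^(q+1) coefficient vectors give the same q coordinates, and the remaining coordinate is
    -- determined by the others.
    dependent : ∀ (f : Fin (suc q) → Element) →
      Σ (Fin (suc q) → ℕ) λ c → (∃ λ i → ¬ p ℕD.∣ c i) × VSum.sum (λ i → c i ⋆ₙ f i) ≈ (𝟘 , ZeroSum-0)
    dependent f = from (FP.pigeonhole (ℕP.^-monoʳ-< p (ℕ.nonTrivial⇒n>1 p {{prime⇒nonTrivial prime}}) (ℕP.n<1+n q)) shadow)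
      where
      coefficient : Fin (p ℕ.^ suc q) → Fin (suc q) → Fin p
      coefficient k = finToFun k
      combination : Fin (p ℕ.^ suc q) → Vec
      combination k b = sum (λ i → value (coefficient k i) ℤ.* proj₁ (f i) b)
      shadow : Fin (p ℕ.^ suc q) → Fin (p ℕ.^ q)
      shadow k = funToFin (λ x → digit (combination k (pt x)))
      from : (∃₂ λ k l → k Data.Fin.< l × shadow k ≡ shadow l) → Σ (Fin (suc q) → ℕ) λ c → (∃ λ i → ¬ p ℕD.∣ c i) × VSum.sum (λ i → c i ⋆ₙ f i) ≈ (𝟘 , ZeroSum-0)
      from (k , l , k<l , eq) = diff , witness , pointwise (on-line at-∞ at-pt)
        where
        -- The difference of two coefficients, raised by p to stay a natural number.
        diff : Fin (suc q) → ℕ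
        diff i = toℕ (coefficient k i) ℕ.+ (p ℕ.∸ toℕ (coefficient l i))
        diff-≃ : ∀ i → + diff i ≃ value (coefficient k i) ℤ.- value (coefficient l i)
        diff-≃ i = ≃-+ (≃-refl {value (coefficient k i)}) (≃-trans (≡⇒≃ (sym (ℤP.⊖-≥ (ℕP.<⇒≤ (FP.toℕ<n (coefficient l i))))))
          (≃-trans (≡⇒≃ (sym (ℤP.m-n≡m⊖n p (toℕ (coefficient l i))))) (≃-trans (≃-+ p≃0 (≃-refl {ℤ.- value (coefficient l i)})) (≡⇒≃ (ℤP.+-identityˡ (ℤ.- value (coefficient l i)))))))
        combo : Vec
        combo = proj₁ (VSum.sum (λ i → diff i ⋆ₙ f i))
        combo-zero : ZeroSum combo
        combo-zero = proj₂ (VSum.sum (λ i → diff i ⋆ₙ f i))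
        combo-at : ∀ b → combo b ≃ combination k b ℤ.- combination l b
        combo-at b = ≃-trans (≡⇒≃ (sum-at (λ i → diff i ⋆ₙ f i) b)) (≃-trans (sum-cong-≋ (λ i → ≃-trans (multiple-at (diff i) (f i) b)
            (≃-trans (≃-* (diff-≃ i) (≃-refl {proj₁ (f i) b})) (solveℤ 3 (λ s t x → (s :-′ t) :*′ x :=′ s :*′ x :+′ (:-′ (t :*′ x))) ≃-refl (value (coefficient k i)) (value (coefficient l i)) (proj₁ (f i) b)))))
          (≃-trans (∑-distrib-+ (λ i → value (coefficient k i) ℤ.* proj₁ (f i) b) (λ i → ℤ.- (value (coefficient l i) ℤ.* proj₁ (f i) b)))
            (≃-+ (≃-refl {combination k b}) (sum-neg (λ i → value (coefficient l i) ℤ.* proj₁ (f i) b)))))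
        at-pt : ∀ x → combo (pt x) ≃ + 0
        at-pt x = ≃-trans (combo-at (pt x)) (≃-trans (≃-+ same (≃-refl {ℤ.- combination l (pt x)})) (≡⇒≃ (ℤP.+-inverseʳ (combination l (pt x)))))
          where
          same : combination k (pt x) ≃ combination l (pt x)
          same = ≃-trans (≃-sym (value-digit _)) (≃-trans (≡⇒≃ (cong value (trans (sym (FP.finToFun-funToFin (λ x → digit (combination k (pt x))) x))
            (trans (cong (λ s → finToFun s x) eq) (FP.finToFun-funToFin (λ x → digit (combination l (pt x))) x))))) (value-digit _))
        at-∞ : combo ∞ ≃ + 0
        at-∞ = ≃-trans (solveℤ 1 (λ a → a :=′ :-′ (:-′ a)) ≃-refl (combo ∞)) (≃-neg (≃-trans (≃-sym (affine-sum combo-zero)) (sum-0 (λ x → combo (pt x)) at-pt)))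
        witness : ∃ λ i → ¬ p ℕD.∣ diff i
        witness with FP.any? (λ i → ¬? (p ℕD.∣? diff i))
        ... | yes found = found
        ... | no none = ⊥-elim (FP.<⇒≢ k<l (trans (sym (FP.funToFin-finToFin {suc q} {p} k)) (trans (funToFin-cong (λ i → equal i)) (FP.funToFin-finToFin {suc q} {p} l))))
          where
          funToFin-cong : ∀ {m} {s t : Fin m → Fin p} → (∀ i → s i ≡ t i) → funToFin s ≡ funToFin t
          funToFin-cong {zero}  eq = refl
          funToFin-cong {suc m} eq = cong₂ Data.Fin.combine (eq zero) (funToFin-cong (λ i → eq (suc i)))
          residue : ∀ i → value (coefficient k i) ≃ value (coefficient l i)
          residue i = ≃-trans (solveℤ 2 (λ s t → s :=′ (s :-′ t) :+′ t) ≃-refl (value (coefficient k i)) (value (coefficient l i)))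
            (≃-trans (≃-+ (≃-trans (≃-sym (diff-≃ i)) (∣⇒≃0 (decidable-stable (p ℕD.∣? diff i) λ ¬d → none (i , ¬d)))) (≃-refl {value (coefficient l i)})) (≡⇒≃ (ℤP.+-identityˡ _)))
          value-inj : ∀ {s t : Fin p} → toℕ t ℕ.≤ toℕ s → value s ≃ value t → s ≡ t
          value-inj {s} {t} le eq = FP.toℕ-injective (ℕP.≤-antisym (ℕP.m∸n≡0⇒m≤n zero-diff) le)
            where
            divides : p ℕD.∣ (toℕ s ℕ.∸ toℕ t)
            divides = subst (λ z → p ℕD.∣ ℤ.∣ z ∣) (trans (ℤP.m-n≡m⊖n (toℕ s) (toℕ t)) (ℤP.⊖-≥ le)) (unmod eq)
            zero-diff : toℕ s ℕ.∸ toℕ t ≡ 0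
            zero-diff = by-cases (toℕ s ℕ.∸ toℕ t) divides (ℕP.≤-<-trans (ℕP.m∸n≤m (toℕ s) (toℕ t)) (FP.toℕ<n s))
              where
              by-cases : ∀ m → p ℕD.∣ m → m ℕ.< p → m ≡ 0
              by-cases zero    _ _  = refl
              by-cases (suc m) d lt = ⊥-elim (ℕP.<⇒≱ lt (ℕD.∣⇒≤ d))
          equal : ∀ i → coefficient k i ≡ coefficient l i
          equal i with ℕP.≤-total (toℕ (coefficient l i)) (toℕ (coefficient k i))
          ... | inj₁ le = value-inj le (residue i)
          ... | inj₂ le = sym (value-inj le (≃-sym (residue i)))

    irreducible-heart : ∀ (S : Element → Set) → (∀ {x y} → x ≈ y → S x → S y) →
      (∀ {x y} → S x → S y → S (AbelianGroup._∙_ heart x y)) → (∀ {x} → S x → S (AbelianGroup._⁻¹ heart x)) →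
      (∀ g {x} → S x → S (ρ g x)) → ∀ x → ¬ x ≈ (𝟘 , ZeroSum-0) → S x → ∀ y → S y
    irreducible-heart S S-resp S-+ S-neg S-ρ x x≉0 Sx y = S-resp ≋-refl (proj₂ (proj₁ irreducible-and-schur invariant x≉0 (proj₂ x , Sx) (proj₂ y)))
      where
      invariant : Invariant (λ v → Σ (ZeroSum v) λ z → S (v , z))
      invariant = record
        { S-zero = proj₁
        ; S-resp = λ { z′ eq (z , s) → z′ , S-resp eq s }
        ; S-+ = λ { {v} {v′} (z , s) (z′ , s′) → ZeroSum-+ {v} {v′} z z′ , S-+ s s′ }
        ; S-neg = λ { {v} (z , s) → ZeroSum-• (ℤ.- + 1) {v} z , S-neg s }
        ; S-u = λ { x {v} (z , s) → op-ZeroSum (u x) z , S-resp (pointwise λ b → ≡⇒≃ (translate-u x v b)) (S-ρ (upper x) s) }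
        ; S-h = λ { a na {v} (z , s) → op-ZeroSum (h a na) z , S-resp (pointwise λ b → ≡⇒≃ (translate-h a na v b)) (S-ρ (diagonal a na) s) }
        ; S-w = λ { {v} (z , s) → op-ZeroSum w z , S-resp (pointwise λ b → ≡⇒≃ (translate-w v b)) (S-ρ weyl s) } }

    -- Left multiplication on the classes is an action modulo sign with at most q points, so
    -- `SmallAction` makes the generators trivial, and g = g · 𝟙 is equivalent to 𝟙.
    small : ∀ (_~_ : SL₂ → SL₂ → Set) → IsEquivalence _~_ → (∀ g h → Dec (g ~ h)) →
      (∀ {g h} → (∀ v → ρ g v ≈ ρ h v) → g ~ h) → (∀ k {g h} → g ~ h → (k · g) ~ (k · h)) →
      (∀ {c} (f : Fin c → SL₂) → (∀ i j → f i ~ f j → i ≡ j) → c ℕ.≤ q) → ∀ g h → g ~ h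
    small _~_ equiv dec ρ⇒~ translate-~ few g g′ = trans~ (to-𝟙 g) (sym~ (to-𝟙 g′))
      where
      open IsEquivalence equiv renaming (refl to refl~; sym to sym~; trans to trans~)
      left : ProjectiveAction SL₂ _~_ _·_
      left = record
        { isEquiv = equiv ; _~?_ = dec ; ⋆-cong = translate-~
        ; ⋆-± = λ {g} {l} k eq → ρ⇒~ λ v → ≋-trans (ρ-· g k v) (≋-trans (ρ-± {g} {l} eq (ρ k v)) (≋-sym (ρ-· l k v)))
        ; ⋆-· = λ g l k → ρ⇒~ λ v → ≋-trans (ρ-· (g · l) k v) (≋-trans (ρ-· g l (ρ k v)) (≋-sym (≋-trans (ρ-· g (l · k) v)
            (pointwise λ b → ≡⇒≃ (cong (proj₁ v) (⋆-inverse-· l k _))))))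
        ; ⋆-𝟙 = λ g → ρ⇒~ λ v → ≋-trans (ρ-· 𝟙 g v) (ρ-𝟙 (ρ g v)) }
      module trivial = SmallAction F (Generators.action left) big few
      to-𝟙 : ∀ g → g ~ 𝟙
      to-𝟙 g = trans~ (ρ⇒~ λ v → ≋-sym (≋-trans (ρ-· g 𝟙 v) (pointwise λ b → ≡⇒≃ (cong (proj₁ v) (trans (sym (⋆-𝟙 _)) (⋆-invʳ 𝟙 _))))))
        (Generators.trivial-on-generators left trivial.U-trivial (λ P na → trivial.H-trivial P na) trivial.W-trivial g 𝟙)

    representation : Representation q p
    representation = record
      { V = heart
      ; _≈?_ = decide
      ; size = p ℕ.^ n
      ; enum = decode
      ; enum-sur = decode-sur
      ; Γ = SL₂
      ; one = 𝟙
      ; _·_ = _·_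
      ; _⁻ = _⁻
      ; ρ = ρ
      ; ρ-cong = λ g {x} {y} eq → differ-by (constant eq) (λ b → differs eq _)
      ; ρ-+ = λ g x y → ≋-refl
      ; ρ-one = ρ-𝟙
      ; ρ-· = ρ-·
      ; ρ-invˡ = λ g x → pointwise λ b → ≡⇒≃ (cong (proj₁ x) (trans (cong ((g ⁻) ⋆_) (⋆-± b (⁻-involutive g))) (⋆-invˡ g b)))
      ; ρ-invʳ = λ g x → pointwise λ b → ≡⇒≃ (cong (proj₁ x) (trans (⋆-± ((g ⁻) ⋆ b) (⁻-involutive g)) (⋆-invʳ g b)))
      ; search = SL₂-search
      ; torsion = torsion
      ; nonzero = nonzero
      ; dependent = dependent
      ; irreducible = irreducible-heart
      ; small = small }
      where
      nonzero : ∃ λ x → ¬ x ≈ (𝟘 , ZeroSum-0)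
      nonzero = (E , E-zero) , E≉0
        where
        E : Vec
        E = vec (ℤ.- + 1) (λ x → δ x 0#)
        E-pt : ∀ x → E (pt x) ≡ δ x 0#
        E-pt = vec-pt (ℤ.- + 1) (λ x → δ x 0#)
        E-zero : ZeroSum E
        E-zero = ≃-trans (total E) (≃-+ (≡⇒≃ (vec-∞ (ℤ.- + 1) (λ x → δ x 0#)))
          (≃-trans (sum-single (λ x → E (pt x)) 0# λ x ne → ≡⇒≃ (trans (E-pt x) (δ-≢ ne))) (≡⇒≃ (trans (E-pt 0#) (δ-≡ {0#} refl)))))
        E≉0 : ¬ E ≋ 𝟘
        E≉0 (differ-by c d) = 2≄0 (≃-* (≃-refl {+ 2}) (≃-trans (≡⇒≃ (sym (δ-≡ {0#} refl))) (≃-trans (at-pt 0#) (≃-trans (≃-sym (at-pt 1#)) (≡⇒≃ (δ-≢ 1-nz))))))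
          where
          at-pt : ∀ x → δ x 0# ≃ c
          at-pt x = ≃-trans (≡⇒≃ (sym (trans (ℤP.+-identityʳ (E (pt x))) (E-pt x)))) (d (pt x))

-- From endomorphisms of the heart back to the given subalgebra.

module CentralSimpleModules where
  open import Defs
  open Counting
  open FiniteFields
  open Actions
  open ProjectiveLines
  open ModularArithmetic
  open HeartCoordinates
  open PrimeHearts
  open HeartIrreducibility
  open Representations
  open NormalSubrings
  open Centres
  open SpecialLinear
  open HeartRepresentations
  open import Data.Nat using (_^_; _<_; _≤_)
  import Data.Nat.Divisibility as ℕD
  open import Data.Fin.Permutation as P using (_⟨$⟩ʳ_; _⟨$⟩ˡ_; flip)

  HeartEq-elim : ∀ {p n h h′} → HeartEq p n h h′ → ∃ λ c → ∀ b → (h b ℤ.- h′ b) ≡[mod p ] c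
  HeartEq-elim {p} {n} eq with p ℕD.∣? n
  HeartEq-elim     eq | yes _ = eq
  HeartEq-elim {p} {h = h} {h′} eq | no _ = + 0 , λ b → ≡.subst (λ z → p ℕD.∣ ℤ.∣ z ∣) (≡.sym (ℤP.+-identityʳ (h b ℤ.- h′ b))) (eq b)

  HeartEq-intro : ∀ {p n h h′} c → (∀ b → (h b ℤ.- h′ b) ≡[mod p ] c) → (¬ p ℕD.∣ n → ∀ b → h b ≡[mod p ] h′ b) → HeartEq p n h h′
  HeartEq-intro {p} {n} c eq eq′ with p ℕD.∣? n
  ... | yes _   = c , eq
  ... | no ¬p∣n = eq′ ¬p∣n

  module CentralSimplicity {q n : ℕ} (F : FiniteField q) (perm : Matrices.SL₂ F → Perm n)
    (projective : Matrices.ProjectiveAction F (Fin n) _≡_ (λ g P → perm g ⟨$⟩ʳ P)) {O ∞ : Fin n}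
    (line : IsProjectiveLine (Matrices.Generators.action F projective) O ∞)
    (big : 12 ≤ q) (p : ℕ) (prime : Prime p) (p≢2 : p ≢ 2) (G : Perm n → Set) (perm∈G : ∀ g → G (perm g))
    {R : RawEnd n → Set} (isSubalgebra : IsSubalgebra p n R) (normal : IsGNormal p n G R) where

    private
      module HR = HeartRepresentation F projective line big p prime p≢2
      module Sub = IsSubalgebra isSubalgebra

    open HR using (Vec; ZeroSum; _≋_; differ-by; ≋-refl; ≋-sym; ≋-trans; ≋-+; ≋-•; pointwise; _⊹_; _•_; 𝟘; ≡⇒≃; _≃_; mod; unmod;
      ≃-trans; ≃-sym; ≃-refl; representation; translate; translate-zero; sum; sum-cong-≋; sumℤ≡sum; Element; upper; weyl; diagonal; _⁻;
      translate-u; translate-h; translate-w; op-ZeroSum; u; h; w; ⟦_⟧)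
    open Endomorphisms representation using (End; fun; _≗_; 0ₑ; idₑ; _⊕_; ⊖_; _⊙_; IsNormalSubring)
    open Clifford representation using (simplicity; IsIdealIn)

    zero-sum : ∀ {v} → InV0 p n v → ZeroSum v
    zero-sum {v} z = mod (≡.subst (λ s → s ≡[mod p ] (+ 0)) (sumℤ≡sum v) z)

    in-V0 : ∀ {v} → ZeroSum v → InV0 p n v
    in-V0 {v} z = ≡.subst (λ s → s ≡[mod p ] (+ 0)) (≡.sym (sumℤ≡sum v)) (unmod z)

    HeartEq⇒≋ : ∀ {v v′} → HeartEq p n v v′ → v ≋ v′
    HeartEq⇒≋ {v} {v′} eq = let (c , d) = HeartEq-elim {p} {n} {v} {v′} eq in differ-by c (λ b → mod (d b))

    -- A constant function of sum zero vanishes unless p ∣ n.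
    ≋⇒HeartEq : ∀ {v v′} → ZeroSum v → ZeroSum v′ → v ≋ v′ → HeartEq p n v v′
    ≋⇒HeartEq {v} {v′} z z′ (differ-by c d) = HeartEq-intro {p} {n} {v} {v′} c (λ b → unmod (d b)) (λ ¬p∣n b → unmod (v≃v′ ¬p∣n b))
      where
      open HR using (cancel; ≃0⇒∣; ∑-distrib-+; sum-neg; sum-const; ≃-+; ≃-neg)
      nc≃0 : + n ℤ.* c ≃ + 0
      nc≃0 = ≃-trans (≃-sym (sum-const n c)) (≃-trans (≃-sym (sum-cong-≋ d))
        (≃-trans (∑-distrib-+ v (λ b → ℤ.- v′ b)) (≃-trans (≃-+ z (≃-trans (sum-neg v′) (≃-neg z′))) ≃-refl)))
      v≃v′ : ¬ p ℕD.∣ n → ∀ b → v b ≃ v′ b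
      v≃v′ ¬p∣n b = ≃-trans (≡⇒≃ (≡.trans (≡.sym (ℤP.+-identityʳ (v b))) (≡.trans (≡.cong (λ k → v b ℤ.+ k) (≡.sym (ℤP.+-inverseˡ (v′ b)))) (≡.sym (ℤP.+-assoc (v b) (ℤ.- v′ b) (v′ b))))))
        (≃-trans (≃-+ (≃-trans (d b) (cancel (λ n≃0 → ¬p∣n (≃0⇒∣ n≃0)) nc≃0)) (≃-refl {v′ b})) (≡⇒≃ (ℤP.+-identityˡ (v′ b))))

    zero-resp : ∀ v v′ → (∀ b → v b ≡ v′ b) → ZeroSum v′ → ZeroSum v
    zero-resp v v′ eq z = ≃-trans {sum v} {sum v′} (sum-cong-≋ {n} {v} {v′} (λ b → ≡⇒≃ (eq b))) z

    module Linear {f : RawEnd n} (linear : IsLinear p n f) where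
      open IsLinear linear renaming (cong to f-cong)

      f-zero : ∀ {v} → ZeroSum v → ZeroSum (f v)
      f-zero z = zero-sum (pres0 _ (in-V0 z))

      f-≋ : ∀ {v v′} → ZeroSum v → ZeroSum v′ → v ≋ v′ → f v ≋ f v′
      f-≋ z z′ eq = HeartEq⇒≋ (f-cong _ _ (in-V0 z) (in-V0 z′) (≋⇒HeartEq z z′ eq))

      f-+ : ∀ {v v′} → ZeroSum v → ZeroSum v′ → f (v ⊹ v′) ≋ f v ⊹ f v′
      f-+ z z′ = HeartEq⇒≋ (add _ _ (in-V0 z) (in-V0 z′))

      f-• : ∀ c {v} → ZeroSum v → f (c • v) ≋ c • f v
      f-• c z = HeartEq⇒≋ (smul c _ (in-V0 z))

      end : End
      end = record
        { fun = λ (v , z) → f v , f-zero z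
        ; cong = λ {x} {y} eq → f-≋ (proj₂ x) (proj₂ y) eq
        ; hom = λ x y → f-+ (proj₂ x) (proj₂ y) }

    open Linear using (f-zero; f-≋; f-+; f-•; end)

    Represents : RawEnd n → End → Set
    Represents f φ = ∀ x → f (proj₁ x) ≋ proj₁ (fun φ x)

    -- The subalgebra consists of raw maps on all integer vectors, the abstract theory of
    -- endomorphisms of the heart. An endomorphism counts as a member if some raw map in `R` induces
    -- it.
    InR : End → Set
    InR φ = ∃ λ f → R f × Represents f φ

    EqE⇒≋ : ∀ {f g} → EqE p n f g → ∀ {v} → ZeroSum v → f v ≋ g v
    EqE⇒≋ eq z = HeartEq⇒≋ (eq _ (in-V0 z))

    represents-⊙ : ∀ {f g φ ψ} (Rf : R f) (Rg : R g) → Represents f φ → Represents g ψ → Represents (f ∘E g) (φ ⊙ ψ)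
    represents-⊙ {ψ = ψ} Rf Rg rf rg x = ≋-trans (f-≋ (Sub.linear _ Rf) (f-zero (Sub.linear _ Rg) (proj₂ x)) (proj₂ (fun ψ x)) (rg x)) (rf (fun ψ x))

    -- Normality under the permutation of g. The inverse permutation has to be identified with the
    -- permutation of the inverse matrix on both sides of f.
    conjugate : ∀ (g : HR.SL₂) {φ} → InR φ → InR (Endomorphisms.conj representation g φ)
    conjugate g {φ} (f , Rf , rf) = act s ∘E (f ∘E act (flip s)) , normal s f (perm∈G g) Rf , represents
      where
      s = perm g
      act-translate : ∀ v b → act (flip s) v b ≡ translate (g ⁻) v b
      act-translate v b = ≡.cong v (≡.sym (Matrices.ProjectiveAction.⋆-± projective {(g ⁻) ⁻} {g} b (HR.⁻-involutive g)))
      inverse : ∀ b → s ⟨$⟩ˡ b ≡ perm (g ⁻) ⟨$⟩ʳ b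
      inverse b = ≡.trans (≡.cong (s ⟨$⟩ˡ_) (≡.sym (HR.⋆-invʳ g b))) (P.inverseˡ s)
      represents : Represents (act s ∘E (f ∘E act (flip s))) (Endomorphisms.conj representation g φ)
      represents x = ≋-trans {_} {λ b → y (perm (g ⁻) ⟨$⟩ʳ b)} (pointwise λ b → ≡⇒≃ (≡.cong y (inverse b)))
          (differ-by (HR.constant inner) (λ b → HR.differs inner (perm (g ⁻) ⟨$⟩ʳ b)))
        where
        v = proj₁ x
        x′ = Representation.ρ representation (g ⁻) x
        y = f (act (flip s) v)
        inner : y ≋ proj₁ (fun φ x′)
        inner = ≋-trans (f-≋ (Sub.linear f Rf) (zero-resp (act (flip s) v) (proj₁ x′) (act-translate v) (proj₂ x′)) (proj₂ x′) (pointwise λ b → ≡⇒≃ (act-translate v b))) (rf x′)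

    isNormalSubring : IsNormalSubring InR
    isNormalSubring = record
      { resp = λ { eq (f , Rf , rf) → f , Rf , λ x → ≋-trans (rf x) (eq x) }
      ; id∈ = idE , Sub.has-id , λ x → ≋-refl
      ; +∈ = λ { (f , Rf , rf) (g , Rg , rg) → f +E g , Sub.plus f g Rf Rg , λ x → ≋-+ (rf x) (rg x) }
      ; neg∈ = λ { (f , Rf , rf) → (ℤ.- + 1) ·E f , Sub.scal (ℤ.- + 1) f Rf , λ x → ≋-• (ℤ.- + 1) (rf x) }
      ; ∘∈ = λ { {φ} {ψ} (f , Rf , rf) (g , Rg , rg) → f ∘E g , Sub.comp f g Rf Rg , represents-⊙ {φ = φ} {ψ} Rf Rg rf rg }
      ; conj∈ = conjugate }

    nonzero : ¬ EqE p n idE zeroE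
    nonzero eq = let ((v , z) , v≉0) = Representation.nonzero representation in v≉0 (EqE⇒≋ {idE} {zeroE} eq z)

    simple : ∀ (I : RawEnd n → Set) → IsIdeal p n R I → (∃[ f ] (I f × ¬ EqE p n f zeroE)) → I idE
    simple I isIdeal (f , If , f≉0) = identity (simplicity {InR} {InI} isNormalSubring ideal {end (lin If)} (f , Ideal.sub f If , λ _ → ≋-refl) (f , If , λ _ → ≋-refl)
        λ eq → f≉0 λ v z → ≋⇒HeartEq (f-zero (lin If) (zero-sum z)) HR.ZeroSum-0 (eq (v , zero-sum z)))
      where
      module Ideal = IsIdeal isIdeal
      lin : ∀ {f} → I f → IsLinear p n f
      lin If = Sub.linear _ (Ideal.sub _ If)
      InI : End → Set
      InI φ = ∃ λ f → I f × Represents f φ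
      ideal : IsIdealIn InR InI
      ideal = record
        { I-resp = λ { eq (f , If , rf) → f , If , λ x → ≋-trans (rf x) (eq x) }
        ; I+ = λ { (f , If , rf) (g , Ig , rg) → f +E g , Ideal.plus f g If Ig , λ x → ≋-+ (rf x) (rg x) }
        ; Ineg = λ { (f , If , rf) → ((ℤ.- + 1) ·E idE) ∘E f , Ideal.mulˡ _ f (Sub.scal (ℤ.- + 1) idE Sub.has-id) If , λ x → ≋-• (ℤ.- + 1) (rf x) }
        ; Iˡ = λ { {φ} {ψ} (f , Rf , rf) (g , Ig , rg) → f ∘E g , Ideal.mulˡ f g Rf Ig , represents-⊙ {φ = φ} {ψ} Rf (Ideal.sub g Ig) rf rg }
        ; Iʳ = λ { {φ} {ψ} (f , If , rf) (g , Rg , rg) → f ∘E g , Ideal.mulʳ g f Rg If , represents-⊙ {φ = φ} {ψ} (Ideal.sub f If) Rg rf rg } }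
      identity : InI idₑ → I idE
      identity (g , Ig , rg) = Ideal.resp g idE Ig Sub.has-id λ v z → ≋⇒HeartEq (f-zero (lin Ig) (zero-sum z)) (zero-sum z) (rg (v , zero-sum z))

    -- A central z commutes with the matrix group by `commutes-with-Γ`, so it is equivariant, and
    -- the scalar statement for the heart applies.
    central : ∀ z → R z → (∀ r → R r → EqE p n (z ∘E r) (r ∘E z)) → ∃[ c ] (EqE p n z (c ·E idE))
    central z Rz commutes = proj₁ scalar , λ v v₀ → ≋⇒HeartEq (f-zero lin (zero-sum v₀)) (HR.ZeroSum-• (proj₁ scalar) {v} (zero-sum v₀)) (proj₂ scalar (zero-sum v₀))
      where
      lin = Sub.linear z Rz
      commutes-InR : ∀ φ → InR φ → end lin ⊙ φ ≗ φ ⊙ end lin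
      commutes-InR φ (f , Rf , rf) x = ≋-trans (f-≋ lin (proj₂ (fun φ x)) (f-zero (Sub.linear f Rf) (proj₂ x)) (≋-sym (rf x)))
        (≋-trans (EqE⇒≋ {z ∘E f} {f ∘E z} (commutes f Rf) (proj₂ x)) (rf (fun (end lin) x)))
      commutes-Γ : ∀ g {v} → ZeroSum v → z (translate g v) ≋ translate g (z v)
      commutes-Γ g v₀ = Centre.Central.commutes-with-Γ representation {InR} isNormalSubring {end lin} (z , Rz , λ _ → ≋-refl) commutes-InR g (_ , v₀)
      commutes-op : ∀ o g → (∀ v b → translate g v b ≡ ⟦ o ⟧ v b) → ∀ {v} → ZeroSum v → z (⟦ o ⟧ v) ≋ ⟦ o ⟧ (z v)
      commutes-op o g eq {v} v₀ = ≋-trans (f-≋ lin (op-ZeroSum o v₀) (translate-zero g {v} v₀) (pointwise λ b → ≡⇒≃ (≡.sym (eq v b))))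
        (≋-trans (commutes-Γ g v₀) (pointwise λ b → ≡⇒≃ (eq (z v) b)))
      scalar : ∃ λ c → ∀ {v} → ZeroSum v → z v ≋ c • v
      scalar = proj₂ HR.irreducible-and-schur record
        { φ-zero = f-zero lin
        ; φ-cong = f-≋ lin
        ; φ-+ = f-+ lin
        ; φ-• = f-• lin
        ; φ-u = λ x → commutes-op (u x) (upper x) (translate-u x)
        ; φ-h = λ a na → commutes-op (h a na) (diagonal a na) (translate-h a na)
        ; φ-w = commutes-op w weyl translate-w }

    isCentralSimple : IsCentralSimple p n R
    isCentralSimple = record { nonzero = nonzero ; simple = simple ; central = central }

  module FaithfulAction {q n : ℕ} (F : FiniteField q) (perm : Matrices.SL₂ F → Perm n)
    (projective : Matrices.ProjectiveAction F (Fin n) _≡_ (λ g P → perm g ⟨$⟩ʳ P))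
    (moved-point : ∃ λ P → perm (Matrices.upper F (FiniteField.1# F)) ⟨$⟩ʳ P ≢ P)
    (big : 12 ≤ q) (small : n ≤ suc q) where

    bound : ∀ {c} (f : Fin c → Fin n) → (∀ i j → f i ≡ f j → i ≡ j) → c ≤ suc q
    bound f f-inj = ℕP.≤-trans (FP.injective⇒≤ {f = f} (λ {i} {j} → f-inj i j)) small

    line : ∃₂ λ O ∞ → IsProjectiveLine (Matrices.Generators.action F projective) O ∞
    line = ProjectiveLine.projective-line F (Matrices.Generators.action F projective) big bound
      {proj₁ moved-point} (λ fix → proj₂ moved-point (fix (FiniteField.1# F)))

    isCentralSimple : ∀ (p : ℕ) (p-prime : Prime p) (p≢2 : p ≢ 2) (G : Perm n → Set) (perm∈G : ∀ g → G (perm g)) → IsCentralSimpleModule p n G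
    isCentralSimple p p-prime p≢2 G perm∈G R isSubalgebra normal =
      CentralSimplicity.isCentralSimple F perm projective (proj₂ (proj₂ line)) big p p-prime p≢2 G perm∈G isSubalgebra normal

  PSL₂-central-simple : ∀ {q n} (K : Field) (card : HasCard K q) (H G : Perm n → Set) (iso : IsoPSL2 K H) → (∀ h → H h → G h) →
    12 ≤ q → n ≤ suc q → ∀ p → Prime p → p ≢ 2 → IsCentralSimpleModule p n G
  PSL₂-central-simple K card H G iso H⊆G big small p p-prime p≢2 =
    FaithfulAction.isCentralSimple finiteField perm projective moved-point big small p p-prime p≢2 G
      (λ g → H⊆G (perm g) (IsoPSL2.into iso (toK g) (toK-SL g)))
    where open PermutationAction K card H iso

open import Defs
open import Data.Nat using (_^_; _+_; _<_; _≤_)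
open CentralSimpleModules

theorem4p10 : (ℓ r : ℕ) → Prime ℓ → 1 ≤ r → 11 < ℓ ^ r →
    (G H : Perm (ℓ ^ r + 1) → Set) →
    IsSubgroup G → IsSubgroup H → (∀ h → H h → G h) →
    (K : Field) → HasCard K (ℓ ^ r) → IsoPSL2 K H →
    (p : ℕ) → Prime p → p ≢ 2 →
    IsCentralSimpleModule p (ℓ ^ r + 1) G
theorem4p10 ℓ r _ _ big G H _ _ H⊆G K card iso =
  PSL₂-central-simple K card H G iso H⊆G big (ℕP.≤-reflexive (ℕP.+-comm (ℓ ^ r) 1))
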